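{- For all integers $k\ge1$ and $n\ge0$, $$e_6(7^{2k}n+\delta_{7,2k})\equiv0\pmod{7^{2k}}.$$
   Context: $q=e^{2\pi i\tau}$, $(q;q)_\infty=\prod_{n\ge1}(1-q^n)$, $E_6(\tau)=1-504\sum_{n\ge1}\sigma_5(n)q^n$ with $\sigma_5(n)=\sum_{d\mid n}d^5$. The numbers $e_6(n)$ are defined by $\sum_{n\ge0}e_6(n)q^n=E_6(\tau)/(q;q)_\infty$. For a prime $\ell\ge5$ and $k\ge1$, $\delta_{\ell,k}$ is the integer with $0<\delta_{\ell,k}<\ell^k$ and $24\delta_{\ell,k}\equiv1\pmod{\ell^k}$. -}

module Defs where

open import Data.Nat as ℕ using (ℕ; zero; suc)
open import Data.Integer as ℤ using (ℤ; +_; _+_; _*_; -_)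
open import Data.List using (List; []; _∷_; map; filter; applyUpTo; foldr)
open import Relation.Nullary using (yes; no)
open import Data.Nat.Divisibility using (_∣?_)

sumℤ : List ℤ → ℤ
sumℤ = foldr _+_ (+ 0)

sumℕ : List ℕ → ℕ
sumℕ = foldr ℕ._+_ 0

Series : Set
Series = ℕ → ℤ

Σ≤ : ℕ → (ℕ → ℤ) → ℤ
Σ≤ n f = sumℤ (applyUpTo f (suc n))

_⊛_ : Series → Series → Series
(a ⊛ b) n = Σ≤ n (λ j → a j * b (n ℕ.∸ j))

oneMinusQ^ : ℕ → Series
oneMinusQ^ m zero = + 1
oneMinusQ^ m (suc i) with suc i ℕ.≟ m
... | yes _ = - (+ 1)
... | no _ = + 0

partialEuler : ℕ → Series
partialEuler zero = λ { zero → + 1 ; (suc _) → + 0 }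
partialEuler (suc N) = partialEuler N ⊛ oneMinusQ^ (suc N)

-- coefficients of (q;q)_∞ : the coefficient of q^n stabilises once N ≥ n
eulerCoeff : Series
eulerCoeff n = partialEuler n n

-- coefficients of 1/(q;q)_∞ (the partition function), the multiplicative
-- inverse of (q;q)_∞ (constant term 1): p 0 = 1, p n = - Σ_{j=1}^n c_j p(n-j)
partition : ℕ → ℤ
partition n = go n n
  where
  -- go fuel m computes p m, fuel ≥ m
  go : ℕ → ℕ → ℤ
  go _ zero = + 1
  go zero (suc m) = + 0
  go (suc fuel) (suc m) =
    - sumℤ (applyUpTo (λ j → eulerCoeff (suc j) * go fuel (m ℕ.∸ j)) (suc m))

σ₅ : ℕ → ℕ
σ₅ n = sumℕ (map (λ d → d ℕ.^ 5) (filter (λ d → d ∣? n) (applyUpTo suc n)))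

E6coeff : Series
E6coeff zero = + 1
E6coeff (suc n) = - (+ (504 ℕ.* σ₅ (suc n)))

e6 : Series
e6 = E6coeff ⊛ partition

{-# OPTIONS --safe #-}

-- Let E = (q;q)_∞, let t = (η(7 z) / η(z))⁴, and let U keep the coefficients in one residue class modulo 7.
--
-- The exponents of E lie in the classes 0, 1, 2, 5 modulo 7 by the pentagonal number theorem, and those of E³ avoid the
-- classes 2, 4, 5 by Jacobi's theorem, which moreover gives the class 6 part. These four relations between the
-- components of E, together with a first order differential equation for the norm of E over the series in q⁷, imply the
-- modular equation of degree 7, a recursion of order 7 for the powers of η(49 z) / η(z) over the polynomials in t(7 z).
--
-- E₆ = E¹⁴ / E(q⁷)² R(t) for an explicit polynomial R: the logarithmic derivative 𝓔 of t and the series E₄ satisfy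
-- algebraic equations linking them to their images under q ↦ q⁷, and such an equation determines a series from its
-- constant term. This gives 𝓔³ and E₄ in terms of t, and E₆ by differentiating E₄.
--
-- Hence the generating function of e₆ is E¹³ / E(q⁷)² R(t). The recursion shows that two applications of U map
-- E¹³ / E(q⁷)² f(t) to a series of the same form, and bounds the 7-adic valuations of the matrix of this map on f
-- well enough to keep the invariant that, after 2 k applications, the coefficient of t^i is divisible by 7^(2 k + i - 1)
-- (by 7^(2 k) for i = 0).

module Submission where

open import Defs
open import Data.Nat as ℕ using (ℕ; zero; suc; s≤s; z≤n; NonZero; ⌊_/2⌋)
import Data.Nat.Properties as ℕP
open import Data.Integer as ℤ using (ℤ; +_; -[1+_])
import Data.Integer.Properties as ℤP
open import Data.Product using (Σ; ∃; _×_; _,_; proj₁; proj₂)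
open import Data.Sum using (inj₁; inj₂)
open import Function using (_∘_)
open import Algebra.Bundles using (CommutativeRing)
open import Relation.Nullary using (Dec; yes; no; ¬_; contradiction; ¬?; _×-dec_; _→-dec_)
open import Relation.Nullary.Decidable using (True; toWitness)
open import Relation.Binary.PropositionalEquality as ≡ using (_≡_; _≢_)

-- Identities that a count of zeros and poles would give are proved here among formal power series
-- alone, by three devices: membership in an explicit polynomial ideal, uniqueness of the solution
-- of `D x ≋ g * x`, and the vanishing of any X without constant term for which V(q) X(q) = U(q)
-- X(q^7) with V(0) nonzero. Modular forms still explain the shapes. At the cusp 0, t has its only
-- pole, a simple one, while η(z)^14 / η(7 z)^2, of weight 6 like E₆, has a zero of order 4; hence R
-- has degree 4. The zeros of 1 + 13 t + 49 t² lie at the elliptic points of Γ₀(7), and 1 + 245 t +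
-- 2401 t² is a factor of the numerator of j. A single application of U does not preserve the
-- family: it leads from E^13 / E(q^7)^2 to E^10 E(q^7), and only the next one leads back. Both
-- matrices are nevertheless read from one table, because m³ E^10 = E^13 τ³ for τ = m / E.

-- The commutative ring of formal power series over ℤ

module SeriesRing where
  open import Data.Integer.Solver using (module +-*-Solver)
  open import Data.Maybe using (Maybe; just; nothing)
  open import Level using (0ℓ)
  open import Algebra.Structures using (IsCommutativeRing)
  import Algebra.Solver.Ring
  open import Algebra.Solver.Ring.AlmostCommutativeRing using (_-Raw-AlmostCommutative⟶_; fromCommutativeRing)

  infix 4 _≋_
  record _≋_ (a b : Series) : Set where
    constructor ext
    field at : ∀ n → a n ≡ b n
  open _≋_ public

  tail : Series → Series
  tail a n = a (suc n)

  addᶜ : Series → Series → Series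
  addᶜ a b n = a n ℤ.+ b n

  constᶜ : ℤ → Series
  constᶜ c zero = c
  constᶜ c (suc _) = + 0

  -- The operations are opaque so that the type checker never unfolds a series to its coefficients.
  opaque
    add mul : Series → Series → Series
    add = addᶜ
    mul = _⊛_

    neg : Series → Series
    neg a n = ℤ.- a n

    const : ℤ → Series
    const = constᶜ

  module _ where
    open ≡.≡-Reasoning
    open +-*-Solver

    -- This and the other convolution lemmas recurse along the definitional unfolding of
    -- `(a ⊛ b) (suc n)` to `a 0 ℤ.* b (suc n)` plus `(tail a ⊛ b) n`. Bounding the indices by n is
    -- what later yields congruences modulo q^N.
    ⊛-cong-upTo : ∀ n {a a′ b b′ : Series} → (∀ i → i ℕ.≤ n → a i ≡ a′ i) → (∀ i → i ℕ.≤ n → b i ≡ b′ i) →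
                  (a ⊛ b) n ≡ (a′ ⊛ b′) n
    ⊛-cong-upTo zero f g = ≡.cong₂ (λ x y → x ℤ.* y ℤ.+ + 0) (f 0 z≤n) (g 0 z≤n)
    ⊛-cong-upTo (suc n) f g = ≡.cong₂ ℤ._+_ (≡.cong₂ ℤ._*_ (f 0 z≤n) (g (suc n) ℕP.≤-refl))
      (⊛-cong-upTo n (λ i i≤n → f (suc i) (s≤s i≤n)) (λ i i≤n → g i (ℕP.m≤n⇒m≤1+n i≤n)))

    ⊛-distribʳ : ∀ (a b c : Series) n → (addᶜ a b ⊛ c) n ≡ (a ⊛ c) n ℤ.+ (b ⊛ c) n
    ⊛-distribʳ a b c zero = solve 3 (λ x y z → (x :+ y) :* z :+ con (+ 0) := (x :* z :+ con (+ 0)) :+ (y :* z :+ con (+ 0))) ≡.refl (a 0) (b 0) (c 0)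
    ⊛-distribʳ a b c (suc n) = begin
      (a 0 ℤ.+ b 0) ℤ.* c (suc n) ℤ.+ (addᶜ (tail a) (tail b) ⊛ c) n
        ≡⟨ ≡.cong (λ z → (a 0 ℤ.+ b 0) ℤ.* c (suc n) ℤ.+ z) (⊛-distribʳ (tail a) (tail b) c n) ⟩
      (a 0 ℤ.+ b 0) ℤ.* c (suc n) ℤ.+ ((tail a ⊛ c) n ℤ.+ (tail b ⊛ c) n)
        ≡⟨ solve 5 (λ x y z u v → (x :+ y) :* z :+ (u :+ v) := (x :* z :+ u) :+ (y :* z :+ v)) ≡.refl (a 0) (b 0) (c (suc n)) _ _ ⟩
      _ ∎

    ⊛-scaleˡ : ∀ (k : ℤ) (a b : Series) n → ((λ i → k ℤ.* a i) ⊛ b) n ≡ k ℤ.* (a ⊛ b) n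
    ⊛-scaleˡ k a b zero = solve 3 (λ k x y → k :* x :* y :+ con (+ 0) := k :* (x :* y :+ con (+ 0))) ≡.refl k (a 0) (b 0)
    ⊛-scaleˡ k a b (suc n) = begin
      k ℤ.* a 0 ℤ.* b (suc n) ℤ.+ ((λ i → k ℤ.* tail a i) ⊛ b) n
        ≡⟨ ≡.cong (λ z → k ℤ.* a 0 ℤ.* b (suc n) ℤ.+ z) (⊛-scaleˡ k (tail a) b n) ⟩
      k ℤ.* a 0 ℤ.* b (suc n) ℤ.+ k ℤ.* (tail a ⊛ b) n
        ≡⟨ solve 4 (λ k x y z → k :* x :* y :+ k :* z := k :* (x :* y :+ z)) ≡.refl k (a 0) (b (suc n)) _ ⟩
      _ ∎

    ⊛-assoc : ∀ (a b c : Series) n → ((a ⊛ b) ⊛ c) n ≡ (a ⊛ (b ⊛ c)) n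
    ⊛-assoc a b c zero = solve 3 (λ x y z → (x :* y :+ con (+ 0)) :* z :+ con (+ 0) := x :* (y :* z :+ con (+ 0)) :+ con (+ 0)) ≡.refl (a 0) (b 0) (c 0)
    ⊛-assoc a b c (suc n) = begin
      (a 0 ℤ.* b 0 ℤ.+ + 0) ℤ.* c (suc n) ℤ.+ (addᶜ (λ i → a 0 ℤ.* tail b i) (tail a ⊛ b) ⊛ c) n
        ≡⟨ ≡.cong (λ z → (a 0 ℤ.* b 0 ℤ.+ + 0) ℤ.* c (suc n) ℤ.+ z) (≡.trans (⊛-distribʳ (λ i → a 0 ℤ.* tail b i) (tail a ⊛ b) c n)
             (≡.cong₂ ℤ._+_ (⊛-scaleˡ (a 0) (tail b) c n) (⊛-assoc (tail a) b c n))) ⟩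
      (a 0 ℤ.* b 0 ℤ.+ + 0) ℤ.* c (suc n) ℤ.+ (a 0 ℤ.* (tail b ⊛ c) n ℤ.+ (tail a ⊛ (b ⊛ c)) n)
        ≡⟨ solve 5 (λ x y z u v → (x :* y :+ con (+ 0)) :* z :+ (x :* u :+ v) := x :* (y :* z :+ u) :+ v) ≡.refl (a 0) (b 0) (c (suc n)) _ _ ⟩
      _ ∎

    -- The definition only splits off the first term of the left factor; the mirrored rule is what
    -- commutativity needs.
    ⊛-sucʳ : ∀ (a b : Series) n → (a ⊛ b) (suc n) ≡ (a ⊛ tail b) n ℤ.+ a (suc n) ℤ.* b 0
    ⊛-sucʳ a b zero = solve 4 (λ x y u v → x :* v :+ (y :* u :+ con (+ 0)) := x :* v :+ con (+ 0) :+ y :* u) ≡.refl (a 0) (a 1) (b 0) (b 1)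
    ⊛-sucʳ a b (suc n) = begin
      a 0 ℤ.* b (suc (suc n)) ℤ.+ (tail a ⊛ b) (suc n) ≡⟨ ≡.cong (λ z → a 0 ℤ.* b (suc (suc n)) ℤ.+ z) (⊛-sucʳ (tail a) b n) ⟩
      a 0 ℤ.* b (suc (suc n)) ℤ.+ ((tail a ⊛ tail b) n ℤ.+ a (suc (suc n)) ℤ.* b 0) ≡⟨ ℤP.+-assoc (a 0 ℤ.* b (suc (suc n))) _ _ ⟨
      _ ∎

    ⊛-comm : ∀ (a b : Series) n → (a ⊛ b) n ≡ (b ⊛ a) n
    ⊛-comm a b zero = ≡.cong (ℤ._+ + 0) (ℤP.*-comm (a 0) (b 0))
    ⊛-comm a b (suc n) = begin
      a 0 ℤ.* b (suc n) ℤ.+ (tail a ⊛ b) n ≡⟨ ≡.cong₂ ℤ._+_ (ℤP.*-comm (a 0) (b (suc n))) (⊛-comm (tail a) b n) ⟩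
      b (suc n) ℤ.* a 0 ℤ.+ (b ⊛ tail a) n ≡⟨ ℤP.+-comm (b (suc n) ℤ.* a 0) _ ⟩
      (b ⊛ tail a) n ℤ.+ b (suc n) ℤ.* a 0 ≡⟨ ⊛-sucʳ b a n ⟨
      _ ∎

    ⊛-zeroˡ : ∀ (a b : Series) n → (∀ i → i ℕ.≤ n → a i ≡ + 0) → (a ⊛ b) n ≡ + 0
    ⊛-zeroˡ a b zero h rewrite h 0 z≤n = ≡.refl
    ⊛-zeroˡ a b (suc n) h rewrite h 0 z≤n = ≡.trans (ℤP.+-identityˡ _) (⊛-zeroˡ (tail a) b n (λ i i≤n → h (suc i) (s≤s i≤n)))

    const-⊛ : ∀ (k : ℤ) (a : Series) n → (constᶜ k ⊛ a) n ≡ k ℤ.* a n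
    const-⊛ k a zero = ℤP.+-identityʳ _
    const-⊛ k a (suc n) = ≡.trans (≡.cong (λ z → k ℤ.* a (suc n) ℤ.+ z) (⊛-zeroˡ (tail (constᶜ k)) a n (λ _ _ → ≡.refl))) (ℤP.+-identityʳ _)

    D-⊛ : ∀ (a b : Series) n → + n ℤ.* (a ⊛ b) n ≡ ((λ i → + i ℤ.* a i) ⊛ b) n ℤ.+ (a ⊛ (λ i → + i ℤ.* b i)) n
    D-⊛ a b zero = solve 2 (λ x y → con (+ 0) :* (x :* y :+ con (+ 0)) := (con (+ 0) :* x :* y :+ con (+ 0)) :+ (x :* (con (+ 0) :* y) :+ con (+ 0))) ≡.refl (a 0) (b 0)
    D-⊛ a b (suc n) = begin
      + suc n ℤ.* (a 0 ℤ.* b (suc n) ℤ.+ u)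
        ≡⟨ solve 4 (λ m x y z → (con (+ 1) :+ m) :* (x :* y :+ z) := x :* ((con (+ 1) :+ m) :* y) :+ (z :+ m :* z)) ≡.refl (+ n) (a 0) (b (suc n)) u ⟩
      a 0 ℤ.* (+ suc n ℤ.* b (suc n)) ℤ.+ (u ℤ.+ + n ℤ.* u)
        ≡⟨ ≡.cong (λ z → a 0 ℤ.* (+ suc n ℤ.* b (suc n)) ℤ.+ (u ℤ.+ z)) (D-⊛ (tail a) b n) ⟩
      a 0 ℤ.* (+ suc n ℤ.* b (suc n)) ℤ.+ (u ℤ.+ (v ℤ.+ w))
        ≡⟨ solve 5 (λ x u v w z → x :+ (u :+ (v :+ w)) := (con (+ 0) :* z :+ (u :+ v)) :+ (x :+ w)) ≡.refl (a 0 ℤ.* (+ suc n ℤ.* b (suc n))) u v w (b (suc n)) ⟩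
      (+ 0 ℤ.* b (suc n) ℤ.+ (u ℤ.+ v)) ℤ.+ (a 0 ℤ.* (+ suc n ℤ.* b (suc n)) ℤ.+ w)
        ≡⟨ ≡.cong (λ z → (+ 0 ℤ.* b (suc n) ℤ.+ z) ℤ.+ (a 0 ℤ.* (+ suc n ℤ.* b (suc n)) ℤ.+ w))
             (≡.trans (⊛-cong-upTo n {b = b} {b′ = b} (λ i _ → ℤP.suc-* (+ i) (tail a i)) (λ _ _ → ≡.refl)) (⊛-distribʳ (tail a) (λ i → + i ℤ.* tail a i) b n)) ⟨
      _ ∎
      where
      u = (tail a ⊛ b) n
      v = ((λ i → + i ℤ.* tail a i) ⊛ b) n
      w = (tail a ⊛ (λ i → + i ℤ.* b i)) n

  ≋-refl : ∀ {a} → a ≋ a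
  ≋-refl = ext λ _ → ≡.refl
  ≋-sym : ∀ {a b} → a ≋ b → b ≋ a
  ≋-sym p = ext λ n → ≡.sym (at p n)
  ≋-trans : ∀ {a b c} → a ≋ b → b ≋ c → a ≋ c
  ≋-trans p r = ext λ n → ≡.trans (at p n) (at r n)

  opaque
    unfolding add mul neg const

    isCommutativeRing : IsCommutativeRing _≋_ add mul neg (const (+ 0)) (const (+ 1))
    isCommutativeRing = record
        { isRing = record
          { +-isAbelianGroup = record
            { isGroup = record
              { isMonoid = record
                { isSemigroup = record
                  { isMagma = record
                    { isEquivalence = record { refl = ≋-refl ; sym = ≋-sym ; trans = ≋-trans }
                    ; ∙-cong = λ p r → ext λ n → ≡.cong₂ ℤ._+_ (at p n) (at r n) }
                  ; assoc = λ a b c → ext λ n → ℤP.+-assoc (a n) (b n) (c n) }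
                ; identity = (λ a → ext λ { zero → ℤP.+-identityˡ _ ; (suc n) → ℤP.+-identityˡ _ })
                           , (λ a → ext λ { zero → ℤP.+-identityʳ _ ; (suc n) → ℤP.+-identityʳ _ }) }
              ; inverse = (λ a → ext λ { zero → ℤP.+-inverseˡ (a 0) ; (suc n) → ℤP.+-inverseˡ (a (suc n)) })
                        , (λ a → ext λ { zero → ℤP.+-inverseʳ (a 0) ; (suc n) → ℤP.+-inverseʳ (a (suc n)) })
              ; ⁻¹-cong = λ p → ext λ n → ≡.cong ℤ.-_ (at p n) }
            ; comm = λ a b → ext λ n → ℤP.+-comm (a n) (b n) }
          ; *-cong = λ p r → ext λ n → ⊛-cong-upTo n (λ i _ → at p i) (λ i _ → at r i)
          ; *-assoc = λ a b c → ext (⊛-assoc a b c)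
          ; *-identity = (λ a → ext λ n → ≡.trans (const-⊛ (+ 1) a n) (ℤP.*-identityˡ _))
                       , (λ a → ext λ n → ≡.trans (⊛-comm a (const (+ 1)) n) (≡.trans (const-⊛ (+ 1) a n) (ℤP.*-identityˡ _)))
          ; distrib = (λ a b c → ext λ n → ≡.trans (⊛-comm a (add b c) n) (≡.trans (⊛-distribʳ b c a n) (≡.cong₂ ℤ._+_ (⊛-comm b a n) (⊛-comm c a n))))
                    , (λ a b c → ext (⊛-distribʳ b c a)) }
        ; *-comm = λ a b → ext (⊛-comm a b) }

    +-at : ∀ a b n → add a b n ≡ a n ℤ.+ b n
    +-at a b n = ≡.refl

    *-at : ∀ a b n → mul a b n ≡ (a ⊛ b) n
    *-at a b n = ≡.refl

    neg-at : ∀ a n → neg a n ≡ ℤ.- a n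
    neg-at a n = ≡.refl

    const-zero : ∀ c → const c 0 ≡ c
    const-zero c = ≡.refl

    const-suc : ∀ c n → const c (suc n) ≡ + 0
    const-suc c n = ≡.refl

    const-*-at : ∀ c a n → mul (const c) a n ≡ c ℤ.* a n
    const-*-at = const-⊛

  seriesRing : CommutativeRing 0ℓ 0ℓ
  seriesRing = record { isCommutativeRing = isCommutativeRing }

  open CommutativeRing seriesRing public
    using (setoid; _+_; _*_; -_; _-_; 0#; 1#; +-cong; +-congˡ; +-congʳ; *-cong; *-congˡ; *-congʳ; -‿cong;
           *-assoc; *-comm; +-assoc; +-comm; +-identityˡ; +-identityʳ; *-identityˡ; *-identityʳ; zeroˡ; zeroʳ; distribˡ; distribʳ; -‿inverseʳ)

  opaque
    unfolding add mul neg const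

    const-+ : ∀ x y → const (x ℤ.+ y) ≋ const x + const y
    const-+ x y = ext λ { zero → ≡.refl ; (suc n) → ≡.refl }

    const-* : ∀ x y → const (x ℤ.* y) ≋ const x * const y
    const-* x y = ext λ { zero → ≡.sym (const-⊛ x (const y) 0) ; (suc n) → ≡.sym (≡.trans (const-⊛ x (const y) (suc n)) (ℤP.*-zeroʳ x)) }

    const-neg : ∀ x → const (ℤ.- x) ≋ - const x
    const-neg x = ext λ { zero → ≡.refl ; (suc n) → ≡.refl }

  -- With ℤ as coefficient ring, the solver computes with numerals instead of treating them as
  -- atoms.
  constMorphism : CommutativeRing.rawRing ℤP.+-*-commutativeRing -Raw-AlmostCommutative⟶ fromCommutativeRing seriesRing
  constMorphism = record
    { ⟦_⟧ = const ; +-homo = const-+ ; *-homo = const-* ; -‿homo = const-neg ; 0-homo = ≋-refl ; 1-homo = ≋-refl }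

  const≟ : ∀ (x y : ℤ) → Maybe (const x ≋ const y)
  const≟ x y with x ℤ.≟ y
  ... | yes ≡.refl = just ≋-refl
  ... | no _ = nothing

  module Solver = Algebra.Solver.Ring (CommutativeRing.rawRing ℤP.+-*-commutativeRing) (fromCommutativeRing seriesRing) constMorphism const≟

  open import Algebra.Properties.Semiring.Exp (CommutativeRing.semiring seriesRing) public using (_^_; ^-homo-*; ^-congˡ; ^-assocʳ)

-- Truncation, the derivation D = q d/dq, and the substitution q ↦ q^m

module SeriesOperators where
  open SeriesRing
  open import Data.Nat.Divisibility as ℕD using (divides; _∣?_)
  import Relation.Binary.Reasoning.Setoid as SetoidReasoning

  module ≋-Reasoning = SetoidReasoning setoid

  infix 4 _≋_mod_
  -- Congruence modulo q^N. Infinite sums and products enter only through finite truncations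
  -- compared at such a precision.
  _≋_mod_ : Series → Series → ℕ → Set
  a ≋ b mod N = ∀ i → i ℕ.< N → a i ≡ b i

  ≋⇒mod : ∀ {a b N} → a ≋ b → a ≋ b mod N
  ≋⇒mod p i _ = at p i

  mod⇒≋ : ∀ {a b} → (∀ N → a ≋ b mod N) → a ≋ b
  mod⇒≋ p = ext λ n → p (suc n) n ℕP.≤-refl

  mod-refl : ∀ {a N} → a ≋ a mod N
  mod-refl _ _ = ≡.refl

  mod-sym : ∀ {a b N} → a ≋ b mod N → b ≋ a mod N
  mod-sym p i i<N = ≡.sym (p i i<N)

  mod-trans : ∀ {a b c N} → a ≋ b mod N → b ≋ c mod N → a ≋ c mod N
  mod-trans p r i i<N = ≡.trans (p i i<N) (r i i<N)

  mod-≤ : ∀ {a b M N} → M ℕ.≤ N → a ≋ b mod N → a ≋ b mod M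
  mod-≤ M≤N p i i<M = p i (ℕP.≤-trans i<M M≤N)

  mod-+ : ∀ {a a′ b b′ N} → a ≋ a′ mod N → b ≋ b′ mod N → a + b ≋ a′ + b′ mod N
  mod-+ {a} {a′} {b} {b′} p r i i<N = ≡.trans (+-at a b i) (≡.trans (≡.cong₂ ℤ._+_ (p i i<N) (r i i<N)) (≡.sym (+-at a′ b′ i)))

  mod-neg : ∀ {a a′ N} → a ≋ a′ mod N → - a ≋ - a′ mod N
  mod-neg {a} {a′} p i i<N = ≡.trans (neg-at a i) (≡.trans (≡.cong ℤ.-_ (p i i<N)) (≡.sym (neg-at a′ i)))

  mod-* : ∀ {a a′ b b′ N} → a ≋ a′ mod N → b ≋ b′ mod N → a * b ≋ a′ * b′ mod N
  mod-* {a} {a′} {b} {b′} p r i i<N = ≡.trans (*-at a b i) (≡.trans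
    (⊛-cong-upTo i (λ j j≤i → p j (ℕP.≤-<-trans j≤i i<N)) (λ j j≤i → r j (ℕP.≤-<-trans j≤i i<N))) (≡.sym (*-at a′ b′ i)))

  mod-^ : ∀ {a a′ N} k → a ≋ a′ mod N → a ^ k ≋ a′ ^ k mod N
  mod-^ zero p = mod-refl
  mod-^ (suc k) p = mod-* p (mod-^ k p)

  q : Series
  q 1 = + 1
  q _ = + 0

  const-0-at : ∀ n → 0# n ≡ + 0
  const-0-at zero = const-zero (+ 0)
  const-0-at (suc n) = const-suc (+ 0) n

  q*-zero : ∀ a → (q * a) 0 ≡ + 0
  q*-zero a = *-at q a 0

  q*-suc : ∀ a n → (q * a) (suc n) ≡ a n
  q*-suc a n = ≡.trans (*-at q a (suc n)) (≡.trans (ℤP.+-identityˡ _)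
    (≡.trans (≡.sym (*-at (tail q) a n)) (at (≋-trans (*-congʳ {a} tail-q) (*-identityˡ a)) n)))
    where
    tail-q : tail q ≋ 1#
    tail-q = ext λ { zero → ≡.sym (const-zero (+ 1)) ; (suc n) → ≡.sym (const-suc (+ 1) n) }

  q^*-+ : ∀ k a n → (q ^ k * a) (k ℕ.+ n) ≡ a n
  q^*-+ zero a n = at (*-identityˡ a) n
  q^*-+ (suc k) a n = ≡.trans (at (*-assoc q (q ^ k) a) _) (≡.trans (q*-suc _ _) (q^*-+ k a n))

  q^*-< : ∀ k a n → n ℕ.< k → (q ^ k * a) n ≡ + 0
  q^*-< (suc k) a zero _ = ≡.trans (at (*-assoc q (q ^ k) a) 0) (q*-zero _)
  q^*-< (suc k) a (suc n) (s≤s n<k) = ≡.trans (at (*-assoc q (q ^ k) a) _) (≡.trans (q*-suc _ n) (q^*-< k a n n<k))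

  q^-*-mod-0 : ∀ {k N} a → N ℕ.≤ k → q ^ k * a ≋ 0# mod N
  q^-*-mod-0 {k} a N≤k i i<N = ≡.trans (q^*-< k a i (ℕP.<-≤-trans i<N N≤k)) (≡.sym (const-0-at i))

  q^-*-mod : ∀ {k a b N} → a ≋ b mod N → q ^ k * a ≋ q ^ k * b mod (k ℕ.+ N)
  q^-*-mod {k} {a} {b} {N} p i i<k+N with k ℕ.≤? i
  ... | no k≰i = ≡.trans (q^*-< k a i (ℕP.≰⇒> k≰i)) (≡.sym (q^*-< k b i (ℕP.≰⇒> k≰i)))
  ... | yes k≤i with ℕP.m≤n⇒∃[o]m+o≡n k≤i
  ... | j , ≡.refl = ≡.trans (q^*-+ k a j) (≡.trans (p j (ℕP.+-cancelˡ-< k j N i<k+N)) (≡.sym (q^*-+ k b j)))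

  q^-*-cancel : ∀ k {a b} → q ^ k * a ≋ q ^ k * b → a ≋ b
  q^-*-cancel k {a} {b} p = ext λ n → ≡.trans (≡.sym (q^*-+ k a n)) (≡.trans (at p (k ℕ.+ n)) (q^*-+ k b n))

  head-tail : ∀ a → a ≋ const (a 0) + q * tail a
  head-tail a = ext λ
    { zero → ≡.sym (≡.trans (+-at _ _ 0) (≡.trans (≡.cong₂ ℤ._+_ (const-zero (a 0)) (q*-zero (tail a))) (ℤP.+-identityʳ _)))
    ; (suc n) → ≡.sym (≡.trans (+-at _ _ (suc n)) (≡.trans (≡.cong₂ ℤ._+_ (const-suc (a 0) n) (q*-suc (tail a) n)) (ℤP.+-identityˡ _))) }

  const-cong : ∀ {x y} → x ≡ y → const x ≋ const y
  const-cong ≡.refl = ≋-refl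

  opaque
    unfolding add mul neg const

    D : Series → Series
    D a n = + n ℤ.* a n

    D-at : ∀ a n → D a n ≡ + n ℤ.* a n
    D-at a n = ≡.refl

    D-cong : ∀ {a b} → a ≋ b → D a ≋ D b
    D-cong p = ext λ n → ≡.cong (+ n ℤ.*_) (at p n)

    D-mod : ∀ {a b N} → a ≋ b mod N → D a ≋ D b mod N
    D-mod p i i<N = ≡.cong (+ i ℤ.*_) (p i i<N)

    D-+ : ∀ a b → D (a + b) ≋ D a + D b
    D-+ a b = ext λ n → ℤP.*-distribˡ-+ (+ n) (a n) (b n)

    D-neg : ∀ a → D (- a) ≋ - D a
    D-neg a = ext λ n → ≡.sym (ℤP.neg-distribʳ-* (+ n) (a n))

    D-const : ∀ c → D (const c) ≋ 0#
    D-const c = ext λ { zero → ≡.refl ; (suc n) → ℤP.*-zeroʳ (+ suc n) }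

    D-* : ∀ a b → D (a * b) ≋ D a * b + a * D b
    D-* a b = ext (D-⊛ a b)

    D-q : D q ≋ q
    D-q = ext λ { 0 → ≡.refl ; 1 → ≡.refl ; (suc (suc n)) → ℤP.*-zeroʳ (+ suc (suc n)) }

  -- The substitution q ↦ q^m.
  opaque
    φ : (m : ℕ) .{{_ : NonZero m}} → Series → Series
    φ m a n with m ∣? n
    ... | yes (divides k _) = a k
    ... | no _ = + 0

    φ-at : ∀ m .{{_ : NonZero m}} a k → φ m a (k ℕ.* m) ≡ a k
    φ-at m a k with m ∣? k ℕ.* m
    ... | yes (divides k′ eq) = ≡.cong a (≡.sym (ℕP.*-cancelʳ-≡ k k′ m eq))
    ... | no ¬d = contradiction (divides k ≡.refl) ¬d

    φ-at-∤ : ∀ m .{{_ : NonZero m}} a n → ¬ m ℕD.∣ n → φ m a n ≡ + 0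
    φ-at-∤ m a n ¬d with m ∣? n
    ... | yes d = contradiction d ¬d
    ... | no _ = ≡.refl

  module _ (m : ℕ) .{{m≢0 : NonZero m}} where

    φ-elim : ∀ (P : ℕ → Set) → (∀ k → P (k ℕ.* m)) → (∀ n → ¬ m ℕD.∣ n → P n) → ∀ n → P n
    φ-elim P f g n with m ∣? n
    ... | yes (divides k ≡.refl) = f k
    ... | no ¬d = g n ¬d

    φ-unique : ∀ {a b} → (∀ k → b (k ℕ.* m) ≡ a k) → (∀ n → ¬ m ℕD.∣ n → b n ≡ + 0) → b ≋ φ m a
    φ-unique {a} {b} f g = ext (φ-elim (λ n → b n ≡ φ m a n) (λ k → ≡.trans (f k) (≡.sym (φ-at m a k))) (λ n ¬d → ≡.trans (g n ¬d) (≡.sym (φ-at-∤ m a n ¬d))))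

    φ-mod : ∀ {a b N} → a ≋ b mod N → φ m a ≋ φ m b mod (N ℕ.* m)
    φ-mod {a} {b} {N} p = φ-elim (λ i → i ℕ.< N ℕ.* m → φ m a i ≡ φ m b i)
      (λ k k< → ≡.trans (φ-at m a k) (≡.trans (p k (ℕP.*-cancelʳ-< m k N k<)) (≡.sym (φ-at m b k))))
      (λ n ¬d _ → ≡.trans (φ-at-∤ m a n ¬d) (≡.sym (φ-at-∤ m b n ¬d)))

    φ-cong : ∀ {a b} → a ≋ b → φ m a ≋ φ m b
    φ-cong {a} {b} p = φ-unique (λ k → ≡.trans (φ-at m a k) (at p k)) (φ-at-∤ m a)

    φ-+ : ∀ a b → φ m (a + b) ≋ φ m a + φ m b
    φ-+ a b = ≋-sym (φ-unique
      (λ k → ≡.trans (+-at _ _ (k ℕ.* m)) (≡.trans (≡.cong₂ ℤ._+_ (φ-at m a k) (φ-at m b k)) (≡.sym (+-at a b k))))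
      (λ n ¬d → ≡.trans (+-at _ _ n) (≡.cong₂ ℤ._+_ (φ-at-∤ m a n ¬d) (φ-at-∤ m b n ¬d))))

    φ-neg : ∀ a → φ m (- a) ≋ - φ m a
    φ-neg a = ≋-sym (φ-unique
      (λ k → ≡.trans (neg-at _ (k ℕ.* m)) (≡.trans (≡.cong ℤ.-_ (φ-at m a k)) (≡.sym (neg-at a k))))
      (λ n ¬d → ≡.trans (neg-at _ n) (≡.cong ℤ.-_ (φ-at-∤ m a n ¬d))))

    φ-const : ∀ c → φ m (const c) ≋ const c
    φ-const c = ≋-sym (φ-unique (at-mult m) λ { zero ¬d → contradiction (ℕD._∣0 m) ¬d ; (suc n) _ → const-suc c n })
      where
      at-mult : ∀ m .{{_ : NonZero m}} k → const c (k ℕ.* m) ≡ const c k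
      at-mult m zero = ≡.refl
      at-mult (suc m) (suc k) = ≡.trans (const-suc c _) (≡.sym (const-suc c k))

    φ-q* : ∀ a → φ m (q * a) ≋ q ^ m * φ m a
    φ-q* a = ≋-sym (φ-unique
      (λ { zero → ≡.trans (q^*-< m (φ m a) 0 (ℕ.>-nonZero⁻¹ m)) (≡.sym (q*-zero a))
         ; (suc k) → ≡.trans (q^*-+ m (φ m a) (k ℕ.* m)) (≡.trans (φ-at m a k) (≡.sym (q*-suc a k))) })
      λ n ¬d → off n ¬d)
      where
      off : ∀ n → ¬ m ℕD.∣ n → (q ^ m * φ m a) n ≡ + 0
      off n ¬d with m ℕ.≤? n
      ... | no m≰n = q^*-< m (φ m a) n (ℕP.≰⇒> m≰n)
      ... | yes m≤n with ℕP.m≤n⇒∃[o]m+o≡n m≤n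
      ... | j , ≡.refl = ≡.trans (q^*-+ m (φ m a) j) (φ-at-∤ m a j (λ d → ¬d (ℕD.∣m∣n⇒∣m+n ℕD.∣-refl d)))

    φ-q : φ m q ≋ q ^ m
    φ-q = ≋-trans (φ-cong (≋-sym (*-identityʳ q))) (≋-trans (φ-q* 1#) (≋-trans (*-congˡ {q ^ m} (φ-const (+ 1))) (*-identityʳ _)))

    φ-scale : ∀ c a → φ m (const c * a) ≋ const c * φ m a
    φ-scale c a = ≋-sym (φ-unique
      (λ k → ≡.trans (const-*-at c (φ m a) (k ℕ.* m)) (≡.trans (≡.cong (c ℤ.*_) (φ-at m a k)) (≡.sym (const-*-at c a k))))
      (λ n ¬d → ≡.trans (const-*-at c (φ m a) n) (≡.trans (≡.cong (c ℤ.*_) (φ-at-∤ m a n ¬d)) (ℤP.*-zeroʳ c))))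

    private
      -- Splitting off the constant term of a leaves the product `tail a * b` behind a factor q^m,
      -- so each use of the induction hypothesis gains m ≥ 1 coefficients of precision.
      φ-*-mod : ∀ N a b → φ m (a * b) ≋ φ m a * φ m b mod N
      φ-*-mod zero a b i ()
      φ-*-mod (suc N) a b = mod-trans (≋⇒mod left) (mod-trans (mod-≤ N<m+N (mod-+ mod-refl (q^-*-mod (mod-+ mod-refl (φ-*-mod N (tail a) b))))) (≋⇒mod (≋-sym right)))
        where
        open ≋-Reasoning
        open Solver using (solve; _:+_; _:*_; _:=_)
        A = const (a 0)
        N<m+N : suc N ℕ.≤ m ℕ.+ N
        N<m+N = ℕP.+-monoˡ-≤ N (ℕ.>-nonZero⁻¹ m)
        left : φ m (a * b) ≋ A * φ m b + q ^ m * (0# + φ m (tail a * b))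
        left = begin
          φ m (a * b) ≈⟨ φ-cong (≋-trans (*-congʳ {b} (head-tail a)) (solve 4 (λ A q t b → (A :+ q :* t) :* b := A :* b :+ q :* (t :* b)) ≋-refl A q (tail a) b)) ⟩
          φ m (A * b + q * (tail a * b)) ≈⟨ φ-+ _ _ ⟩
          φ m (A * b) + φ m (q * (tail a * b)) ≈⟨ +-cong (φ-scale (a 0) b) (φ-q* _) ⟩
          A * φ m b + q ^ m * φ m (tail a * b) ≈⟨ +-congˡ (*-congˡ (+-identityˡ _)) ⟨
          A * φ m b + q ^ m * (0# + φ m (tail a * b)) ∎
        right : φ m a * φ m b ≋ A * φ m b + q ^ m * (0# + φ m (tail a) * φ m b)
        right = begin
          φ m a * φ m b ≈⟨ *-congʳ (φ-cong (head-tail a)) ⟩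
          φ m (A + q * tail a) * φ m b ≈⟨ *-congʳ (≋-trans (φ-+ _ _) (+-cong (φ-const (a 0)) (φ-q* _))) ⟩
          (A + q ^ m * φ m (tail a)) * φ m b ≈⟨ solve 4 (λ A q t b → (A :+ q :* t) :* b := A :* b :+ q :* (Solver.con (+ 0) :+ t :* b)) ≋-refl A (q ^ m) (φ m (tail a)) (φ m b) ⟩
          _ ∎

    φ-* : ∀ a b → φ m (a * b) ≋ φ m a * φ m b
    φ-* a b = mod⇒≋ λ N → φ-*-mod N a b

    φ-^ : ∀ a k → φ m (a ^ k) ≋ φ m a ^ k
    φ-^ a zero = φ-const (+ 1)
    φ-^ a (suc k) = ≋-trans (φ-* a (a ^ k)) (*-congˡ (φ-^ a k))

    D-φ : ∀ a → D (φ m a) ≋ const (+ m) * φ m (D a)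
    D-φ a = ext λ n → ≡.trans (D-at (φ m a) n) (≡.trans (φ-elim (λ n → + n ℤ.* φ m a n ≡ + m ℤ.* φ m (D a) n) mult nonmult n)
      (≡.sym (const-*-at (+ m) (φ m (D a)) n)))
      where
      open ≡.≡-Reasoning
      mult : ∀ k → + (k ℕ.* m) ℤ.* φ m a (k ℕ.* m) ≡ + m ℤ.* φ m (D a) (k ℕ.* m)
      mult k = begin
        + (k ℕ.* m) ℤ.* φ m a (k ℕ.* m) ≡⟨ ≡.cong₂ ℤ._*_ (≡.trans (ℤP.pos-* k m) (ℤP.*-comm (+ k) (+ m))) (φ-at m a k) ⟩
        + m ℤ.* + k ℤ.* a k ≡⟨ ℤP.*-assoc (+ m) (+ k) (a k) ⟩
        + m ℤ.* (+ k ℤ.* a k) ≡⟨ ≡.cong (+ m ℤ.*_) (≡.trans (φ-at m (D a) k) (D-at a k)) ⟨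
        _ ∎
      nonmult : ∀ n → ¬ m ℕD.∣ n → + n ℤ.* φ m a n ≡ + m ℤ.* φ m (D a) n
      nonmult n ¬d = ≡.trans (≡.cong (+ n ℤ.*_) (φ-at-∤ m a n ¬d)) (≡.trans (ℤP.*-zeroʳ (+ n))
        (≡.sym (≡.trans (≡.cong (+ m ℤ.*_) (φ-at-∤ m (D a) n ¬d)) (ℤP.*-zeroʳ (+ m)))))

-- Components of a series by exponents modulo 7

module ResidueClasses where
  open SeriesRing
  open SeriesOperators
  open import Data.Nat.DivMod using (_%_; %-distribˡ-+; [m+kn]%n≡m%n; m*n%n≡0)
  open import Data.Nat.Divisibility as ℕD using (divides)
  open import Data.Nat.Solver using () renaming (module +-*-Solver to ℕSolver)

  infix 4 _≡₇_
  _≡₇_ : ℕ → ℕ → Set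
  m ≡₇ n = m % 7 ≡ n % 7

  ≡₇-+ : ∀ {a b c d} → a ≡₇ b → c ≡₇ d → a ℕ.+ c ≡₇ b ℕ.+ d
  ≡₇-+ {a} {b} {c} {d} p r = ≡.trans (%-distribˡ-+ a c 7) (≡.trans (≡.cong₂ (λ x y → (x ℕ.+ y) % 7) p r) (≡.sym (%-distribˡ-+ b d 7)))

  ≡₇-* : ∀ k {a b} → a ≡₇ b → k ℕ.* a ≡₇ k ℕ.* b
  ≡₇-* zero p = ≡.refl
  ≡₇-* (suc k) {a} {b} p = ≡₇-+ {a} {b} {k ℕ.* a} {k ℕ.* b} p (≡₇-* k {a} {b} p)

  +k*7 : ∀ a k → a ℕ.+ k ℕ.* 7 ≡₇ a
  +k*7 a k = [m+kn]%n≡m%n a k 7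

  ≡₇-cancelˡ : ∀ {a b c d} → a ≡₇ b → a ℕ.+ c ≡₇ b ℕ.+ d → c ≡₇ d
  -- Modulo 7, the factor 6 acts as - 1, so adding `6 ℕ.* a` removes a without subtraction.
  ≡₇-cancelˡ {a} {b} {c} {d} p r = ≡.trans (≡.sym (reduce a c)) (≡.trans (≡₇-+ {6 ℕ.* a} {6 ℕ.* b} {a ℕ.+ c} {b ℕ.+ d} (≡₇-* 6 {a} {b} p) r) (reduce b d))
    where
    reduce : ∀ a c → 6 ℕ.* a ℕ.+ (a ℕ.+ c) ≡₇ c
    reduce a c = ≡.trans (≡.cong (_% 7) (ℕSolver.solve 2 (λ a c → con 6 :* a :+ (a :+ c) := c :+ a :* con 7) ≡.refl a c)) (+k*7 c a)
      where open ℕSolver using (con; _:*_; _:+_; _:=_)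

  ⊛-vanish : ∀ (x z : Series) n → (∀ i j → i ℕ.+ j ≡ n → x i ℤ.* z j ≡ + 0) → (x * z) n ≡ + 0
  ⊛-vanish x z n h = ≡.trans (*-at x z n) (go x n h)
    where
    go : ∀ x n → (∀ i j → i ℕ.+ j ≡ n → x i ℤ.* z j ≡ + 0) → (x ⊛ z) n ≡ + 0
    go x zero h = ≡.trans (ℤP.+-identityʳ _) (h 0 0 ≡.refl)
    go x (suc n) h = ≡.cong₂ ℤ._+_ (h 0 (suc n) ≡.refl) (go (tail x) n (λ i j e → h (suc i) j (≡.cong suc e)))

  record Cls (r : ℕ) (a : Series) : Set where
    constructor cls
    field vanish : ∀ n → ¬ n ≡₇ r → a n ≡ + 0
  open Cls public

  opaque
    pr : ℕ → Series → Series
    pr r a n with n % 7 ℕ.≟ r % 7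
    ... | yes _ = a n
    ... | no _ = + 0

    pr-at : ∀ {r n} a → n ≡₇ r → pr r a n ≡ a n
    pr-at {r} {n} a p with n % 7 ℕ.≟ r % 7
    ... | yes _ = ≡.refl
    ... | no ¬p = contradiction p ¬p

    pr-at-≢ : ∀ {r n} a → ¬ n ≡₇ r → pr r a n ≡ + 0
    pr-at-≢ {r} {n} a ¬p with n % 7 ℕ.≟ r % 7
    ... | yes p = contradiction p ¬p
    ... | no _ = ≡.refl

  Cls-pr : ∀ {r} a → Cls r (pr r a)
  Cls-pr a = cls λ n → pr-at-≢ a

  pr-elim : ∀ r (P : ℕ → Set) → (∀ n → n ≡₇ r → P n) → (∀ n → ¬ n ≡₇ r → P n) → ∀ n → P n
  pr-elim r P f g n with n % 7 ℕ.≟ r % 7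
  ... | yes p = f n p
  ... | no ¬p = g n ¬p

  pr-unique : ∀ {r a b} → (∀ n → n ≡₇ r → b n ≡ a n) → Cls r b → pr r a ≋ b
  pr-unique {r} {a} {b} f g = ext (pr-elim r (λ n → pr r a n ≡ b n)
    (λ n p → ≡.trans (pr-at a p) (≡.sym (f n p))) (λ n ¬p → ≡.trans (pr-at-≢ a ¬p) (≡.sym (vanish g n ¬p))))

  pr-cong : ∀ {r a b} → a ≋ b → pr r a ≋ pr r b
  pr-cong {r} {a} {b} p = pr-unique (λ n e → ≡.trans (pr-at b e) (≡.sym (at p n))) (Cls-pr b)

  pr-mod : ∀ {r a b N} → a ≋ b mod N → pr r a ≋ pr r b mod N
  pr-mod {r} {a} {b} {N} p = pr-elim r (λ n → n ℕ.< N → pr r a n ≡ pr r b n)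
    (λ n e n<N → ≡.trans (pr-at a e) (≡.trans (p n n<N) (≡.sym (pr-at b e))))
    (λ n ¬e _ → ≡.trans (pr-at-≢ a ¬e) (≡.sym (pr-at-≢ b ¬e)))

  Cls-≋ : ∀ {r a b} → a ≋ b → Cls r a → Cls r b
  Cls-≋ p c = cls λ n ¬e → ≡.trans (≡.sym (at p n)) (vanish c n ¬e)

  Cls-+ : ∀ {r a b} → Cls r a → Cls r b → Cls r (a + b)
  Cls-+ {r} {a} {b} c d = cls λ n ¬e → ≡.trans (+-at a b n) (≡.cong₂ ℤ._+_ (vanish c n ¬e) (vanish d n ¬e))

  Cls-neg : ∀ {r a} → Cls r a → Cls r (- a)
  Cls-neg {r} {a} c = cls λ n ¬e → ≡.trans (neg-at a n) (≡.cong ℤ.-_ (vanish c n ¬e))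

  Cls-const : ∀ c → Cls 0 (const c)
  Cls-const c = cls λ { zero ¬e → contradiction ≡.refl ¬e ; (suc n) _ → const-suc c n }

  Cls-q : Cls 1 q
  Cls-q = cls λ { 0 _ → ≡.refl ; 1 ¬e → contradiction ≡.refl ¬e ; (suc (suc n)) _ → ≡.refl }

  Cls-* : ∀ {r s a b} → Cls r a → Cls s b → Cls (r ℕ.+ s) (a * b)
  Cls-* {r} {s} {a} {b} c d = cls λ n ¬e → ⊛-vanish a b n (term n ¬e)
    where
    term : ∀ n → ¬ n ≡₇ r ℕ.+ s → ∀ i j → i ℕ.+ j ≡ n → a i ℤ.* b j ≡ + 0
    term n ¬e i j ≡.refl with i % 7 ℕ.≟ r % 7 | j % 7 ℕ.≟ s % 7
    ... | no i≢r | _ = ≡.trans (≡.cong (ℤ._* b j) (vanish c i i≢r)) (ℤP.*-zeroˡ (b j))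
    ... | yes _ | no j≢s = ≡.trans (≡.cong (a i ℤ.*_) (vanish d j j≢s)) (ℤP.*-zeroʳ (a i))
    ... | yes i≡r | yes j≡s = contradiction (≡₇-+ {i} {r} {j} {s} i≡r j≡s) ¬e

  Cls-^ : ∀ {r a} k → Cls r a → Cls (k ℕ.* r) (a ^ k)
  Cls-^ zero c = Cls-const (+ 1)
  Cls-^ {r} (suc k) c = Cls-* {r} c (Cls-^ k c)

  Cls-φ : ∀ a → Cls 0 (φ 7 a)
  Cls-φ a = cls λ n ¬e → φ-at-∤ 7 a n λ { (divides k ≡.refl) → ¬e (m*n%n≡0 k 7) }

  Cls-D : ∀ {r a} → Cls r a → Cls r (D a)
  Cls-D {r} {a} c = cls λ n ¬e → ≡.trans (D-at a n) (≡.trans (≡.cong (+ n ℤ.*_) (vanish c n ¬e)) (ℤP.*-zeroʳ (+ n)))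

  Cls-≡₇ : ∀ {r s a} → r ≡₇ s → Cls r a → Cls s a
  Cls-≡₇ p c = cls λ n ¬e → vanish c n λ e → ¬e (≡.trans e p)

  pr-same : ∀ {r a} s → Cls r a → r ≡₇ s → pr s a ≋ a
  pr-same {r} {a} s c p = pr-unique (λ _ _ → ≡.refl) (Cls-≡₇ {r} {s} p c)

  pr-other : ∀ {r a} s → Cls r a → ¬ r ≡₇ s → pr s a ≋ 0#
  pr-other {r} {a} s c ¬p = pr-unique (λ n e → ≡.trans (const-0-at n) (≡.sym (vanish c n λ e′ → ¬p (≡.trans (≡.sym e′) e)))) (cls λ n _ → const-0-at n)

  pr-+ : ∀ r a b → pr r (a + b) ≋ pr r a + pr r b
  pr-+ r a b = pr-unique (λ n e → ≡.trans (+-at _ _ n) (≡.trans (≡.cong₂ ℤ._+_ (pr-at a e) (pr-at b e)) (≡.sym (+-at a b n))))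
    (Cls-+ {r} (Cls-pr a) (Cls-pr b))

  pr-neg : ∀ r a → pr r (- a) ≋ - pr r a
  pr-neg r a = pr-unique (λ n e → ≡.trans (neg-at _ n) (≡.trans (≡.cong ℤ.-_ (pr-at a e)) (≡.sym (neg-at a n)))) (Cls-neg {r} (Cls-pr a))

  pr-0 : ∀ r → pr r 0# ≋ 0#
  pr-0 r = pr-unique (λ _ _ → ≡.refl) (cls λ n _ → const-0-at n)

  pr-D : ∀ r a → pr r (D a) ≋ D (pr r a)
  pr-D r a = pr-unique (λ n e → ≡.trans (D-at _ n) (≡.trans (≡.cong (+ n ℤ.*_) (pr-at a e)) (≡.sym (D-at a n)))) (Cls-D {r} (Cls-pr a))

  -- After y is split into its class r part and the rest, the rest contributes nothing: two indices
  -- with sum in class t, the first in class s, have the second in class r.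
  pr-*ˡ : ∀ {s x} r t y → Cls s x → s ℕ.+ r ≡₇ t → pr t (x * y) ≋ x * pr r y
  pr-*ˡ {s} {x} r t y c p = begin
    pr t (x * y) ≈⟨ pr-cong (*-congˡ (solve 2 (λ y z → y := z :+ (y :- z)) ≋-refl y (pr r y))) ⟩
    pr t (x * (pr r y + (y - pr r y))) ≈⟨ pr-cong (distribˡ x _ _) ⟩
    pr t (x * pr r y + x * (y - pr r y)) ≈⟨ pr-+ t _ _ ⟩
    pr t (x * pr r y) + pr t (x * (y - pr r y)) ≈⟨ +-cong (pr-same t (Cls-* {s} {r} c (Cls-pr y)) p) (pr-unique {t} {x * (y - pr r y)} {0#} rest (cls λ n _ → const-0-at n)) ⟩
    x * pr r y + 0# ≈⟨ +-identityʳ _ ⟩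
    x * pr r y ∎
    where
    open ≋-Reasoning
    open Solver using (solve; _:+_; _:-_; _:=_)
    rest : ∀ n → n ≡₇ t → 0# n ≡ (x * (y - pr r y)) n
    rest n e = ≡.trans (const-0-at n) (≡.sym (⊛-vanish x _ n term))
      where
      term : ∀ i j → i ℕ.+ j ≡ n → x i ℤ.* (y - pr r y) j ≡ + 0
      term i j ≡.refl with i % 7 ℕ.≟ s % 7
      ... | no i≢s = ≡.trans (≡.cong (ℤ._* (y - pr r y) j) (vanish c i i≢s)) (ℤP.*-zeroˡ ((y - pr r y) j))
      ... | yes i≡s = ≡.trans (≡.cong (x i ℤ.*_) (≡.trans (+-at y _ j) (≡.trans (≡.cong (λ z → y j ℤ.+ z) (≡.trans (neg-at _ j)
                        (≡.cong ℤ.-_ (pr-at y (≡₇-cancelˡ {i} {s} {j} {r} i≡s (≡.trans e (≡.sym p))))))) (ℤP.+-inverseʳ (y j))))) (ℤP.*-zeroʳ (x i))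

  pr-scale : ∀ r c a → pr r (const c * a) ≋ const c * pr r a
  pr-scale r c a = pr-*ˡ r r a (Cls-const c) ≡.refl

  pr-ext : ∀ {a b} → (∀ r → pr r a ≋ pr r b) → a ≋ b
  pr-ext {a} {b} h = ext λ n → ≡.trans (≡.sym (pr-at {n} a ≡.refl)) (≡.trans (at (h n) n) (pr-at b ≡.refl))

  -- This is the operator U: a component written as q^r times a series in q^7 exhibits the extracted
  -- series.
  pr⇒coefficients : ∀ {a z} r → pr r a ≋ q ^ r * φ 7 z → ∀ n → a (n ℕ.* 7 ℕ.+ r) ≡ z n
  pr⇒coefficients {a} {z} r p n = begin
    a (n ℕ.* 7 ℕ.+ r) ≡⟨ pr-at {r} a (≡.trans (≡.cong (_% 7) (ℕP.+-comm (n ℕ.* 7) r)) (+k*7 r n)) ⟨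
    pr r a (n ℕ.* 7 ℕ.+ r) ≡⟨ at p _ ⟩
    (q ^ r * φ 7 z) (n ℕ.* 7 ℕ.+ r) ≡⟨ ≡.cong (q ^ r * φ 7 z) (ℕP.+-comm (n ℕ.* 7) r) ⟩
    (q ^ r * φ 7 z) (r ℕ.+ n ℕ.* 7) ≡⟨ q^*-+ r (φ 7 z) (n ℕ.* 7) ⟩
    φ 7 z (n ℕ.* 7) ≡⟨ φ-at 7 z n ⟩
    z n ∎
    where open ≡.≡-Reasoning

-- Euler's product, partitions, and the pentagonal number theorem

module EulerProduct where
  open SeriesRing
  open SeriesOperators
  open import Data.List using (applyUpTo; foldr)

  open Solver using (solve; _:+_; _:*_; _:-_; :-_; con; _:=_)

  qfac : ℕ → Series
  qfac zero = 1#
  qfac (suc n) = qfac n * (1# - q ^ suc n)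

  q^-at : ∀ m i → (q ^ m) i ≡ (q ^ m * 1#) i
  q^-at m i = ≡.sym (at (*-identityʳ (q ^ m)) i)

  q^-≡ : ∀ m → (q ^ m) m ≡ + 1
  q^-≡ m = ≡.trans (q^-at m m) (≡.trans (≡.cong (q ^ m * 1#) (≡.sym (ℕP.+-identityʳ m))) (≡.trans (q^*-+ m 1# 0) (const-zero (+ 1))))

  q^-≢ : ∀ m i → i ≢ m → (q ^ m) i ≡ + 0
  q^-≢ m i i≢m with m ℕ.≤? i
  ... | no m≰i = ≡.trans (q^-at m i) (q^*-< m 1# i (ℕP.≰⇒> m≰i))
  ... | yes m≤i with ℕP.m≤n⇒∃[o]m+o≡n m≤i
  ... | zero , ≡.refl = contradiction (ℕP.+-identityʳ m) i≢m
  ... | suc j , ≡.refl = ≡.trans (q^-at m (m ℕ.+ suc j)) (≡.trans (q^*-+ m 1# (suc j)) (const-suc (+ 1) j))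

  oneMinusQ^-≋ : ∀ m .{{_ : NonZero m}} → oneMinusQ^ m ≋ 1# - q ^ m
  oneMinusQ^-≋ m@(suc k) = ext go
    where
    open ≡.≡-Reasoning
    expand : ∀ i → (1# - q ^ m) i ≡ 1# i ℤ.- (q ^ m) i
    expand i = ≡.trans (+-at 1# _ i) (≡.cong (λ z → 1# i ℤ.+ z) (neg-at (q ^ m) i))
    go : ∀ i → oneMinusQ^ m i ≡ (1# - q ^ m) i
    go zero = ≡.sym (≡.trans (expand 0) (≡.cong₂ ℤ._-_ (const-zero (+ 1)) (q^-≢ m 0 λ ())))
    go (suc i) with suc i ℕ.≟ m
    ... | yes ≡.refl = ≡.sym (≡.trans (expand m) (≡.cong₂ ℤ._-_ (const-suc (+ 1) k) (q^-≡ m)))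
    ... | no i≢m = ≡.sym (≡.trans (expand (suc i)) (≡.cong₂ ℤ._-_ (const-suc (+ 1) i) (q^-≢ m (suc i) i≢m)))

  partialEuler-≋ : ∀ n → partialEuler n ≋ qfac n
  partialEuler-≋ zero = ext λ { zero → ≡.sym (const-zero (+ 1)) ; (suc n) → ≡.sym (const-suc (+ 1) n) }
  partialEuler-≋ (suc n) = ≋-trans (ext λ i → ≡.sym (*-at (partialEuler n) (oneMinusQ^ (suc n)) i))
    (*-cong (partialEuler-≋ n) (oneMinusQ^-≋ (suc n)))

  1-q^-mod : ∀ {m N} → N ℕ.≤ m → 1# - q ^ m ≋ 1# mod N
  1-q^-mod {m} N≤m = mod-trans (mod-+ mod-refl (mod-neg (mod-trans (≋⇒mod (≋-sym (*-identityʳ (q ^ m)))) (q^-*-mod-0 1# N≤m))))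
    (≋⇒mod (solve 0 (con (+ 1) :- con (+ 0) := con (+ 1)) ≋-refl))

  qfac-mod : ∀ n k → qfac (k ℕ.+ n) ≋ qfac n mod (suc n)
  qfac-mod n zero = mod-refl
  qfac-mod n (suc k) = mod-trans (mod-* (qfac-mod n k) (1-q^-mod (s≤s (ℕP.m≤n+m n k)))) (≋⇒mod (*-identityʳ _))

  E : Series
  E = eulerCoeff

  E≋qfac : ∀ n → E ≋ qfac n mod (suc n)
  E≋qfac n i (s≤s i≤n) with ℕP.m≤n⇒∃[o]m+o≡n i≤n
  ... | j , ≡.refl = ≡.trans (at (partialEuler-≋ i) i)
    (≡.trans (≡.sym (qfac-mod i j i ℕP.≤-refl)) (≡.cong (λ n → qfac n i) (ℕP.+-comm j i)))

  sumℤ-cong : ∀ n {f g : ℕ → ℤ} → (∀ i → i ℕ.< n → f i ≡ g i) → sumℤ (applyUpTo f n) ≡ sumℤ (applyUpTo g n)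
  sumℤ-cong zero h = ≡.refl
  sumℤ-cong (suc n) h = ≡.cong₂ ℤ._+_ (h 0 (s≤s z≤n)) (sumℤ-cong n (λ i i<n → h (suc i) (s≤s i<n)))

  -- The summand for j = 0 is `partition m` by definition, since its fuel equals its argument. The
  -- other summands run the local recursion with fuel to spare; the pair gives access to them.
  partition-unfold : ∀ m → Σ (ℕ → ℤ) λ f → partition (suc m) ≡ ℤ.- (E 1 ℤ.* partition m ℤ.+ foldr ℤ._+_ (+ 0) (applyUpTo f m))
  partition-unfold m = _ , ≡.refl

  -- `W c f m` stands for c times the value of the recursion at m with fuel f. Only its defining
  -- equations are assumed, so the result applies to a function that cannot be named; the factor c
  -- matches the form in which unification supplies it.
  fuel-irrelevant : (W : ℤ → ℕ → ℕ → ℤ) → (∀ c f f′ → W c f 0 ≡ W c f′ 0) →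
      (∀ c f m → W c (suc f) (suc m) ≡ c ℤ.* ℤ.- sumℤ (applyUpTo (λ j → W (E (suc j)) f (m ℕ.∸ j)) (suc m))) →
      ∀ c f f′ k → k ℕ.≤ f → k ℕ.≤ f′ → W c f k ≡ W c f′ k
  fuel-irrelevant W base step c f f′ zero _ _ = base c f f′
  fuel-irrelevant W base step c (suc f) (suc f′) (suc k) (s≤s k≤f) (s≤s k≤f′) =
      ≡.trans (step c f k) (≡.trans (≡.cong (λ z → c ℤ.* ℤ.- z) (sumℤ-cong (suc k) λ j _ →
        (fuel-irrelevant W base step (E (suc j)) f f′ (k ℕ.∸ j) (ℕP.≤-trans (ℕP.m∸n≤m k j) k≤f) (ℕP.≤-trans (ℕP.m∸n≤m k j) k≤f′))))
        (≡.sym (step c f′ k)))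

  -- The recursion behind partition is local to its definition and has no name; after its
  -- arguments have been abstracted, unification finds scaled c f m, its value times c.
  mutual
    scaled : ℤ → ℕ → ℕ → ℤ
    scaled = _

    partition-unfold-spec : ∀ m x → proj₁ (partition-unfold m) x ≡ E (suc (suc x)) ℤ.* partition (m ℕ.∸ suc x)
    partition-unfold-spec m x with E (suc (suc x)) | m ℕ.∸ suc x | ℕP.m∸n≤m m (suc x)
    ... | c | k | k≤m = fuel-irrelevant scaled (λ _ _ _ → ≡.refl) (λ _ _ _ → ≡.refl) c m k k k≤m ℕP.≤-refl

  partition-suc : ∀ m → partition (suc m) ≡ ℤ.- sumℤ (applyUpTo (λ j → E (suc j) ℤ.* partition (m ℕ.∸ j)) (suc m))
  partition-suc m = ≡.trans (proj₂ (partition-unfold m))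
    (≡.cong (λ z → ℤ.- (E 1 ℤ.* partition m ℤ.+ z)) (sumℤ-cong m λ j _ → partition-unfold-spec m j))

  E*partition : E * partition ≋ 1#
  E*partition = ext λ
    { zero → ≡.trans (*-at E partition 0) (≡.sym (const-zero (+ 1)))
    ; (suc n) → ≡.trans (*-at E partition (suc n)) (≡.trans
        (≡.cong (λ z → + 1 ℤ.* z ℤ.+ (tail E ⊛ partition) n) (partition-suc n))
        (≡.trans (≡.cong (ℤ._+ (tail E ⊛ partition) n) (ℤP.*-identityˡ (ℤ.- (tail E ⊛ partition) n))) (≡.trans (ℤP.+-inverseˡ ((tail E ⊛ partition) n)) (≡.sym (const-suc (+ 1) n))))) }

  ∑ : ℕ → (ℕ → Series) → Series
  ∑ zero f = 0#
  ∑ (suc n) f = ∑ n f + f n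

  ∑-cong : ∀ n {f g} → (∀ i → i ℕ.< n → f i ≋ g i) → ∑ n f ≋ ∑ n g
  ∑-cong zero h = ≋-refl
  ∑-cong (suc n) h = +-cong (∑-cong n λ i i<n → h i (ℕP.m≤n⇒m≤1+n i<n)) (h n ℕP.≤-refl)

  ∑-mod : ∀ n {f g N} → (∀ i → i ℕ.< n → f i ≋ g i mod N) → ∑ n f ≋ ∑ n g mod N
  ∑-mod zero h = mod-refl
  ∑-mod (suc n) h = mod-+ (∑-mod n λ i i<n → h i (ℕP.m≤n⇒m≤1+n i<n)) (h n ℕP.≤-refl)

  ∑-*ˡ : ∀ n a f → a * ∑ n f ≋ ∑ n (λ i → a * f i)
  ∑-*ˡ zero a f = zeroʳ a
  ∑-*ˡ (suc n) a f = ≋-trans (distribˡ a _ _) (+-congʳ (∑-*ˡ n a f))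

  sgn : ℕ → Series
  sgn zero = 1#
  sgn (suc k) = - sgn k

  tri : ℕ → ℕ
  tri zero = 0
  tri (suc k) = suc k ℕ.+ tri k

  q^-+ : ∀ a b → q ^ (a ℕ.+ b) ≋ q ^ a * q ^ b
  q^-+ = ^-homo-* q

  q^-cong : ∀ {a b} → a ≡ b → q ^ a ≋ q ^ b
  q^-cong ≡.refl = ≋-refl

  mod-0-* : ∀ {a N} b → a ≋ 0# mod N → b * a ≋ 0# mod N
  mod-0-* b p = mod-trans (mod-* mod-refl p) (≋⇒mod (zeroʳ b))

  q^-mod-0 : ∀ {k N} → N ℕ.≤ k → q ^ k ≋ 0# mod N
  q^-mod-0 {k} N≤k = mod-trans (≋⇒mod (≋-sym (*-identityʳ (q ^ k)))) (q^-*-mod-0 1# N≤k)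

  -- Shanks' finite form of the pentagonal number theorem.
  module Pentagonal where
    open ≋-Reasoning

    run : ℕ → ℕ → Series
    run s zero = 1#
    run s (suc d) = run s d * (1# - q ^ (s ℕ.+ suc d))

    run-peelˡ : ∀ s d → run (suc s) d * (1# - q ^ suc s) ≋ run s (suc d)
    run-peelˡ s zero = *-congˡ (+-congˡ (-‿cong (q^-cong (ℕP.+-comm 1 s))))
    run-peelˡ s (suc d) = begin
      run (suc s) d * (1# - q ^ (suc s ℕ.+ suc d)) * (1# - q ^ suc s)
        ≈⟨ solve 3 (λ a b c → a :* b :* c := a :* c :* b) ≋-refl (run (suc s) d) _ _ ⟩
      run (suc s) d * (1# - q ^ suc s) * (1# - q ^ (suc s ℕ.+ suc d))
        ≈⟨ *-cong (run-peelˡ s d) (+-congˡ (-‿cong (q^-cong (≡.sym (ℕP.+-suc s (suc d)))))) ⟩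
      run s (suc (suc d)) ∎

    f : ℕ → ℕ → Series
    f n s = sgn s * (run s (n ℕ.∸ s) * q ^ (s ℕ.* n ℕ.+ tri s))

    h : ℕ → ℕ → Series
    h n s = sgn s * (run s (n ℕ.∸ s) * q ^ (tri s ℕ.+ suc s ℕ.* suc n))

    f-suc : ∀ n s → s ℕ.≤ n → f (suc n) s ≋ sgn s * (run s (n ℕ.∸ s) * (1# - q ^ suc n) * q ^ (s ℕ.* suc n ℕ.+ tri s))
    f-suc n s s≤n rewrite ℕP.+-∸-assoc 1 s≤n =
      *-congˡ (*-congʳ (*-congˡ (+-congˡ (-‿cong (q^-cong (≡.trans (ℕP.+-suc s _) (≡.cong suc (ℕP.m+[n∸m]≡n s≤n))))))))

    -- Raising n multiplies the s-th product by 1 - q^(n + 1). Taken over partial sums, the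
    -- resulting corrections cancel in succession and leave only `h n j`, which for j = n is the
    -- next pentagonal term up to sign.
    telescope : ∀ n j → j ℕ.≤ n → ∑ (suc j) (f (suc n)) ≋ ∑ (suc j) (f n) - h n j
    telescope n zero _ = begin
      0# + f (suc n) 0 ≈⟨ +-congˡ (f-suc n 0 z≤n) ⟩
      0# + 1# * (run 0 n * (1# - q ^ suc n) * 1#) ≈⟨ solve 2 (λ c Q → con (+ 0) :+ con (+ 1) :* (c :* (con (+ 1) :- Q) :* con (+ 1))
           := con (+ 0) :+ con (+ 1) :* (c :* con (+ 1)) :- con (+ 1) :* (c :* Q)) ≋-refl (run 0 n) (q ^ suc n) ⟩
      0# + f n 0 - 1# * (run 0 n * q ^ suc n) ≈⟨ +-congˡ (-‿cong (*-congˡ (*-congˡ (q^-cong (≡.sym (ℕP.*-identityˡ (suc n))))))) ⟩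
      0# + f n 0 - h n 0 ∎
    telescope n (suc j) j<n = begin
      ∑ (suc j) (f (suc n)) + f (suc n) (suc j)
        ≈⟨ +-cong (telescope n j (ℕP.<⇒≤ j<n)) (≋-trans (f-suc n (suc j) j<n) (*-congˡ (*-congˡ e₁))) ⟩
      S - h n j + - σ * (c * (1# - Q) * (A * B * (A * C)))
        ≈⟨ +-congʳ (+-congˡ (-‿cong (*-congˡ (*-cong run-j e₂)))) ⟩
      S - σ * (c * (1# - A) * (C * (A * B))) + - σ * (c * (1# - Q) * (A * B * (A * C)))
        ≈⟨ solve 7 (λ S σ c A B C Q → S :- σ :* (c :* (con (+ 1) :- A) :* (C :* (A :* B))) :+ (:- σ) :* (c :* (con (+ 1) :- Q) :* (A :* B :* (A :* C)))
             := S :+ (:- σ) :* (c :* (B :* (A :* C))) :- (:- σ) :* (c :* (A :* C :* (Q :* (A :* B))))) ≋-refl S σ c A B C Q ⟩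
      S + - σ * (c * (B * (A * C))) - - σ * (c * (A * C * (Q * (A * B))))
        ≈⟨ +-cong (+-congˡ (*-congˡ (*-congˡ e₃))) (-‿cong (*-congˡ (*-congˡ e₄))) ⟨
      ∑ (suc (suc j)) (f n) - h n (suc j) ∎
      where
      S = ∑ (suc j) (f n)
      σ = sgn j
      c = run (suc j) (n ℕ.∸ suc j)
      A = q ^ suc j
      B = q ^ (suc j ℕ.* n)
      C = q ^ tri j
      Q = q ^ suc n
      eAB : q ^ (suc j ℕ.* suc n) ≋ A * B
      eAB = ≋-trans (q^-cong (ℕP.*-suc (suc j) n)) (q^-+ (suc j) (suc j ℕ.* n))
      eAC : q ^ tri (suc j) ≋ A * C
      eAC = q^-+ (suc j) (tri j)
      e₁ : q ^ (suc j ℕ.* suc n ℕ.+ tri (suc j)) ≋ A * B * (A * C)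
      e₁ = ≋-trans (q^-+ (suc j ℕ.* suc n) (tri (suc j))) (*-cong eAB eAC)
      e₂ : q ^ (tri j ℕ.+ suc j ℕ.* suc n) ≋ C * (A * B)
      e₂ = ≋-trans (q^-+ (tri j) _) (*-congˡ eAB)
      e₃ : q ^ (suc j ℕ.* n ℕ.+ tri (suc j)) ≋ B * (A * C)
      e₃ = ≋-trans (q^-+ (suc j ℕ.* n) _) (*-congˡ eAC)
      e₄ : q ^ (tri (suc j) ℕ.+ suc (suc j) ℕ.* suc n) ≋ A * C * (Q * (A * B))
      e₄ = ≋-trans (q^-+ (tri (suc j)) _) (*-cong eAC (≋-trans (q^-+ (suc n) _) (*-congˡ eAB)))
      run-j : run j (n ℕ.∸ j) ≋ c * (1# - A)
      run-j rewrite ≡.sym (ℕP.suc-pred (n ℕ.∸ j) {{ℕ.>-nonZero (ℕP.m<n⇒0<n∸m j<n)}}) | ℕP.pred[m∸n]≡m∸[1+n] n j = ≋-sym (run-peelˡ j (n ℕ.∸ suc j))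

    -- The k-th and the (- k - 1)-st term of the pentagonal series.
    a b : ℕ → Series
    a k = sgn k * q ^ (k ℕ.* k ℕ.+ tri k)
    b k = - (sgn k * q ^ (tri k ℕ.+ suc k ℕ.* suc k))

    f-diagonal : ∀ n → f n n ≋ a n
    f-diagonal n rewrite ℕP.n∸n≡0 n = *-congˡ (*-identityˡ _)

    shanks : ∀ n → ∑ (suc n) (f n) ≋ ∑ n (λ k → a k + b k) + a n
    shanks zero = +-congˡ (f-diagonal 0)
    shanks (suc n) = begin
      ∑ (suc n) (f (suc n)) + f (suc n) (suc n) ≈⟨ +-cong (telescope n n ℕP.≤-refl) (f-diagonal (suc n)) ⟩
      ∑ (suc n) (f n) - h n n + a (suc n) ≈⟨ +-congʳ (+-cong (shanks n) h-diagonal) ⟩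
      ∑ n (λ k → a k + b k) + a n + b n + a (suc n) ≈⟨ +-congʳ (+-assoc _ _ _) ⟩
      ∑ (suc n) (λ k → a k + b k) + a (suc n) ∎
      where
      h-diagonal : - h n n ≋ b n
      h-diagonal rewrite ℕP.n∸n≡0 n = -‿cong (*-congˡ (*-identityˡ _))

    run-0 : ∀ n → run 0 n ≋ qfac n
    run-0 zero = ≋-refl
    run-0 (suc n) = *-congʳ (run-0 n)

    -- For s ≥ 1 the exponent s n + s (s + 1) / 2 exceeds n, so only the summand for s = 0 survives.
    leading : ∀ n j → ∑ (suc j) (f n) ≋ qfac n mod (suc n)
    leading n zero = ≋⇒mod (≋-trans (solve 1 (λ x → con (+ 0) :+ con (+ 1) :* (x :* con (+ 1)) := x) ≋-refl (run 0 n)) (run-0 n))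
    leading n (suc j) = mod-trans (mod-+ (leading n j) (mod-0-* (sgn (suc j)) (mod-0-* (run (suc j) (n ℕ.∸ suc j)) (q^-mod-0 big)))) (≋⇒mod (+-identityʳ _))
      where
      big : suc n ℕ.≤ suc j ℕ.* n ℕ.+ tri (suc j)
      big = ℕP.≤-trans (ℕP.≤-reflexive (ℕP.+-comm 1 n)) (ℕP.+-mono-≤ (ℕP.m≤m+n n (j ℕ.* n)) (s≤s z≤n))

    E≋pentagonal : ∀ n → E ≋ ∑ n (λ k → a k + b k) mod n
    E≋pentagonal n = mod-trans (mod-≤ (ℕP.n≤1+n n) (mod-trans (E≋qfac n) (mod-trans (mod-sym (leading n n)) (≋⇒mod (shanks n)))))
      (mod-trans (mod-+ mod-refl (mod-0-* (sgn n) (q^-mod-0 n≤))) (≋⇒mod (+-identityʳ _)))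
      where
      n≤ : n ℕ.≤ n ℕ.* n ℕ.+ tri n
      n≤ = go n
        where
        go : ∀ n → n ℕ.≤ n ℕ.* n ℕ.+ tri n
        go zero = z≤n
        go n@(suc m) = ℕP.≤-trans (ℕP.m≤m+n n (m ℕ.* n)) (ℕP.m≤m+n (n ℕ.* n) (tri n))

-- Gaussian binomials and a finite Jacobi triple product

module TripleProduct where
  open SeriesRing
  open SeriesOperators
  open EulerProduct
  open import Data.Nat.Solver using () renaming (module +-*-Solver to ℕSolver)

  open Solver using (solve; _:+_; _:*_; _:-_; :-_; con; _:=_)

  module GaussianBinomial where
    open ≋-Reasoning

    -- The Gaussian binomial coefficient [i + j choose i].
    B : ℕ → ℕ → Series
    B zero j = 1#
    B (suc i) zero = 1#
    B (suc i) (suc j) = B i (suc j) + q ^ suc i * B (suc i) j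

    B-0 : ∀ i → B i 0 ≋ 1#
    B-0 zero = ≋-refl
    B-0 (suc i) = ≋-refl

    mutual
      -- Division-free forms of the product formula for Gaussian binomials. This rule and `absorbˡ`
      -- are proved together: their right-hand sides coincide, and each inductive step exchanges one
      -- for the other.
      absorbʳ : ∀ i j → (1# - q ^ suc j) * B i (suc j) ≋ (1# - q ^ suc (i ℕ.+ j)) * B i j
      absorbʳ zero j = ≋-refl
      absorbʳ (suc i) j = begin
        (1# - y) * (B i (suc j) + x * X) ≈⟨ solve 4 (λ x y b X → (con (+ 1) :- y) :* (b :+ x :* X) := (con (+ 1) :- y) :* b :+ (con (+ 1) :- y) :* (x :* X)) ≋-refl x y (B i (suc j)) X ⟩
        (1# - y) * B i (suc j) + (1# - y) * (x * X) ≈⟨ +-congʳ (≋-trans (absorbʳ i j) (≋-sym (absorbˡ i j))) ⟩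
        (1# - x) * X + (1# - y) * (x * X) ≈⟨ solve 3 (λ x y X → (con (+ 1) :- x) :* X :+ (con (+ 1) :- y) :* (x :* X) := (con (+ 1) :- x :* y) :* X) ≋-refl x y X ⟩
        (1# - x * y) * X ≈⟨ *-congʳ (+-congˡ (-‿cong (≋-trans (q^-cong (≡.sym (ℕP.+-suc (suc i) j))) (q^-+ (suc i) (suc j))))) ⟨
        (1# - q ^ suc (suc i ℕ.+ j)) * X ∎
        where
        x = q ^ suc i
        y = q ^ suc j
        X = B (suc i) j

      absorbˡ : ∀ i j → (1# - q ^ suc i) * B (suc i) j ≋ (1# - q ^ suc (i ℕ.+ j)) * B i j
      absorbˡ i zero = *-cong (+-congˡ (-‿cong (q^-cong (≡.cong suc (≡.sym (ℕP.+-identityʳ i)))))) (≋-sym (B-0 i))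
      absorbˡ i (suc j) = begin
        (1# - x) * (Y + x * B (suc i) j) ≈⟨ solve 3 (λ x b Y → (con (+ 1) :- x) :* (Y :+ x :* b) := (con (+ 1) :- x) :* Y :+ x :* ((con (+ 1) :- x) :* b)) ≋-refl x (B (suc i) j) Y ⟩
        (1# - x) * Y + x * ((1# - x) * B (suc i) j) ≈⟨ +-congˡ (*-congˡ (≋-trans (absorbˡ i j) (≋-sym (absorbʳ i j)))) ⟩
        (1# - x) * Y + x * ((1# - y) * Y) ≈⟨ solve 3 (λ x y X → (con (+ 1) :- x) :* X :+ x :* ((con (+ 1) :- y) :* X) := (con (+ 1) :- x :* y) :* X) ≋-refl x y Y ⟩
        (1# - x * y) * Y ≈⟨ *-congʳ (+-congˡ (-‿cong (q^-+ (suc i) (suc j)))) ⟨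
        (1# - q ^ suc (i ℕ.+ suc j)) * Y ∎
        where
        x = q ^ suc i
        y = q ^ suc j
        Y = B i (suc j)

    -- The second q-Pascal rule differs from the defining one by `absorbʳ` minus `absorbˡ`.
    pascal : ∀ i j → B (suc i) (suc j) ≋ q ^ suc j * B i (suc j) + B (suc i) j
    pascal i j = begin
      b + x * X ≈⟨ solve 4 (λ x y b X → b :+ x :* X := y :* b :+ X :+ ((con (+ 1) :- y) :* b :- (con (+ 1) :- x) :* X)) ≋-refl x y b X ⟩
      y * b + X + ((1# - y) * b - (1# - x) * X) ≈⟨ +-congˡ (+-congʳ (≋-trans (absorbʳ i j) (≋-sym (absorbˡ i j)))) ⟩
      y * b + X + ((1# - x) * X - (1# - x) * X) ≈⟨ ≋-trans (+-congˡ (-‿inverseʳ _)) (+-identityʳ _) ⟩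
      y * b + X ∎
      where
      x = q ^ suc i
      y = q ^ suc j
      b = B i (suc j)
      X = B (suc i) j

    B-comm : ∀ i j → B i j ≋ B j i
    B-comm zero j = ≋-sym (B-0 j)
    B-comm (suc i) zero = ≋-refl
    B-comm (suc i) (suc j) = begin
      B i (suc j) + q ^ suc i * B (suc i) j ≈⟨ +-cong (B-comm i (suc j)) (*-congˡ (B-comm (suc i) j)) ⟩
      B (suc j) i + q ^ suc i * B j (suc i) ≈⟨ +-comm _ _ ⟩
      q ^ suc i * B j (suc i) + B (suc j) i ≈⟨ pascal j i ⟨
      B (suc j) (suc i) ∎

    -- The lower index is shifted by one so that 0 stands for - 1; thus `G n k` vanishes for k > n
    -- by itself.
    B⁻ : ℕ → ℕ → Series
    B⁻ zero j = 0#
    B⁻ (suc i) j = B i j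

    pascal⁻ : ∀ i j → B i (suc j) ≋ q ^ suc j * B⁻ i (suc j) + B i j
    pascal⁻ zero j = solve 1 (λ y → con (+ 1) := y :* con (+ 0) :+ con (+ 1)) ≋-refl (q ^ suc j)
    pascal⁻ (suc i) j = pascal i j

    -- Both q-Pascal rules in succession; this is the recurrence produced by the pair of factors (1
    -- - u q^n) (1 - q^n / u).
    three-term : ∀ i j → B (suc i) (suc (suc j)) ≋
      (1# + q ^ (suc i ℕ.+ suc j)) * B i (suc j) + q ^ suc i * B (suc i) j + q ^ suc (suc j) * B⁻ i (suc (suc j))
    three-term i j = begin
      B i (suc (suc j)) + x * B (suc i) (suc j) ≈⟨ +-cong (pascal⁻ i (suc j)) (*-congˡ (pascal i j)) ⟩
      z * B⁻ i (suc (suc j)) + b + x * (y * b + B (suc i) j)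
        ≈⟨ solve 6 (λ x y z b c d → z :* c :+ b :+ x :* (y :* b :+ d) := (con (+ 1) :+ x :* y) :* b :+ x :* d :+ z :* c) ≋-refl x y z b (B⁻ i (suc (suc j))) (B (suc i) j) ⟩
      (1# + x * y) * b + x * B (suc i) j + z * B⁻ i (suc (suc j)) ≈⟨ +-congʳ (+-congʳ (*-congʳ (+-congˡ (q^-+ (suc i) (suc j))))) ⟨
      (1# + q ^ (suc i ℕ.+ suc j)) * b + x * B (suc i) j + z * B⁻ i (suc (suc j)) ∎
      where
      x = q ^ suc i
      y = q ^ suc j
      z = q ^ suc (suc j)
      b = B i (suc j)

    -- For fixed i, the binomial [i + j choose i] tends to the inverse of `qfac i` as j grows.
    qfac*B : ∀ i j → qfac i * B i j ≋ 1# mod (suc j)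
    qfac*B zero j = ≋⇒mod (*-identityˡ 1#)
    qfac*B (suc i) zero = mod-trans (≋⇒mod (*-identityʳ _)) (≡.subst (λ k → qfac k ≋ 1# mod 1) (ℕP.+-identityʳ (suc i)) (qfac-mod 0 (suc i)))
    qfac*B (suc i) (suc j) = mod-trans (≋⇒mod (solve 4 (λ f Q b c → f :* (con (+ 1) :- Q) :* (b :+ Q :* c) := (con (+ 1) :- Q) :* (f :* b) :+ Q :* (f :* (con (+ 1) :- Q) :* c)) ≋-refl (qfac i) Q (B i (suc j)) (B (suc i) j)))
      (mod-trans (mod-+ (mod-* mod-refl (qfac*B i (suc j))) (mod-≤ (s≤s (ℕP.m≤n+m (suc j) i)) (q^-*-mod {suc i} (qfac*B (suc i) j))))
        (≋⇒mod (solve 1 (λ Q → (con (+ 1) :- Q) :* con (+ 1) :+ Q :* con (+ 1) := con (+ 1)) ≋-refl Q)))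
      where Q = q ^ suc i

  open GaussianBinomial

  -- Sequences ℕ → Series are power series in w = u + 1/u - 2 over the q-series.
  prev : (ℕ → Series) → ℕ → Series
  prev f zero = 0#
  prev f (suc j) = f j

  δ : ℕ → Series
  δ zero = 1#
  δ (suc j) = 0#

  -- Multiplication by u + 1/u.
  v· : (ℕ → Series) → ℕ → Series
  v· f j = const (+ 2) * f j + prev f j

  -- χ k is the character u^(-k) + … + u^k.
  χ : ℕ → ℕ → Series
  χ zero j = δ j
  χ (suc zero) j = v· δ j + δ j
  χ (suc (suc k)) j = v· (χ (suc k)) j - χ k j

  -- ∏ (1 - u q^i) (1 - q^i / u) over 1 ≤ i ≤ n.
  Π : ℕ → ℕ → Series
  Π zero j = δ j
  Π (suc n) j = (1# + q ^ suc n * q ^ suc n) * Π n j - q ^ suc n * v· (Π n) j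

  module FiniteTripleProduct where
    open ≋-Reasoning

    G : ℕ → ℕ → Series
    G n k = B⁻ (suc n ℕ.∸ k) (suc (n ℕ.+ k))

    x : ℕ → ℕ → Series
    x n k = sgn k * (q ^ tri k * G n k)

    prev-cong : ∀ {f g} → (∀ j → f j ≋ g j) → ∀ j → prev f j ≋ prev g j
    prev-cong h zero = ≋-refl
    prev-cong h (suc j) = h j

    v·-cong : ∀ {f g} → (∀ j → f j ≋ g j) → ∀ j → v· f j ≋ v· g j
    v·-cong h j = +-cong (*-congˡ (h j)) (prev-cong h j)

    prev-∑ : ∀ n (c : ℕ → Series) (f : ℕ → ℕ → Series) j → prev (λ j → ∑ n (λ k → c k * f k j)) j ≋ ∑ n (λ k → c k * prev (f k) j)
    prev-∑ n c f (suc j) = ≋-refl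
    prev-∑ zero c f zero = ≋-refl
    prev-∑ (suc n) c f zero = ≋-trans (≋-sym (+-identityʳ 0#)) (+-cong (prev-∑ n c f zero) (≋-sym (zeroʳ (c n))))

    v·-∑ : ∀ n (c : ℕ → Series) (f : ℕ → ℕ → Series) j → v· (λ j → ∑ n (λ k → c k * f k j)) j ≋ ∑ n (λ k → c k * v· (f k) j)
    v·-∑ n c f j = ≋-trans (+-congˡ (prev-∑ n c f j)) (go n)
      where
      go : ∀ n → const (+ 2) * ∑ n (λ k → c k * f k j) + ∑ n (λ k → c k * prev (f k) j) ≋ ∑ n (λ k → c k * v· (f k) j)
      go zero = solve 0 (con (+ 2) :* con (+ 0) :+ con (+ 0) := con (+ 0)) ≋-refl
      go (suc n) = ≋-trans (solve 5 (λ S T c f g → con (+ 2) :* (S :+ c :* f) :+ (T :+ c :* g) := con (+ 2) :* S :+ T :+ c :* (con (+ 2) :* f :+ g)) ≋-refl _ _ (c n) (f n j) (prev (f n) j)) (+-congʳ (go n))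

    -- χ (-1) = - χ 0 explains the value of the reflected coefficient at 0.
    reflect : (ℕ → Series) → ℕ → Series
    reflect y zero = - y 0
    reflect y (suc k) = y k

    -- By v χ_k = χ_(k+1) + χ_(k-1), multiplication by v = u + 1/u moves from the characters to the
    -- coefficients, at the price of two boundary terms.
    summation-by-parts : ∀ (y : ℕ → Series) j M → ∑ (suc M) (λ k → y k * v· (χ k) j) ≋
      ∑ (suc M) (λ k → (reflect y k + y (suc k)) * χ k j) + y M * χ (suc M) j - y (suc M) * χ M j
    summation-by-parts y j zero = solve 4 (λ y₀ y₁ c v → con (+ 0) :+ y₀ :* v :=
      con (+ 0) :+ (:- y₀ :+ y₁) :* c :+ y₀ :* (v :+ c) :- y₁ :* c) ≋-refl (y 0) (y 1) (δ j) (v· δ j)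
    summation-by-parts y j (suc M) = begin
      ∑ (suc M) (λ k → y k * v· (χ k) j) + y (suc M) * v₁ ≈⟨ +-congʳ (summation-by-parts y j M) ⟩
      S + y M * c₁ - y (suc M) * c₀ + y (suc M) * v₁
        ≈⟨ solve 7 (λ S y₀ y₁ y₂ c₀ c₁ v₁ → S :+ y₀ :* c₁ :- y₁ :* c₀ :+ y₁ :* v₁ := S :+ (y₀ :+ y₂) :* c₁ :+ y₁ :* (v₁ :- c₀) :- y₂ :* c₁) ≋-refl S (y M) (y (suc M)) (y (suc (suc M))) c₀ c₁ v₁ ⟩
      S + (y M + y (suc (suc M))) * c₁ + y (suc M) * χ (suc (suc M)) j - y (suc (suc M)) * c₁ ∎
      where
      S = ∑ (suc M) (λ k → (reflect y k + y (suc k)) * χ k j)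
      c₀ = χ M j
      c₁ = χ (suc M) j
      v₁ = v· (χ (suc M)) j

    x-vanish : ∀ n k → n ℕ.< k → x n k ≋ 0#
    x-vanish n k n<k rewrite ℕP.m≤n⇒m∸n≡0 n<k = solve 2 (λ s t → s :* (t :* con (+ 0)) := con (+ 0)) ≋-refl (sgn k) (q ^ tri k)

    G-suc : ∀ n k → k ℕ.≤ n → G (suc n) (suc k) ≋
      (1# + q ^ suc n * q ^ suc n) * G n (suc k) + q ^ (n ℕ.∸ k) * G n k + q ^ suc (suc k) * q ^ suc n * G n (suc (suc k))
    G-suc n k k≤n with ℕP.m≤n⇒∃[o]m+o≡n k≤n
    ... | zero , ≡.refl rewrite ℕP.+-identityʳ k | ℕP.n∸n≡0 k | ℕP.+-∸-assoc 1 (ℕP.≤-refl {k}) | ℕP.n∸n≡0 k | ℕP.m≤n⇒m∸n≡0 (ℕP.n≤1+n k) =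
      solve 2 (λ Q z → con (+ 1) := (con (+ 1) :+ Q :* Q) :* con (+ 0) :+ con (+ 1) :* con (+ 1) :+ z :* Q :* con (+ 0)) ≋-refl (q ^ suc k) (q ^ suc (suc k))
    ... | suc c , k+1+c≡n = interior n∸k (≡.trans (ℕP.+-∸-assoc 1 k≤n) (≡.cong suc n∸k)) (≡.trans (≡.sym (ℕP.pred[m∸n]≡m∸[1+n] n k)) (≡.cong ℕ.pred n∸k))
      where
      n∸k : n ℕ.∸ k ≡ suc c
      n∸k = ≡.trans (≡.cong (ℕ._∸ k) (≡.sym k+1+c≡n)) (ℕP.m+n∸m≡n k (suc c))
      eQQ : q ^ (suc c ℕ.+ suc (suc (n ℕ.+ k))) ≋ q ^ suc n * q ^ suc n
      eQQ = ≋-trans (q^-cong (≡.subst (λ n → suc c ℕ.+ suc (suc (n ℕ.+ k)) ≡ suc n ℕ.+ suc n) k+1+c≡n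
        (ℕSolver.solve 2 (λ c k → con₁ 1 :+₁ c :+₁ (con₁ 2 :+₁ ((k :+₁ (con₁ 1 :+₁ c)) :+₁ k)) :=₁ (con₁ 1 :+₁ (k :+₁ (con₁ 1 :+₁ c))) :+₁ (con₁ 1 :+₁ (k :+₁ (con₁ 1 :+₁ c)))) ≡.refl c k)))
        (q^-+ (suc n) (suc n))
        where open ℕSolver using () renaming (con to con₁; _:+_ to _:+₁_; _:=_ to _:=₁_)
      eQ : q ^ suc (suc (suc (n ℕ.+ k))) ≋ q ^ suc (suc k) * q ^ suc n
      eQ = ≋-trans (q^-cong (≡.trans (≡.cong suc (≡.sym (ℕP.+-suc (suc n) k))) (≡.trans (≡.sym (ℕP.+-suc (suc n) (suc k))) (ℕP.+-comm (suc n) (suc (suc k)))))) (q^-+ (suc (suc k)) (suc n))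
      interior : n ℕ.∸ k ≡ suc c → suc n ℕ.∸ k ≡ suc (suc c) → n ℕ.∸ suc k ≡ c → G (suc n) (suc k) ≋
        (1# + q ^ suc n * q ^ suc n) * G n (suc k) + q ^ (n ℕ.∸ k) * G n k + q ^ suc (suc k) * q ^ suc n * G n (suc (suc k))
      interior e₁ e₂ e₃ rewrite e₁ | e₂ | e₃ | ℕP.+-suc n (suc k) | ℕP.+-suc n k =
        ≋-trans (three-term c (suc (n ℕ.+ k))) (+-cong (+-cong (*-congʳ (+-congˡ eQQ)) ≋-refl) (*-cong eQ ≋-refl))

    G-zero : ∀ n → G (suc n) 0 ≋ (1# + q ^ suc n * q ^ suc n) * G n 0 + q ^ suc n * G n 0 + q * q ^ suc n * G n 1
    G-zero n rewrite ℕP.+-identityʳ n | ℕP.+-comm n 1 = ≋-trans (three-term n n)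
      (+-cong (+-cong (*-congʳ (+-congˡ (q^-+ (suc n) (suc n)))) (*-congˡ (B-comm (suc n) n))) ≋-refl)

-- The triple product as a theta series; derivatives of the geometric series

module ThetaSeries where
  open SeriesRing
  open SeriesOperators
  open EulerProduct
  open TripleProduct
  open import Data.Nat.Solver using () renaming (module +-*-Solver to ℕSolver)

  open Solver using (solve; _:+_; _:*_; _:-_; :-_; _:^_; con; _:=_)
  open GaussianBinomial
  open FiniteTripleProduct

  -- Induction on n: summation by parts turns the new pair of factors into a recurrence for the
  -- coefficients, which `G-suc` and `G-zero` identify with that of [2 n + 1 choose n - k].
  finite-triple-product : ∀ n j → Π n j ≋ ∑ (suc n) (λ k → x n k * χ k j)
  finite-triple-product zero j = solve 1 (λ d → d := con (+ 0) :+ con (+ 1) :* (con (+ 1) :* con (+ 1)) :* d) ≋-refl (δ j)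
  finite-triple-product (suc n) j = begin
    (1# + Q * Q) * Π n j - Q * v· (Π n) j
      ≈⟨ +-cong (*-congˡ (extend j)) (-‿cong (*-congˡ (≋-trans (v·-cong extend j) (v·-∑ (suc (suc n)) (x n) χ j)))) ⟩
    (1# + Q * Q) * ∑ (suc (suc n)) (λ k → x n k * χ k j) - Q * ∑ (suc (suc n)) (λ k → x n k * v· (χ k) j)
      ≈⟨ +-congˡ (-‿cong (*-congˡ (≋-trans (summation-by-parts (x n) j (suc n)) boundary))) ⟩
    (1# + Q * Q) * ∑ (suc (suc n)) (λ k → x n k * χ k j) - Q * ∑ (suc (suc n)) (λ k → (reflect (x n) k + x n (suc k)) * χ k j)
      ≈⟨ merge (suc (suc n)) ℕP.≤-refl ⟩
    ∑ (suc (suc n)) (λ k → x (suc n) k * χ k j) ∎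
    where
    open ≋-Reasoning
    Q = q ^ suc n
    extend : ∀ j → Π n j ≋ ∑ (suc (suc n)) (λ k → x n k * χ k j)
    extend j = ≋-trans (finite-triple-product n j) (≋-sym (≋-trans (+-congˡ (≋-trans (*-congʳ (x-vanish n (suc n) ℕP.≤-refl)) (zeroˡ _))) (+-identityʳ _)))
    boundary : ∑ (suc (suc n)) (λ k → (reflect (x n) k + x n (suc k)) * χ k j) + x n (suc n) * χ (suc (suc n)) j - x n (suc (suc n)) * χ (suc n) j
      ≋ ∑ (suc (suc n)) (λ k → (reflect (x n) k + x n (suc k)) * χ k j)
    boundary = ≋-trans (+-cong (+-congˡ (*-congʳ (x-vanish n (suc n) ℕP.≤-refl))) (-‿cong (*-congʳ (x-vanish n (suc (suc n)) (s≤s (ℕP.n≤1+n n))))))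
      (solve 3 (λ S a b → S :+ con (+ 0) :* a :- con (+ 0) :* b := S) ≋-refl _ (χ (suc (suc n)) j) (χ (suc n) j))
    coefficient : ∀ k → k ℕ.< suc (suc n) → (1# + Q * Q) * x n k - Q * (reflect (x n) k + x n (suc k)) ≋ x (suc n) k
    coefficient zero _ = ≋-sym (≋-trans (*-congˡ (*-congˡ (G-zero n)))
      (solve 4 (λ q Q g₀ g₁ → con (+ 1) :* (con (+ 1) :* ((con (+ 1) :+ Q :* Q) :* g₀ :+ Q :* g₀ :+ q :* Q :* g₁))
        := (con (+ 1) :+ Q :* Q) :* (con (+ 1) :* (con (+ 1) :* g₀)) :- Q :* (:- (con (+ 1) :* (con (+ 1) :* g₀)) :+ (:- con (+ 1)) :* (q :* con (+ 1) :* g₁))) ≋-refl q Q (G n 0) (G n 1)))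
    coefficient (suc k) (s≤s (s≤s k≤n)) = ≋-sym (begin
      - σ * (A * G (suc n) (suc k)) ≈⟨ *-congˡ (*-congˡ (G-suc n k k≤n)) ⟩
      - σ * (A * ((1# + Q * Q) * g₁ + z * g₀ + y * Q * g₂))
        ≈⟨ solve 8 (λ σ A Q g₀ g₁ g₂ z y → (:- σ) :* (A :* ((con (+ 1) :+ Q :* Q) :* g₁ :+ z :* g₀ :+ y :* Q :* g₂))
          := (con (+ 1) :+ Q :* Q) :* ((:- σ) :* (A :* g₁)) :- (σ :* ((A :* z) :* g₀) :+ Q :* (σ :* ((y :* A) :* g₂)))) ≋-refl σ A Q g₀ g₁ g₂ z y ⟩
      (1# + Q * Q) * (- σ * (A * g₁)) - (σ * ((A * z) * g₀) + Q * (σ * ((y * A) * g₂)))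
        ≈⟨ +-congˡ (-‿cong (+-cong (*-congˡ (*-congʳ Az)) (*-congˡ (*-congˡ (*-congʳ (≋-sym (q^-+ (suc (suc k)) (tri (suc k))))))))) ⟩
      (1# + Q * Q) * (- σ * (A * g₁)) - (σ * ((Q * q ^ tri k) * g₀) + Q * (σ * (q ^ tri (suc (suc k)) * g₂)))
        ≈⟨ solve 7 (λ L Q σ t g₀ s g₂ → L :- (σ :* ((Q :* t) :* g₀) :+ Q :* (σ :* (s :* g₂))) := L :- Q :* (σ :* (t :* g₀) :+ (:- (:- σ)) :* (s :* g₂))) ≋-refl
             ((1# + Q * Q) * (- σ * (A * g₁))) Q σ (q ^ tri k) g₀ (q ^ tri (suc (suc k))) g₂ ⟩
      (1# + Q * Q) * x n (suc k) - Q * (x n k + x n (suc (suc k))) ∎)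
      where
      σ = sgn k
      A = q ^ tri (suc k)
      g₀ = G n k
      g₁ = G n (suc k)
      g₂ = G n (suc (suc k))
      z = q ^ (n ℕ.∸ k)
      y = q ^ suc (suc k)
      Az : A * z ≋ Q * q ^ tri k
      Az = ≋-trans (≋-sym (q^-+ (tri (suc k)) (n ℕ.∸ k))) (≋-trans (q^-cong exponent) (q^-+ (suc n) (tri k)))
        where
        exponent : tri (suc k) ℕ.+ (n ℕ.∸ k) ≡ suc n ℕ.+ tri k
        exponent = ≡.trans (≡.cong suc (≡.trans (ℕSolver.solve 3 (λ k t d → k :+₁ t :+₁ d :=₁ k :+₁ d :+₁ t) ≡.refl k (tri k) (n ℕ.∸ k)) (≡.cong (ℕ._+ tri k) (ℕP.m+[n∸m]≡n k≤n)))) ≡.refl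
          where open ℕSolver using () renaming (_:+_ to _:+₁_; _:=_ to _:=₁_)
    merge : ∀ m → m ℕ.≤ suc (suc n) → (1# + Q * Q) * ∑ m (λ k → x n k * χ k j) - Q * ∑ m (λ k → (reflect (x n) k + x n (suc k)) * χ k j)
      ≋ ∑ m (λ k → x (suc n) k * χ k j)
    merge zero _ = solve 1 (λ Q → (con (+ 1) :+ Q :* Q) :* con (+ 0) :- Q :* con (+ 0) := con (+ 0)) ≋-refl Q
    merge (suc m) m<  = ≋-trans (solve 6 (λ Q S T a b c → (con (+ 1) :+ Q :* Q) :* (S :+ a :* c) :- Q :* (T :+ b :* c)
        := (con (+ 1) :+ Q :* Q) :* S :- Q :* T :+ ((con (+ 1) :+ Q :* Q) :* a :- Q :* b) :* c) ≋-refl Q _ _ (x n m) (reflect (x n) m + x n (suc m)) (χ m j))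
      (+-cong (merge m (ℕP.<⇒≤ m<)) (*-congʳ (coefficient m m<)))

  -- The coefficients of the theta series ∑ (-1)^k q^(k(k+1)/2) χ_k.
  J : ℕ → ℕ → Series
  J n j = ∑ (suc n) (λ k → sgn k * q ^ tri k * χ k j)

  k≤tri : ∀ k → k ℕ.≤ tri k
  k≤tri zero = z≤n
  k≤tri (suc k) = ℕP.m≤m+n (suc k) (tri k)

  -- The product of `qfac n` and `G n k` is 1 up to an error of order q^(n - k + 1); the factor q^(k
  -- (k + 1) / 2) pushes this error beyond q^n.
  qfac*Π≋J : ∀ n j → qfac n * Π n j ≋ J n j mod (suc n)
  qfac*Π≋J n j = mod-trans (≋⇒mod (≋-trans (*-congˡ (finite-triple-product n j)) (∑-*ˡ (suc n) (qfac n) _))) (∑-mod (suc n) term)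
    where
    term : ∀ k → k ℕ.< suc n → qfac n * (x n k * χ k j) ≋ sgn k * q ^ tri k * χ k j mod (suc n)
    term k (s≤s k≤n) = mod-trans (≋⇒mod (solve 5 (λ f s t g c → f :* (s :* (t :* g) :* c) := s :* (t :* (f :* g)) :* c) ≋-refl (qfac n) (sgn k) (q ^ tri k) (G n k) (χ k j)))
      (mod-trans (mod-* (mod-* mod-refl (mod-≤ bound (q^-*-mod {tri k} unit))) mod-refl)
        (≋⇒mod (*-congʳ (*-congˡ (*-identityʳ (q ^ tri k))))))
      where
      bound : suc n ℕ.≤ tri k ℕ.+ suc (n ℕ.∸ k)
      bound = ℕP.≤-trans (ℕP.≤-reflexive (≡.trans (≡.cong suc (≡.sym (ℕP.m+[n∸m]≡n k≤n))) (≡.sym (ℕP.+-suc k (n ℕ.∸ k))))) (ℕP.+-monoˡ-≤ _ (k≤tri k))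
      unit : qfac n * G n k ≋ 1# mod (suc (n ℕ.∸ k))
      unit rewrite ℕP.+-∸-assoc 1 k≤n = mod-trans
        (mod-* (≡.subst (λ m → qfac m ≋ qfac (n ℕ.∸ k) mod (suc (n ℕ.∸ k))) (ℕP.m+[n∸m]≡n k≤n) (qfac-mod (n ℕ.∸ k) k)) mod-refl)
        (mod-≤ (s≤s (ℕP.≤-trans (ℕP.m∸n≤m n k) (ℕP.≤-trans (ℕP.m≤m+n n k) (ℕP.n≤1+n _)))) (qfac*B (n ℕ.∸ k) (suc (n ℕ.+ k))))

  -- ∑ q^m, so that D geometric = q / (1 - q)².
  geometric : Series
  geometric _ = + 1

  geometric-unfold : geometric ≋ 1# + q * geometric
  geometric-unfold = ≋-trans (head-tail geometric) (+-congˡ (*-congˡ ≋-refl))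

  module LambertSeries where
    open ≋-Reasoning
    g = geometric
    y₀ = D geometric

    Dg : y₀ ≋ g * g - g
    Dg = begin
      y₀ ≈⟨ ≋-trans (solve 3 (λ g q y → y := (con (+ 1) :+ q :* g) :* y :- q :* y :* g) ≋-refl g q y₀) (+-congʳ (*-congʳ (≋-sym geometric-unfold))) ⟩
      g * y₀ - q * y₀ * g ≈⟨ +-congʳ (*-congˡ Dg′) ⟩
      g * (q * g + q * y₀) - q * y₀ * g ≈⟨ solve 3 (λ g q y → g :* (q :* g :+ q :* y) :- q :* y :* g := ((con (+ 1) :+ q :* g) :- con (+ 1)) :* g) ≋-refl g q y₀ ⟩
      (1# + q * g - 1#) * g ≈⟨ *-congʳ (+-congʳ (≋-sym geometric-unfold)) ⟩
      (g - 1#) * g ≈⟨ solve 1 (λ g → (g :- con (+ 1)) :* g := g :* g :- g) ≋-refl g ⟩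
      g * g - g ∎
      where
      Dg′ : D g ≋ q * g + q * D g
      Dg′ = begin
        D g ≈⟨ D-cong geometric-unfold ⟩
        D (1# + q * g) ≈⟨ ≋-trans (D-+ _ _) (+-cong (D-const _) (≋-trans (D-* q g) (+-congʳ (*-congʳ D-q)))) ⟩
        0# + (q * g + q * D g) ≈⟨ +-identityˡ _ ⟩
        q * g + q * D g ∎

    y₀-equation : (1# - q) * (1# - q) * y₀ ≋ q
    y₀-equation = begin
      (1# - q) * (1# - q) * y₀ ≈⟨ *-congˡ Dg ⟩
      (1# - q) * (1# - q) * (g * g - g)
        ≈⟨ solve 2 (λ g q → (con (+ 1) :- q) :* (con (+ 1) :- q) :* (g :* g :- g) := (g :- q :* g) :* (g :- q :* g) :- (con (+ 1) :- q) :* (g :- q :* g)) ≋-refl g q ⟩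
      (g - q * g) * (g - q * g) - (1# - q) * (g - q * g) ≈⟨ +-cong (*-cong one one) (-‿cong (*-congˡ one)) ⟩
      1# * 1# - (1# - q) * 1# ≈⟨ solve 1 (λ q → con (+ 1) :* con (+ 1) :- (con (+ 1) :- q) :* con (+ 1) := q) ≋-refl q ⟩
      q ∎
      where
      one : g - q * g ≋ 1#
      one = ≋-trans (+-congʳ geometric-unfold) (solve 2 (λ g q → con (+ 1) :+ q :* g :- q :* g := con (+ 1)) ≋-refl g q)

    D-- : ∀ a b → D (a - b) ≋ D a - D b
    D-- a b = ≋-trans (D-+ a (- b)) (+-congˡ (D-neg b))

    -- Since D y₀ = r y₀ with r² = 4 y₀ + 1, the derivatives of y₀ of even order are polynomials in
    -- y₀. This makes the Lambert series of E₆ a combination of power sums of y₀(q^i).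
    D⁵g : D (D (D (D (D g)))) ≋ const (+ 120) * y₀ ^ 3 + const (+ 30) * y₀ ^ 2 + y₀
    D⁵g = begin
      D (D (D (D y₀))) ≈⟨ D-cong (D-cong (D-cong D¹)) ⟩
      D (D (D (r * y₀))) ≈⟨ D-cong (D-cong D²) ⟩
      D (D (y₀ + const (+ 6) * (y₀ * y₀))) ≈⟨ D-cong D³ ⟩
      D ((1# + const (+ 12) * y₀) * (r * y₀)) ≈⟨ D-* _ _ ⟩
      D (1# + const (+ 12) * y₀) * (r * y₀) + (1# + const (+ 12) * y₀) * D (r * y₀)
        ≈⟨ +-cong (*-congʳ (≋-trans (D-+ _ _) (+-cong (D-const _) (≋-trans (D-* _ _) (+-cong (*-congʳ (D-const _)) (*-congˡ D¹)))))) (*-congˡ D²) ⟩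
      (0# + (0# * y₀ + const (+ 12) * (r * y₀))) * (r * y₀) + (1# + const (+ 12) * y₀) * (y₀ + const (+ 6) * (y₀ * y₀))
        ≈⟨ solve 2 (λ r y → (con (+ 0) :+ (con (+ 0) :* y :+ con (+ 12) :* (r :* y))) :* (r :* y) :+ (con (+ 1) :+ con (+ 12) :* y) :* (y :+ con (+ 6) :* (y :* y))
             := con (+ 12) :* (r :* r) :* (y :* y) :+ (con (+ 1) :+ con (+ 12) :* y) :* (y :+ con (+ 6) :* (y :* y))) ≋-refl r y₀ ⟩
      const (+ 12) * (r * r) * (y₀ * y₀) + (1# + const (+ 12) * y₀) * (y₀ + const (+ 6) * (y₀ * y₀))
        ≈⟨ +-congʳ (*-congʳ (*-congˡ r²)) ⟩
      const (+ 12) * (const (+ 4) * y₀ + 1#) * (y₀ * y₀) + (1# + const (+ 12) * y₀) * (y₀ + const (+ 6) * (y₀ * y₀))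
        ≈⟨ solve 1 (λ y → con (+ 12) :* (con (+ 4) :* y :+ con (+ 1)) :* (y :* y) :+ (con (+ 1) :+ con (+ 12) :* y) :* (y :+ con (+ 6) :* (y :* y))
             := con (+ 120) :* y :^ 3 :+ con (+ 30) :* y :^ 2 :+ y) ≋-refl y₀ ⟩
      const (+ 120) * y₀ ^ 3 + const (+ 30) * y₀ ^ 2 + y₀ ∎
      where
      r = const (+ 2) * g - 1#
      r² : r * r ≋ const (+ 4) * y₀ + 1#
      r² = ≋-trans (solve 1 (λ g → (con (+ 2) :* g :- con (+ 1)) :* (con (+ 2) :* g :- con (+ 1)) := con (+ 4) :* (g :* g :- g) :+ con (+ 1)) ≋-refl g) (+-congʳ (*-congˡ (≋-sym Dg)))
      Dr : D r ≋ const (+ 2) * y₀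
      Dr = ≋-trans (D-- _ _) (≋-trans (+-cong (≋-trans (D-* _ _) (+-congʳ (*-congʳ (D-const _)))) (-‿cong (D-const _)))
        (solve 2 (λ g y → con (+ 0) :* g :+ con (+ 2) :* y :- con (+ 0) := con (+ 2) :* y) ≋-refl g y₀))
      D¹ : D y₀ ≋ r * y₀
      D¹ = begin
        D y₀ ≈⟨ D-cong Dg ⟩
        D (g * g - g) ≈⟨ ≋-trans (D-- _ _) (+-congʳ (D-* g g)) ⟩
        y₀ * g + g * y₀ - y₀ ≈⟨ solve 2 (λ g y → y :* g :+ g :* y :- y := (con (+ 2) :* g :- con (+ 1)) :* y) ≋-refl g y₀ ⟩
        r * y₀ ∎
      D² : D (r * y₀) ≋ y₀ + const (+ 6) * (y₀ * y₀)
      D² = begin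
        D (r * y₀) ≈⟨ ≋-trans (D-* _ _) (+-cong (*-congʳ Dr) (*-congˡ D¹)) ⟩
        const (+ 2) * y₀ * y₀ + r * (r * y₀) ≈⟨ +-congˡ (≋-trans (≋-sym (*-assoc r r y₀)) (*-congʳ r²)) ⟩
        const (+ 2) * y₀ * y₀ + (const (+ 4) * y₀ + 1#) * y₀ ≈⟨ solve 1 (λ y → con (+ 2) :* y :* y :+ (con (+ 4) :* y :+ con (+ 1)) :* y := y :+ con (+ 6) :* (y :* y)) ≋-refl y₀ ⟩
        y₀ + const (+ 6) * (y₀ * y₀) ∎
      D³ : D (y₀ + const (+ 6) * (y₀ * y₀)) ≋ (1# + const (+ 12) * y₀) * (r * y₀)
      D³ = begin
        D (y₀ + const (+ 6) * (y₀ * y₀)) ≈⟨ ≋-trans (D-+ _ _) (+-cong D¹ (≋-trans (D-* _ _) (+-cong (*-congʳ (D-const _)) (*-congˡ (≋-trans (D-* _ _) (+-cong (*-congʳ D¹) (*-congˡ D¹))))))) ⟩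
        r * y₀ + (0# * (y₀ * y₀) + const (+ 6) * (r * y₀ * y₀ + y₀ * (r * y₀)))
          ≈⟨ solve 2 (λ r y → r :* y :+ (con (+ 0) :* (y :* y) :+ con (+ 6) :* (r :* y :* y :+ y :* (r :* y))) := (con (+ 1) :+ con (+ 12) :* y) :* (r :* y)) ≋-refl r y₀ ⟩
        (1# + const (+ 12) * y₀) * (r * y₀) ∎

-- Elementary symmetric functions of q^i / (1 - q^i)² through theta series

module LambertExpansion where
  open SeriesRing
  open SeriesOperators
  open EulerProduct
  open TripleProduct
  open ThetaSeries

  open Solver using (solve; _:+_; _:*_; _:-_; :-_; _:^_; con; _:=_)

  const-*-cancel-mod : ∀ c .{{_ : ℤ.NonZero c}} {a b N} → const c * a ≋ const c * b mod N → a ≋ b mod N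
  const-*-cancel-mod c {a} {b} h i i<N = ℤP.*-cancelˡ-≡ c (a i) (b i) (≡.trans (≡.sym (const-*-at c a i)) (≡.trans (h i i<N) (const-*-at c b i)))

  module MacMahon where
    open ≋-Reasoning
    open LambertSeries using (y₀; y₀-equation)

    y : ℕ → Series
    y i = φ (suc i) y₀

    y-equation : ∀ i → (1# - q ^ suc i) * (1# - q ^ suc i) * y i ≋ q ^ suc i
    y-equation i = begin
      (1# - q ^ suc i) * (1# - q ^ suc i) * y i ≈⟨ *-congʳ (*-cong 1-φ 1-φ) ⟨
      φ (suc i) (1# - q) * φ (suc i) (1# - q) * y i ≈⟨ ≋-trans (φ-* (suc i) _ _) (*-congʳ (φ-* (suc i) _ _)) ⟨
      φ (suc i) ((1# - q) * (1# - q) * y₀) ≈⟨ φ-cong (suc i) y₀-equation ⟩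
      φ (suc i) q ≈⟨ φ-q (suc i) ⟩
      q ^ suc i ∎
      where
      1-φ : φ (suc i) (1# - q) ≋ 1# - q ^ suc i
      1-φ = ≋-trans (φ-+ (suc i) 1# (- q)) (+-cong (φ-const (suc i) (+ 1)) (≋-trans (φ-neg (suc i) q) (-‿cong (φ-q (suc i)))))

    -- The coefficients of ∏ (1 - w y i) over i < n.
    c : ℕ → ℕ → Series
    c zero j = δ j
    c (suc n) j = c n j - y n * prev (c n) j

    -- (1 - u Q) (1 - Q / u) = (1 - Q)² - Q w for Q = q^i, and `y-equation` allows (1 - Q)² to be
    -- factored out.
    Π≋c : ∀ n j → Π n j ≋ qfac n * qfac n * c n j
    Π≋c zero j = solve 1 (λ d → d := con (+ 1) :* con (+ 1) :* d) ≋-refl (δ j)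
    Π≋c (suc n) j = begin
      (1# + Q * Q) * Π n j - Q * (const (+ 2) * Π n j + prev (Π n) j)
        ≈⟨ solve 3 (λ Q a b → (con (+ 1) :+ Q :* Q) :* a :- Q :* (con (+ 2) :* a :+ b) := (con (+ 1) :- Q) :* (con (+ 1) :- Q) :* a :- Q :* b) ≋-refl Q (Π n j) (prev (Π n) j) ⟩
      (1# - Q) * (1# - Q) * Π n j - Q * prev (Π n) j
        ≈⟨ +-cong (*-congˡ (Π≋c n j)) (-‿cong (*-cong (≋-sym (y-equation n)) (prev-Π j))) ⟩
      (1# - Q) * (1# - Q) * (qfac n * qfac n * c n j) - (1# - Q) * (1# - Q) * y n * (qfac n * qfac n * prev (c n) j)
        ≈⟨ solve 5 (λ Q f a y b → (con (+ 1) :- Q) :* (con (+ 1) :- Q) :* (f :* f :* a) :- (con (+ 1) :- Q) :* (con (+ 1) :- Q) :* y :* (f :* f :* b)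
             := f :* (con (+ 1) :- Q) :* (f :* (con (+ 1) :- Q)) :* (a :- y :* b)) ≋-refl Q (qfac n) (c n j) (y n) (prev (c n) j) ⟩
      qfac (suc n) * qfac (suc n) * c (suc n) j ∎
      where
      Q = q ^ suc n
      prev-Π : ∀ j → prev (Π n) j ≋ qfac n * qfac n * prev (c n) j
      prev-Π zero = ≋-sym (zeroʳ _)
      prev-Π (suc j) = Π≋c n j

    E³c≋J : ∀ n j → E ^ 3 * c n j ≋ J n j mod (suc n)
    E³c≋J n j = mod-trans (mod-* (mod-^ 3 (E≋qfac n)) mod-refl) (mod-trans (≋⇒mod
      (≋-trans (solve 2 (λ f c → f :^ 3 :* c := f :* (f :* f :* c)) ≋-refl (qfac n) (c n j)) (*-congˡ (≋-sym (Π≋c n j))))) (qfac*Π≋J n j))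

    c₀ : ∀ n → c n 0 ≋ 1#
    c₀ zero = ≋-refl
    c₀ (suc n) = ≋-trans (+-congʳ (c₀ n)) (solve 1 (λ y → con (+ 1) :- y :* con (+ 0) := con (+ 1)) ≋-refl (y n))

    -- Jacobi's identity for E³: the point u = 1 is w = 0, where χ_k takes the value 2 k + 1.
    E³≋J : ∀ n → E ^ 3 ≋ J n 0 mod (suc n)
    E³≋J n = mod-trans (≋⇒mod (≋-trans (≋-sym (*-identityʳ _)) (*-congˡ (≋-sym (c₀ n))))) (E³c≋J n 0)

    p₁ p₂ p₃ : ℕ → Series
    p₁ n = ∑ n y
    p₂ n = ∑ n (λ i → y i ^ 2)
    p₃ n = ∑ n (λ i → y i ^ 3)

    newton₁ : ∀ n → c n 1 ≋ - p₁ n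
    newton₁ zero = solve 0 (con (+ 0) := :- con (+ 0)) ≋-refl
    newton₁ (suc n) = ≋-trans (+-cong (newton₁ n) (-‿cong (*-congˡ (c₀ n)))) (solve 2 (λ p y → :- p :- y :* con (+ 1) := :- (p :+ y)) ≋-refl (p₁ n) (y n))

    newton₂ : ∀ n → const (+ 2) * c n 2 ≋ p₁ n * p₁ n - p₂ n
    newton₂ zero = solve 0 (con (+ 2) :* con (+ 0) := con (+ 0) :* con (+ 0) :- con (+ 0)) ≋-refl
    newton₂ (suc n) = begin
      const (+ 2) * (c n 2 - y n * c n 1) ≈⟨ solve 3 (λ c y d → con (+ 2) :* (c :- y :* d) := con (+ 2) :* c :- con (+ 2) :* (y :* d)) ≋-refl (c n 2) (y n) (c n 1) ⟩
      const (+ 2) * c n 2 - const (+ 2) * (y n * c n 1) ≈⟨ +-cong (newton₂ n) (-‿cong (*-congˡ (*-congˡ (newton₁ n)))) ⟩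
      p₁ n * p₁ n - p₂ n - const (+ 2) * (y n * - p₁ n)
        ≈⟨ solve 3 (λ p r y → p :* p :- r :- con (+ 2) :* (y :* :- p) := (p :+ y) :* (p :+ y) :- (r :+ y :^ 2)) ≋-refl (p₁ n) (p₂ n) (y n) ⟩
      p₁ (suc n) * p₁ (suc n) - p₂ (suc n) ∎

    newton₃ : ∀ n → const (+ 6) * c n 3 ≋ - (p₁ n ^ 3 - const (+ 3) * (p₁ n * p₂ n) + const (+ 2) * p₃ n)
    newton₃ zero = solve 0 (con (+ 6) :* con (+ 0) := :- (con (+ 0) :^ 3 :- con (+ 3) :* (con (+ 0) :* con (+ 0)) :+ con (+ 2) :* con (+ 0))) ≋-refl
    newton₃ (suc n) = begin
      const (+ 6) * (c n 3 - y n * c n 2) ≈⟨ solve 3 (λ c y d → con (+ 6) :* (c :- y :* d) := con (+ 6) :* c :- con (+ 3) :* (y :* (con (+ 2) :* d))) ≋-refl (c n 3) (y n) (c n 2) ⟩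
      const (+ 6) * c n 3 - const (+ 3) * (y n * (const (+ 2) * c n 2)) ≈⟨ +-cong (newton₃ n) (-‿cong (*-congˡ (*-congˡ (newton₂ n)))) ⟩
      - (p₁ n ^ 3 - const (+ 3) * (p₁ n * p₂ n) + const (+ 2) * p₃ n) - const (+ 3) * (y n * (p₁ n * p₁ n - p₂ n))
        ≈⟨ solve 4 (λ p r s y → :- (p :^ 3 :- con (+ 3) :* (p :* r) :+ con (+ 2) :* s) :- con (+ 3) :* (y :* (p :* p :- r))
             := :- ((p :+ y) :^ 3 :- con (+ 3) :* ((p :+ y) :* (r :+ y :^ 2)) :+ con (+ 2) :* (s :+ y :^ 3))) ≋-refl (p₁ n) (p₂ n) (p₃ n) (y n) ⟩
      _ ∎

    κ : ℕ → Series
    κ k = const (+ k)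

    κ-suc : ∀ k → κ (suc k) ≋ κ k + 1#
    κ-suc k = ≋-trans (const-cong (≡.cong +_ (ℕP.+-comm 1 k))) (const-+ (+ k) (+ 1))

    2tri : ∀ k → const (+ 2) * κ (tri k) ≋ κ k * κ k + κ k
    2tri zero = solve 0 (con (+ 2) :* con (+ 0) := con (+ 0) :* con (+ 0) :+ con (+ 0)) ≋-refl
    2tri (suc k) = begin
      const (+ 2) * κ (suc k ℕ.+ tri k) ≈⟨ *-congˡ (≋-trans (const-+ (+ suc k) (+ tri k)) (+-congʳ (κ-suc k))) ⟩
      const (+ 2) * (κ k + 1# + κ (tri k)) ≈⟨ solve 2 (λ k t → con (+ 2) :* (k :+ con (+ 1) :+ t) := con (+ 2) :* t :+ con (+ 2) :* (k :+ con (+ 1))) ≋-refl (κ k) (κ (tri k)) ⟩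
      const (+ 2) * κ (tri k) + const (+ 2) * (κ k + 1#) ≈⟨ +-congʳ (2tri k) ⟩
      κ k * κ k + κ k + const (+ 2) * (κ k + 1#) ≈⟨ solve 1 (λ k → k :* k :+ k :+ con (+ 2) :* (k :+ con (+ 1)) := (k :+ con (+ 1)) :* (k :+ con (+ 1)) :+ (k :+ con (+ 1))) ≋-refl (κ k) ⟩
      (κ k + 1#) * (κ k + 1#) + (κ k + 1#) ≈⟨ +-cong (*-cong (κ-suc k) (κ-suc k)) (κ-suc k) ⟨
      κ (suc k) * κ (suc k) + κ (suc k) ∎

    -- These are (2 j + 1)! times the coefficient of w^j in χ_k. Besides the factor 2 k + 1, only k
    -- (k + 1) = 2 `tri k` occurs. Since D multiplies the k-th theta term by `tri k`, the higher
    -- coefficients of the theta series become derivatives of E³.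
    F₀ F₁ F₂ F₃ : Series → Series
    F₀ k = const (+ 2) * k + 1#
    F₁ k = F₀ k * (k * k + k)
    F₂ k = F₁ k * (k * k + k - const (+ 2))
    F₃ k = F₂ k * (k * k + k - const (+ 6))

    χ-F : ∀ k → (χ k 0 ≋ F₀ (κ k)) × (const (+ 6) * χ k 1 ≋ F₁ (κ k)) × (const (+ 120) * χ k 2 ≋ F₂ (κ k)) × (const (+ 5040) * χ k 3 ≋ F₃ (κ k))
    χ-F k = proj₁ (go k)
      where
      Claim : ℕ → Set
      Claim k = (χ k 0 ≋ F₀ (κ k)) × (const (+ 6) * χ k 1 ≋ F₁ (κ k)) × (const (+ 120) * χ k 2 ≋ F₂ (κ k)) × (const (+ 5040) * χ k 3 ≋ F₃ (κ k))
      module S = Solver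
      G₀ G₁ G₂ G₃ : ∀ {n} → S.Polynomial n → S.Polynomial n
      G₀ k = con (+ 2) :* k :+ con (+ 1)
      G₁ k = G₀ k :* (k :* k :+ k)
      G₂ k = G₁ k :* (k :* k :+ k :- con (+ 2))
      G₃ k = G₂ k :* (k :* k :+ k :- con (+ 6))
      F₀-cong : ∀ {a b} → a ≋ b → F₀ a ≋ F₀ b
      F₀-cong e = +-congʳ (*-congˡ e)
      F₁-cong : ∀ {a b} → a ≋ b → F₁ a ≋ F₁ b
      F₁-cong e = *-cong (F₀-cong e) (+-cong (*-cong e e) e)
      F₂-cong : ∀ {a b} → a ≋ b → F₂ a ≋ F₂ b
      F₂-cong e = *-cong (F₁-cong e) (+-congʳ (+-cong (*-cong e e) e))
      F₃-cong : ∀ {a b} → a ≋ b → F₃ a ≋ F₃ b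
      F₃-cong e = *-cong (F₂-cong e) (+-congʳ (+-cong (*-cong e e) e))
      κ-2+ : ∀ k → κ (suc (suc k)) ≋ κ k + const (+ 2)
      κ-2+ k = ≋-trans (const-cong (≡.cong +_ (ℕP.+-comm 2 k))) (const-+ (+ k) (+ 2))
      go : ∀ k → Claim k × Claim (suc k)
      go zero = (solve 0 (con (+ 1) := G₀ (con (+ 0))) ≋-refl , solve 0 (con (+ 6) :* con (+ 0) := G₁ (con (+ 0))) ≋-refl
                , solve 0 (con (+ 120) :* con (+ 0) := G₂ (con (+ 0))) ≋-refl , solve 0 (con (+ 5040) :* con (+ 0) := G₃ (con (+ 0))) ≋-refl)
              , (solve 0 (con (+ 2) :* con (+ 1) :+ con (+ 0) :+ con (+ 1) := G₀ (con (+ 1))) ≋-refl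
                , solve 0 (con (+ 6) :* (con (+ 2) :* con (+ 0) :+ con (+ 1) :+ con (+ 0)) := G₁ (con (+ 1))) ≋-refl
                , solve 0 (con (+ 120) :* (con (+ 2) :* con (+ 0) :+ con (+ 0) :+ con (+ 0)) := G₂ (con (+ 1))) ≋-refl
                , solve 0 (con (+ 5040) :* (con (+ 2) :* con (+ 0) :+ con (+ 0) :+ con (+ 0)) := G₃ (con (+ 1))) ≋-refl)
      go (suc k) with go k
      ... | (a₀ , a₁ , a₂ , a₃) , cl@(b₀′ , b₁′ , b₂′ , b₃′) = cl ,
        ( ≋-trans (+-cong (+-congʳ (*-congˡ b₀)) (-‿cong a₀)) (≋-trans (solve 1 (λ k → con (+ 2) :* G₀ (k :+ con (+ 1)) :+ con (+ 0) :- G₀ k := G₀ (k :+ con (+ 2))) ≋-refl (κ k)) (F₀-cong (≋-sym (κ-2+ k))))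
        , ≋-trans (solve 3 (λ b a c → con (+ 6) :* (con (+ 2) :* b :+ a :- c) := con (+ 2) :* (con (+ 6) :* b) :+ con (+ 6) :* a :- con (+ 6) :* c) ≋-refl (χ (suc k) 1) (χ (suc k) 0) (χ k 1))
            (≋-trans (+-cong (+-cong (*-congˡ b₁) (*-congˡ b₀)) (-‿cong a₁)) (≋-trans (solve 1 (λ k → con (+ 2) :* G₁ (k :+ con (+ 1)) :+ con (+ 6) :* G₀ (k :+ con (+ 1)) :- G₁ k := G₁ (k :+ con (+ 2))) ≋-refl (κ k)) (F₁-cong (≋-sym (κ-2+ k)))))
        , ≋-trans (solve 3 (λ b a c → con (+ 120) :* (con (+ 2) :* b :+ a :- c) := con (+ 2) :* (con (+ 120) :* b) :+ con (+ 20) :* (con (+ 6) :* a) :- con (+ 120) :* c) ≋-refl (χ (suc k) 2) (χ (suc k) 1) (χ k 2))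
            (≋-trans (+-cong (+-cong (*-congˡ b₂) (*-congˡ b₁)) (-‿cong a₂)) (≋-trans (solve 1 (λ k → con (+ 2) :* G₂ (k :+ con (+ 1)) :+ con (+ 20) :* G₁ (k :+ con (+ 1)) :- G₂ k := G₂ (k :+ con (+ 2))) ≋-refl (κ k)) (F₂-cong (≋-sym (κ-2+ k)))))
        , ≋-trans (solve 3 (λ b a c → con (+ 5040) :* (con (+ 2) :* b :+ a :- c) := con (+ 2) :* (con (+ 5040) :* b) :+ con (+ 42) :* (con (+ 120) :* a) :- con (+ 5040) :* c) ≋-refl (χ (suc k) 3) (χ (suc k) 2) (χ k 3))
            (≋-trans (+-cong (+-cong (*-congˡ b₃) (*-congˡ b₂)) (-‿cong a₃)) (≋-trans (solve 1 (λ k → con (+ 2) :* G₃ (k :+ con (+ 1)) :+ con (+ 42) :* G₂ (k :+ con (+ 1)) :- G₃ k := G₃ (k :+ con (+ 2))) ≋-refl (κ k)) (F₃-cong (≋-sym (κ-2+ k))))) )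
        where
        b₀ = ≋-trans b₀′ (F₀-cong (κ-suc k))
        b₁ = ≋-trans b₁′ (F₁-cong (κ-suc k))
        b₂ = ≋-trans b₂′ (F₂-cong (κ-suc k))
        b₃ = ≋-trans b₃′ (F₃-cong (κ-suc k))

    D-sgn : ∀ k → D (sgn k) ≋ 0#
    D-sgn zero = D-const (+ 1)
    D-sgn (suc k) = ≋-trans (D-neg _) (≋-trans (-‿cong (D-sgn k)) (solve 0 (:- con (+ 0) := con (+ 0)) ≋-refl))

    D-q^ : ∀ m → D (q ^ m) ≋ κ m * q ^ m
    D-q^ zero = ≋-trans (D-const (+ 1)) (≋-sym (zeroˡ _))
    D-q^ (suc m) = ≋-trans (D-* q (q ^ m)) (≋-trans (+-cong (*-congʳ D-q) (*-congˡ (D-q^ m)))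
      (≋-trans (solve 3 (λ q Q k → q :* Q :+ q :* (k :* Q) := (k :+ con (+ 1)) :* (q :* Q)) ≋-refl q (q ^ m) (κ m)) (*-congʳ (≋-sym (κ-suc m)))))

    module _ (k : ℕ) where
      private
        T = κ (tri k)
        ψ = sgn k * q ^ tri k * χ k 0
        D-eigen : ∀ a → D a ≋ 0# → D (sgn k * q ^ tri k * a) ≋ T * (sgn k * q ^ tri k * a)
        D-eigen a Da = ≋-trans (D-* _ _) (≋-trans (+-cong (*-congʳ (≋-trans (D-* _ _) (+-cong (*-congʳ (D-sgn k)) (*-congˡ (D-q^ (tri k)))))) (*-congˡ Da))
          (solve 4 (λ s Q t a → (con (+ 0) :* Q :+ s :* (t :* Q)) :* a :+ s :* Q :* con (+ 0) := t :* (s :* Q :* a)) ≋-refl (sgn k) (q ^ tri k) T a))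
        D-F₀ : D (χ k 0) ≋ 0#
        D-F₀ = ≋-trans (D-cong (proj₁ (χ-F k))) (≋-trans (D-+ _ _) (≋-trans (+-cong (≋-trans (D-* _ _) (+-cong (*-congʳ (D-const _)) (*-congˡ (D-const _)))) (D-const _))
          (solve 1 (λ k → con (+ 0) :* k :+ con (+ 2) :* con (+ 0) :+ con (+ 0) := con (+ 0)) ≋-refl (κ k))))
        Dψ : D ψ ≋ T * ψ
        Dψ = D-eigen _ D-F₀
        D-T* : ∀ a → D a ≋ T * a → D (T * a) ≋ T * (T * a)
        D-T* a h = ≋-trans (D-* T a) (≋-trans (+-cong (*-congʳ (D-const _)) (*-congˡ h)) (solve 2 (λ t a → con (+ 0) :* a :+ t :* (t :* a) := t :* (t :* a)) ≋-refl T a))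
        DDψ : D (D ψ) ≋ T * (T * ψ)
        DDψ = ≋-trans (D-cong Dψ) (D-T* ψ Dψ)
        DDDψ : D (D (D ψ)) ≋ T * (T * (T * ψ))
        DDDψ = ≋-trans (D-cong DDψ) (D-T* (T * ψ) (D-T* ψ Dψ))

      term₁ : const (+ 6) * (sgn k * q ^ tri k * χ k 1) ≋ const (+ 2) * D ψ
      term₁ = begin
        const (+ 6) * (sgn k * q ^ tri k * χ k 1) ≈⟨ solve 3 (λ s c Q → con (+ 6) :* (s :* Q :* c) := s :* Q :* (con (+ 6) :* c)) ≋-refl (sgn k) (χ k 1) (q ^ tri k) ⟩
        sgn k * q ^ tri k * (const (+ 6) * χ k 1) ≈⟨ *-congˡ (≋-trans (proj₁ (proj₂ (χ-F k))) (*-cong (≋-sym (proj₁ (χ-F k))) (≋-sym (2tri k)))) ⟩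
        sgn k * q ^ tri k * (χ k 0 * (const (+ 2) * T)) ≈⟨ solve 4 (λ s Q c t → s :* Q :* (c :* (con (+ 2) :* t)) := con (+ 2) :* (t :* (s :* Q :* c))) ≋-refl (sgn k) (q ^ tri k) (χ k 0) T ⟩
        const (+ 2) * (T * ψ) ≈⟨ *-congˡ Dψ ⟨
        const (+ 2) * D ψ ∎

      term₂ : const (+ 120) * (sgn k * q ^ tri k * χ k 2) ≋ const (+ 4) * (D (D ψ) - D ψ)
      term₂ = begin
        const (+ 120) * (sgn k * q ^ tri k * χ k 2) ≈⟨ solve 3 (λ s c Q → con (+ 120) :* (s :* Q :* c) := s :* Q :* (con (+ 120) :* c)) ≋-refl (sgn k) (χ k 2) (q ^ tri k) ⟩
        sgn k * q ^ tri k * (const (+ 120) * χ k 2) ≈⟨ *-congˡ (≋-trans (proj₁ (proj₂ (proj₂ (χ-F k)))) (*-cong (*-cong (≋-sym (proj₁ (χ-F k))) (≋-sym (2tri k))) (+-congʳ (≋-sym (2tri k))))) ⟩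
        sgn k * q ^ tri k * (χ k 0 * (const (+ 2) * T) * (const (+ 2) * T - const (+ 2)))
          ≈⟨ solve 4 (λ s Q c t → s :* Q :* (c :* (con (+ 2) :* t) :* (con (+ 2) :* t :- con (+ 2))) := con (+ 4) :* (t :* (t :* (s :* Q :* c)) :- t :* (s :* Q :* c))) ≋-refl (sgn k) (q ^ tri k) (χ k 0) T ⟩
        const (+ 4) * (T * (T * ψ) - T * ψ) ≈⟨ *-congˡ (+-cong DDψ (-‿cong Dψ)) ⟨
        const (+ 4) * (D (D ψ) - D ψ) ∎

      term₃ : const (+ 5040) * (sgn k * q ^ tri k * χ k 3) ≋ const (+ 8) * (D (D (D ψ)) - const (+ 4) * D (D ψ) + const (+ 3) * D ψ)
      term₃ = begin
        const (+ 5040) * (sgn k * q ^ tri k * χ k 3) ≈⟨ solve 3 (λ s c Q → con (+ 5040) :* (s :* Q :* c) := s :* Q :* (con (+ 5040) :* c)) ≋-refl (sgn k) (χ k 3) (q ^ tri k) ⟩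
        sgn k * q ^ tri k * (const (+ 5040) * χ k 3) ≈⟨ *-congˡ (≋-trans (proj₂ (proj₂ (proj₂ (χ-F k)))) (*-cong (*-cong (*-cong (≋-sym (proj₁ (χ-F k))) (≋-sym (2tri k))) (+-congʳ (≋-sym (2tri k)))) (+-congʳ (≋-sym (2tri k))))) ⟩
        sgn k * q ^ tri k * (χ k 0 * (const (+ 2) * T) * (const (+ 2) * T - const (+ 2)) * (const (+ 2) * T - const (+ 6)))
          ≈⟨ solve 4 (λ s Q c t → s :* Q :* (c :* (con (+ 2) :* t) :* (con (+ 2) :* t :- con (+ 2)) :* (con (+ 2) :* t :- con (+ 6)))
               := con (+ 8) :* (t :* (t :* (t :* (s :* Q :* c))) :- con (+ 4) :* (t :* (t :* (s :* Q :* c))) :+ con (+ 3) :* (t :* (s :* Q :* c)))) ≋-refl (sgn k) (q ^ tri k) (χ k 0) T ⟩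
        const (+ 8) * (T * (T * (T * ψ)) - const (+ 4) * (T * (T * ψ)) + const (+ 3) * (T * ψ)) ≈⟨ *-congˡ (+-cong (+-cong DDDψ (-‿cong (*-congˡ DDψ))) (*-congˡ Dψ)) ⟨
        const (+ 8) * (D (D (D ψ)) - const (+ 4) * D (D ψ) + const (+ 3) * D ψ) ∎

    D-∑ : ∀ n f → D (∑ n f) ≋ ∑ n (λ k → D (f k))
    D-∑ zero f = D-const (+ 0)
    D-∑ (suc n) f = ≋-trans (D-+ _ _) (+-congʳ (D-∑ n f))

    ∑-+ : ∀ n f g → ∑ n (λ k → f k + g k) ≋ ∑ n f + ∑ n g
    ∑-+ zero f g = ≋-sym (+-identityʳ 0#)
    ∑-+ (suc n) f g = ≋-trans (+-congʳ (∑-+ n f g)) (solve 4 (λ a b c d → a :+ b :+ (c :+ d) := a :+ c :+ (b :+ d)) ≋-refl _ _ (f n) (g n))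

    ∑-neg : ∀ n f → ∑ n (λ k → - f k) ≋ - ∑ n f
    ∑-neg zero f = solve 0 (con (+ 0) := :- con (+ 0)) ≋-refl
    ∑-neg (suc n) f = ≋-trans (+-congʳ (∑-neg n f)) (solve 2 (λ a b → :- a :+ :- b := :- (a :+ b)) ≋-refl _ (f n))

    J₁ : ∀ n → const (+ 6) * J n 1 ≋ const (+ 2) * D (J n 0)
    J₁ n = ≋-trans (∑-*ˡ (suc n) _ _) (≋-trans (∑-cong (suc n) (λ k _ → term₁ k)) (≋-trans (≋-sym (∑-*ˡ (suc n) _ _)) (*-congˡ (≋-sym (D-∑ (suc n) _)))))

    private
      ∑-DD : ∀ n f → ∑ n (λ k → D (D (f k))) ≋ D (D (∑ n f))
      ∑-DD n f = ≋-trans (≋-sym (D-∑ n _)) (D-cong (≋-sym (D-∑ n f)))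
      ∑-DDD : ∀ n f → ∑ n (λ k → D (D (D (f k)))) ≋ D (D (D (∑ n f)))
      ∑-DDD n f = ≋-trans (≋-sym (D-∑ n _)) (D-cong (∑-DD n f))

    J₂ : ∀ n → const (+ 120) * J n 2 ≋ const (+ 4) * (D (D (J n 0)) - D (J n 0))
    J₂ n = ≋-trans (∑-*ˡ (suc n) _ _) (≋-trans (∑-cong (suc n) (λ k _ → term₂ k)) (≋-trans (≋-sym (∑-*ˡ (suc n) _ _))
      (*-congˡ (≋-trans (∑-+ (suc n) _ _) (+-cong (∑-DD (suc n) _) (≋-trans (∑-neg (suc n) _) (-‿cong (≋-sym (D-∑ (suc n) _)))))))))

    J₃ : ∀ n → const (+ 5040) * J n 3 ≋ const (+ 8) * (D (D (D (J n 0))) - const (+ 4) * D (D (J n 0)) + const (+ 3) * D (J n 0))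
    J₃ n = ≋-trans (∑-*ˡ (suc n) _ _) (≋-trans (∑-cong (suc n) (λ k _ → term₃ k)) (≋-trans (≋-sym (∑-*ˡ (suc n) _ _))
      (*-congˡ (≋-trans (∑-+ (suc n) _ _) (+-cong (≋-trans (∑-+ (suc n) _ _) (+-cong (∑-DDD (suc n) _) (≋-trans (∑-neg (suc n) _) (-‿cong (≋-trans (≋-sym (∑-*ˡ (suc n) _ _)) (*-congˡ (∑-DD (suc n) _))))))) (≋-trans (≋-sym (∑-*ˡ (suc n) _ _)) (*-congˡ (≋-sym (D-∑ (suc n) _)))))))))

-- E₆ as a differential polynomial in the logarithmic derivative of E

module EisensteinSeries where
  open SeriesRing
  open SeriesOperators
  open EulerProduct
  open ThetaSeries
  open LambertExpansion

  open Solver using (solve; _:+_; _:*_; _:-_; :-_; _:^_; con; _:=_)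

  -- `L` is the logarithmic derivative of E: - L generates the divisor sums σ₁, and 1 + 24 L is the
  -- Eisenstein series of weight 2.
  p L : Series
  p = partition
  L = D E * p

  D-^2 : ∀ a → D (a ^ 2) ≋ const (+ 2) * a * D a
  D-^2 a = ≋-trans (D-* a (a * 1#)) (≋-trans (+-congˡ (*-congˡ (≋-trans (D-* a 1#) (+-congˡ (*-congˡ (D-const (+ 1)))))))
    (solve 2 (λ a d → d :* (a :* con (+ 1)) :+ a :* (d :* con (+ 1) :+ a :* con (+ 0)) := con (+ 2) :* a :* d) ≋-refl a (D a)))

  D-^3 : ∀ a → D (a ^ 3) ≋ const (+ 3) * a ^ 2 * D a
  D-^3 a = ≋-trans (D-* a (a ^ 2)) (≋-trans (+-congˡ (*-congˡ (D-^2 a)))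
    (solve 2 (λ a d → d :* a :^ 2 :+ a :* (con (+ 2) :* a :* d) := con (+ 3) :* a :^ 2 :* d) ≋-refl a (D a)))

  DE≋E*L : D E ≋ E * L
  DE≋E*L = ≋-trans (≋-sym (*-identityʳ (D E))) (≋-trans (*-congˡ (≋-sym E*partition)) (solve 3 (λ e d p → d :* (e :* p) := e :* (d :* p)) ≋-refl E (D E) p))

  E-cancel-mod : ∀ k {a b N} → E ^ k * a ≋ E ^ k * b mod N → a ≋ b mod N
  E-cancel-mod k {a} {b} h = mod-trans (≋⇒mod (≋-sym (unit k a))) (mod-trans (mod-* (mod-refl {p ^ k}) h) (≋⇒mod (unit k b)))
    where
    unit : ∀ k a → p ^ k * (E ^ k * a) ≋ a
    unit zero a = ≋-trans (*-identityˡ _) (*-identityˡ a)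
    unit (suc k) a = ≋-trans (solve 5 (λ p P e F a → p :* P :* (e :* F :* a) := (e :* p) :* (P :* (F :* a))) ≋-refl p (p ^ k) E (E ^ k) a)
      (≋-trans (*-cong E*partition (unit k a)) (*-identityˡ a))

  module Eisenstein where
    open ≋-Reasoning
    open MacMahon
    open LambertSeries using (y₀; D⁵g)

    D¹ : D (E ^ 3) ≋ E ^ 3 * (const (+ 3) * L)
    D¹ = ≋-trans (D-^3 E) (≋-trans (*-congˡ DE≋E*L) (solve 2 (λ e l → con (+ 3) :* e :^ 2 :* (e :* l) := e :^ 3 :* (con (+ 3) :* l)) ≋-refl E L))

    D-E³* : ∀ a → D (E ^ 3 * a) ≋ E ^ 3 * (const (+ 3) * L * a + D a)
    D-E³* a = ≋-trans (D-* _ a) (≋-trans (+-congʳ (*-congʳ D¹)) (solve 4 (λ e l a d → e :* (con (+ 3) :* l) :* a :+ e :* d := e :* (con (+ 3) :* l :* a :+ d)) ≋-refl (E ^ 3) L a (D a)))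

    D-scale : ∀ c a → D (const c * a) ≋ const c * D a
    D-scale c a = ≋-trans (D-* _ a) (≋-trans (+-congʳ (≋-trans (*-congʳ (D-const c)) (zeroˡ a))) (+-identityˡ _))

    D² : D (D (E ^ 3)) ≋ E ^ 3 * (const (+ 9) * (L * L) + const (+ 3) * D L)
    D² = ≋-trans (D-cong D¹) (≋-trans (D-E³* _) (≋-trans (*-congˡ (+-congˡ (D-scale (+ 3) L)))
      (solve 3 (λ e l d → e :* (con (+ 3) :* l :* (con (+ 3) :* l) :+ con (+ 3) :* d) := e :* (con (+ 9) :* (l :* l) :+ con (+ 3) :* d)) ≋-refl (E ^ 3) L (D L))))

    D³ : D (D (D (E ^ 3))) ≋ E ^ 3 * (const (+ 27) * L ^ 3 + const (+ 27) * (L * D L) + const (+ 3) * D (D L))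
    D³ = ≋-trans (D-cong D²) (≋-trans (D-E³* _) (≋-trans (*-congˡ (+-congˡ (≋-trans (D-+ _ _) (+-cong (≋-trans (D-scale (+ 9) _) (*-congˡ (D-* L L))) (D-scale (+ 3) (D L))))))
      (solve 4 (λ e l d d₂ → e :* (con (+ 3) :* l :* (con (+ 9) :* (l :* l) :+ con (+ 3) :* d) :+ (con (+ 9) :* (d :* l :+ l :* d) :+ con (+ 3) :* d₂))
        := e :* (con (+ 27) :* l :^ 3 :+ con (+ 27) :* (l :* d) :+ con (+ 3) :* d₂)) ≋-refl (E ^ 3) L (D L) (D (D L)))))

    private
      -- Comparing coefficients of w^j after division by E³ expresses the elementary symmetric
      -- functions of the `y i` by L and its derivatives.
      extract : ∀ n j a b {X} → const a * J n j ≋ X → X ≋ E ^ 3 * b mod (suc n) → const a * c n j ≋ b mod (suc n)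
      extract n j a b {X} e h = E-cancel-mod 3 (mod-trans (≋⇒mod (solve 3 (λ e a c → e :* (a :* c) := a :* (e :* c)) ≋-refl (E ^ 3) (const a) (c n j)))
        (mod-trans (mod-* mod-refl (E³c≋J n j)) (mod-trans (≋⇒mod e) h)))

    p₁≋-L : ∀ n → p₁ n ≋ - L mod (suc n)
    p₁≋-L n = mod-trans (≋⇒mod (≋-trans (solve 1 (λ p → p := :- (:- p)) ≋-refl (p₁ n)) (-‿cong (≋-sym (newton₁ n))))) (mod-neg c₁)
      where
      c₁ : c n 1 ≋ L mod (suc n)
      c₁ = const-*-cancel-mod (+ 6) (extract n 1 (+ 6) (const (+ 6) * L) (J₁ n)
        (mod-trans (mod-* mod-refl (D-mod (mod-sym (E³≋J n)))) (≋⇒mod (≋-trans (*-congˡ D¹)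
          (solve 2 (λ e l → con (+ 2) :* (e :* (con (+ 3) :* l)) := e :* (con (+ 6) :* l)) ≋-refl (E ^ 3) L)))))

    c₂ : ∀ n → const (+ 10) * c n 2 ≋ D L + const (+ 3) * (L * L) - L mod (suc n)
    c₂ n = const-*-cancel-mod (+ 12) (mod-trans (≋⇒mod (solve 1 (λ c → con (+ 12) :* (con (+ 10) :* c) := con (+ 120) :* c) ≋-refl (c n 2)))
      (extract n 2 (+ 120) _ (J₂ n) (mod-trans (mod-* mod-refl (mod-+ (D-mod (D-mod (mod-sym (E³≋J n)))) (mod-neg (D-mod (mod-sym (E³≋J n))))))
        (≋⇒mod (≋-trans (*-congˡ (+-cong D² (-‿cong D¹)))
          (solve 3 (λ e l d → con (+ 4) :* (e :* (con (+ 9) :* (l :* l) :+ con (+ 3) :* d) :- e :* (con (+ 3) :* l)) := e :* (con (+ 12) :* (d :+ con (+ 3) :* (l :* l) :- l))) ≋-refl (E ^ 3) L (D L)))))))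

    c₃ : ∀ n → const (+ 210) * c n 3 ≋ D (D L) + const (+ 9) * (L * D L) + const (+ 9) * L ^ 3 - const (+ 4) * D L - const (+ 12) * (L * L) + const (+ 3) * L mod (suc n)
    c₃ n = const-*-cancel-mod (+ 24) (mod-trans (≋⇒mod (solve 1 (λ c → con (+ 24) :* (con (+ 210) :* c) := con (+ 5040) :* c) ≋-refl (c n 3)))
      (extract n 3 (+ 5040) _ (J₃ n) (mod-trans (mod-* mod-refl (mod-+ (mod-+ (D-mod (D-mod (D-mod (mod-sym (E³≋J n))))) (mod-neg (mod-* mod-refl (D-mod (D-mod (mod-sym (E³≋J n))))))) (mod-* mod-refl (D-mod (mod-sym (E³≋J n))))))
        (≋⇒mod (≋-trans (*-congˡ (+-cong (+-cong D³ (-‿cong (*-congˡ D²))) (*-congˡ D¹)))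
          (solve 4 (λ e l d d₂ → con (+ 8) :* (e :* (con (+ 27) :* l :^ 3 :+ con (+ 27) :* (l :* d) :+ con (+ 3) :* d₂) :- con (+ 4) :* (e :* (con (+ 9) :* (l :* l) :+ con (+ 3) :* d)) :+ con (+ 3) :* (e :* (con (+ 3) :* l)))
            := e :* (con (+ 24) :* (d₂ :+ con (+ 9) :* (l :* d) :+ con (+ 9) :* l :^ 3 :- con (+ 4) :* d :- con (+ 12) :* (l :* l) :+ con (+ 3) :* l))) ≋-refl (E ^ 3) L (D L) (D (D L))))))))

    -- Ramanujan's P³ - 18 P D P + 36 D² P with P = 1 + 24 L.
    E₆′ : Series
    E₆′ = (1# + const (+ 24) * L) ^ 3 - const (+ 432) * ((1# + const (+ 24) * L) * D L) + const (+ 864) * D (D L)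

    -- Newton's identities pass from power sums to elementary symmetric functions, which `p₁≋-L`,
    -- `c₂` and `c₃` give in terms of L.
    lambert : ∀ n → 1# - const (+ 504) * ∑ n (λ i → φ (suc i) (D (D (D (D (D geometric)))))) ≋ E₆′ mod (suc n)
    lambert n = mod-trans (≋⇒mod (≋-trans (+-congˡ (-‿cong (*-congˡ powers))) regroup)) (mod-trans substitute (≋⇒mod collect))
      where
      powers : ∑ n (λ i → φ (suc i) (D (D (D (D (D geometric)))))) ≋ const (+ 120) * p₃ n + const (+ 30) * p₂ n + p₁ n
      powers = ≋-trans (∑-cong n (λ i _ → ≋-trans (φ-cong (suc i) D⁵g) (hom i))) (≋-trans (∑-+ n _ _) (+-congʳ (≋-trans (∑-+ n _ _) (+-cong (≋-sym (∑-*ˡ n _ _)) (≋-sym (∑-*ˡ n _ _))))))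
        where
        hom : ∀ i → φ (suc i) (const (+ 120) * y₀ ^ 3 + const (+ 30) * y₀ ^ 2 + y₀) ≋ const (+ 120) * y i ^ 3 + const (+ 30) * y i ^ 2 + y i
        hom i = ≋-trans (φ-+ (suc i) _ _) (+-congʳ (≋-trans (φ-+ (suc i) _ _) (+-cong (≋-trans (φ-scale (suc i) (+ 120) _) (*-congˡ (φ-^ (suc i) y₀ 3))) (≋-trans (φ-scale (suc i) (+ 30) _) (*-congˡ (φ-^ (suc i) y₀ 2))))))
      -- The factors 210 and 10 are split off so that the left-hand sides of `c₃` and `c₂` appear
      -- literally.
      regroup : 1# - const (+ 504) * (const (+ 120) * p₃ n + const (+ 30) * p₂ n + p₁ n) ≋
        1# + const (+ 864) * (const (+ 210) * c n 3) + const (+ 30240) * p₁ n ^ 3 - (const (+ 90720) * p₁ n + const (+ 15120)) * (p₁ n * p₁ n) + const (+ 3024) * (const (+ 6) * p₁ n + 1#) * (const (+ 10) * c n 2) - const (+ 504) * p₁ n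
      regroup = begin
        1# - const (+ 504) * (const (+ 120) * p₃ n + const (+ 30) * p₂ n + p₁ n)
          ≈⟨ solve 3 (λ p₁ p₂ p₃ → con (+ 1) :- con (+ 504) :* (con (+ 120) :* p₃ :+ con (+ 30) :* p₂ :+ p₁) :=
               con (+ 1) :+ con (+ 30240) :* (:- (p₁ :^ 3 :- con (+ 3) :* (p₁ :* p₂) :+ con (+ 2) :* p₃)) :+ con (+ 30240) :* p₁ :^ 3
                 :- (con (+ 90720) :* p₁ :+ con (+ 15120)) :* (p₁ :* p₁) :+ (con (+ 90720) :* p₁ :+ con (+ 15120)) :* (p₁ :* p₁ :- p₂) :- con (+ 504) :* p₁) ≋-refl (p₁ n) (p₂ n) (p₃ n) ⟩
        _ ≈⟨ +-congʳ (+-cong (+-congʳ (+-congʳ (+-congˡ (*-congˡ (≋-sym (newton₃ n)))))) (*-congˡ (≋-sym (newton₂ n)))) ⟩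
        1# + const (+ 30240) * (const (+ 6) * c n 3) + const (+ 30240) * p₁ n ^ 3 - (const (+ 90720) * p₁ n + const (+ 15120)) * (p₁ n * p₁ n)
            + (const (+ 90720) * p₁ n + const (+ 15120)) * (const (+ 2) * c n 2) - const (+ 504) * p₁ n
          ≈⟨ solve 3 (λ p₁ c₂ c₃ → con (+ 1) :+ con (+ 30240) :* (con (+ 6) :* c₃) :+ con (+ 30240) :* p₁ :^ 3 :- (con (+ 90720) :* p₁ :+ con (+ 15120)) :* (p₁ :* p₁)
                 :+ (con (+ 90720) :* p₁ :+ con (+ 15120)) :* (con (+ 2) :* c₂) :- con (+ 504) :* p₁
               := con (+ 1) :+ con (+ 864) :* (con (+ 210) :* c₃) :+ con (+ 30240) :* p₁ :^ 3 :- (con (+ 90720) :* p₁ :+ con (+ 15120)) :* (p₁ :* p₁)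
                 :+ con (+ 3024) :* (con (+ 6) :* p₁ :+ con (+ 1)) :* (con (+ 10) :* c₂) :- con (+ 504) :* p₁) ≋-refl (p₁ n) (c n 2) (c n 3) ⟩
        _ ∎
      substitute : _ ≋ _ mod (suc n)
      substitute = mod-+ (mod-+ (mod-+ (mod-+ (mod-+ mod-refl (mod-* (mod-refl {const (+ 864)}) (c₃ n))) (mod-* (mod-refl {const (+ 30240)}) (mod-^ 3 (p₁≋-L n))))
          (mod-neg (mod-* (mod-+ (mod-* (mod-refl {const (+ 90720)}) (p₁≋-L n)) (mod-refl {const (+ 15120)})) (mod-* (p₁≋-L n) (p₁≋-L n)))))
          (mod-* (mod-* (mod-refl {const (+ 3024)}) (mod-+ (mod-* (mod-refl {const (+ 6)}) (p₁≋-L n)) (mod-refl {1#}))) (c₂ n)))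
          (mod-neg (mod-* (mod-refl {const (+ 504)}) (p₁≋-L n)))
      collect : 1# + const (+ 864) * (D (D L) + const (+ 9) * (L * D L) + const (+ 9) * L ^ 3 - const (+ 4) * D L - const (+ 12) * (L * L) + const (+ 3) * L)
          + const (+ 30240) * (- L) ^ 3 - (const (+ 90720) * - L + const (+ 15120)) * (- L * - L)
          + const (+ 3024) * (const (+ 6) * - L + 1#) * (D L + const (+ 3) * (L * L) - L) - const (+ 504) * - L ≋ E₆′
      collect = solve 3 (λ l d d₂ → con (+ 1) :+ con (+ 864) :* (d₂ :+ con (+ 9) :* (l :* d) :+ con (+ 9) :* l :^ 3 :- con (+ 4) :* d :- con (+ 12) :* (l :* l) :+ con (+ 3) :* l)
          :+ con (+ 30240) :* (:- l) :^ 3 :- (con (+ 90720) :* :- l :+ con (+ 15120)) :* (:- l :* :- l)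
          :+ con (+ 3024) :* (con (+ 6) :* :- l :+ con (+ 1)) :* (d :+ con (+ 3) :* (l :* l) :- l) :- con (+ 504) :* :- l
        := (con (+ 1) :+ con (+ 24) :* l) :^ 3 :- con (+ 432) :* ((con (+ 1) :+ con (+ 24) :* l) :* d) :+ con (+ 864) :* d₂) ≋-refl L (D L) (D (D L))

-- The Lambert series of E₆ and the divisor sums σ₅

module DivisorSums where
  open SeriesRing
  open SeriesOperators
  open EulerProduct
  open ThetaSeries
  open EisensteinSeries
  open import Data.Nat.Divisibility as ℕD using (divides; _∣?_)
  open import Data.List using (applyUpTo; map; filter)

  module DivisorSum where
    open ≡.≡-Reasoning

    S : ℕ → (ℕ → ℕ) → ℕ
    S zero f = 0
    S (suc n) f = f 0 ℕ.+ S n (f ∘ suc)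

    S-cong : ∀ n {f g} → (∀ i → i ℕ.< n → f i ≡ g i) → S n f ≡ S n g
    S-cong zero h = ≡.refl
    S-cong (suc n) h = ≡.cong₂ ℕ._+_ (h 0 (s≤s z≤n)) (S-cong n (λ i i<n → h (suc i) (s≤s i<n)))

    S-0 : ∀ n → S n (λ _ → 0) ≡ 0
    S-0 zero = ≡.refl
    S-0 (suc n) = S-0 n

    S-+ : ∀ n f g → S n (λ i → f i ℕ.+ g i) ≡ S n f ℕ.+ S n g
    S-+ zero f g = ≡.refl
    S-+ (suc n) f g = ≡.trans (≡.cong (f 0 ℕ.+ g 0 ℕ.+_) (S-+ n (f ∘ suc) (g ∘ suc))) (interchange (f 0) (g 0) _ _)
      where
      interchange : ∀ a b c d → a ℕ.+ b ℕ.+ (c ℕ.+ d) ≡ a ℕ.+ c ℕ.+ (b ℕ.+ d)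
      interchange a b c d = ≡.trans (ℕP.+-assoc a b _) (≡.trans (≡.cong (a ℕ.+_) (≡.trans (≡.sym (ℕP.+-assoc b c d))
        (≡.trans (≡.cong (ℕ._+ d) (ℕP.+-comm b c)) (ℕP.+-assoc c b d)))) (≡.sym (ℕP.+-assoc a c _)))

    S-swap : ∀ m n (f : ℕ → ℕ → ℕ) → S m (λ i → S n (f i)) ≡ S n (λ j → S m (λ i → f i j))
    S-swap zero n f = ≡.sym (S-0 n)
    S-swap (suc m) n f = ≡.trans (≡.cong (S n (f 0) ℕ.+_) (S-swap m n (f ∘ suc))) (≡.sym (S-+ n (f 0) _))

    S-single : ∀ n k f → k ℕ.< n → (∀ i → i ≢ k → f i ≡ 0) → S n f ≡ f k
    S-single (suc n) zero f _ h = ≡.trans (≡.cong (f 0 ℕ.+_) (≡.trans (S-cong n (λ i _ → h (suc i) λ ())) (S-0 n))) (ℕP.+-identityʳ _)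
    S-single (suc n) (suc k) f (s≤s k<n) h = ≡.trans (≡.cong (ℕ._+ S n (f ∘ suc)) (h 0 λ ()))
      (S-single n k (f ∘ suc) k<n (λ i i≢k → h (suc i) (i≢k ∘ ℕP.suc-injective)))

    S-none : ∀ n f → (∀ i → f i ≡ 0) → S n f ≡ 0
    S-none n f h = ≡.trans (S-cong n (λ i _ → h i)) (S-0 n)

    -- A double count over a b = M: for fixed a the sum over b is a Lambert term, for fixed b the
    -- sum over a is a term of σ₅.
    cell : ℕ → ℕ → ℕ → ℕ
    cell M a b with a ℕ.* b ℕ.≟ M
    ... | yes _ = b ℕ.^ 5
    ... | no _ = 0

    cell-≡ : ∀ M a b → a ℕ.* b ≡ M → cell M a b ≡ b ℕ.^ 5
    cell-≡ M a b e with a ℕ.* b ℕ.≟ M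
    ... | yes _ = ≡.refl
    ... | no ¬e = contradiction e ¬e

    cell-≢ : ∀ M a b → a ℕ.* b ≢ M → cell M a b ≡ 0
    cell-≢ M a b ¬e with a ℕ.* b ℕ.≟ M
    ... | yes e = contradiction e ¬e
    ... | no _ = ≡.refl

    divisorTerm : ℕ → ℕ → ℕ
    divisorTerm M d with d ∣? M
    ... | yes _ = d ℕ.^ 5
    ... | no _ = 0

    column : ∀ M n b → suc M ℕ.≤ n → S n (λ i → cell (suc M) (suc i) (suc b)) ≡ divisorTerm (suc M) (suc b)
    column M n b M<n with suc b ∣? suc M
    ... | no ¬d = S-none n _ (λ i → cell-≢ (suc M) (suc i) (suc b) λ e → ¬d (divides (suc i) (≡.sym e)))
    ... | yes (divides zero ())
    ... | yes (divides (suc k) eq) = ≡.trans (S-single n k (λ i → cell (suc M) (suc i) (suc b)) k<n off) (cell-≡ (suc M) (suc k) (suc b) (≡.sym eq))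
      where
      k<n : k ℕ.< n
      k<n = ℕP.≤-trans (ℕP.≤-trans (ℕP.m≤m*n (suc k) (suc b)) (ℕP.≤-reflexive (≡.sym eq))) M<n
      off : ∀ i → i ≢ k → cell (suc M) (suc i) (suc b) ≡ 0
      off i i≢k = cell-≢ (suc M) (suc i) (suc b) λ e → i≢k (ℕP.suc-injective (ℕP.*-cancelʳ-≡ (suc i) (suc k) (suc b) (≡.trans e eq)))

    fifth : Series
    fifth = D (D (D (D (D geometric))))

    fifth-at : ∀ m → fifth m ≡ + (m ℕ.^ 5)
    fifth-at m = ≡.trans (step 4 (step 3 (step 2 (step 1 (step 0 ≡.refl))))) ≡.refl
      where
      step : ∀ k {a : Series} → a m ≡ + (m ℕ.^ k) → D a m ≡ + (m ℕ.^ suc k)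
      step k {a} h = ≡.trans (D-at a m) (≡.trans (≡.cong (+ m ℤ.*_) h) (≡.sym (ℤP.pos-* m (m ℕ.^ k))))

    row : ∀ M i → φ (suc i) fifth (suc M) ≡ + S (suc M) (λ b → cell (suc M) (suc i) (suc b))
    row M i with suc i ∣? suc M
    ... | no ¬d = ≡.trans (φ-at-∤ (suc i) fifth (suc M) ¬d)
            (≡.cong +_ (≡.sym (S-none (suc M) _ (λ b → cell-≢ (suc M) (suc i) (suc b) λ e → ¬d (divides (suc b) (≡.trans (≡.sym e) (ℕP.*-comm (suc i) (suc b))))))))
    ... | yes (divides zero ())
    ... | yes (divides (suc k) eq) = begin
      φ (suc i) fifth (suc M) ≡⟨ ≡.cong (φ (suc i) fifth) eq ⟩
      φ (suc i) fifth (suc k ℕ.* suc i) ≡⟨ φ-at (suc i) fifth (suc k) ⟩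
      fifth (suc k) ≡⟨ fifth-at (suc k) ⟩
      + (suc k ℕ.^ 5) ≡⟨ ≡.cong +_ (≡.trans (S-single (suc M) k (λ b → cell (suc M) (suc i) (suc b)) k<M off) (cell-≡ (suc M) (suc i) (suc k) eq′)) ⟨
      _ ∎
      where
      eq′ : suc i ℕ.* suc k ≡ suc M
      eq′ = ≡.trans (ℕP.*-comm (suc i) (suc k)) (≡.sym eq)
      k<M : k ℕ.< suc M
      k<M = ℕP.≤-trans (ℕP.m≤m*n (suc k) (suc i)) (ℕP.≤-reflexive (≡.sym eq))
      off : ∀ b → b ≢ k → cell (suc M) (suc i) (suc b) ≡ 0
      off b b≢k = cell-≢ (suc M) (suc i) (suc b) λ e → b≢k (ℕP.suc-injective (ℕP.*-cancelˡ-≡ (suc b) (suc k) (suc i) (≡.trans e (≡.sym eq′))))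

    σ₅-S : ∀ M → σ₅ M ≡ S M (λ b → divisorTerm M (suc b))
    σ₅-S M = go M suc
      where
      go : ∀ n (f : ℕ → ℕ) → sumℕ (map (λ d → d ℕ.^ 5) (filter (λ d → d ∣? M) (applyUpTo f n))) ≡ S n (divisorTerm M ∘ f)
      go zero f = ≡.refl
      go (suc n) f with f 0 ∣? M
      ... | yes _ = ≡.cong (f 0 ℕ.^ 5 ℕ.+_) (go n (f ∘ suc))
      ... | no _ = go n (f ∘ suc)

    ∑-at : ∀ n (f : ℕ → Series) (g : ℕ → ℕ) m → (∀ i → f i m ≡ + g i) → ∑ n f m ≡ + S n g
    ∑-at n f g m h = go n
      where
      S-sucʳ : ∀ n (g : ℕ → ℕ) → S (suc n) g ≡ S n g ℕ.+ g n
      S-sucʳ zero g = ℕP.+-comm (g 0) 0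
      S-sucʳ (suc n) g = ≡.trans (≡.cong (g 0 ℕ.+_) (S-sucʳ n (g ∘ suc))) (≡.sym (ℕP.+-assoc (g 0) _ _))
      go : ∀ n → ∑ n f m ≡ + S n g
      go zero = const-0-at m
      go (suc n) = ≡.trans (+-at _ _ m) (≡.trans (≡.cong₂ ℤ._+_ (go n) (h n)) (≡.trans (≡.sym (ℤP.pos-+ (S n g) (g n))) (≡.cong +_ (≡.sym (S-sucʳ n g)))))

    σ₅-lambert : ∀ M n → suc M ℕ.≤ n → ∑ n (λ i → φ (suc i) fifth) (suc M) ≡ + σ₅ (suc M)
    σ₅-lambert M n M<n = begin
      ∑ n (λ i → φ (suc i) fifth) (suc M) ≡⟨ ∑-at n _ _ (suc M) (row M) ⟩
      + S n (λ i → S (suc M) (λ b → cell (suc M) (suc i) (suc b))) ≡⟨ ≡.cong +_ (S-swap n (suc M) (λ i b → cell (suc M) (suc i) (suc b))) ⟩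
      + S (suc M) (λ b → S n (λ i → cell (suc M) (suc i) (suc b))) ≡⟨ ≡.cong +_ (S-cong (suc M) (λ b _ → column M n b M<n)) ⟩
      + S (suc M) (λ b → divisorTerm (suc M) (suc b)) ≡⟨ ≡.cong +_ (σ₅-S (suc M)) ⟨
      + σ₅ (suc M) ∎

    E6-lambert : ∀ n → E6coeff ≋ 1# - const (+ 504) * ∑ n (λ i → φ (suc i) fifth) mod (suc n)
    E6-lambert n i i<n = ≡.sym (≡.trans (+-at 1# _ i) (≡.trans (≡.cong (λ z → 1# i ℤ.+ z) (≡.trans (neg-at _ i) (≡.cong ℤ.-_ (const-*-at (+ 504) _ i)))) (go i i<n)))
      where
      go : ∀ i → i ℕ.< suc n → 1# i ℤ.- (+ 504 ℤ.* ∑ n (λ i → φ (suc i) fifth) i) ≡ E6coeff i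
      go zero _ = ≡.trans (≡.cong₂ (λ x z → x ℤ.- (+ 504 ℤ.* z)) (const-zero (+ 1)) (∑-at n _ (λ _ → 0) 0 λ i → ≡.trans (φ-at (suc i) fifth 0) (fifth-at 0)))
        (≡.cong (λ z → + 1 ℤ.- (+ 504 ℤ.* + z)) (S-0 n))
      go (suc M) (s≤s M<n) = ≡.trans (≡.cong₂ (λ x z → x ℤ.- (+ 504 ℤ.* z)) (const-suc (+ 1) M) (σ₅-lambert M n M<n))
        (≡.trans (ℤP.+-identityˡ _) (≡.cong ℤ.-_ (≡.sym (ℤP.pos-* 504 (σ₅ (suc M))))))

  E6≋E₆′ : E6coeff ≋ Eisenstein.E₆′
  E6≋E₆′ = mod⇒≋ λ n → mod-≤ (ℕP.n≤1+n n) (mod-trans (DivisorSum.E6-lambert n) (Eisenstein.lambert n))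

-- The components of E and E³ modulo 7

module SevenDissection where
  open SeriesRing
  open SeriesOperators
  open ResidueClasses
  open EulerProduct
  open TripleProduct
  open LambertExpansion
  open import Data.Nat.DivMod using (_%_; %-distribˡ-*)
  open import Data.Nat.Solver using () renaming (module +-*-Solver to ℕSolver)
  open import Data.Fin using (zero; suc)

  open Solver using (solve; _:+_; _:*_; _:-_; :-_; con; _:=_)

  pr-∑ : ∀ r n f → pr r (∑ n f) ≋ ∑ n (λ k → pr r (f k))
  pr-∑ r zero f = pr-0 r
  pr-∑ r (suc n) f = ≋-trans (pr-+ r _ _) (+-congʳ (pr-∑ r n f))

  φ-∑ : ∀ m .{{_ : NonZero m}} n f → φ m (∑ n f) ≋ ∑ n (λ k → φ m (f k))
  φ-∑ m zero f = φ-const m (+ 0)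
  φ-∑ m (suc n) f = ≋-trans (φ-+ m _ _) (+-congʳ (φ-∑ m n f))

  ∑-7 : ∀ n f → ∑ (n ℕ.* 7) f ≋ ∑ n (λ l → ∑ 7 (λ i → f (i ℕ.+ l ℕ.* 7)))
  ∑-7 zero f = ≋-refl
  ∑-7 (suc n) f = ≋-trans (solve 8 (λ S a b c d e g h → S :+ a :+ b :+ c :+ d :+ e :+ g :+ h := S :+ (con (+ 0) :+ a :+ b :+ c :+ d :+ e :+ g :+ h)) ≋-refl (∑ (n ℕ.* 7) f) _ _ _ _ _ _ _)
    (+-congʳ (∑-7 n f))

  ∑-0 : ∀ n {f} → (∀ k → f k ≋ 0#) → ∑ n f ≋ 0#
  ∑-0 zero h = ≋-refl
  ∑-0 (suc n) h = ≋-trans (+-cong (∑-0 n h) (h n)) (+-identityʳ 0#)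

  ∑-single : ∀ n k f → k ℕ.< n → (∀ i → i ℕ.< n → i ≢ k → f i ≋ 0#) → ∑ n f ≋ f k
  ∑-single (suc n) k f k<n h with k ℕ.≟ n
  ... | yes ≡.refl = ≋-trans (+-congʳ (≋-trans (∑-cong n λ i i<n → h i (ℕP.m≤n⇒m≤1+n i<n) (ℕP.<⇒≢ i<n)) (∑-0 n λ _ → ≋-refl))) (+-identityˡ _)
  ... | no k≢n = ≋-trans (+-cong (∑-single n k f (ℕP.≤∧≢⇒< (ℕP.≤-pred k<n) k≢n) (λ i i<n → h i (ℕP.m≤n⇒m≤1+n i<n))) (h n ℕP.≤-refl (k≢n ∘ ≡.sym))) (+-identityʳ _)

  φ-q^ : ∀ m .{{_ : NonZero m}} k → φ m (q ^ k) ≋ q ^ (m ℕ.* k)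
  φ-q^ m k = ≋-trans (φ-^ m q k) (≋-trans (^-congˡ k (φ-q m)) (^-assocʳ q m k))

  φ-sgn : ∀ m .{{_ : NonZero m}} k → φ m (sgn k) ≋ sgn k
  φ-sgn m zero = φ-const m (+ 1)
  φ-sgn m (suc k) = ≋-trans (φ-neg m _) (-‿cong (φ-sgn m k))

  Cls-q^ : ∀ k → Cls k (q ^ k)
  Cls-q^ k = Cls-≡₇ {k ℕ.* 1} (≡.cong (_% 7) (ℕP.*-identityʳ k)) (Cls-^ k Cls-q)

  Cls-sgn : ∀ k → Cls 0 (sgn k)
  Cls-sgn zero = Cls-const (+ 1)
  Cls-sgn (suc k) = Cls-neg (Cls-sgn k)

  sgn-7 : ∀ l → sgn (l ℕ.* 7) ≋ sgn l
  sgn-7 zero = ≋-refl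
  sgn-7 (suc l) = ≋-trans (solve 1 (λ s → :- (:- (:- (:- (:- (:- (:- s)))))) := :- s) ≋-refl (sgn (l ℕ.* 7))) (-‿cong (sgn-7 l))

  ≡₇-*-cong : ∀ {a b c d} → a ≡₇ b → c ≡₇ d → a ℕ.* c ≡₇ b ℕ.* d
  ≡₇-*-cong {a} {b} {c} {d} e f = ≡.trans (%-distribˡ-* a c 7) (≡.trans (≡.cong₂ (λ x y → (x ℕ.* y) % 7) e f) (≡.sym (%-distribˡ-* b d 7)))

  open ℕSolver using () renaming (solve to solveℕ; con to conℕ; _:+_ to _:+ℕ_; _:*_ to _:*ℕ_; _:=_ to _:=ℕ_)

  2*tri : ∀ k → 2 ℕ.* tri k ≡ k ℕ.* k ℕ.+ k
  2*tri zero = ≡.refl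
  2*tri (suc k) = ≡.trans (solveℕ 2 (λ k t → conℕ 2 :*ℕ (conℕ 1 :+ℕ k :+ℕ t) :=ℕ conℕ 2 :*ℕ (conℕ 1 :+ℕ k) :+ℕ conℕ 2 :*ℕ t) ≡.refl k (tri k))
    (≡.trans (≡.cong (2 ℕ.* suc k ℕ.+_) (2*tri k)) (solveℕ 1 (λ k → conℕ 2 :*ℕ (conℕ 1 :+ℕ k) :+ℕ (k :*ℕ k :+ℕ k) :=ℕ (conℕ 1 :+ℕ k) :*ℕ (conℕ 1 :+ℕ k) :+ℕ (conℕ 1 :+ℕ k)) ≡.refl k))

  tri-≡₇ : ∀ i l → tri (i ℕ.+ l ℕ.* 7) ≡₇ tri i
  tri-≡₇ i zero = ≡.cong (λ k → tri k % 7) (ℕP.+-identityʳ i)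
  tri-≡₇ i (suc l) = ≡.trans (≡.cong (λ k → tri k % 7) (solveℕ 2 (λ i m → i :+ℕ (conℕ 7 :+ℕ m) :=ℕ conℕ 7 :+ℕ (i :+ℕ m)) ≡.refl i (l ℕ.* 7)))
    (≡.trans (≡.cong (_% 7) (solveℕ 2 (λ k t → (conℕ 7 :+ℕ k) :+ℕ ((conℕ 6 :+ℕ k) :+ℕ ((conℕ 5 :+ℕ k) :+ℕ ((conℕ 4 :+ℕ k) :+ℕ ((conℕ 3 :+ℕ k) :+ℕ ((conℕ 2 :+ℕ k) :+ℕ ((conℕ 1 :+ℕ k) :+ℕ t))))))
        :=ℕ t :+ℕ (k :+ℕ conℕ 4) :*ℕ conℕ 7) ≡.refl k (tri k)))
      (≡.trans (+k*7 (tri k) (k ℕ.+ 4)) (tri-≡₇ i l)))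
    where k = i ℕ.+ l ℕ.* 7

  open Pentagonal using (a; b; E≋pentagonal)

  expᵃ expᵇ : ℕ → ℕ
  expᵃ k = k ℕ.* k ℕ.+ tri k
  expᵇ k = tri k ℕ.+ suc k ℕ.* suc k

  Cls-a : ∀ i l → Cls (expᵃ i) (a (i ℕ.+ l ℕ.* 7))
  Cls-a i l = Cls-≡₇ {expᵃ k} (≡₇-+ {k ℕ.* k} {i ℕ.* i} {tri k} (≡₇-*-cong {k} {i} {k} {i} (+k*7 i l) (+k*7 i l)) (tri-≡₇ i l)) (Cls-* {0} (Cls-sgn k) (Cls-q^ (expᵃ k)))
    where k = i ℕ.+ l ℕ.* 7

  Cls-b : ∀ i l → Cls (expᵇ i) (b (i ℕ.+ l ℕ.* 7))
  Cls-b i l = Cls-neg (Cls-≡₇ {expᵇ k} (≡₇-+ {tri k} {tri i} {suc k ℕ.* suc k} (tri-≡₇ i l) (≡₇-*-cong {suc k} {suc i} {suc k} {suc i} (+k*7 (suc i) l) (+k*7 (suc i) l))) (Cls-* {0} (Cls-sgn k) (Cls-q^ (expᵇ k))))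
    where k = i ℕ.+ l ℕ.* 7

  pr-E-mod : ∀ r N → pr r E ≋ ∑ N (λ l → ∑ 7 (λ i → pr r (a (i ℕ.+ l ℕ.* 7)) + pr r (b (i ℕ.+ l ℕ.* 7)))) mod (N ℕ.* 7)
  pr-E-mod r N = mod-trans (pr-mod (E≋pentagonal (N ℕ.* 7))) (≋⇒mod (≋-trans (pr-∑ r (N ℕ.* 7) (λ k → a k + b k)) (≋-trans (∑-7 N (λ k → pr r (a k + b k))) (∑-cong N λ l _ → ∑-cong 7 λ i _ → pr-+ r (a (i ℕ.+ l ℕ.* 7)) (b (i ℕ.+ l ℕ.* 7))))))

  N≤N*7 : ∀ N → N ℕ.≤ N ℕ.* 7
  N≤N*7 N = ℕP.m≤m*n N 7

  -- The class of a pentagonal exponent depends only on its index modulo 7, so seven indices decide.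
  pr-E-vanish : ∀ r → (∀ {i} → i ℕ.< 7 → ¬ expᵃ i ≡₇ r × ¬ expᵇ i ≡₇ r) → pr r E ≋ 0#
  pr-E-vanish r h = mod⇒≋ λ N → mod-≤ (N≤N*7 N) (mod-trans (pr-E-mod r N) (≋⇒mod (∑-0 N λ l → ≋-trans (∑-cong 7 λ i i<7 →
    ≋-trans (+-cong (pr-other r (Cls-a i l) (proj₁ (h i<7))) (pr-other r (Cls-b i l) (proj₂ (h i<7)))) (+-identityʳ 0#)) (∑-0 7 λ _ → ≋-refl))))

  private
    avoids? : ∀ r → Dec (∀ {i} → i ℕ.< 7 → ¬ expᵃ i ≡₇ r × ¬ expᵇ i ≡₇ r)
    avoids? r = ℕP.allUpTo? (λ i → ¬? (expᵃ i % 7 ℕ.≟ r % 7) ×-dec ¬? (expᵇ i % 7 ℕ.≟ r % 7)) 7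

  pr-3-E : pr 3 E ≋ 0#
  pr-3-E = pr-E-vanish 3 (toWitness {a? = avoids? 3} _)

  pr-4-E : pr 4 E ≋ 0#
  pr-4-E = pr-E-vanish 4 (toWitness {a? = avoids? 4} _)

  pr-6-E : pr 6 E ≋ 0#
  pr-6-E = pr-E-vanish 6 (toWitness {a? = avoids? 6} _)

  φ² : Series → Series
  φ² x = φ 7 (φ 7 x)

  φ²-mod : ∀ {x y} N → x ≋ y mod N → φ² x ≋ φ² y mod N
  φ²-mod N h = mod-≤ (ℕP.≤-trans (N≤N*7 N) (N≤N*7 (N ℕ.* 7))) (φ-mod 7 (φ-mod 7 h))

  φ²-cong : ∀ {x y} → x ≋ y → φ² x ≋ φ² y
  φ²-cong h = φ-cong 7 (φ-cong 7 h)

  φ²-sgn-q^ : ∀ l k → φ² (sgn l * q ^ k) ≋ sgn l * q ^ (49 ℕ.* k)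
  φ²-sgn-q^ l k = ≋-trans (φ-cong 7 (≋-trans (φ-* 7 _ _) (*-cong (φ-sgn 7 l) (φ-q^ 7 k)))) (≋-trans (φ-* 7 _ _) (*-cong (φ-sgn 7 l) (≋-trans (φ-q^ 7 (7 ℕ.* k)) (q^-cong (≡.sym (ℕP.*-assoc 7 7 k))))))

  φ²-neg : ∀ x → φ² (- x) ≋ - φ² x
  φ²-neg x = ≋-trans (φ-cong 7 (φ-neg 7 x)) (φ-neg 7 _)

  -- For a pentagonal exponent n, 24 n + 1 is a square. In class 2 it is divisible by 7, hence by
  -- 49, and the quotient belongs to a pentagonal number again. The indices are 1 + 7 l in `a` and 5
  -- + 7 l in `b`; both reverse the sign.
  pr-2-E : pr 2 E ≋ - (q ^ 2 * φ² E)
  pr-2-E = mod⇒≋ λ N → mod-trans (mod-≤ (N≤N*7 N) (pr-E-mod 2 N)) (mod-trans (≋⇒mod (assemble N)) (mod-neg (mod-* mod-refl (φ²-mod N (mod-sym (E≋pentagonal N))))))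
    where
    open ≋-Reasoning
    halve : ∀ {m n} → 2 ℕ.* m ≡ 2 ℕ.* n → m ≡ n
    halve {m} {n} = ℕP.*-cancelˡ-≡ m n 2
    exponentᵃ : ∀ l → expᵃ (1 ℕ.+ l ℕ.* 7) ≡ 2 ℕ.+ 49 ℕ.* expᵃ l
    exponentᵃ l = halve (≡.trans (ℕP.*-distribˡ-+ 2 (k ℕ.* k) (tri k)) (≡.trans (≡.cong (2 ℕ.* (k ℕ.* k) ℕ.+_) (2*tri k))
      (≡.trans (solveℕ 1 (λ l → (conℕ 2 :*ℕ ((conℕ 1 :+ℕ l :*ℕ conℕ 7) :*ℕ (conℕ 1 :+ℕ l :*ℕ conℕ 7))) :+ℕ ((conℕ 1 :+ℕ l :*ℕ conℕ 7) :*ℕ (conℕ 1 :+ℕ l :*ℕ conℕ 7) :+ℕ (conℕ 1 :+ℕ l :*ℕ conℕ 7))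
          :=ℕ conℕ 4 :+ℕ conℕ 98 :*ℕ (l :*ℕ l) :+ℕ conℕ 49 :*ℕ (l :*ℕ l :+ℕ l)) ≡.refl l)
        (≡.trans (≡.cong (λ t → 4 ℕ.+ 98 ℕ.* (l ℕ.* l) ℕ.+ 49 ℕ.* t) (≡.sym (2*tri l)))
          (solveℕ 2 (λ l t → conℕ 4 :+ℕ conℕ 98 :*ℕ (l :*ℕ l) :+ℕ conℕ 49 :*ℕ (conℕ 2 :*ℕ t) :=ℕ conℕ 2 :*ℕ (conℕ 2 :+ℕ conℕ 49 :*ℕ (l :*ℕ l :+ℕ t))) ≡.refl l (tri l))))))
      where k = 1 ℕ.+ l ℕ.* 7
    exponentᵇ : ∀ l → expᵇ (5 ℕ.+ l ℕ.* 7) ≡ 2 ℕ.+ 49 ℕ.* expᵇ l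
    exponentᵇ l = halve (≡.trans (ℕP.*-distribˡ-+ 2 (tri k) (suc k ℕ.* suc k)) (≡.trans (≡.cong (ℕ._+ 2 ℕ.* (suc k ℕ.* suc k)) (2*tri k))
      (≡.trans (solveℕ 1 (λ l → (conℕ 5 :+ℕ l :*ℕ conℕ 7) :*ℕ (conℕ 5 :+ℕ l :*ℕ conℕ 7) :+ℕ (conℕ 5 :+ℕ l :*ℕ conℕ 7) :+ℕ conℕ 2 :*ℕ ((conℕ 6 :+ℕ l :*ℕ conℕ 7) :*ℕ (conℕ 6 :+ℕ l :*ℕ conℕ 7))
          :=ℕ conℕ 4 :+ℕ conℕ 49 :*ℕ (l :*ℕ l :+ℕ l) :+ℕ conℕ 98 :*ℕ ((conℕ 1 :+ℕ l) :*ℕ (conℕ 1 :+ℕ l))) ≡.refl l)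
        (≡.trans (≡.cong (λ t → 4 ℕ.+ 49 ℕ.* t ℕ.+ 98 ℕ.* (suc l ℕ.* suc l)) (≡.sym (2*tri l)))
          (solveℕ 2 (λ l t → conℕ 4 :+ℕ conℕ 49 :*ℕ (conℕ 2 :*ℕ t) :+ℕ conℕ 98 :*ℕ ((conℕ 1 :+ℕ l) :*ℕ (conℕ 1 :+ℕ l)) :=ℕ conℕ 2 :*ℕ (conℕ 2 :+ℕ conℕ 49 :*ℕ (t :+ℕ (conℕ 1 :+ℕ l) :*ℕ (conℕ 1 :+ℕ l)))) ≡.refl l (tri l))))))
      where k = 5 ℕ.+ l ℕ.* 7
    a-7 : ∀ l → a (1 ℕ.+ l ℕ.* 7) ≋ - (q ^ 2 * φ² (a l))
    a-7 l = begin
      - sgn (l ℕ.* 7) * q ^ expᵃ (1 ℕ.+ l ℕ.* 7) ≈⟨ *-cong (-‿cong (sgn-7 l)) (≋-trans (q^-cong (exponentᵃ l)) (q^-+ 2 (49 ℕ.* expᵃ l))) ⟩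
      - sgn l * (q ^ 2 * q ^ (49 ℕ.* expᵃ l)) ≈⟨ solve 3 (λ s x y → (:- s) :* (x :* y) := :- (x :* (s :* y))) ≋-refl (sgn l) (q ^ 2) (q ^ (49 ℕ.* expᵃ l)) ⟩
      - (q ^ 2 * (sgn l * q ^ (49 ℕ.* expᵃ l))) ≈⟨ -‿cong (*-congˡ (φ²-sgn-q^ l (expᵃ l))) ⟨
      - (q ^ 2 * φ² (a l)) ∎
    b-7 : ∀ l → b (5 ℕ.+ l ℕ.* 7) ≋ - (q ^ 2 * φ² (b l))
    b-7 l = begin
      - (- (- (- (- (- sgn (l ℕ.* 7))))) * q ^ expᵇ (5 ℕ.+ l ℕ.* 7)) ≈⟨ -‿cong (*-cong (-‿cong (-‿cong (-‿cong (-‿cong (-‿cong (sgn-7 l)))))) (≋-trans (q^-cong (exponentᵇ l)) (q^-+ 2 (49 ℕ.* expᵇ l)))) ⟩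
      - (- (- (- (- (- sgn l)))) * (q ^ 2 * q ^ (49 ℕ.* expᵇ l))) ≈⟨ solve 3 (λ s x y → :- ((:- (:- (:- (:- (:- s))))) :* (x :* y)) := :- (x :* :- (s :* y))) ≋-refl (sgn l) (q ^ 2) (q ^ (49 ℕ.* expᵇ l)) ⟩
      - (q ^ 2 * - (sgn l * q ^ (49 ℕ.* expᵇ l))) ≈⟨ -‿cong (*-congˡ (≋-trans (φ²-neg _) (-‿cong (φ²-sgn-q^ l (expᵇ l))))) ⟨
      - (q ^ 2 * φ² (b l)) ∎
    onlyᵃ : ∀ {i} → i ℕ.< 7 → i ≢ 1 → ¬ expᵃ i ≡₇ 2
    onlyᵃ = toWitness {a? = ℕP.allUpTo? (λ i → ¬? (i ℕ.≟ 1) →-dec ¬? (expᵃ i % 7 ℕ.≟ 2)) 7} _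
    onlyᵇ : ∀ {i} → i ℕ.< 7 → i ≢ 5 → ¬ expᵇ i ≡₇ 2
    onlyᵇ = toWitness {a? = ℕP.allUpTo? (λ i → ¬? (i ℕ.≟ 5) →-dec ¬? (expᵇ i % 7 ℕ.≟ 2)) 7} _
    block : ∀ l → ∑ 7 (λ i → pr 2 (a (i ℕ.+ l ℕ.* 7)) + pr 2 (b (i ℕ.+ l ℕ.* 7))) ≋ - (q ^ 2 * (φ² (a l + b l)))
    block l = begin
      ∑ 7 (λ i → pr 2 (a (i ℕ.+ l ℕ.* 7)) + pr 2 (b (i ℕ.+ l ℕ.* 7))) ≈⟨ MacMahon.∑-+ 7 (λ i → pr 2 (a (i ℕ.+ l ℕ.* 7))) (λ i → pr 2 (b (i ℕ.+ l ℕ.* 7))) ⟩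
      ∑ 7 (λ i → pr 2 (a (i ℕ.+ l ℕ.* 7))) + ∑ 7 (λ i → pr 2 (b (i ℕ.+ l ℕ.* 7)))
        ≈⟨ +-cong (∑-single 7 1 (λ i → pr 2 (a (i ℕ.+ l ℕ.* 7))) (s≤s (s≤s z≤n)) (λ i i<7 i≢ → pr-other 2 (Cls-a i l) (onlyᵃ i<7 i≢)))
                  (∑-single 7 5 (λ i → pr 2 (b (i ℕ.+ l ℕ.* 7))) (s≤s (s≤s (s≤s (s≤s (s≤s (s≤s z≤n)))))) (λ i i<7 i≢ → pr-other 2 (Cls-b i l) (onlyᵇ i<7 i≢))) ⟩
      pr 2 (a (1 ℕ.+ l ℕ.* 7)) + pr 2 (b (5 ℕ.+ l ℕ.* 7)) ≈⟨ +-cong (≋-trans (pr-same 2 (Cls-a 1 l) ≡.refl) (a-7 l)) (≋-trans (pr-same 2 (Cls-b 5 l) ≡.refl) (b-7 l)) ⟩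
      - (q ^ 2 * φ² (a l)) + - (q ^ 2 * φ² (b l)) ≈⟨ solve 3 (λ x y z → :- (x :* y) :+ :- (x :* z) := :- (x :* (y :+ z))) ≋-refl (q ^ 2) (φ² (a l)) (φ² (b l)) ⟩
      - (q ^ 2 * (φ² (a l) + φ² (b l))) ≈⟨ -‿cong (*-congˡ (≋-trans (φ-cong 7 (φ-+ 7 _ _)) (φ-+ 7 _ _))) ⟨
      - (q ^ 2 * φ² (a l + b l)) ∎
    assemble : ∀ N → ∑ N (λ l → ∑ 7 (λ i → pr 2 (a (i ℕ.+ l ℕ.* 7)) + pr 2 (b (i ℕ.+ l ℕ.* 7)))) ≋ - (q ^ 2 * φ² (∑ N (λ k → a k + b k)))
    assemble N = begin
      _ ≈⟨ ∑-cong N (λ l _ → block l) ⟩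
      ∑ N (λ l → - (q ^ 2 * φ² (a l + b l))) ≈⟨ MacMahon.∑-neg N _ ⟩
      - ∑ N (λ l → q ^ 2 * φ² (a l + b l)) ≈⟨ -‿cong (∑-*ˡ N _ _) ⟨
      - (q ^ 2 * ∑ N (λ l → φ² (a l + b l))) ≈⟨ -‿cong (*-congˡ (≋-trans (φ-cong 7 (φ-∑ 7 N _)) (φ-∑ 7 N _))) ⟨
      - (q ^ 2 * φ² (∑ N (λ k → a k + b k))) ∎

  open MacMahon using (E³≋J; χ-F)

  θ : ℕ → Series
  θ k = sgn k * q ^ tri k * χ k 0

  χ-const : ∀ k → χ k 0 ≋ const (+ (2 ℕ.* k ℕ.+ 1))
  χ-const k = ≋-trans (proj₁ (χ-F k)) (≋-sym (≋-trans (const-cong (≡.cong (ℤ._+ + 1) (ℤP.pos-* 2 k))) (≋-trans (const-+ _ (+ 1)) (+-congʳ (const-* (+ 2) (+ k))))))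

  E³-mod : ∀ n → E ^ 3 ≋ ∑ n θ mod n
  E³-mod zero i ()
  E³-mod (suc n) = E³≋J n

  Cls-θ : ∀ i l → Cls (tri i) (θ (i ℕ.+ l ℕ.* 7))
  Cls-θ i l = Cls-≡₇ {tri k ℕ.+ 0} (≡.trans (≡.cong (_% 7) (ℕP.+-identityʳ (tri k))) (tri-≡₇ i l))
    (Cls-* {tri k} {0} (Cls-* {0} (Cls-sgn k) (Cls-q^ (tri k))) (Cls-≋ (≋-sym (χ-const k)) (Cls-const _)))
    where k = i ℕ.+ l ℕ.* 7

  pr-E³-mod : ∀ r N → pr r (E ^ 3) ≋ ∑ N (λ l → ∑ 7 (λ i → pr r (θ (i ℕ.+ l ℕ.* 7)))) mod (N ℕ.* 7)
  pr-E³-mod r N = mod-trans (pr-mod (E³-mod (N ℕ.* 7))) (≋⇒mod (≋-trans (pr-∑ r (N ℕ.* 7) θ) (∑-7 N (λ k → pr r (θ k)))))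

  pr-E³-vanish : ∀ r → (∀ {i} → i ℕ.< 7 → ¬ tri i ≡₇ r) → pr r (E ^ 3) ≋ 0#
  pr-E³-vanish r h = mod⇒≋ λ N → mod-≤ (N≤N*7 N) (mod-trans (pr-E³-mod r N) (≋⇒mod (∑-0 N λ l → ≋-trans (∑-cong 7 λ i i<7 →
    pr-other r (Cls-θ i l) (h i<7)) (∑-0 7 λ _ → ≋-refl))))

  private
    tri-avoids? : ∀ r → Dec (∀ {i} → i ℕ.< 7 → ¬ tri i ≡₇ r)
    tri-avoids? r = ℕP.allUpTo? (λ i → ¬? (tri i % 7 ℕ.≟ r % 7)) 7

  pr-2-E³ : pr 2 (E ^ 3) ≋ 0#
  pr-2-E³ = pr-E³-vanish 2 (toWitness {a? = tri-avoids? 2} _)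

  pr-4-E³ : pr 4 (E ^ 3) ≋ 0#
  pr-4-E³ = pr-E³-vanish 4 (toWitness {a? = tri-avoids? 4} _)

  pr-5-E³ : pr 5 (E ^ 3) ≋ 0#
  pr-5-E³ = pr-E³-vanish 5 (toWitness {a? = tri-avoids? 5} _)

  -- Here 8 n + 1 = (2 k + 1)², and class 6 means that 7 divides 2 k + 1, that is k = 3 + 7 l. The
  -- factor 7 comes from the coefficient 2 k + 1.
  pr-6-E³ : pr 6 (E ^ 3) ≋ - (const (+ 7) * q ^ 6 * φ² (E ^ 3))
  pr-6-E³ = mod⇒≋ λ N → mod-trans (mod-≤ (N≤N*7 N) (pr-E³-mod 6 N)) (mod-trans (≋⇒mod (assemble N)) (mod-neg (mod-* mod-refl (φ²-mod N (mod-sym (E³-mod N))))))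
    where
    open ≋-Reasoning
    exponent : ∀ l → tri (3 ℕ.+ l ℕ.* 7) ≡ 6 ℕ.+ 49 ℕ.* tri l
    exponent l = ℕP.*-cancelˡ-≡ _ _ 2 (≡.trans (2*tri (3 ℕ.+ l ℕ.* 7)) (≡.trans (solveℕ 1 (λ l → (conℕ 3 :+ℕ l :*ℕ conℕ 7) :*ℕ (conℕ 3 :+ℕ l :*ℕ conℕ 7) :+ℕ (conℕ 3 :+ℕ l :*ℕ conℕ 7)
        :=ℕ conℕ 12 :+ℕ conℕ 49 :*ℕ (l :*ℕ l :+ℕ l)) ≡.refl l) (≡.trans (≡.cong (λ t → 12 ℕ.+ 49 ℕ.* t) (≡.sym (2*tri l)))
        (solveℕ 1 (λ t → conℕ 12 :+ℕ conℕ 49 :*ℕ (conℕ 2 :*ℕ t) :=ℕ conℕ 2 :*ℕ (conℕ 6 :+ℕ conℕ 49 :*ℕ t)) ≡.refl (tri l)))))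
    χ-7 : ∀ l → χ (3 ℕ.+ l ℕ.* 7) 0 ≋ const (+ 7) * χ l 0
    χ-7 l = ≋-trans (χ-const (3 ℕ.+ l ℕ.* 7)) (≋-trans (const-cong (≡.trans (≡.cong +_ (solveℕ 1 (λ l → conℕ 2 :*ℕ (conℕ 3 :+ℕ l :*ℕ conℕ 7) :+ℕ conℕ 1 :=ℕ conℕ 7 :*ℕ (conℕ 2 :*ℕ l :+ℕ conℕ 1)) ≡.refl l)) (ℤP.pos-* 7 (2 ℕ.* l ℕ.+ 1))))
      (≋-trans (const-* (+ 7) (+ (2 ℕ.* l ℕ.+ 1))) (*-congˡ (≋-sym (χ-const l)))))
    φ²-θ : ∀ l → φ² (θ l) ≋ sgn l * q ^ (49 ℕ.* tri l) * χ l 0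
    φ²-θ l = ≋-trans (φ-cong 7 (φ-* 7 _ _)) (≋-trans (φ-* 7 _ _) (*-cong (φ²-sgn-q^ l (tri l)) (≋-trans (φ²-cong (χ-const l)) (≋-trans (φ-cong 7 (φ-const 7 _)) (≋-trans (φ-const 7 _) (≋-sym (χ-const l)))))))
    θ-7 : ∀ l → θ (3 ℕ.+ l ℕ.* 7) ≋ - (const (+ 7) * q ^ 6 * φ² (θ l))
    θ-7 l = begin
      - (- (- sgn (l ℕ.* 7))) * q ^ tri (3 ℕ.+ l ℕ.* 7) * χ (3 ℕ.+ l ℕ.* 7) 0
        ≈⟨ *-cong (*-cong (-‿cong (-‿cong (-‿cong (sgn-7 l)))) (≋-trans (q^-cong (exponent l)) (q^-+ 6 (49 ℕ.* tri l)))) (χ-7 l) ⟩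
      - (- (- sgn l)) * (q ^ 6 * q ^ (49 ℕ.* tri l)) * (const (+ 7) * χ l 0)
        ≈⟨ solve 4 (λ s x y c → (:- (:- (:- s))) :* (x :* y) :* (con (+ 7) :* c) := :- (con (+ 7) :* x :* (s :* y :* c))) ≋-refl (sgn l) (q ^ 6) (q ^ (49 ℕ.* tri l)) (χ l 0) ⟩
      - (const (+ 7) * q ^ 6 * (sgn l * q ^ (49 ℕ.* tri l) * χ l 0)) ≈⟨ -‿cong (*-congˡ (φ²-θ l)) ⟨
      - (const (+ 7) * q ^ 6 * φ² (θ l)) ∎
    only : ∀ {i} → i ℕ.< 7 → i ≢ 3 → ¬ tri i ≡₇ 6
    only = toWitness {a? = ℕP.allUpTo? (λ i → ¬? (i ℕ.≟ 3) →-dec ¬? (tri i % 7 ℕ.≟ 6)) 7} _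
    assemble : ∀ N → ∑ N (λ l → ∑ 7 (λ i → pr 6 (θ (i ℕ.+ l ℕ.* 7)))) ≋ - (const (+ 7) * q ^ 6 * φ² (∑ N θ))
    assemble N = begin
      _ ≈⟨ ∑-cong N (λ l _ → ≋-trans (∑-single 7 3 (λ i → pr 6 (θ (i ℕ.+ l ℕ.* 7))) (s≤s (s≤s (s≤s (s≤s z≤n)))) (λ i i<7 i≢ → pr-other 6 (Cls-θ i l) (only i<7 i≢)))
             (≋-trans (pr-same 6 (Cls-θ 3 l) ≡.refl) (θ-7 l))) ⟩
      ∑ N (λ l → - (const (+ 7) * q ^ 6 * φ² (θ l))) ≈⟨ MacMahon.∑-neg N _ ⟩
      - ∑ N (λ l → const (+ 7) * q ^ 6 * φ² (θ l)) ≈⟨ -‿cong (∑-*ˡ N _ _) ⟨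
      - (const (+ 7) * q ^ 6 * ∑ N (λ l → φ² (θ l))) ≈⟨ -‿cong (*-congˡ (≋-trans (φ-cong 7 (φ-∑ 7 N _)) (φ-∑ 7 N _))) ⟨
      - (const (+ 7) * q ^ 6 * φ² (∑ N θ)) ∎

-- Cancellation, first order equations, and the class 0 part of L

module LinearEquations where
  open SeriesRing
  open SeriesOperators
  open ResidueClasses
  open EulerProduct
  open ThetaSeries
  open LambertExpansion
  open EisensteinSeries
  open SevenDissection
  open import Data.Nat.DivMod using (m<n⇒m%n≡m)
  open import Data.Nat.Divisibility as ℕD using (divides)
  open import Data.Nat.Primality using (Prime; prime?; prime⇒irreducible)
  open import Data.Nat.Coprimality as Coprime using (Coprime)

  open Solver using (solve; _:+_; _:*_; _:-_; :-_; con; _:=_)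
  open ≋-Reasoning

  pr-≡₇ : ∀ {r s} a → r ≡₇ s → pr r a ≋ pr s a
  pr-≡₇ {r} {s} a e = pr-unique (λ n n≡r → pr-at a (≡.trans n≡r e)) (Cls-≡₇ {s} {r} (≡.sym e) (Cls-pr a))

  ≋-by-mod : ∀ {x y} → x 0 ≡ y 0 → (∀ n → x ≋ y mod (suc n) → x (suc n) ≡ y (suc n)) → x ≋ y
  ≋-by-mod {x} {y} base step = mod⇒≋ go
    where
    top : ∀ n → x ≋ y mod n → x n ≡ y n
    top zero _ = base
    top (suc n) below = step n below
    extend : ∀ n → x ≋ y mod n → x ≋ y mod (suc n)
    extend n below i i<1+n with i ℕ.≟ n
    ... | yes ≡.refl = top n below
    ... | no i≢n = below i (ℕP.≤∧≢⇒< (ℕP.≤-pred i<1+n) i≢n)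
    go : ∀ N → x ≋ y mod N
    go zero i ()
    go (suc n) = extend n (go n)

  *-at-0 : ∀ a b → (a * b) 0 ≡ a 0 ℤ.* b 0
  *-at-0 a b = ≡.trans (*-at a b 0) (ℤP.+-identityʳ _)

  *-at-suc : ∀ a b n → (a * b) (suc n) ≡ a 0 ℤ.* b (suc n) ℤ.+ (tail a * b) n
  *-at-suc a b n = ≡.trans (*-at a b (suc n)) (≡.cong (λ z → a 0 ℤ.* b (suc n) ℤ.+ z) (≡.sym (*-at (tail a) b n)))

  0*-mod : ∀ {x N} a → x ≋ 0# mod N → a * x ≋ 0# mod N
  0*-mod a h = mod-0-* a h

  *-cancelˡ-unit : ∀ u {x} .{{_ : ℤ.NonZero (u 0)}} → u * x ≋ 0# → x ≋ 0#
  *-cancelˡ-unit u {x} h = ≋-by-mod (zero-at 0 (≡.trans (≡.sym (*-at-0 u x)) (at h 0)))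
    λ n below → zero-at (suc n) (≡.trans (≡.sym (≡.trans (≡.cong (λ z → u 0 ℤ.* x (suc n) ℤ.+ z) (≡.trans (0*-mod (tail u) below n ℕP.≤-refl) (const-0-at n))) (ℤP.+-identityʳ _)))
      (≡.trans (≡.sym (*-at-suc u x n)) (at h (suc n))))
    where
    zero-at : ∀ n → u 0 ℤ.* x n ≡ 0# n → x n ≡ 0# n
    zero-at n e = ≡.trans (ℤP.*-cancelˡ-≡ (u 0) (x n) (+ 0) (≡.trans e (≡.trans (const-0-at n) (≡.sym (ℤP.*-zeroʳ (u 0)))))) (≡.sym (const-0-at n))

  *-cancelˡ-≋ : ∀ u {x y} .{{_ : ℤ.NonZero (u 0)}} → u * x ≋ u * y → x ≋ y
  *-cancelˡ-≋ u {x} {y} h = begin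
    x ≈⟨ solve 2 (λ x y → x := (x :- y) :+ y) ≋-refl x y ⟩
    (x - y) + y ≈⟨ +-congʳ (*-cancelˡ-unit u (≋-trans (solve 3 (λ u x y → u :* (x :- y) := u :* x :- u :* y) ≋-refl u x y) (≋-trans (+-congʳ h) (-‿inverseʳ _)))) ⟩
    0# + y ≈⟨ +-identityˡ y ⟩
    y ∎

  const-*-cancel : ∀ c .{{_ : ℤ.NonZero c}} {a b} → const c * a ≋ const c * b → a ≋ b
  const-*-cancel c h = mod⇒≋ λ N → const-*-cancel-mod c (≋⇒mod h)

  -- As g has no constant term, the coefficient of q^(n + 1) in the equation gives (n + 1) x_(n+1)
  -- in terms of earlier coefficients.
  ODE-unique : ∀ g {x y} → g 0 ≡ + 0 → D x ≋ g * x → D y ≋ g * y → x 0 ≡ y 0 → x ≋ y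
  ODE-unique g {x} {y} g₀ hx hy base = ≋-by-mod base step
    where
    step : ∀ n → x ≋ y mod (suc n) → x (suc n) ≡ y (suc n)
    step n below = ℤP.*-cancelˡ-≡ (+ suc n) (x (suc n)) (y (suc n))
      (≡.trans (side x hx) (≡.trans (mod-* (mod-refl {tail g}) below n ℕP.≤-refl) (≡.sym (side y hy))))
      where
      side : ∀ z → D z ≋ g * z → + suc n ℤ.* z (suc n) ≡ (tail g * z) n
      side z h = ≡.trans (≡.sym (D-at z (suc n))) (≡.trans (at h (suc n)) (≡.trans (*-at-suc g z n)
        (≡.trans (≡.cong (λ w → w ℤ.* z (suc n) ℤ.+ (tail g * z) n) g₀) (≡.trans (≡.cong (ℤ._+ (tail g * z) n) (ℤP.*-zeroˡ (z (suc n)))) (ℤP.+-identityˡ _)))))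

  φ-φ : ∀ m n .{{_ : NonZero m}} .{{_ : NonZero n}} .{{_ : NonZero (n ℕ.* m)}} a → φ m (φ n a) ≋ φ (n ℕ.* m) a
  φ-φ m n a = φ-unique (n ℕ.* m)
    (λ k → ≡.trans (≡.cong (φ m (φ n a)) (≡.sym (ℕP.*-assoc k n m))) (≡.trans (φ-at m (φ n a) (k ℕ.* n)) (φ-at n a k)))
    (φ-elim m (λ j → ¬ n ℕ.* m ℕD.∣ j → φ m (φ n a) j ≡ + 0)
      (λ k ¬d → ≡.trans (φ-at m (φ n a) k) (φ-at-∤ n a k λ d → ¬d (ℕD.*-monoˡ-∣ m d)))
      (λ j ¬m _ → φ-at-∤ m (φ n a) j ¬m))

  module LogDerivative where
    open MacMahon using (y; p₁; ∑-+)
    open Eisenstein using (p₁≋-L)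
    open LambertSeries using (y₀)

    prime-7 : Prime 7
    prime-7 = toWitness {a? = prime? 7} _

    y₀-at : ∀ m → y₀ m ≡ + m
    y₀-at m = ≡.trans (D-at geometric m) (ℤP.*-identityʳ (+ m))

    -- The coefficient of `φ n y₀` at a multiple j of n is j / n. If 7 does not divide n, then n
    -- divides 7 k only if it divides k, and passing from k to 7 k multiplies the coefficient by 7.
    pr-φ-∤ : ∀ n .{{_ : NonZero n}} → ¬ 7 ℕD.∣ n → pr 0 (φ n y₀) ≋ const (+ 7) * φ 7 (φ n y₀)
    pr-φ-∤ n 7∤n = pr-unique {0} (λ j j≡0 → on j j≡0) (Cls-* {0} {0} (Cls-const (+ 7)) (Cls-φ _))
      where
      at-multiple : ∀ k → (const (+ 7) * φ 7 (φ n y₀)) (k ℕ.* 7) ≡ φ n y₀ (k ℕ.* 7)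
      at-multiple k = ≡.trans (const-*-at (+ 7) _ (k ℕ.* 7)) (≡.trans (≡.cong (+ 7 ℤ.*_) (φ-at 7 (φ n y₀) k))
        (φ-elim n (λ k → + 7 ℤ.* φ n y₀ k ≡ φ n y₀ (k ℕ.* 7)) mult nonmult k))
        where
        mult : ∀ t → + 7 ℤ.* φ n y₀ (t ℕ.* n) ≡ φ n y₀ (t ℕ.* n ℕ.* 7)
        mult t = ≡.trans (≡.cong (+ 7 ℤ.*_) (≡.trans (φ-at n y₀ t) (y₀-at t))) (≡.sym (≡.trans (≡.cong (φ n y₀) swap) (≡.trans (φ-at n y₀ (7 ℕ.* t)) (≡.trans (y₀-at (7 ℕ.* t)) (ℤP.pos-* 7 t)))))
          where
          swap : t ℕ.* n ℕ.* 7 ≡ 7 ℕ.* t ℕ.* n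
          swap = ≡.trans (ℕP.*-comm (t ℕ.* n) 7) (≡.sym (ℕP.*-assoc 7 t n))
        nonmult : ∀ k → ¬ n ℕD.∣ k → + 7 ℤ.* φ n y₀ k ≡ φ n y₀ (k ℕ.* 7)
        nonmult k ¬d = ≡.trans (≡.cong (+ 7 ℤ.*_) (φ-at-∤ n y₀ k ¬d)) (≡.sym (φ-at-∤ n y₀ (k ℕ.* 7) (¬d ∘ divide)))
          where
          coprime : Coprime n 7
          coprime (d∣n , d∣7) with prime⇒irreducible prime-7 d∣7
          ... | inj₁ d≡1 = d≡1
          ... | inj₂ ≡.refl = contradiction d∣n 7∤n
          divide : n ℕD.∣ k ℕ.* 7 → n ℕD.∣ k
          divide d = Coprime.coprime-divisor coprime (≡.subst (n ℕD.∣_) (ℕP.*-comm k 7) d)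
      on : ∀ j → j ≡₇ 0 → (const (+ 7) * φ 7 (φ n y₀)) j ≡ φ n y₀ j
      on j j≡0 with ℕD.m%n≡0⇒n∣m j 7 j≡0
      ... | divides k ≡.refl = at-multiple k

    pr-φ-7* : ∀ l → pr 0 (y (6 ℕ.+ l ℕ.* 7)) ≋ φ 7 (y l)
    pr-φ-7* l = ≋-trans (pr-cong (≋-sym (φ-φ 7 (suc l) y₀))) (pr-same 0 (Cls-φ (φ (suc l) y₀)) ≡.refl)

    pr-y : ∀ i l → i ℕ.< 6 → pr 0 (y (i ℕ.+ l ℕ.* 7)) ≋ const (+ 7) * φ 7 (y (i ℕ.+ l ℕ.* 7))
    pr-y i l i<6 = pr-φ-∤ (suc (i ℕ.+ l ℕ.* 7)) λ d → contradiction
      (≡.trans (≡.sym (m<n⇒m%n≡m (s≤s i<6))) (≡.trans (≡.sym (+k*7 (suc i) l)) (ℕD.n∣m⇒m%n≡0 (suc (i ℕ.+ l ℕ.* 7)) 7 d))) λ ()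

    -- The summands with index divisible by 7 follow another rule than the rest. They are included
    -- in the sum with factor 7 all the same, and the last two terms correct this.
    pr-p₁ : ∀ N → pr 0 (p₁ (N ℕ.* 7)) ≋ const (+ 7) * φ 7 (p₁ (N ℕ.* 7)) + (φ 7 (p₁ N) - const (+ 7) * φ² (p₁ N))
    pr-p₁ N = begin
      pr 0 (∑ (N ℕ.* 7) y) ≈⟨ ≋-trans (pr-∑ 0 (N ℕ.* 7) y) (∑-7 N (λ k → pr 0 (y k))) ⟩
      ∑ N (λ l → ∑ 7 (λ i → pr 0 (y (i ℕ.+ l ℕ.* 7)))) ≈⟨ ∑-cong N (λ l _ → block l) ⟩
      ∑ N (λ l → ∑ 7 (λ i → const (+ 7) * φ 7 (y (i ℕ.+ l ℕ.* 7))) + (φ 7 (y l) - const (+ 7) * φ² (y l)))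
        ≈⟨ ≋-trans (∑-+ N (λ l → ∑ 7 (λ i → const (+ 7) * φ 7 (y (i ℕ.+ l ℕ.* 7)))) (λ l → φ 7 (y l) - const (+ 7) * φ² (y l)))
             (+-cong (≋-sym (∑-7 N (λ k → const (+ 7) * φ 7 (y k)))) (≋-trans (∑-+ N (λ l → φ 7 (y l)) (λ l → - (const (+ 7) * φ² (y l)))) (+-congˡ (MacMahon.∑-neg N _)))) ⟩
      ∑ (N ℕ.* 7) (λ k → const (+ 7) * φ 7 (y k)) + (∑ N (λ l → φ 7 (y l)) - ∑ N (λ l → const (+ 7) * φ² (y l)))
        ≈⟨ +-cong (≋-trans (*-congˡ (φ-∑ 7 (N ℕ.* 7) y)) (∑-*ˡ (N ℕ.* 7) _ _))
             (+-cong (φ-∑ 7 N y) (-‿cong (≋-trans (*-congˡ (≋-trans (φ-cong 7 (φ-∑ 7 N y)) (φ-∑ 7 N (λ l → φ 7 (y l))))) (∑-*ˡ N _ _)))) ⟨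
      const (+ 7) * φ 7 (p₁ (N ℕ.* 7)) + (φ 7 (p₁ N) - const (+ 7) * φ² (p₁ N)) ∎
      where
      block : ∀ l → ∑ 7 (λ i → pr 0 (y (i ℕ.+ l ℕ.* 7))) ≋ ∑ 7 (λ i → const (+ 7) * φ 7 (y (i ℕ.+ l ℕ.* 7))) + (φ 7 (y l) - const (+ 7) * φ² (y l))
      block l = ≋-trans (+-cong (∑-cong 6 {λ i → pr 0 (y (i ℕ.+ l ℕ.* 7))} {λ i → const (+ 7) * φ 7 (y (i ℕ.+ l ℕ.* 7))} (λ i i<6 → pr-y i l i<6)) (pr-φ-7* l))
        (≋-trans (solve 3 (λ S z w → S :+ z := S :+ con (+ 7) :* w :+ (z :- con (+ 7) :* w)) ≋-refl (∑ 6 (λ i → const (+ 7) * φ 7 (y (i ℕ.+ l ℕ.* 7)))) (φ 7 (y l)) (φ² (y l)))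
          (+-congʳ (+-congˡ (*-congˡ (φ-cong 7 (φ-φ 7 (suc l) y₀))))))

    p₁-mod : ∀ n → p₁ n ≋ - L mod n
    p₁-mod n = mod-≤ (ℕP.n≤1+n n) (p₁≋-L n)

    -- In coefficients: σ₁(7 n) = 8 σ₁(n) - 7 σ₁(n / 7).
    pr-0-L : pr 0 L ≋ const (+ 8) * φ 7 L - const (+ 7) * φ² L
    pr-0-L = begin
      pr 0 L ≈⟨ pr-cong (solve 1 (λ l → l := :- (:- l)) ≋-refl L) ⟩
      pr 0 (- - L) ≈⟨ pr-neg 0 (- L) ⟩
      - pr 0 (- L) ≈⟨ -‿cong (mod⇒≋ limit) ⟩
      - (const (+ 7) * φ 7 (- L) + (φ 7 (- L) - const (+ 7) * φ² (- L))) ≈⟨ -‿cong (+-cong (*-congˡ (φ-neg 7 L)) (+-cong (φ-neg 7 L) (-‿cong (*-congˡ (φ²-neg L))))) ⟩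
      - (const (+ 7) * - φ 7 L + (- φ 7 L - const (+ 7) * - φ² L)) ≈⟨ solve 2 (λ x z → :- (con (+ 7) :* :- x :+ (:- x :- con (+ 7) :* :- z)) := con (+ 8) :* x :- con (+ 7) :* z) ≋-refl (φ 7 L) (φ² L) ⟩
      const (+ 8) * φ 7 L - const (+ 7) * φ² L ∎
      where
      limit : ∀ N → pr 0 (- L) ≋ const (+ 7) * φ 7 (- L) + (φ 7 (- L) - const (+ 7) * φ² (- L)) mod N
      limit N = mod-trans (mod-≤ (N≤N*7 N) (pr-mod (mod-sym (p₁-mod (N ℕ.* 7))))) (mod-trans (≋⇒mod (pr-p₁ N))
        (mod-+ (mod-* (mod-refl {const (+ 7)}) (mod-≤ (ℕP.≤-trans (N≤N*7 N) (N≤N*7 (N ℕ.* 7))) (φ-mod 7 (p₁-mod (N ℕ.* 7)))))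
          (mod-+ (mod-≤ (N≤N*7 N) (φ-mod 7 (p₁-mod N))) (mod-neg (mod-* (mod-refl {const (+ 7)}) (φ²-mod N (p₁-mod N)))))))

-- Relations between the components of E and the modular equation of degree 7

module ModularEquation where
  open SeriesRing
  open SeriesOperators
  open ResidueClasses
  open EulerProduct
  open SevenDissection
  open LinearEquations
  open import Data.Nat.DivMod using (_%_; m%n<n; m%n%n≡m%n)
  open import Data.Fin using (zero; suc)
  open import Data.Vec using (Vec; []; _∷_)

  open Solver using (solve; prove; Polynomial; _:+_; _:*_; _:-_; :-_; _:^_; con; var; _:=_; ⟦_⟧)
  open ≋-Reasoning

  ∑-pr : ∀ x → x ≋ ∑ 7 (λ s → pr s x)
  ∑-pr x = pr-ext λ r → begin
    pr r x ≈⟨ pr-unique (λ n e → ≡.trans (pr-at x (≡.trans e (≡.sym (m%n%n≡m%n r 7)))) ≡.refl) (Cls-≡₇ {r % 7} (m%n%n≡m%n r 7) (Cls-pr x)) ⟩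
    pr (r % 7) x ≈⟨ pr-same r (Cls-pr {r % 7} x) (m%n%n≡m%n r 7) ⟨
    pr r (pr (r % 7) x) ≈⟨ ∑-single 7 (r % 7) (λ s → pr r (pr s x)) (m%n<n r 7) (λ s s<7 s≢ → pr-other r (Cls-pr x) λ e → s≢ (≡.trans (≡.sym (small s<7)) e)) ⟨
    ∑ 7 (λ s → pr r (pr s x)) ≈⟨ pr-∑ r 7 (λ s → pr s x) ⟨
    pr r (∑ 7 (λ s → pr s x)) ∎
    where
    open import Data.Nat.DivMod using (m<n⇒m%n≡m)
    small : ∀ {s} → s ℕ.< 7 → s % 7 ≡ s
    small = m<n⇒m%n≡m

  -- `K` is q E(q^7)^4 in terms of the components of E. This value is only reached in `K≋`, through
  -- the norm; the algebra before it works with the polynomial.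
  a b e c m E₇ K : Series
  a = pr 0 E
  b = pr 1 E
  e = pr 2 E
  c = pr 5 E
  E₇ = φ 7 E
  m = q ^ 2 * φ² E
  K = - (a ^ 3 * b + b ^ 3 * c + c ^ 3 * a + const (+ 8) * e ^ 4)

  e≋-m : e ≋ - m
  e≋-m = pr-2-E

  E-components : E ≋ a + b + e + c
  E-components = ≋-trans (∑-pr E) (≋-trans (+-cong (+-cong (+-cong (+-cong (+-congˡ ≋-refl) pr-3-E) pr-4-E) ≋-refl) pr-6-E)
    (solve 4 (λ a b e c → con (+ 0) :+ a :+ b :+ e :+ con (+ 0) :+ con (+ 0) :+ c :+ con (+ 0) := a :+ b :+ e :+ c) ≋-refl a b e c))

  -- The residues r - 1, r - 2 and r - 5 are written as 6 + r, 5 + r and 2 + r to stay within ℕ.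
  pr-E* : ∀ r y → pr r (E * y) ≋ a * pr r y + b * pr (6 ℕ.+ r) y + e * pr (5 ℕ.+ r) y + c * pr (2 ℕ.+ r) y
  pr-E* r y = begin
    pr r (E * y) ≈⟨ pr-cong (≋-trans (*-congʳ E-components) (solve 5 (λ a b e c y → (a :+ b :+ e :+ c) :* y := a :* y :+ b :* y :+ e :* y :+ c :* y) ≋-refl a b e c y)) ⟩
    pr r (a * y + b * y + e * y + c * y) ≈⟨ ≋-trans (pr-+ r _ _) (+-congʳ (≋-trans (pr-+ r _ _) (+-congʳ (pr-+ r _ _)))) ⟩
    pr r (a * y) + pr r (b * y) + pr r (e * y) + pr r (c * y)
      ≈⟨ +-cong (+-cong (+-cong (pr-*ˡ r r y (Cls-pr {0} E) ≡.refl) (pr-*ˡ (6 ℕ.+ r) r y (Cls-pr {1} E) ≡.refl)) (pr-*ˡ (5 ℕ.+ r) r y (Cls-pr {2} E) ≡.refl)) (pr-*ˡ (2 ℕ.+ r) r y (Cls-pr {5} E) ≡.refl) ⟩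
    a * pr r y + b * pr (6 ℕ.+ r) y + e * pr (5 ℕ.+ r) y + c * pr (2 ℕ.+ r) y ∎

  -- A solver polynomial instead of a series, so that `prove` can compare the components of E^k with
  -- explicit expressions.
  component : ℕ → ℕ → Polynomial 4
  component zero r with r % 7 ℕ.≟ 0
  ... | yes _ = con (+ 1)
  ... | no _ = con (+ 0)
  component (suc k) r = var zero :* component k r :+ var (suc zero) :* component k (6 ℕ.+ r)
    :+ var (suc (suc zero)) :* component k (5 ℕ.+ r) :+ var (suc (suc (suc zero))) :* component k (2 ℕ.+ r)

  ρ : Vec Series 4
  ρ = a ∷ b ∷ e ∷ c ∷ []

  pr-E^ : ∀ k r → pr r (E ^ k) ≋ ⟦ component k r ⟧ ρ
  pr-E^ zero r with r % 7 ℕ.≟ 0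
  ... | yes p = pr-same r (Cls-const (+ 1)) (≡.sym p)
  ... | no ¬p = pr-other r (Cls-const (+ 1)) (λ p → ¬p (≡.sym p))
  pr-E^ (suc k) r = ≋-trans (pr-E* r (E ^ k)) (+-cong (+-cong (+-cong (*-congˡ (pr-E^ k r)) (*-congˡ (pr-E^ k (6 ℕ.+ r)))) (*-congˡ (pr-E^ k (5 ℕ.+ r)))) (*-congˡ (pr-E^ k (2 ℕ.+ r))))

  module _ {n} (a b e c : Polynomial n) where
    :E :K :r₁ :r₂ :r₃ :r₄ : Polynomial n
    :E = a :+ b :+ e :+ c
    :K = :- (a :^ 3 :* b :+ b :^ 3 :* c :+ c :^ 3 :* a :+ con (+ 8) :* e :^ 4)
    :r₁ = a :* a :* e :+ a :* b :* b :+ c :* e :* e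
    :r₂ = a :* e :* e :+ b :* b :* e :+ b :* c :* c
    :r₃ = a :* a :* c :+ b :* e :* e :+ c :* c :* e
    :r₄ = e :* e :* e :- a :* b :* c

    -- The norm of E over the series in q^7, and the components of its cofactor (norm / E).
    :norm :adj₀ :adj₁ :adj₂ :adj₃ :adj₄ :adj₅ :adj₆ : Polynomial n
    :norm = a :^ 7 :- con (+ 7) :* a :^ 5 :* e :* c :+ con (+ 7) :* a :^ 4 :* b :^ 2 :* c :- con (+ 7) :* a :^ 3 :* b :* e :^ 3 :+ con (+ 14) :* a :^ 3 :* e :^ 2 :* c :^ 2 :+ con (+ 14) :* a :^ 2 :* b :^ 3 :* e :^ 2
       :- con (+ 7) :* a :^ 2 :* b :^ 2 :* e :* c :^ 2 :+ con (+ 7) :* a :^ 2 :* b :* c :^ 4 :- con (+ 7) :* a :* b :^ 5 :* e :+ con (+ 7) :* a :* b :^ 4 :* c :^ 2 :+ con (+ 14) :* a :* b :* e :^ 4 :* c :- con (+ 7) :* a :* e :^ 3 :* c :^ 3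
       :+ b :^ 7 :- con (+ 7) :* b :^ 3 :* e :^ 3 :* c :+ con (+ 14) :* b :^ 2 :* e :^ 2 :* c :^ 3 :- con (+ 7) :* b :* e :* c :^ 5 :+ e :^ 7 :+ c :^ 7
    :adj₀ = a :^ 6 :- con (+ 5) :* a :^ 4 :* e :* c :+ con (+ 4) :* a :^ 3 :* b :^ 2 :* c :- con (+ 3) :* a :^ 2 :* b :* e :^ 3 :+ con (+ 6) :* a :^ 2 :* e :^ 2 :* c :^ 2 :+ con (+ 4) :* a :* b :^ 3 :* e :^ 2
       :- con (+ 2) :* a :* b :^ 2 :* e :* c :^ 2 :+ con (+ 2) :* a :* b :* c :^ 4 :- b :^ 5 :* e :+ b :^ 4 :* c :^ 2 :+ con (+ 2) :* b :* e :^ 4 :* c :- e :^ 3 :* c :^ 3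
    :adj₁ = a :^ 3 :* b :* e :* c :+ a :^ 2 :* e :^ 4 :+ con (+ 2) :* a :* e :* c :^ 4 :+ b :^ 4 :* e :^ 2 :+ b :^ 2 :* c :^ 4 :- a :^ 5 :* b
       :- a :^ 3 :* c :^ 3 :- con (+ 3) :* a :^ 2 :* b :^ 3 :* c :- con (+ 3) :* a :* b :^ 2 :* e :^ 3 :- con (+ 2) :* a :* b :* e :^ 2 :* c :^ 2 :- con (+ 3) :* b :^ 3 :* e :* c :^ 2 :- e :^ 5 :* c
    :adj₂ = a :^ 4 :* b :^ 2 :+ con (+ 4) :* a :^ 3 :* e :^ 2 :* c :+ con (+ 4) :* a :^ 2 :* b :* c :^ 3 :+ con (+ 2) :* a :* b :^ 4 :* c :+ con (+ 2) :* a :* b :* e :^ 4 :+ con (+ 6) :* b :^ 2 :* e :^ 2 :* c :^ 2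
       :+ c :^ 6 :- a :^ 5 :* e :- con (+ 2) :* a :^ 2 :* b :^ 2 :* e :* c :- con (+ 3) :* a :* e :^ 3 :* c :^ 2 :- b :^ 3 :* e :^ 3 :- con (+ 5) :* b :* e :* c :^ 4
    :adj₃ = con (+ 2) :* a :^ 4 :* b :* e :+ a :^ 4 :* c :^ 2 :- a :^ 3 :* b :^ 3 :- con (+ 2) :* a :^ 2 :* b :* e :^ 2 :* c :- con (+ 3) :* a :^ 2 :* e :* c :^ 3 :+ a :* b :^ 3 :* e :* c
       :- con (+ 3) :* a :* b :^ 2 :* c :^ 3 :- a :* e :^ 5 :- b :^ 5 :* c :+ b :^ 2 :* e :^ 4 :- con (+ 3) :* b :* e :^ 3 :* c :^ 2 :+ e :^ 2 :* c :^ 4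
    :adj₄ = a :^ 4 :* e :^ 2 :- con (+ 3) :* a :^ 3 :* b :^ 2 :* e :- con (+ 3) :* a :^ 3 :* b :* c :^ 2 :+ a :^ 2 :* b :^ 4 :- con (+ 3) :* a :^ 2 :* e :^ 3 :* c :- con (+ 2) :* a :* b :^ 2 :* e :^ 2 :* c
       :+ a :* b :* e :* c :^ 3 :- a :* c :^ 5 :+ con (+ 2) :* b :^ 4 :* e :* c :- b :^ 3 :* c :^ 3 :- b :* e :^ 5 :+ e :^ 4 :* c :^ 2
    :adj₅ = con (+ 4) :* a :^ 3 :* e :* c :^ 2 :+ con (+ 4) :* a :^ 2 :* b :^ 3 :* e :+ con (+ 8) :* a :* b :* e :^ 3 :* c :+ con (+ 4) :* b :^ 2 :* e :* c :^ 3 :+ e :^ 6 :- a :^ 5 :* c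
       :- con (+ 3) :* a :^ 3 :* b :* e :^ 2 :- a :^ 2 :* b :^ 2 :* c :^ 2 :- a :* b :^ 5 :- con (+ 3) :* a :* e :^ 2 :* c :^ 3 :- con (+ 3) :* b :^ 3 :* e :^ 2 :* c :- b :* c :^ 5
    :adj₆ = con (+ 2) :* a :^ 4 :* b :* c :- a :^ 3 :* e :^ 3 :+ con (+ 6) :* a :^ 2 :* b :^ 2 :* e :^ 2 :- con (+ 2) :* a :^ 2 :* b :* e :* c :^ 2 :+ a :^ 2 :* c :^ 4 :- con (+ 5) :* a :* b :^ 4 :* e
       :+ con (+ 4) :* a :* b :^ 3 :* c :^ 2 :+ con (+ 2) :* a :* e :^ 4 :* c :+ b :^ 6 :- con (+ 3) :* b :^ 2 :* e :^ 3 :* c :+ con (+ 4) :* b :* e :^ 2 :* c :^ 3 :- e :* c :^ 5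

  v₀ v₁ v₂ v₃ : ∀ {n} → Polynomial (4 ℕ.+ n)
  v₀ = var zero
  v₁ = var (suc zero)
  v₂ = var (suc (suc zero))
  v₃ = var (suc (suc (suc zero)))

  relation : (∀ {n} → Polynomial n → Polynomial n → Polynomial n → Polynomial n → Polynomial n) → Series
  relation r = ⟦ r {4} v₀ v₁ v₂ v₃ ⟧ ρ

  -- Each relation is a component of E³ up to an integer factor. The classes 2, 4 and 5 vanish;
  -- class 6 is e³ + 6 a b c and equals 7 e³, whence a b c = e³.
  R₁ : relation :r₁ ≋ 0#
  R₁ = const-*-cancel (+ 3) (begin
    const (+ 3) * relation :r₁ ≈⟨ prove ρ (con (+ 3) :* :r₁ v₀ v₁ v₂ v₃) (component 3 2) ≋-refl ⟩
    ⟦ component 3 2 ⟧ ρ ≈⟨ ≋-trans (≋-sym (pr-E^ 3 2)) pr-2-E³ ⟩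
    0# ≈⟨ zeroʳ _ ⟨
    const (+ 3) * 0# ∎)

  R₂ : relation :r₂ ≋ 0#
  R₂ = const-*-cancel (+ 3) (begin
    const (+ 3) * relation :r₂ ≈⟨ prove ρ (con (+ 3) :* :r₂ v₀ v₁ v₂ v₃) (component 3 4) ≋-refl ⟩
    ⟦ component 3 4 ⟧ ρ ≈⟨ ≋-trans (≋-sym (pr-E^ 3 4)) pr-4-E³ ⟩
    0# ≈⟨ zeroʳ _ ⟨
    const (+ 3) * 0# ∎)

  R₃ : relation :r₃ ≋ 0#
  R₃ = const-*-cancel (+ 3) (begin
    const (+ 3) * relation :r₃ ≈⟨ prove ρ (con (+ 3) :* :r₃ v₀ v₁ v₂ v₃) (component 3 5) ≋-refl ⟩
    ⟦ component 3 5 ⟧ ρ ≈⟨ ≋-trans (≋-sym (pr-E^ 3 5)) pr-5-E³ ⟩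
    0# ≈⟨ zeroʳ _ ⟨
    const (+ 3) * 0# ∎)

  pr-6-E³-e : pr 6 (E ^ 3) ≋ const (+ 7) * e ^ 3
  pr-6-E³-e = begin
    pr 6 (E ^ 3) ≈⟨ pr-6-E³ ⟩
    - (const (+ 7) * q ^ 6 * φ² (E ^ 3)) ≈⟨ -‿cong (*-congˡ (≋-trans (φ-cong 7 (φ-^ 7 E 3)) (φ-^ 7 _ 3))) ⟩
    - (const (+ 7) * q ^ 6 * φ² E ^ 3) ≈⟨ solve 2 (λ q x → :- (con (+ 7) :* q :^ 6 :* x :^ 3) := con (+ 7) :* (:- (q :^ 2 :* x)) :^ 3) ≋-refl q (φ² E) ⟩
    const (+ 7) * (- m) ^ 3 ≈⟨ *-congˡ (^-congˡ 3 e≋-m) ⟨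
    const (+ 7) * e ^ 3 ∎

  R₄ : relation :r₄ ≋ 0#
  R₄ = const-*-cancel (+ 6) (begin
    const (+ 6) * relation :r₄ ≈⟨ prove ρ (con (+ 6) :* :r₄ v₀ v₁ v₂ v₃) (con (+ 7) :* v₂ :^ 3 :- component 3 6) ≋-refl ⟩
    const (+ 7) * e ^ 3 - ⟦ component 3 6 ⟧ ρ ≈⟨ +-congˡ (-‿cong (≋-trans (≋-sym (pr-E^ 3 6)) pr-6-E³-e)) ⟩
    const (+ 7) * e ^ 3 - const (+ 7) * e ^ 3 ≈⟨ ≋-trans (-‿inverseʳ _) (≋-sym (zeroʳ _)) ⟩
    const (+ 6) * 0# ∎)

  -- Calculation modulo the ideal of the four relations, with the cofactors as witnesses; the
  -- remaining hypothesis is a plain polynomial identity.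
  reduce : ∀ {x} y g₁ g₂ g₃ g₄ → x ≋ y + (g₁ * relation :r₁ + g₂ * relation :r₂ + g₃ * relation :r₃ + g₄ * relation :r₄) → x ≋ y
  reduce y g₁ g₂ g₃ g₄ h = ≋-trans h (≋-trans (+-congˡ (+-cong (+-cong (+-cong (*-congˡ R₁) (*-congˡ R₂)) (*-congˡ R₃)) (*-congˡ R₄)))
    (solve 5 (λ y a b c d → y :+ (a :* con (+ 0) :+ b :* con (+ 0) :+ c :* con (+ 0) :+ d :* con (+ 0)) := y) ≋-refl y g₁ g₂ g₃ g₄))

  module _ {n} (a b e c : Polynomial n) where
    -- Cofactors which show that N e + K² and the modular equation belong to the ideal of the relations.
    :n₁ :n₂ :n₃ :n₄ : Polynomial n
    :n₁ = a :^ 5 :- con (+ 10) :* a :^ 3 :* e :* c :+ con (+ 15) :* a :^ 2 :* b :^ 2 :* c :+ con (+ 9) :* a :* b :* e :^ 3 :+ con (+ 24) :* a :* e :^ 2 :* c :^ 2 :- con (+ 61) :* b :^ 3 :* e :^ 2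
       :- con (+ 41) :* b :^ 2 :* e :* c :^ 2 :+ con (+ 7) :* b :* c :^ 4
    :n₂ = con (+ 2) :* a :^ 4 :* c :+ con (+ 66) :* a :* b :^ 3 :* e :- con (+ 5) :* a :* b :^ 2 :* c :^ 2 :+ b :^ 5 :+ con (+ 70) :* b :* e :^ 3 :* c :- con (+ 15) :* e :^ 2 :* c :^ 3
    :n₃ = c :^ 5 :- con (+ 13) :* a :* b :^ 4
    :n₄ = con (+ 65) :* e :^ 5
    :m₁ :m₂ :m₃ :m₄ : Polynomial n
    :m₁ = a :^ 5 :+ con (+ 7) :* a :^ 4 :* c :+ con (+ 35) :* a :^ 3 :* b :* e :+ con (+ 21) :* a :^ 3 :* b :* c :- con (+ 3) :* a :^ 3 :* e :* c :+ con (+ 21) :* a :^ 3 :* c :^ 2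
       :+ con (+ 112) :* a :^ 2 :* b :^ 2 :* e :+ con (+ 64) :* a :^ 2 :* b :^ 2 :* c :+ con (+ 56) :* a :^ 2 :* b :* e :* c :+ con (+ 84) :* a :^ 2 :* b :* c :^ 2 :- con (+ 14) :* a :^ 2 :* e :^ 3 :- con (+ 7) :* a :^ 2 :* e :* c :^ 2
       :+ con (+ 28) :* a :^ 2 :* c :^ 3 :+ con (+ 224) :* a :* b :^ 3 :* e :+ con (+ 84) :* a :* b :^ 3 :* c :+ con (+ 14) :* a :* b :^ 2 :* e :^ 2 :+ con (+ 140) :* a :* b :^ 2 :* e :* c :+ con (+ 203) :* a :* b :^ 2 :* c :^ 2
       :- con (+ 61) :* a :* b :* e :^ 3 :- con (+ 35) :* a :* b :* e :^ 2 :* c :+ con (+ 7) :* a :* b :* e :* c :^ 2 :+ con (+ 112) :* a :* b :* c :^ 3 :- con (+ 56) :* a :* e :^ 3 :* c :+ con (+ 3) :* a :* e :^ 2 :* c :^ 2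
       :- con (+ 7) :* a :* e :* c :^ 3 :+ con (+ 14) :* a :* c :^ 4 :+ con (+ 224) :* b :^ 4 :* e :- con (+ 131) :* b :^ 3 :* e :^ 2 :+ con (+ 217) :* b :^ 3 :* e :* c :+ con (+ 217) :* b :^ 3 :* c :^ 2
       :- con (+ 84) :* b :^ 2 :* e :^ 3 :- con (+ 140) :* b :^ 2 :* e :^ 2 :* c :- con (+ 6) :* b :^ 2 :* e :* c :^ 2 :+ con (+ 196) :* b :^ 2 :* c :^ 3 :+ con (+ 84) :* b :* e :^ 4 :- con (+ 42) :* b :* e :^ 3 :* c
       :- con (+ 140) :* b :* e :^ 2 :* c :^ 2 :- con (+ 56) :* b :* e :* c :^ 3 :+ con (+ 63) :* b :* c :^ 4 :- con (+ 28) :* e :^ 5 :+ con (+ 70) :* e :^ 4 :* c :- con (+ 14) :* e :^ 2 :* c :^ 3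
    :m₂ = con (+ 2) :* a :^ 4 :* c :+ con (+ 192) :* a :* b :^ 3 :* e :+ con (+ 168) :* a :* b :^ 2 :* e :* c :+ con (+ 84) :* a :* b :* e :* c :^ 2 :+ con (+ 70) :* a :* e :^ 4 :+ con (+ 21) :* a :* e :* c :^ 3
       :+ b :^ 5 :+ con (+ 84) :* b :^ 4 :* e :+ con (+ 14) :* b :^ 3 :* e :* c :+ con (+ 28) :* b :^ 2 :* e :* c :^ 2 :+ con (+ 84) :* b :* e :^ 4 :+ con (+ 70) :* b :* e :^ 3 :* c
       :+ con (+ 21) :* b :* e :* c :^ 3 :+ con (+ 84) :* e :^ 4 :* c :+ con (+ 56) :* e :^ 3 :* c :^ 2 :+ con (+ 7) :* e :* c :^ 4 :- con (+ 21) :* a :^ 4 :* b :- con (+ 84) :* a :^ 3 :* b :^ 2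
       :- con (+ 28) :* a :^ 3 :* b :* c :- con (+ 203) :* a :^ 2 :* b :^ 3 :- con (+ 112) :* a :^ 2 :* b :^ 2 :* c :- con (+ 14) :* a :^ 2 :* b :* c :^ 2 :- con (+ 217) :* a :* b :^ 4 :- con (+ 196) :* a :* b :^ 3 :* c
       :- con (+ 61) :* a :* b :^ 2 :* c :^ 2 :- con (+ 84) :* a :* b :* e :^ 3 :- con (+ 196) :* a :* b :* e :^ 2 :* c :- con (+ 28) :* a :* e :^ 3 :* c :- con (+ 84) :* a :* e :^ 2 :* c :^ 2 :- con (+ 56) :* b :^ 3 :* e :^ 2
       :- con (+ 42) :* b :^ 2 :* e :^ 3 :- con (+ 224) :* b :^ 2 :* e :^ 2 :* c :- con (+ 203) :* b :* e :^ 2 :* c :^ 2 :- con (+ 28) :* e :^ 5 :- con (+ 64) :* e :^ 2 :* c :^ 3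
    :m₃ = con (+ 56) :* b :^ 4 :* e :+ con (+ 28) :* b :^ 3 :* e :^ 2 :+ con (+ 70) :* b :* e :^ 4 :+ c :^ 5 :- con (+ 7) :* a :^ 3 :* b :^ 2 :- con (+ 21) :* a :^ 2 :* b :^ 3
       :- con (+ 62) :* a :* b :^ 4 :- con (+ 84) :* b :^ 5 :- con (+ 84) :* b :^ 2 :* e :^ 3 :- con (+ 28) :* e :^ 5
    :m₄ = con (+ 9) :* e :^ 5

  N : Series
  N = ⟦ :norm {4} v₀ v₁ v₂ v₃ ⟧ ρ

  -- Once N is known as an eta quotient, this determines K up to sign.
  N*e : N * e ≋ - (K * K)
  N*e = reduce _ (⟦ :n₁ {4} v₀ v₁ v₂ v₃ ⟧ ρ) (⟦ :n₂ {4} v₀ v₁ v₂ v₃ ⟧ ρ) (⟦ :n₃ {4} v₀ v₁ v₂ v₃ ⟧ ρ) (⟦ :n₄ {4} v₀ v₁ v₂ v₃ ⟧ ρ)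
    (prove ρ (:norm v₀ v₁ v₂ v₃ :* v₂) (:- (:K v₀ v₁ v₂ v₃ :* :K v₀ v₁ v₂ v₃) :+ (:n₁ v₀ v₁ v₂ v₃ :* :r₁ v₀ v₁ v₂ v₃ :+ :n₂ v₀ v₁ v₂ v₃ :* :r₂ v₀ v₁ v₂ v₃
      :+ :n₃ v₀ v₁ v₂ v₃ :* :r₃ v₀ v₁ v₂ v₃ :+ :n₄ v₀ v₁ v₂ v₃ :* :r₄ v₀ v₁ v₂ v₃)) ≋-refl)

  -- Homogeneous of degree 8 if E and m have degree 1 and K has degree 4; multiplication by p^8
  -- therefore turns it into a relation between t₀ and τ.
  :modular : ∀ {n} → Polynomial n → Polynomial n → Polynomial n → Polynomial n
  :modular E K m = m :* (con (+ 7) :* E :^ 3 :+ con (+ 35) :* (E :^ 2 :* m) :+ con (+ 49) :* (E :* m :^ 2)) :* K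
    :+ m :* (E :^ 7 :+ con (+ 7) :* (E :^ 6 :* m) :+ con (+ 21) :* (E :^ 5 :* m :^ 2) :+ con (+ 49) :* (E :^ 4 :* m :^ 3)
      :+ con (+ 147) :* (E :^ 3 :* m :^ 4) :+ con (+ 343) :* (E :^ 2 :* m :^ 5) :+ con (+ 343) :* (E :* m :^ 6))

  modular : Series → Series → Series → Series
  modular E K m = ⟦ :modular {3} (var zero) (var (suc zero)) (var (suc (suc zero))) ⟧ (E ∷ K ∷ m ∷ [])

  private
    modular-components : K * K ≋ modular (a + b + e + c) K (- e)
    modular-components = reduce _ (⟦ :m₁ {4} v₀ v₁ v₂ v₃ ⟧ ρ) (⟦ :m₂ {4} v₀ v₁ v₂ v₃ ⟧ ρ) (⟦ :m₃ {4} v₀ v₁ v₂ v₃ ⟧ ρ) (⟦ :m₄ {4} v₀ v₁ v₂ v₃ ⟧ ρ)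
      (prove ρ (:K v₀ v₁ v₂ v₃ :* :K v₀ v₁ v₂ v₃) (:modular (:E v₀ v₁ v₂ v₃) (:K v₀ v₁ v₂ v₃) (:- v₂) :+ (:m₁ v₀ v₁ v₂ v₃ :* :r₁ v₀ v₁ v₂ v₃ :+ :m₂ v₀ v₁ v₂ v₃ :* :r₂ v₀ v₁ v₂ v₃
        :+ :m₃ v₀ v₁ v₂ v₃ :* :r₃ v₀ v₁ v₂ v₃ :+ :m₄ v₀ v₁ v₂ v₃ :* :r₄ v₀ v₁ v₂ v₃)) ≋-refl)

  modular-cong : ∀ {x x′ y z z′} → x ≋ x′ → z ≋ z′ → modular x y z ≋ modular x′ y z′
  modular-cong h k = +-cong (*-congʳ (*-cong k (+-cong (+-cong (*-congˡ (^-congˡ 3 h)) (*-congˡ (*-cong (^-congˡ 2 h) k))) (*-congˡ (*-cong h (^-congˡ 2 k))))))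
    (*-cong k (+-cong (+-cong (+-cong (+-cong (+-cong (+-cong (^-congˡ 7 h) (*-congˡ (*-cong (^-congˡ 6 h) k))) (*-congˡ (*-cong (^-congˡ 5 h) (^-congˡ 2 k)))) (*-congˡ (*-cong (^-congˡ 4 h) (^-congˡ 3 k))))
      (*-congˡ (*-cong (^-congˡ 3 h) (^-congˡ 4 k)))) (*-congˡ (*-cong (^-congˡ 2 h) (^-congˡ 5 k)))) (*-congˡ (*-cong h (^-congˡ 6 k)))))

  modular-equation : K * K ≋ modular E K m
  modular-equation = ≋-trans modular-components (modular-cong (≋-sym E-components) (≋-trans (-‿cong e≋-m) (solve 1 (λ m → :- (:- m) := m) ≋-refl m)))

-- Formal derivatives and the differential equation of the norm

module NormDerivative where
  open SeriesRing
  open SeriesOperators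
  open ResidueClasses
  open EulerProduct
  open EisensteinSeries
  open SevenDissection
  open LinearEquations
  open ModularEquation
  open import Data.Fin using (zero; suc; _↑ˡ_; _↑ʳ_)
  open import Data.Vec using (Vec; []; _∷_; _++_; map)
  open import Data.Vec.Properties using (lookup-++ˡ; lookup-++ʳ; lookup-map)

  open Solver using (solve; prove; Polynomial; op; [+]; [*]; _:+_; _:*_; _:-_; :-_; _:^_; con; var; _:=_; ⟦_⟧)
  open ≋-Reasoning

  -- In weaken x and der x, the variable n ↑ʳ i stands for the derivative of the variable i.
  weaken der : ∀ {n} → Polynomial n → Polynomial (n ℕ.+ n)
  weaken (op o x y) = op o (weaken x) (weaken y)
  weaken (con c) = con c
  weaken (var i) = var (i ↑ˡ _)
  weaken (x :^ k) = weaken x :^ k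
  weaken (:- x) = :- weaken x

  der-^ : ∀ {n} → Polynomial (n ℕ.+ n) → Polynomial (n ℕ.+ n) → ℕ → Polynomial (n ℕ.+ n)
  der-^ x dx zero = con (+ 0)
  der-^ {n} x dx (suc k) = dx :* x :^ k :+ x :* der-^ {n} x dx k

  der (op [+] x y) = der x :+ der y
  der (op [*] x y) = der x :* weaken y :+ weaken x :* der y
  der (con c) = con (+ 0)
  der {n} (var i) = var (n ↑ʳ i)
  der {n} (x :^ k) = der-^ {n} (weaken x) (der x) k
  der (:- x) = :- der x

  module _ {n} (σ : Vec Series n) where
    private
      σ⁺ = σ ++ map D σ

    ⟦weaken⟧ : ∀ P → ⟦ weaken P ⟧ σ⁺ ≋ ⟦ P ⟧ σ
    ⟦weaken⟧ (op [+] x y) = +-cong (⟦weaken⟧ x) (⟦weaken⟧ y)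
    ⟦weaken⟧ (op [*] x y) = *-cong (⟦weaken⟧ x) (⟦weaken⟧ y)
    ⟦weaken⟧ (con c) = ≋-refl
    ⟦weaken⟧ (var i) = ext λ k → ≡.cong (λ s → s k) (lookup-++ˡ σ (map D σ) i)
    ⟦weaken⟧ (x :^ k) = ^-congˡ k (⟦weaken⟧ x)
    ⟦weaken⟧ (:- x) = -‿cong (⟦weaken⟧ x)

    D-⟦⟧ : ∀ P → D (⟦ P ⟧ σ) ≋ ⟦ der P ⟧ σ⁺
    D-⟦⟧ (op [+] x y) = ≋-trans (D-+ _ _) (+-cong (D-⟦⟧ x) (D-⟦⟧ y))
    D-⟦⟧ (op [*] x y) = ≋-trans (D-* _ _) (+-cong (*-cong (D-⟦⟧ x) (≋-sym (⟦weaken⟧ y))) (*-cong (≋-sym (⟦weaken⟧ x)) (D-⟦⟧ y)))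
    D-⟦⟧ (con c) = D-const c
    D-⟦⟧ (var i) = ext λ k → ≡.cong (λ s → s k) (≡.sym (≡.trans (lookup-++ʳ σ (map D σ) i) (lookup-map i D σ)))
    D-⟦⟧ (x :^ zero) = D-const (+ 1)
    D-⟦⟧ (x :^ suc k) = ≋-trans (D-* _ _) (+-cong (*-cong (D-⟦⟧ x) (^-congˡ k (≋-sym (⟦weaken⟧ x)))) (*-cong (≋-sym (⟦weaken⟧ x)) (D-⟦⟧ (x :^ k))))
    D-⟦⟧ (:- x) = ≋-trans (D-neg _) (-‿cong (D-⟦⟧ x))

  ℓ : ℕ → Series
  ℓ s = pr s L

  D-component : ∀ r → D (pr r E) ≋ a * ℓ r + b * ℓ (6 ℕ.+ r) + e * ℓ (5 ℕ.+ r) + c * ℓ (2 ℕ.+ r)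
  D-component r = ≋-trans (≋-sym (pr-D r E)) (≋-trans (pr-cong DE≋E*L) (pr-E* r L))

  module _ {n} (a b e c : Polynomial n) (l : ℕ → Polynomial n) where
    :row : ℕ → ℕ → ℕ → ℕ → Polynomial n
    :row i j k h = a :* l i :+ b :* l j :+ e :* l k :+ c :* l h

  -- The derivative of the norm with respect to the component of class r is 7 times the component of
  -- class - r of the cofactor norm / E. So D N is 7 times the class 0 part of (norm / E) D E = norm
  -- L, and the norm lies in class 0.
  N-ODE : D N ≋ const (+ 7) * ℓ 0 * N
  N-ODE = begin
    D N ≈⟨ D-⟦⟧ ρ (:norm v₀ v₁ v₂ v₃) ⟩
    ⟦ der (:norm {4} v₀ v₁ v₂ v₃) ⟧ (ρ ++ map D ρ)
      ≈⟨ prove (ρ ++ map D ρ) (der (:norm {4} v₀ v₁ v₂ v₃)) (con (+ 7) :* (:adj₀ v₀ v₁ v₂ v₃ :* w₀ :+ :adj₆ v₀ v₁ v₂ v₃ :* w₁ :+ :adj₅ v₀ v₁ v₂ v₃ :* w₂ :+ :adj₂ v₀ v₁ v₂ v₃ :* w₃)) ≋-refl ⟩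
    const (+ 7) * (A₀ * D a + A₆ * D b + A₅ * D e + A₂ * D c)
      ≈⟨ *-congˡ (+-cong (+-cong (+-cong (*-congˡ d₀) (*-congˡ d₁)) (*-congˡ d₂)) (*-congˡ d₅)) ⟩
    const (+ 7) * (A₀ * row 0 6 5 2 + A₆ * row 1 0 6 3 + A₅ * row 2 1 0 4 + A₂ * row 5 4 3 0)
      -- The classes 3, 4 and 6 of D E are zero; their rows are added to complete the class 0 part
      -- of the product.
      ≈⟨ solve 4 (λ S x y z → con (+ 7) :* S := con (+ 7) :* (S :+ x :* con (+ 0) :+ y :* con (+ 0) :+ z :* con (+ 0))) ≋-refl _ A₄ A₃ A₁ ⟩
    const (+ 7) * (A₀ * row 0 6 5 2 + A₆ * row 1 0 6 3 + A₅ * row 2 1 0 4 + A₂ * row 5 4 3 0 + A₄ * 0# + A₃ * 0# + A₁ * 0#)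
      ≈⟨ *-congˡ (+-cong (+-cong (+-congˡ (*-congˡ d₃)) (*-congˡ d₄)) (*-congˡ d₆)) ⟩
    const (+ 7) * (A₀ * row 0 6 5 2 + A₆ * row 1 0 6 3 + A₅ * row 2 1 0 4 + A₂ * row 5 4 3 0 + A₄ * row 3 2 1 5 + A₃ * row 4 3 2 6 + A₁ * row 6 5 4 1)
      ≈⟨ prove (ρ ++ ℓs) (con (+ 7) :* (:adj₀ v₀ v₁ v₂ v₃ :* :row′ 0 6 5 2 :+ :adj₆ v₀ v₁ v₂ v₃ :* :row′ 1 0 6 3 :+ :adj₅ v₀ v₁ v₂ v₃ :* :row′ 2 1 0 4
           :+ :adj₂ v₀ v₁ v₂ v₃ :* :row′ 5 4 3 0 :+ :adj₄ v₀ v₁ v₂ v₃ :* :row′ 3 2 1 5 :+ :adj₃ v₀ v₁ v₂ v₃ :* :row′ 4 3 2 6 :+ :adj₁ v₀ v₁ v₂ v₃ :* :row′ 6 5 4 1))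
           (con (+ 7) :* lv 0 :* :norm v₀ v₁ v₂ v₃) ≋-refl ⟩
    const (+ 7) * ℓ 0 * N ∎
    where
    adj : Polynomial 4 → Series
    adj P = ⟦ P ⟧ ρ
    A₀ = adj (:adj₀ v₀ v₁ v₂ v₃)
    A₁ = adj (:adj₁ v₀ v₁ v₂ v₃)
    A₂ = adj (:adj₂ v₀ v₁ v₂ v₃)
    A₃ = adj (:adj₃ v₀ v₁ v₂ v₃)
    A₄ = adj (:adj₄ v₀ v₁ v₂ v₃)
    A₅ = adj (:adj₅ v₀ v₁ v₂ v₃)
    A₆ = adj (:adj₆ v₀ v₁ v₂ v₃)
    w₀ w₁ w₂ w₃ : Polynomial 8
    w₀ = var (4 ↑ʳ zero)
    w₁ = var (4 ↑ʳ suc zero)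
    w₂ = var (4 ↑ʳ suc (suc zero))
    w₃ = var (4 ↑ʳ suc (suc (suc zero)))
    row : ℕ → ℕ → ℕ → ℕ → Series
    row i j k h = a * ℓ i + b * ℓ j + e * ℓ k + c * ℓ h
    row-cong : ∀ {i j k h i′ j′ k′ h′} → i ≡₇ i′ → j ≡₇ j′ → k ≡₇ k′ → h ≡₇ h′ → row i j k h ≋ row i′ j′ k′ h′
    row-cong {i} {j} {k} {h} {i′} {j′} {k′} {h′} p r s t =
      +-cong (+-cong (+-cong (*-congˡ (pr-≡₇ {i} {i′} L p)) (*-congˡ (pr-≡₇ {j} {j′} L r))) (*-congˡ (pr-≡₇ {k} {k′} L s))) (*-congˡ (pr-≡₇ {h} {h′} L t))
    d₀ : D a ≋ row 0 6 5 2
    d₀ = D-component 0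
    d₁ : D b ≋ row 1 0 6 3
    d₁ = ≋-trans (D-component 1) (row-cong {1} {7} {6} {3} {1} {0} {6} {3} ≡.refl ≡.refl ≡.refl ≡.refl)
    d₂ : D e ≋ row 2 1 0 4
    d₂ = ≋-trans (D-component 2) (row-cong {2} {8} {7} {4} {2} {1} {0} {4} ≡.refl ≡.refl ≡.refl ≡.refl)
    d₅ : D c ≋ row 5 4 3 0
    d₅ = ≋-trans (D-component 5) (row-cong {5} {11} {10} {7} {5} {4} {3} {0} ≡.refl ≡.refl ≡.refl ≡.refl)
    d₃ : 0# ≋ row 3 2 1 5
    d₃ = ≋-trans (≋-sym (≋-trans (D-cong pr-3-E) (D-const (+ 0)))) (≋-trans (D-component 3) (row-cong {3} {9} {8} {5} {3} {2} {1} {5} ≡.refl ≡.refl ≡.refl ≡.refl))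
    d₄ : 0# ≋ row 4 3 2 6
    d₄ = ≋-trans (≋-sym (≋-trans (D-cong pr-4-E) (D-const (+ 0)))) (≋-trans (D-component 4) (row-cong {4} {10} {9} {6} {4} {3} {2} {6} ≡.refl ≡.refl ≡.refl ≡.refl))
    d₆ : 0# ≋ row 6 5 4 1
    d₆ = ≋-trans (≋-sym (≋-trans (D-cong pr-6-E) (D-const (+ 0)))) (≋-trans (D-component 6) (row-cong {6} {12} {11} {8} {6} {5} {4} {1} ≡.refl ≡.refl ≡.refl ≡.refl))
    ℓs : Vec Series 7
    ℓs = ℓ 0 ∷ ℓ 1 ∷ ℓ 2 ∷ ℓ 3 ∷ ℓ 4 ∷ ℓ 5 ∷ ℓ 6 ∷ []
    lv : ℕ → Polynomial 11
    lv 0 = var (4 ↑ʳ zero)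
    lv 1 = var (4 ↑ʳ suc zero)
    lv 2 = var (4 ↑ʳ suc (suc zero))
    lv 3 = var (4 ↑ʳ suc (suc (suc zero)))
    lv 4 = var (4 ↑ʳ suc (suc (suc (suc zero))))
    lv 5 = var (4 ↑ʳ suc (suc (suc (suc (suc zero)))))
    lv _ = var (4 ↑ʳ suc (suc (suc (suc (suc (suc zero))))))
    :row′ : ℕ → ℕ → ℕ → ℕ → Polynomial 11
    :row′ = :row v₀ v₁ v₂ v₃ lv

-- The norm and K as eta products

module NormEvaluation where
  open SeriesRing
  open SeriesOperators
  open ResidueClasses
  open EulerProduct
  open LambertExpansion
  open EisensteinSeries
  open SevenDissection
  open LinearEquations
  open ModularEquation
  open NormDerivative
  open import Data.Fin using (zero; suc)
  open import Data.Vec using (Vec; []; _∷_; lookup)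

  open Solver using (solve; prove; op; [+]; [*]; _:+_; _:*_; _:-_; :-_; _:^_; con; var; _:=_; ⟦_⟧)
  open ≋-Reasoning

  ⟦⟧-mod : ∀ {n M} (σ τ : Vec Series n) → (∀ i → lookup σ i ≋ lookup τ i mod M) → ∀ P → ⟦ P ⟧ σ ≋ ⟦ P ⟧ τ mod M
  ⟦⟧-mod σ τ h (op [+] x y) = mod-+ (⟦⟧-mod σ τ h x) (⟦⟧-mod σ τ h y)
  ⟦⟧-mod σ τ h (op [*] x y) = mod-* (⟦⟧-mod σ τ h x) (⟦⟧-mod σ τ h y)
  ⟦⟧-mod σ τ h (con c) = mod-refl
  ⟦⟧-mod σ τ h (var i) = h i
  ⟦⟧-mod σ τ h (x :^ k) = mod-^ k (⟦⟧-mod σ τ h x)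
  ⟦⟧-mod σ τ h (:- x) = mod-neg (⟦⟧-mod σ τ h x)

  Dp : D p ≋ - (L * p)
  Dp = begin
    D p ≈⟨ solve 3 (λ d x y → d := (x :+ d) :- x) ≋-refl (D p) (L * p) p ⟩
    (L * p + D p) - L * p ≈⟨ +-congʳ (+-cong ≋-refl (≋-trans (≋-sym (*-identityˡ _)) (*-congʳ (≋-sym E*partition)))) ⟩
    (L * p + E * p * D p) - L * p ≈⟨ solve 4 (λ l p e d → l :* p :+ e :* p :* d :- l :* p := p :* (l :+ e :* d) :- l :* p) ≋-refl L p E (D p) ⟩
    p * (L + E * D p) - L * p ≈⟨ +-congʳ (≋-trans (*-congˡ (≋-trans (≋-sym (D-* E p)) (≋-trans (D-cong E*partition) (D-const (+ 1))))) (zeroʳ p)) ⟩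
    0# - L * p ≈⟨ +-identityˡ _ ⟩
    - (L * p) ∎

  L₇ L₄₉ E₄₉ p₇ p₄₉ : Series
  L₇ = φ 7 L
  L₄₉ = φ² L
  E₄₉ = φ² E
  p₇ = φ 7 p
  p₄₉ = φ² p

  E₇*p₇ : E₇ * p₇ ≋ 1#
  E₇*p₇ = ≋-trans (≋-sym (φ-* 7 E p)) (≋-trans (φ-cong 7 E*partition) (φ-const 7 (+ 1)))

  E₄₉*p₄₉ : E₄₉ * p₄₉ ≋ 1#
  E₄₉*p₄₉ = ≋-trans (≋-sym (φ-* 7 E₇ p₇)) (≋-trans (φ-cong 7 E₇*p₇) (φ-const 7 (+ 1)))

  DE₇ : D E₇ ≋ const (+ 7) * L₇ * E₇
  DE₇ = ≋-trans (D-φ 7 E) (≋-trans (*-congˡ (≋-trans (φ-cong 7 DE≋E*L) (φ-* 7 E L))) (solve 2 (λ e l → con (+ 7) :* (e :* l) := con (+ 7) :* l :* e) ≋-refl E₇ L₇))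

  DE₄₉ : D E₄₉ ≋ const (+ 49) * L₄₉ * E₄₉
  DE₄₉ = ≋-trans (D-φ 7 E₇) (≋-trans (*-congˡ (≋-trans (φ-cong 7 DE₇) (≋-trans (φ-* 7 _ _) (*-congʳ (φ-scale 7 (+ 7) L₇)))))
    (solve 2 (λ e l → con (+ 7) :* (con (+ 7) :* l :* e) := con (+ 49) :* l :* e) ≋-refl E₄₉ L₄₉))

  Dp₄₉ : D p₄₉ ≋ - (const (+ 49) * L₄₉ * p₄₉)
  Dp₄₉ = ≋-trans (D-φ 7 p₇) (≋-trans (*-congˡ (≋-trans (φ-cong 7 (≋-trans (D-φ 7 p) (*-congˡ (≋-trans (φ-cong 7 Dp) (≋-trans (φ-neg 7 _) (-‿cong (φ-* 7 L p)))))))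
      (≋-trans (φ-scale 7 (+ 7) _) (*-congˡ (≋-trans (φ-neg 7 _) (-‿cong (φ-* 7 L₇ p₇)))))))
    (solve 2 (λ l p → con (+ 7) :* (con (+ 7) :* :- (l :* p)) := :- (con (+ 49) :* l :* p)) ≋-refl L₄₉ p₄₉))

  D-^suc : ∀ x d k → D x ≋ d * x → D (x ^ k) ≋ const (+ k) * d * x ^ k
  D-^suc x d zero h = ≋-trans (D-const (+ 1)) (solve 1 (λ d → con (+ 0) := con (+ 0) :* d :* con (+ 1)) ≋-refl d)
  D-^suc x d (suc k) h = ≋-trans (D-* x (x ^ k)) (≋-trans (+-cong (*-congʳ h) (*-congˡ (D-^suc x d k h)))
    (≋-trans (solve 4 (λ x d y k → d :* x :* y :+ x :* (k :* d :* y) := (k :+ con (+ 1)) :* d :* (x :* y)) ≋-refl x d (x ^ k) (const (+ k)))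
      (*-congʳ (*-congʳ (≋-sym (MacMahon.κ-suc k))))))

  L-at-0 : L 0 ≡ + 0
  L-at-0 = ≡.trans (*-at-0 (D E) p) (≡.trans (≡.cong (ℤ._* p 0) (D-at E 0)) ≡.refl)

  private
    components-mod-1 : ∀ i → lookup ρ i ≋ lookup (1# ∷ 0# ∷ 0# ∷ 0# ∷ []) i mod 1
    components-mod-1 zero zero _ = ≡.trans (pr-at {0} {0} E ≡.refl) (≡.sym (const-zero (+ 1)))
    components-mod-1 (suc zero) zero _ = ≡.trans (pr-at-≢ {1} {0} E λ ()) (≡.sym (const-zero (+ 0)))
    components-mod-1 (suc (suc zero)) zero _ = ≡.trans (pr-at-≢ {2} {0} E λ ()) (≡.sym (const-zero (+ 0)))
    components-mod-1 (suc (suc (suc zero))) zero _ = ≡.trans (pr-at-≢ {5} {0} E λ ()) (≡.sym (const-zero (+ 0)))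
    components-mod-1 _ (suc _) (s≤s ())

    -- One coefficient would not do for K, which has no constant term: its sign is seen at q.
    components-mod-2 : ∀ i → lookup ρ i ≋ lookup (1# ∷ - q ∷ 0# ∷ 0# ∷ []) i mod 2
    components-mod-2 zero 0 _ = ≡.trans (pr-at {0} {0} E ≡.refl) (≡.sym (const-zero (+ 1)))
    components-mod-2 zero 1 _ = ≡.trans (pr-at-≢ {0} {1} E λ ()) (≡.sym (const-suc (+ 1) 0))
    components-mod-2 (suc zero) 0 _ = ≡.trans (pr-at-≢ {1} {0} E λ ()) (≡.sym (neg-at q 0))
    components-mod-2 (suc zero) 1 _ = ≡.trans (pr-at {1} {1} E ≡.refl) (≡.sym (neg-at q 1))
    components-mod-2 (suc (suc zero)) 0 _ = ≡.trans (pr-at-≢ {2} {0} E λ ()) (≡.sym (const-zero (+ 0)))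
    components-mod-2 (suc (suc zero)) 1 _ = ≡.trans (pr-at-≢ {2} {1} E λ ()) (≡.sym (const-suc (+ 0) 0))
    components-mod-2 (suc (suc (suc zero))) 0 _ = ≡.trans (pr-at-≢ {5} {0} E λ ()) (≡.sym (const-zero (+ 0)))
    components-mod-2 (suc (suc (suc zero))) 1 _ = ≡.trans (pr-at-≢ {5} {1} E λ ()) (≡.sym (const-suc (+ 0) 0))
    components-mod-2 _ (suc (suc _)) (s≤s (s≤s ()))

  φ-at-0 : ∀ m .{{_ : NonZero m}} x → φ m x 0 ≡ x 0
  φ-at-0 m x = φ-at m x 0

  -- The right-hand side is the product of E(ζ q) over the seventh roots of unity ζ. By `pr-0-L` it
  -- satisfies the same differential equation as N, and both constant terms are 1.
  N≋ : N ≋ E₇ ^ 8 * p₄₉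
  N≋ = ODE-unique (const (+ 7) * ℓ 0) g₀ N-ODE rhs-ODE base
    where
    g₀ : (const (+ 7) * ℓ 0) 0 ≡ + 0
    g₀ = ≡.trans (const-*-at (+ 7) (ℓ 0) 0) (≡.cong (+ 7 ℤ.*_) (≡.trans (pr-at {0} {0} L ≡.refl) L-at-0))
    rhs-ODE : D (E₇ ^ 8 * p₄₉) ≋ const (+ 7) * ℓ 0 * (E₇ ^ 8 * p₄₉)
    rhs-ODE = begin
      D (E₇ ^ 8 * p₄₉) ≈⟨ ≋-trans (D-* _ _) (+-cong (*-congʳ (D-^suc E₇ _ 8 DE₇)) (*-congˡ Dp₄₉)) ⟩
      const (+ 8) * (const (+ 7) * L₇) * E₇ ^ 8 * p₄₉ + E₇ ^ 8 * - (const (+ 49) * L₄₉ * p₄₉)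
        ≈⟨ solve 4 (λ l l′ x y → con (+ 8) :* (con (+ 7) :* l) :* x :* y :+ x :* :- (con (+ 49) :* l′ :* y) := con (+ 7) :* (con (+ 8) :* l :- con (+ 7) :* l′) :* (x :* y)) ≋-refl L₇ L₄₉ (E₇ ^ 8) p₄₉ ⟩
      const (+ 7) * (const (+ 8) * L₇ - const (+ 7) * L₄₉) * (E₇ ^ 8 * p₄₉) ≈⟨ *-congʳ (*-congˡ LogDerivative.pr-0-L) ⟨
      const (+ 7) * ℓ 0 * (E₇ ^ 8 * p₄₉) ∎
    base : N 0 ≡ (E₇ ^ 8 * p₄₉) 0
    base = ≡.trans (⟦⟧-mod ρ (1# ∷ 0# ∷ 0# ∷ 0# ∷ []) components-mod-1 (:norm {4} v₀ v₁ v₂ v₃) 0 (s≤s z≤n)) (≡.trans (at one 0) (≡.sym (rhs 0 (s≤s z≤n))))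
      where
      one : ⟦ :norm {4} v₀ v₁ v₂ v₃ ⟧ (1# ∷ 0# ∷ 0# ∷ 0# ∷ []) ≋ 1#
      one = prove [] (:norm (con (+ 1)) (con (+ 0)) (con (+ 0)) (con (+ 0))) (con (+ 1)) ≋-refl
      E₇-1 : E₇ ≋ 1# mod 1
      E₇-1 zero _ = ≡.trans (φ-at-0 7 E) (≡.sym (const-zero (+ 1)))
      E₇-1 (suc _) (s≤s ())
      p₄₉-1 : p₄₉ ≋ 1# mod 1
      p₄₉-1 zero _ = ≡.trans (φ-at-0 7 p₇) (≡.trans (φ-at-0 7 p) (≡.sym (const-zero (+ 1))))
      p₄₉-1 (suc _) (s≤s ())
      rhs : E₇ ^ 8 * p₄₉ ≋ 1# mod 1
      rhs = mod-trans (mod-* (mod-^ 8 E₇-1) p₄₉-1) (≋⇒mod (solve 0 (con (+ 1) :^ 8 :* con (+ 1) := con (+ 1)) ≋-refl))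

  -- `N*e` and `N≋` show that K and q E₇⁴ have the same square. Their sum begins with 2 q, so after
  -- division by q it can be cancelled from (K + q E₇⁴) (K - q E₇⁴) = 0.
  K≋ : K ≋ q * E₇ ^ 4
  K≋ = begin
    K ≈⟨ solve 2 (λ x y → x := (x :- y) :+ y) ≋-refl K (q * E₇ ^ 4) ⟩
    (K - q * E₇ ^ 4) + q * E₇ ^ 4 ≈⟨ +-congʳ (*-cancelˡ-unit u {{nonzero}} (q^-*-cancel 1 cancelled)) ⟩
    0# + q * E₇ ^ 4 ≈⟨ +-identityˡ _ ⟩
    q * E₇ ^ 4 ∎
    where
    u : Series
    u = tail (K + q * E₇ ^ 4)
    squares : K * K ≋ q * E₇ ^ 4 * (q * E₇ ^ 4)
    squares = begin
      K * K ≈⟨ solve 1 (λ x → x :* x := :- (:- (x :* x))) ≋-refl K ⟩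
      - - (K * K) ≈⟨ -‿cong (≋-trans (≋-sym N*e) (*-cong N≋ e≋-m)) ⟩
      - (E₇ ^ 8 * p₄₉ * - (q ^ 2 * E₄₉)) ≈⟨ solve 4 (λ x p e q → :- (x :^ 8 :* p :* :- (q :^ 2 :* e)) := q :* x :^ 4 :* (q :* x :^ 4) :* (e :* p)) ≋-refl E₇ p₄₉ E₄₉ q ⟩
      q * E₇ ^ 4 * (q * E₇ ^ 4) * (E₄₉ * p₄₉) ≈⟨ ≋-trans (*-congˡ E₄₉*p₄₉) (*-identityʳ _) ⟩
      q * E₇ ^ 4 * (q * E₇ ^ 4) ∎
    K-mod : K ≋ q mod 2
    K-mod = mod-trans (⟦⟧-mod ρ (1# ∷ - q ∷ 0# ∷ 0# ∷ []) components-mod-2 (:K {4} v₀ v₁ v₂ v₃)) (≋⇒mod (prove (q ∷ []) (:K (con (+ 1)) (:- var zero) (con (+ 0)) (con (+ 0))) (var zero) ≋-refl))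
    qE₇⁴-mod : q * E₇ ^ 4 ≋ q mod 2
    qE₇⁴-mod 0 _ = ≡.trans (q*-zero _) ≡.refl
    qE₇⁴-mod 1 _ = ≡.trans (q*-suc _ 0) (≡.trans (mod-^ 4 E₇-1 0 (s≤s z≤n)) (≡.trans (at (solve 0 (con (+ 1) :^ 4 := con (+ 1)) ≋-refl) 0) (const-zero (+ 1))))
      where
      E₇-1 : E₇ ≋ 1# mod 1
      E₇-1 zero _ = ≡.trans (φ-at-0 7 E) (≡.sym (const-zero (+ 1)))
      E₇-1 (suc _) (s≤s ())
    qE₇⁴-mod (suc (suc _)) (s≤s (s≤s ()))
    sum-mod : K + q * E₇ ^ 4 ≋ q + q mod 2
    sum-mod = mod-+ K-mod qE₇⁴-mod
    u-0 : u 0 ≡ + 2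
    u-0 = ≡.trans (sum-mod 1 (s≤s (s≤s z≤n))) (+-at q q 1)
    nonzero : ℤ.NonZero (u 0)
    nonzero = ≡.subst ℤ.NonZero (≡.sym u-0) _
    cancelled : q ^ 1 * (u * (K - q * E₇ ^ 4)) ≋ q ^ 1 * 0#
    cancelled = begin
      q ^ 1 * (u * (K - q * E₇ ^ 4)) ≈⟨ solve 3 (λ q u d → q :^ 1 :* (u :* d) := (con (+ 0) :+ q :* u) :* d) ≋-refl q u _ ⟩
      (0# + q * u) * (K - q * E₇ ^ 4) ≈⟨ *-congʳ (≋-trans (head-tail (K + q * E₇ ^ 4)) (+-congʳ (const-cong (≡.trans (sum-mod 0 (s≤s z≤n)) (+-at q q 0))))) ⟨
      (K + q * E₇ ^ 4) * (K - q * E₇ ^ 4) ≈⟨ solve 2 (λ x y → (x :+ y) :* (x :- y) := x :* x :- y :* y) ≋-refl K (q * E₇ ^ 4) ⟩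
      K * K - q * E₇ ^ 4 * (q * E₇ ^ 4) ≈⟨ ≋-trans (+-congʳ squares) (-‿inverseʳ _) ⟩
      0# ≈⟨ zeroʳ _ ⟨
      q ^ 1 * 0# ∎

-- The recursion for powers of τ and the class 5 parts of E^13 τ^i

module PowersOfTau where
  open SeriesRing
  open SeriesOperators
  open ResidueClasses
  open EulerProduct
  open EisensteinSeries
  open SevenDissection
  open ModularEquation
  open NormEvaluation
  open import Data.Fin using (zero; suc)
  open import Data.Vec using (Vec; []; _∷_)
  open import Data.List as List using (List; []; _∷_)
  open import Data.Bool using (T)
  open import Algebra.Properties.CommutativeSemiring.Exp (CommutativeRing.commutativeSemiring seriesRing) using (^-distrib-*)

  open Solver using (solve; prove; Polynomial; _:+_; _:*_; _:-_; :-_; _:^_; con; var; _:=_; ⟦_⟧)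
  open ≋-Reasoning

  -- Up to the variable z of the eta function, τ = η(49 z) / η(z) and t₀ = (η(7 z) / η(z))⁴.
  τ t₀ t₁ : Series
  τ = m * p
  t₀ = q * E₇ ^ 4 * p ^ 4
  t₁ = φ 7 t₀

  t₁≋ : t₁ ≋ q ^ 7 * E₄₉ ^ 4 * p₇ ^ 4
  t₁≋ = ≋-trans (φ-* 7 _ _) (*-cong (≋-trans (φ-* 7 _ _) (*-cong (φ-q 7) (φ-^ 7 E₇ 4))) (φ-^ 7 p 4))

  ^-1# : ∀ k {x} → x ≋ 1# → x ^ k ≋ 1#
  ^-1# zero h = ≋-refl
  ^-1# (suc k) h = ≋-trans (*-cong h (^-1# k h)) (*-identityˡ 1#)

  *-1# : ∀ y {x} → x ≋ 1# → y * x ≋ y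
  *-1# y h = ≋-trans (*-congˡ h) (*-identityʳ y)

  t₀*t₁ : t₀ * t₁ ≋ τ ^ 4
  t₀*t₁ = ≋-trans (*-congˡ t₁≋) (≋-trans (solve 6 (λ q e p e′ p′ x → q :* e :^ 4 :* p :^ 4 :* (q :^ 7 :* x :^ 4 :* p′ :^ 4) := (q :^ 2 :* x :* p) :^ 4 :* (e :* p′) :^ 4) ≋-refl q E₇ p E₄₉ p₇ E₄₉)
    (*-1# _ (^-1# 4 E₇*p₇)))

  K*t₁ : K * t₁ ≋ m ^ 4
  K*t₁ = ≋-trans (*-cong K≋ t₁≋) (≋-trans (solve 4 (λ q e x p′ → q :* e :^ 4 :* (q :^ 7 :* x :^ 4 :* p′ :^ 4) := (q :^ 2 :* x) :^ 4 :* (e :* p′) :^ 4) ≋-refl q E₇ E₄₉ p₇)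
    (*-1# _ (^-1# 4 E₇*p₇)))

  E^*p^ : ∀ k → E ^ k * p ^ k ≋ 1#
  E^*p^ zero = *-identityˡ 1#
  E^*p^ (suc k) = ≋-trans (solve 4 (λ e f p r → e :* f :* (p :* r) := (e :* p) :* (f :* r)) ≋-refl E (E ^ k) p (p ^ k)) (≋-trans (*-cong E*partition (E^*p^ k)) (*-identityˡ 1#))

  modular-t₀ : t₀ * t₀ ≋ modular 1# t₀ τ
  modular-t₀ = begin
    t₀ * t₀ ≈⟨ *-cong t₀′ t₀′ ⟩
    K * p ^ 4 * (K * p ^ 4) ≈⟨ solve 2 (λ K p → K :* p :^ 4 :* (K :* p :^ 4) := K :* K :* p :^ 8) ≋-refl K p ⟩
    K * K * p ^ 8 ≈⟨ *-congʳ modular-equation ⟩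
    modular E K m * p ^ 8 ≈⟨ prove (E ∷ K ∷ m ∷ p ∷ []) (:modular x₀ x₁ x₂ :* x₃ :^ 8) (:modular (x₀ :* x₃) (x₁ :* x₃ :^ 4) (x₂ :* x₃)) ≋-refl ⟩
    modular (E * p) (K * p ^ 4) τ ≈⟨ modular-cong E*partition ≋-refl ⟩
    modular 1# (K * p ^ 4) τ ≈⟨ +-congʳ (*-congˡ (≋-sym t₀′)) ⟩
    modular 1# t₀ τ ∎
    where
    t₀′ : t₀ ≋ K * p ^ 4
    t₀′ = *-congʳ (≋-sym K≋)
    x₀ x₁ x₂ x₃ : Polynomial 4
    x₀ = v₀
    x₁ = v₁
    x₂ = v₂
    x₃ = v₃

  τ-cancel : ∀ {x y} → τ * x ≋ τ * y → x ≋ y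
  τ-cancel {x} {y} h = q^-*-cancel 2 (≋-trans (unit x) (≋-trans (*-congˡ h) (≋-sym (unit y))))
    where
    unit : ∀ x → q ^ 2 * x ≋ E * p₄₉ * (τ * x)
    unit x = ≋-sym (≋-trans (solve 6 (λ E p₄₉ q E₄₉ p x → E :* p₄₉ :* (q :^ 2 :* E₄₉ :* p :* x) := q :^ 2 :* x :* ((E :* p) :* (E₄₉ :* p₄₉))) ≋-refl E p₄₉ q E₄₉ p x)
      (*-1# _ (≋-trans (*-cong E*partition E₄₉*p₄₉) (*-identityˡ 1#))))

  t₁-cancel : ∀ {x y} → t₁ * x ≋ t₁ * y → x ≋ y
  t₁-cancel {x} {y} h = q^-*-cancel 7 (≋-trans (unit x) (≋-trans (*-congˡ h) (≋-sym (unit y))))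
    where
    unit : ∀ x → q ^ 7 * x ≋ E₇ ^ 4 * p₄₉ ^ 4 * (t₁ * x)
    unit x = ≋-sym (≋-trans (*-congˡ (*-congʳ t₁≋)) (≋-trans (solve 6 (λ e p₄₉ q E₄₉ p₇ x → e :^ 4 :* p₄₉ :^ 4 :* (q :^ 7 :* E₄₉ :^ 4 :* p₇ :^ 4 :* x) := q :^ 7 :* x :* ((e :* p₇) :^ 4 :* (E₄₉ :* p₄₉) :^ 4)) ≋-refl E₇ p₄₉ q E₄₉ p₇ x)
      (*-1# _ (≋-trans (*-cong (^-1# 4 E₇*p₇) (^-1# 4 E₄₉*p₄₉)) (*-identityˡ 1#)))))

  t₁^-cancel : ∀ k {x y} → t₁ ^ k * x ≋ t₁ ^ k * y → x ≋ y
  t₁^-cancel zero {x} {y} h = ≋-trans (≋-sym (*-identityˡ x)) (≋-trans h (*-identityˡ y))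
  t₁^-cancel (suc k) {x} {y} h = t₁^-cancel k (t₁-cancel (≋-trans (≋-sym (*-assoc t₁ (t₁ ^ k) x)) (≋-trans h (*-assoc t₁ (t₁ ^ k) y))))

  :order7 : ∀ {n} → Polynomial n → (ℕ → Polynomial n) → Polynomial n
  :order7 t x = t :* (con (+ 7) :* x 4 :+ con (+ 35) :* x 5 :+ con (+ 49) :* x 6)
    :+ t :^ 2 :* (x 0 :+ con (+ 7) :* x 1 :+ con (+ 21) :* x 2 :+ con (+ 49) :* x 3 :+ con (+ 147) :* x 4 :+ con (+ 343) :* x 5 :+ con (+ 343) :* x 6)

  order7 : Series → (ℕ → Series) → Series
  order7 t x = t * (const (+ 7) * x 4 + const (+ 35) * x 5 + const (+ 49) * x 6)
    + t ^ 2 * (x 0 + const (+ 7) * x 1 + const (+ 21) * x 2 + const (+ 49) * x 3 + const (+ 147) * x 4 + const (+ 343) * x 5 + const (+ 343) * x 6)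

  -- In the quadratic equation of t₀, multiplied by t₁², the relation t₀ t₁ = τ⁴ eliminates t₀; then
  -- one factor τ cancels.
  τ-recursion : τ ^ 7 ≋ order7 t₁ (τ ^_)
  τ-recursion = τ-cancel (begin
    τ * τ ^ 7 ≈⟨ solve 1 (λ τ → τ :* τ :^ 7 := τ :^ 4 :* τ :^ 4) ≋-refl τ ⟩
    τ ^ 4 * τ ^ 4 ≈⟨ *-cong t₀*t₁ t₀*t₁ ⟨
    t₀ * t₁ * (t₀ * t₁) ≈⟨ solve 2 (λ x y → x :* y :* (x :* y) := x :* x :* y :^ 2) ≋-refl t₀ t₁ ⟩
    t₀ * t₀ * t₁ ^ 2 ≈⟨ *-congʳ modular-t₀ ⟩
    modular 1# t₀ τ * t₁ ^ 2 ≈⟨ prove (t₀ ∷ τ ∷ t₁ ∷ []) (:modular (con (+ 1)) u₀ u₁ :* u₂ :^ 2)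
        (u₁ :* (con (+ 7) :+ con (+ 35) :* u₁ :+ con (+ 49) :* u₁ :^ 2) :* (u₀ :* u₂) :* u₂ :+ rest) ≋-refl ⟩
    τ * (const (+ 7) + const (+ 35) * τ + const (+ 49) * τ ^ 2) * (t₀ * t₁) * t₁ + ⟦ rest ⟧ (t₀ ∷ τ ∷ t₁ ∷ []) ≈⟨ +-congʳ (*-congʳ (*-congˡ t₀*t₁)) ⟩
    τ * (const (+ 7) + const (+ 35) * τ + const (+ 49) * τ ^ 2) * τ ^ 4 * t₁ + ⟦ rest ⟧ (t₀ ∷ τ ∷ t₁ ∷ [])
      ≈⟨ prove (t₀ ∷ τ ∷ t₁ ∷ []) (u₁ :* (con (+ 7) :+ con (+ 35) :* u₁ :+ con (+ 49) :* u₁ :^ 2) :* u₁ :^ 4 :* u₂ :+ rest) (u₁ :* :order7 u₂ (u₁ :^_)) ≋-refl ⟩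
    τ * order7 t₁ (τ ^_) ∎)
    where
    u₀ u₁ u₂ rest : Polynomial 3
    u₀ = var zero
    u₁ = var (suc zero)
    u₂ = var (suc (suc zero))
    rest = u₁ :* (con (+ 1) :+ con (+ 7) :* u₁ :+ con (+ 21) :* u₁ :^ 2 :+ con (+ 49) :* u₁ :^ 3 :+ con (+ 147) :* u₁ :^ 4 :+ con (+ 343) :* u₁ :^ 5 :+ con (+ 343) :* u₁ :^ 6) :* u₂ :^ 2

  -- E^13 is what division by E leaves of the E^14 in E₆. Its class 5 matters because 24 * 5 + 13 is
  -- divisible by 7.
  X : ℕ → Series
  X i = E ^ 13 * τ ^ i

  X-recursion : ∀ i → X (7 ℕ.+ i) ≋ order7 t₁ (λ k → X (k ℕ.+ i))
  X-recursion i = begin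
    E ^ 13 * τ ^ (7 ℕ.+ i) ≈⟨ *-congˡ (^-homo-* τ 7 i) ⟩
    E ^ 13 * (τ ^ 7 * τ ^ i) ≈⟨ *-congˡ (*-congʳ τ-recursion) ⟩
    E ^ 13 * (order7 t₁ (τ ^_) * τ ^ i) ≈⟨ prove (E ∷ τ ^ i ∷ τ ∷ t₁ ∷ []) (v₀ :^ 13 :* (:order7 v₃ (v₂ :^_) :* v₁)) (:order7 v₃ (λ k → v₀ :^ 13 :* (v₂ :^ k :* v₁))) ≋-refl ⟩
    order7 t₁ (λ k → E ^ 13 * (τ ^ k * τ ^ i)) ≈⟨ order7-cong t₁ (λ k → *-congˡ {E ^ 13} (≋-sym (^-homo-* τ k i))) ⟩
    order7 t₁ (λ k → X (k ℕ.+ i)) ∎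
    where
    order7-cong : ∀ t {x y} → (∀ k → x k ≋ y k) → order7 t x ≋ order7 t y
    order7-cong t {x} {y} h = +-cong (*-congˡ (+-cong (+-cong (*-congˡ (h 4)) (*-congˡ (h 5))) (*-congˡ (h 6))))
      (*-congˡ (+-cong (+-cong (+-cong (+-cong (+-cong (+-cong (h 0) (*-congˡ (h 1))) (*-congˡ (h 2))) (*-congˡ (h 3))) (*-congˡ (h 4))) (*-congˡ (h 5))) (*-congˡ (h 6))))

  pr-t₁* : ∀ r x → pr r (t₁ * x) ≋ t₁ * pr r x
  pr-t₁* r x = pr-*ˡ {0} r r x (Cls-φ t₀) ≡.refl

  pr-order7 : ∀ r x → pr r (order7 t₁ x) ≋ order7 t₁ (λ k → pr r (x k))
  pr-order7 r x = ≋-trans (pr-+ r _ _) (+-cong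
    (≋-trans (pr-t₁* r _) (*-congˡ (≋-trans (pr-+ r _ _) (+-cong (≋-trans (pr-+ r _ _) (+-cong (s 7 4) (s 35 5))) (s 49 6)))))
    (≋-trans (pr-*ˡ {0} r r _ (Cls-^ 2 (Cls-φ t₀)) ≡.refl) (*-congˡ (≋-trans (pr-+ r _ _) (+-cong (≋-trans (pr-+ r _ _) (+-cong (≋-trans (pr-+ r _ _) (+-cong (≋-trans (pr-+ r _ _) (+-cong
      (≋-trans (pr-+ r _ _) (+-cong (≋-trans (pr-+ r _ _) (+-congˡ (s 7 1))) (s 21 2))) (s 49 3))) (s 147 4))) (s 343 5))) (s 343 6))))))
    where
    s : ∀ c k → pr r (const (+ c) * x k) ≋ const (+ c) * pr r (x k)
    s c k = pr-scale r (+ c) (x k)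

  Poly : Set
  Poly = List ℤ

  eval : Poly → Series → Series
  eval [] t = 0#
  eval (x ∷ f) t = const x + t * eval f t

  :eval : ∀ {n} → Poly → Polynomial n → Polynomial n
  :eval [] t = con (+ 0)
  :eval (x ∷ f) t = con x :+ t :* :eval f t

  infixl 6 _⊞_
  infixr 7 _·_
  _⊞_ : Poly → Poly → Poly
  [] ⊞ g = g
  (x ∷ f) ⊞ [] = x ∷ f
  (x ∷ f) ⊞ (y ∷ g) = x ℤ.+ y ∷ f ⊞ g

  _·_ : ℤ → Poly → Poly
  c · [] = []
  c · (x ∷ f) = c ℤ.* x ∷ c · f

  eval-⊞ : ∀ f g t → eval (f ⊞ g) t ≋ eval f t + eval g t
  eval-⊞ [] g t = ≋-sym (+-identityˡ _)
  eval-⊞ (x ∷ f) [] t = ≋-sym (+-identityʳ _)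
  eval-⊞ (x ∷ f) (y ∷ g) t = ≋-trans (+-cong (const-+ x y) (*-congˡ (eval-⊞ f g t)))
    (solve 5 (λ x y t f g → x :+ y :+ t :* (f :+ g) := (x :+ t :* f) :+ (y :+ t :* g)) ≋-refl (const x) (const y) t (eval f t) (eval g t))

  eval-· : ∀ c f t → eval (c · f) t ≋ const c * eval f t
  eval-· c [] t = ≋-sym (zeroʳ _)
  eval-· c (x ∷ f) t = ≋-trans (+-cong (const-* c x) (*-congˡ (eval-· c f t)))
    (solve 4 (λ c x t f → c :* x :+ t :* (c :* f) := c :* (x :+ t :* f)) ≋-refl (const c) (const x) t (eval f t))

  eval-shift : ∀ f t → eval (+ 0 ∷ f) t ≋ t * eval f t
  eval-shift f t = +-identityˡ _

  φ-eval : ∀ m .{{_ : NonZero m}} f t → φ m (eval f t) ≋ eval f (φ m t)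
  φ-eval m [] t = φ-const m (+ 0)
  φ-eval m (x ∷ f) t = ≋-trans (φ-+ m _ _) (+-cong (φ-const m x) (≋-trans (φ-* m _ _) (*-congˡ (φ-eval m f t))))

  polyOrder7 : (ℕ → Poly) → Poly
  polyOrder7 w = (+ 0 ∷ (+ 7 · w 4 ⊞ + 35 · w 5 ⊞ + 49 · w 6))
    ⊞ (+ 0 ∷ + 0 ∷ (w 0 ⊞ + 7 · w 1 ⊞ + 21 · w 2 ⊞ + 49 · w 3 ⊞ + 147 · w 4 ⊞ + 343 · w 5 ⊞ + 343 · w 6))

  eval-order7 : ∀ w t → eval (polyOrder7 w) t ≋ order7 t (λ k → eval (w k) t)
  eval-order7 w t = ≋-trans (eval-⊞ (+ 0 ∷ A) (+ 0 ∷ + 0 ∷ B) t) (+-cong (≋-trans (eval-shift A t) (*-congˡ evalA))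
    (≋-trans (eval-shift (+ 0 ∷ B) t) (≋-trans (*-congˡ (eval-shift B t)) (≋-trans (solve 2 (λ t b → t :* (t :* b) := t :^ 2 :* b) ≋-refl t (eval B t)) (*-congˡ evalB)))))
    where
    A B : Poly
    A = + 7 · w 4 ⊞ + 35 · w 5 ⊞ + 49 · w 6
    B = w 0 ⊞ + 7 · w 1 ⊞ + 21 · w 2 ⊞ + 49 · w 3 ⊞ + 147 · w 4 ⊞ + 343 · w 5 ⊞ + 343 · w 6
    add-term : ∀ {x} f c k → eval f t ≋ x → eval (f ⊞ + c · w k) t ≋ x + const (+ c) * eval (w k) t
    add-term f c k h = ≋-trans (eval-⊞ f (+ c · w k) t) (+-cong h (eval-· (+ c) (w k) t))
    evalA : eval A t ≋ const (+ 7) * eval (w 4) t + const (+ 35) * eval (w 5) t + const (+ 49) * eval (w 6) t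
    evalA = add-term (+ 7 · w 4 ⊞ + 35 · w 5) 49 6 (add-term (+ 7 · w 4) 35 5 (eval-· (+ 7) (w 4) t))
    evalB : eval B t ≋ _
    evalB = add-term (w 0 ⊞ + 7 · w 1 ⊞ + 21 · w 2 ⊞ + 49 · w 3 ⊞ + 147 · w 4 ⊞ + 343 · w 5) 343 6 (add-term (w 0 ⊞ + 7 · w 1 ⊞ + 21 · w 2 ⊞ + 49 · w 3 ⊞ + 147 · w 4) 343 5
      (add-term (w 0 ⊞ + 7 · w 1 ⊞ + 21 · w 2 ⊞ + 49 · w 3) 147 4 (add-term (w 0 ⊞ + 7 · w 1 ⊞ + 21 · w 2) 49 3 (add-term (w 0 ⊞ + 7 · w 1) 21 2 (add-term (w 0) 7 1 ≋-refl)))))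

  -- Keeping seven consecutive polynomials turns the recursion of order 7 into an iteration, and for
  -- k < 7, `window i k` and `α (k + i)` agree by computation.
  step : (ℕ → Poly) → ℕ → Poly
  step w 0 = w 1
  step w 1 = w 2
  step w 2 = w 3
  step w 3 = w 4
  step w 4 = w 5
  step w 5 = w 6
  step w _ = polyOrder7 w

  -- The initial values come from running the recursion backwards from the values at 7, …, 13.
  window : ℕ → ℕ → Poly
  window zero 0 = + 728 ∷ + 11466 ∷ + 62426 ∷ + 117649 ∷ []
  window zero 1 = -[1+ 87 ] ∷ + 0 ∷ + 0 ∷ -[1+ 16806 ] ∷ []
  window zero 2 = -[1+ 10 ] ∷ -[1+ 76 ] ∷ + 3773 ∷ + 16807 ∷ []
  window zero 3 = + 0 ∷ + 0 ∷ + 0 ∷ + 2401 ∷ []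
  window zero 4 = + 0 ∷ -[1+ 89 ] ∷ -[1+ 881 ] ∷ -[1+ 2400 ] ∷ []
  window zero 5 = + 0 ∷ + 20 ∷ + 0 ∷ -[1+ 342 ] ∷ []
  window zero _ = + 0 ∷ + 1 ∷ + 49 ∷ []
  window (suc i) = step (window i)

  -- Evaluated at t₁, this is t₁³ times the class 0 part of τ^(i - 13).
  α : ℕ → Poly
  α i = window i 0

  -- Chosen with W t₁³ = m^13: the class 5 part of `X i` is m^13 times the class 0 part of τ^(i -
  -- 13), and t₁³ clears the denominators of the latter.
  W : Series
  W = q ^ 5 * (E₄₉ * E₇ ^ 12)

  W*t₁³ : W * t₁ ^ 3 ≋ m ^ 13
  W*t₁³ = ≋-trans (*-congˡ (^-congˡ 3 t₁≋)) (≋-trans (solve 4 (λ q x e p → q :^ 5 :* (x :* e :^ 12) :* (q :^ 7 :* x :^ 4 :* p :^ 4) :^ 3 := (q :^ 2 :* x) :^ 13 :* (e :* p) :^ 12) ≋-refl q E₄₉ E₇ p₇)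
    (*-1# _ (^-1# 12 E₇*p₇)))

  K*m⁹ : K * m ^ 9 ≋ W * t₁ ^ 2
  K*m⁹ = t₁-cancel (begin
    t₁ * (K * m ^ 9) ≈⟨ solve 3 (λ t K m → t :* (K :* m :^ 9) := K :* t :* m :^ 9) ≋-refl t₁ K m ⟩
    K * t₁ * m ^ 9 ≈⟨ *-congʳ K*t₁ ⟩
    m ^ 4 * m ^ 9 ≈⟨ solve 1 (λ m → m :^ 4 :* m :^ 9 := m :^ 13) ≋-refl m ⟩
    m ^ 13 ≈⟨ W*t₁³ ⟨
    W * t₁ ^ 3 ≈⟨ solve 2 (λ W t → W :* t :^ 3 := t :* (W :* t :^ 2)) ≋-refl W t₁ ⟩
    t₁ * (W * t₁ ^ 2) ∎)

  -- For k = 1, ..., 6 the class 2 k part of E^k, divided by m^k, is the class 0 part of τ^(- k).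
  -- The four relations reduce it to K and m.
  H₁ : pr 2 (E ^ 1) ≋ - m
  H₁ = ≋-trans (pr-E^ 1 2) (≋-trans (prove ρ (component 1 2) v₂ ≋-refl) e≋-m)

  H₂ : pr 4 (E ^ 2) ≋ m ^ 2
  H₂ = ≋-trans (pr-E^ 2 4) (≋-trans (prove ρ (component 2 4) (v₂ :^ 2) ≋-refl) (≋-trans (^-congˡ 2 e≋-m) (solve 1 (λ m → (:- m) :^ 2 := m :^ 2) ≋-refl m)))

  H₃ : pr 6 (E ^ 3) ≋ - (const (+ 7) * m ^ 3)
  H₃ = ≋-trans pr-6-E³-e (≋-trans (*-congˡ (^-congˡ 3 e≋-m)) (solve 1 (λ m → con (+ 7) :* (:- m) :^ 3 := :- (con (+ 7) :* m :^ 3)) ≋-refl m))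

  H₄ : pr 1 (E ^ 4) ≋ - (const (+ 4) * K + const (+ 7) * m ^ 4)
  H₄ = ≋-trans (pr-E^ 4 1) (≋-trans (reduce (- (const (+ 4) * K + const (+ 7) * e ^ 4)) 0# 0# 0# (- (const (+ 24) * e))
    (prove ρ (component 4 1) (:- (con (+ 4) :* :K v₀ v₁ v₂ v₃ :+ con (+ 7) :* v₂ :^ 4) :+ (con (+ 0) :* :r₁ v₀ v₁ v₂ v₃ :+ con (+ 0) :* :r₂ v₀ v₁ v₂ v₃ :+ con (+ 0) :* :r₃ v₀ v₁ v₂ v₃ :+ :- (con (+ 24) :* v₂) :* :r₄ v₀ v₁ v₂ v₃)) ≋-refl))
    (≋-trans (-‿cong (+-congˡ (*-congˡ (^-congˡ 4 e≋-m)))) (solve 2 (λ K m → :- (con (+ 4) :* K :+ con (+ 7) :* (:- m) :^ 4) := :- (con (+ 4) :* K :+ con (+ 7) :* m :^ 4)) ≋-refl K m)))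

  H₅ : pr 3 (E ^ 5) ≋ const (+ 10) * (K * m) + const (+ 49) * m ^ 5
  H₅ = ≋-trans (pr-E^ 5 3) (≋-trans (reduce (- (const (+ 10) * (K * e) + const (+ 49) * e ^ 5)) (const (+ 10) * (a * b)) (const (+ 10) * (b * c)) (const (+ 10) * (a * c)) (- (const (+ 30) * e ^ 2))
    (prove ρ (component 5 3) (:- (con (+ 10) :* (:K v₀ v₁ v₂ v₃ :* v₂) :+ con (+ 49) :* v₂ :^ 5) :+ (con (+ 10) :* (v₀ :* v₁) :* :r₁ v₀ v₁ v₂ v₃ :+ con (+ 10) :* (v₁ :* v₃) :* :r₂ v₀ v₁ v₂ v₃ :+ con (+ 10) :* (v₀ :* v₃) :* :r₃ v₀ v₁ v₂ v₃ :+ :- (con (+ 30) :* v₂ :^ 2) :* :r₄ v₀ v₁ v₂ v₃)) ≋-refl))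
    (≋-trans (-‿cong (+-cong (*-congˡ (*-congˡ e≋-m)) (*-congˡ (^-congˡ 5 e≋-m)))) (solve 2 (λ K m → :- (con (+ 10) :* (K :* :- m) :+ con (+ 49) :* (:- m) :^ 5) := con (+ 10) :* (K :* m) :+ con (+ 49) :* m :^ 5) ≋-refl K m)))

  H₆ : pr 5 (E ^ 6) ≋ const (+ 49) * m ^ 6
  H₆ = ≋-trans (pr-E^ 6 5) (≋-trans (reduce (const (+ 49) * e ^ 6) (const (+ 18) * (a * b * e) + const (+ 54) * (a * c ^ 2) + const (+ 6) * b ^ 3) (const (+ 36) * (a ^ 2 * b) + const (+ 54) * (b * e * c) + const (+ 6) * c ^ 3) (const (+ 6) * a ^ 3) (- (const (+ 48) * e ^ 3))
    (prove ρ (component 6 5) (con (+ 49) :* v₂ :^ 6 :+ ((con (+ 18) :* (v₀ :* v₁ :* v₂) :+ con (+ 54) :* (v₀ :* v₃ :^ 2) :+ con (+ 6) :* v₁ :^ 3) :* :r₁ v₀ v₁ v₂ v₃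
      :+ (con (+ 36) :* (v₀ :^ 2 :* v₁) :+ con (+ 54) :* (v₁ :* v₂ :* v₃) :+ con (+ 6) :* v₃ :^ 3) :* :r₂ v₀ v₁ v₂ v₃ :+ con (+ 6) :* v₀ :^ 3 :* :r₃ v₀ v₁ v₂ v₃ :+ :- (con (+ 48) :* v₂ :^ 3) :* :r₄ v₀ v₁ v₂ v₃)) ≋-refl))
    (≋-trans (*-congˡ (^-congˡ 6 e≋-m)) (solve 1 (λ m → con (+ 49) :* (:- m) :^ 6 := con (+ 49) :* m :^ 6) ≋-refl m)))

  Cls-m : Cls 2 m
  Cls-m = Cls-* {2} {0} (Cls-q^ 2) (Cls-φ E₇)

  private
    -- For 7 ≤ i ≤ 13 the claim only involves the powers E^(13 - i); the recursion of order 7 carries it down to 0 and up.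
    Claim : ℕ → Set
    Claim i = pr 5 (X i) ≋ W * eval (α i) t₁

    X-high : ∀ k j → j ℕ.+ k ≡ 13 → X j ≋ m ^ j * E ^ k
    X-high k j j+k≡13 = begin
      E ^ 13 * (m * p) ^ j ≈⟨ *-cong E13 (^-distrib-* m p j) ⟩
      E ^ j * E ^ k * (m ^ j * p ^ j) ≈⟨ solve 4 (λ e f m p → e :* f :* (m :* p) := m :* f :* (e :* p)) ≋-refl (E ^ j) (E ^ k) (m ^ j) (p ^ j) ⟩
      m ^ j * E ^ k * (E ^ j * p ^ j) ≈⟨ *-1# _ (E^*p^ j) ⟩
      m ^ j * E ^ k ∎
      where
      E13 : E ^ 13 ≋ E ^ j * E ^ k
      E13 = ≡.subst (λ n → E ^ n ≋ E ^ j * E ^ k) j+k≡13 (^-homo-* E j k)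

    high : ∀ j k r {h} P → j ℕ.+ k ≡ 13 → j ℕ.* 2 ℕ.+ r ≡₇ 5 → pr r (E ^ k) ≋ h → m ^ j * h ≋ W * ⟦ P ⟧ (t₁ ∷ []) → ⟦ P ⟧ (t₁ ∷ []) ≋ eval (α j) t₁ → Claim j
    high j k r P j+k≡13 cls-eq hk eq polyEq = ≋-trans (pr-cong (X-high k j j+k≡13)) (≋-trans (pr-*ˡ {j ℕ.* 2} r 5 (E ^ k) (Cls-^ j Cls-m) cls-eq)
      (≋-trans (*-congˡ hk) (≋-trans eq (*-congˡ polyEq))))

    x : Polynomial 1
    x = var zero

    m¹³ : ∀ c → const c * m ^ 13 ≋ W * (const c * t₁ ^ 3)
    m¹³ c = ≋-trans (*-congˡ (≋-sym W*t₁³)) (solve 3 (λ c W t → c :* (W :* t) := W :* (c :* t)) ≋-refl (const c) W (t₁ ^ 3))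

    high₁₃ : Claim 13
    high₁₃ = high 13 0 0 (con (+ 1) :* x :^ 3) ≡.refl ≡.refl (pr-same 0 (Cls-const (+ 1)) ≡.refl) (≋-trans (*-comm _ _) (m¹³ (+ 1)))
      (prove (t₁ ∷ []) (con (+ 1) :* x :^ 3) (:eval (α 13) x) ≋-refl)

    high₁₂ : Claim 12
    high₁₂ = high 12 1 2 (con -[1+ 0 ] :* x :^ 3) ≡.refl ≡.refl H₁ (≋-trans (solve 1 (λ m → m :^ 12 :* :- m := con -[1+ 0 ] :* m :^ 13) ≋-refl m) (m¹³ -[1+ 0 ]))
      (prove (t₁ ∷ []) (con -[1+ 0 ] :* x :^ 3) (:eval (α 12) x) ≋-refl)

    high₁₁ : Claim 11
    high₁₁ = high 11 2 4 (con (+ 1) :* x :^ 3) ≡.refl ≡.refl H₂ (≋-trans (solve 1 (λ m → m :^ 11 :* m :^ 2 := con (+ 1) :* m :^ 13) ≋-refl m) (m¹³ (+ 1)))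
      (prove (t₁ ∷ []) (con (+ 1) :* x :^ 3) (:eval (α 11) x) ≋-refl)

    high₁₀ : Claim 10
    high₁₀ = high 10 3 6 (con -[1+ 6 ] :* x :^ 3) ≡.refl ≡.refl H₃ (≋-trans (solve 1 (λ m → m :^ 10 :* :- (con (+ 7) :* m :^ 3) := con -[1+ 6 ] :* m :^ 13) ≋-refl m) (m¹³ -[1+ 6 ]))
      (prove (t₁ ∷ []) (con -[1+ 6 ] :* x :^ 3) (:eval (α 10) x) ≋-refl)

    high₉ : Claim 9
    high₉ = high 9 4 1 (con -[1+ 3 ] :* x :^ 2 :+ con -[1+ 6 ] :* x :^ 3) ≡.refl ≡.refl H₄
      (≋-trans (solve 2 (λ K m → m :^ 9 :* :- (con (+ 4) :* K :+ con (+ 7) :* m :^ 4) := con -[1+ 3 ] :* (K :* m :^ 9) :+ con -[1+ 6 ] :* m :^ 13) ≋-refl K m)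
        (≋-trans (+-cong (*-congˡ K*m⁹) (m¹³ -[1+ 6 ])) (solve 2 (λ W t → con -[1+ 3 ] :* (W :* t :^ 2) :+ W :* (con -[1+ 6 ] :* t :^ 3) := W :* (con -[1+ 3 ] :* t :^ 2 :+ con -[1+ 6 ] :* t :^ 3)) ≋-refl W t₁)))
      (prove (t₁ ∷ []) (con -[1+ 3 ] :* x :^ 2 :+ con -[1+ 6 ] :* x :^ 3) (:eval (α 9) x) ≋-refl)

    high₈ : Claim 8
    high₈ = high 8 5 3 (con (+ 10) :* x :^ 2 :+ con (+ 49) :* x :^ 3) ≡.refl ≡.refl H₅
      (≋-trans (solve 2 (λ K m → m :^ 8 :* (con (+ 10) :* (K :* m) :+ con (+ 49) :* m :^ 5) := con (+ 10) :* (K :* m :^ 9) :+ con (+ 49) :* m :^ 13) ≋-refl K m)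
        (≋-trans (+-cong (*-congˡ K*m⁹) (m¹³ (+ 49))) (solve 2 (λ W t → con (+ 10) :* (W :* t :^ 2) :+ W :* (con (+ 49) :* t :^ 3) := W :* (con (+ 10) :* t :^ 2 :+ con (+ 49) :* t :^ 3)) ≋-refl W t₁)))
      (prove (t₁ ∷ []) (con (+ 10) :* x :^ 2 :+ con (+ 49) :* x :^ 3) (:eval (α 8) x) ≋-refl)

    high₇ : Claim 7
    high₇ = high 7 6 5 (con (+ 49) :* x :^ 3) ≡.refl ≡.refl H₆ (≋-trans (solve 1 (λ m → m :^ 7 :* (con (+ 49) :* m :^ 6) := con (+ 49) :* m :^ 13) ≋-refl m) (m¹³ (+ 49)))
      (prove (t₁ ∷ []) (con (+ 49) :* x :^ 3) (:eval (α 7) x) ≋-refl)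

    recursion : ∀ i → pr 5 (X (7 ℕ.+ i)) ≋ order7 t₁ (λ k → pr 5 (X (k ℕ.+ i)))
    recursion i = ≋-trans (pr-cong (X-recursion i)) (pr-order7 5 (λ k → X (k ℕ.+ i)))

    α-recursion : ∀ i → W * eval (α (7 ℕ.+ i)) t₁ ≋ order7 t₁ (λ k → W * eval (α (k ℕ.+ i)) t₁)
    α-recursion i = ≋-trans (*-congˡ (eval-order7 (window i) t₁))
      (solve 9 (λ W t a b c d e f g → W :* (t :* (con (+ 7) :* e :+ con (+ 35) :* f :+ con (+ 49) :* g) :+ t :^ 2 :* (a :+ con (+ 7) :* b :+ con (+ 21) :* c :+ con (+ 49) :* d :+ con (+ 147) :* e :+ con (+ 343) :* f :+ con (+ 343) :* g))
        := t :* (con (+ 7) :* (W :* e) :+ con (+ 35) :* (W :* f) :+ con (+ 49) :* (W :* g)) :+ t :^ 2 :* (W :* a :+ con (+ 7) :* (W :* b) :+ con (+ 21) :* (W :* c) :+ con (+ 49) :* (W :* d) :+ con (+ 147) :* (W :* e) :+ con (+ 343) :* (W :* f) :+ con (+ 343) :* (W :* g)))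
        ≋-refl W t₁ (ev 0) (ev 1) (ev 2) (ev 3) (ev 4) (ev 5) (ev 6))
      where
      ev : ℕ → Series
      ev k = eval (α (k ℕ.+ i)) t₁

    up : ∀ i → (∀ k → k ℕ.< 7 → Claim (k ℕ.+ i)) → Claim (7 ℕ.+ i)
    up i h = ≋-trans (recursion i) (≋-trans (+-cong (*-congˡ (+-cong (+-cong (*-congˡ (cl 4)) (*-congˡ (cl 5))) (*-congˡ (cl 6))))
      (*-congˡ (+-cong (+-cong (+-cong (+-cong (+-cong (+-cong (cl 0) (*-congˡ (cl 1))) (*-congˡ (cl 2))) (*-congˡ (cl 3))) (*-congˡ (cl 4))) (*-congˡ (cl 5))) (*-congˡ (cl 6)))))
      (≋-sym (α-recursion i)))
      where
      cl : ∀ k → {T (k ℕ.<ᵇ 7)} → Claim (k ℕ.+ i)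
      cl k {lt} = h k (ℕP.<ᵇ⇒< k 7 lt)

    -- The lowest term occurs in the recursion with the bare factor t₁², which can be cancelled, so
    -- the recursion also runs backwards.
    down : ∀ i → (∀ k → k ℕ.< 7 → Claim (suc k ℕ.+ i)) → Claim i
    down i h = t₁^-cancel 2 (begin
      t₁ ^ 2 * pr 5 (X i) ≈⟨ isolate (λ k → pr 5 (X (k ℕ.+ i))) ⟩
      order7 t₁ (λ k → pr 5 (X (k ℕ.+ i))) - rest (λ k → pr 5 (X (k ℕ.+ i)))
        ≈⟨ +-cong (≋-trans (≋-sym (recursion i)) (≋-trans (cl 6) (α-recursion i))) (-‿cong rest-eq) ⟩
      order7 t₁ (λ k → W * eval (α (k ℕ.+ i)) t₁) - rest (λ k → W * eval (α (k ℕ.+ i)) t₁) ≈⟨ isolate (λ k → W * eval (α (k ℕ.+ i)) t₁) ⟨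
      t₁ ^ 2 * (W * eval (α i) t₁) ∎)
      where
      cl : ∀ k → {T (k ℕ.<ᵇ 7)} → Claim (suc k ℕ.+ i)
      cl k {lt} = h k (ℕP.<ᵇ⇒< k 7 lt)
      rest : (ℕ → Series) → Series
      rest x = t₁ * (const (+ 7) * x 4 + const (+ 35) * x 5 + const (+ 49) * x 6)
        + t₁ ^ 2 * (const (+ 7) * x 1 + const (+ 21) * x 2 + const (+ 49) * x 3 + const (+ 147) * x 4 + const (+ 343) * x 5 + const (+ 343) * x 6)
      isolate : ∀ x → t₁ ^ 2 * x 0 ≋ order7 t₁ x - rest x
      isolate x = solve 8 (λ t a b c d e f g → t :^ 2 :* a := t :* (con (+ 7) :* e :+ con (+ 35) :* f :+ con (+ 49) :* g) :+ t :^ 2 :* (a :+ con (+ 7) :* b :+ con (+ 21) :* c :+ con (+ 49) :* d :+ con (+ 147) :* e :+ con (+ 343) :* f :+ con (+ 343) :* g)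
        :- (t :* (con (+ 7) :* e :+ con (+ 35) :* f :+ con (+ 49) :* g) :+ t :^ 2 :* (con (+ 7) :* b :+ con (+ 21) :* c :+ con (+ 49) :* d :+ con (+ 147) :* e :+ con (+ 343) :* f :+ con (+ 343) :* g)))
        ≋-refl t₁ (x 0) (x 1) (x 2) (x 3) (x 4) (x 5) (x 6)
      rest-eq : rest (λ k → pr 5 (X (k ℕ.+ i))) ≋ rest (λ k → W * eval (α (k ℕ.+ i)) t₁)
      rest-eq = +-cong (*-congˡ (+-cong (+-cong (*-congˡ (cl 3)) (*-congˡ (cl 4))) (*-congˡ (cl 5))))
        (*-congˡ (+-cong (+-cong (+-cong (+-cong (+-cong (*-congˡ (cl 0)) (*-congˡ (cl 1))) (*-congˡ (cl 2))) (*-congˡ (cl 3))) (*-congˡ (cl 4))) (*-congˡ (cl 5))))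

    from : ∀ s → s ℕ.≤ 7 → ∀ k → k ℕ.< 7 → Claim (k ℕ.+ s)
    from s s≤7 = go (7 ℕ.∸ s) s (ℕP.m∸n+n≡m s≤7)
      where
      base : ∀ k → k ℕ.< 7 → Claim (k ℕ.+ 7)
      base 0 _ = high₇
      base 1 _ = high₈
      base 2 _ = high₉
      base 3 _ = high₁₀
      base 4 _ = high₁₁
      base 5 _ = high₁₂
      base 6 _ = high₁₃
      base (suc (suc (suc (suc (suc (suc (suc _))))))) (s≤s (s≤s (s≤s (s≤s (s≤s (s≤s (s≤s ())))))))
      go : ∀ d s → d ℕ.+ s ≡ 7 → ∀ k → k ℕ.< 7 → Claim (k ℕ.+ s)
      go zero s ≡.refl = base
      go (suc d) s e = extend
        where
        above : ∀ k → k ℕ.< 7 → Claim (k ℕ.+ suc s)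
        above = go d (suc s) (≡.trans (ℕP.+-suc d s) e)
        extend : ∀ k → k ℕ.< 7 → Claim (k ℕ.+ s)
        extend zero _ = down s (λ k k<7 → ≡.subst Claim (ℕP.+-suc k s) (above k k<7))
        extend (suc k) k<7 = ≡.subst Claim (ℕP.+-suc k s) (above k (ℕP.<-trans (ℕP.n<1+n k) k<7))

    windows : ∀ s k → k ℕ.< 7 → Claim (k ℕ.+ s)
    windows zero = from 0 z≤n
    windows (suc s) k k<7 with k ℕ.≟ 6
    ... | yes ≡.refl = up s (windows s)
    ... | no k≢6 = ≡.subst Claim (≡.sym (ℕP.+-suc k s)) (windows s (suc k) (s≤s (ℕP.≤∧≢⇒< (ℕP.≤-pred k<7) k≢6)))

  pr-X : ∀ i → pr 5 (X i) ≋ W * eval (α i) t₁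
  pr-X i = windows i 0 (s≤s z≤n)

-- Identities in ℤ[τ, t₀] modulo the quadratic equation of t₀

module AlgebraicIdentities where
  open SeriesRing
  open SeriesOperators
  open ModularEquation
  open PowersOfTau
  open import Data.Fin using (zero; suc)
  open import Data.Vec using (Vec; []; _∷_)
  open import Data.List as List using ([]; _∷_)
  open import Data.List.Relation.Unary.All as All using (All; []; _∷_)

  open Solver using (solve; prove; Polynomial; op; [+]; [*]; _:+_; _:*_; _:-_; :-_; _:^_; con; var; _:=_; ⟦_⟧)
  open ≋-Reasoning

  infixl 7 _⊠_
  _⊠_ : Poly → Poly → Poly
  [] ⊠ g = []
  (x ∷ f) ⊠ g = x · g ⊞ (+ 0 ∷ f ⊠ g)

  eval-⊠ : ∀ f g t → eval (f ⊠ g) t ≋ eval f t * eval g t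
  eval-⊠ [] g t = ≋-sym (zeroˡ _)
  eval-⊠ (x ∷ f) g t = ≋-trans (eval-⊞ (x · g) (+ 0 ∷ f ⊠ g) t) (≋-trans (+-cong (eval-· x g t) (≋-trans (eval-shift (f ⊠ g) t) (*-congˡ (eval-⊠ f g t))))
    (solve 4 (λ x t f g → x :* g :+ t :* (f :* g) := (x :+ t :* f) :* g) ≋-refl (const x) t (eval f t) (eval g t)))

  eval-0 : ∀ {f} t → All (_≡ + 0) f → eval f t ≋ 0#
  eval-0 t [] = ≋-refl
  eval-0 {_ ∷ f} t (≡.refl ∷ h) = ≋-trans (eval-shift f t) (≋-trans (*-congˡ (eval-0 t h)) (zeroʳ t))

  :A :B : ∀ {n} → Polynomial n → Polynomial n
  :A x = con (+ 7) :* x :+ con (+ 35) :* x :^ 2 :+ con (+ 49) :* x :^ 3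
  :B x = x :+ con (+ 7) :* x :^ 2 :+ con (+ 21) :* x :^ 3 :+ con (+ 49) :* x :^ 4 :+ con (+ 147) :* x :^ 5 :+ con (+ 343) :* x :^ 6 :+ con (+ 343) :* x :^ 7

  x₀ x₁ : Polynomial 2
  x₀ = var zero
  x₁ = var (suc zero)

  σ₂ : Vec Series 2
  σ₂ = τ ∷ t₀ ∷ []

  t₀-quadratic : t₀ * t₀ ≋ ⟦ :A x₀ :* x₁ :+ :B x₀ ⟧ σ₂
  t₀-quadratic = ≋-trans modular-t₀ (prove σ₂ (:modular (con (+ 1)) x₁ x₀) (:A x₀ :* x₁ :+ :B x₀) ≋-refl)

  -- Computation in the quadratic extension ℤ[τ, t₀] of ℤ[τ]: the pair (u , v) stands for u(τ) + v(τ) t₀.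
  module QuadraticExtension where
    Elt : Set
    Elt = Poly × Poly

    A B : Poly
    A = + 0 ∷ + 7 ∷ + 35 ∷ + 49 ∷ []
    B = + 0 ∷ + 1 ∷ + 7 ∷ + 21 ∷ + 49 ∷ + 147 ∷ + 343 ∷ + 343 ∷ []

    value : Elt → Series
    value (u , v) = eval u τ + eval v τ * t₀

    mulᵉ : Elt → Elt → Elt
    mulᵉ (u , v) (u′ , v′) = u ⊠ u′ ⊞ B ⊠ (v ⊠ v′) , u ⊠ v′ ⊞ v ⊠ u′ ⊞ A ⊠ (v ⊠ v′)

    powᵉ : Elt → ℕ → Elt
    powᵉ x zero = + 1 ∷ [] , []
    powᵉ x (suc k) = mulᵉ x (powᵉ x k)

    normal : Polynomial 2 → Elt
    normal (op [+] x y) = proj₁ (normal x) ⊞ proj₁ (normal y) , proj₂ (normal x) ⊞ proj₂ (normal y)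
    normal (op [*] x y) = mulᵉ (normal x) (normal y)
    normal (con c) = c ∷ [] , []
    normal (var zero) = + 0 ∷ + 1 ∷ [] , []
    normal (var (suc _)) = [] , + 1 ∷ []
    normal (x :^ k) = powᵉ (normal x) k
    normal (:- x) = -[1+ 0 ] · proj₁ (normal x) , -[1+ 0 ] · proj₂ (normal x)

    t₀² : t₀ * t₀ ≋ eval A τ * t₀ + eval B τ
    t₀² = ≋-trans t₀-quadratic (prove σ₂ (:A x₀ :* x₁ :+ :B x₀) (:eval A x₀ :* x₁ :+ :eval B x₀) ≋-refl)

    value-mul : ∀ x y → value (mulᵉ x y) ≋ value x * value y
    value-mul (u , v) (u′ , v′) = begin
      eval (u ⊠ u′ ⊞ B ⊠ (v ⊠ v′)) τ + eval (u ⊠ v′ ⊞ v ⊠ u′ ⊞ A ⊠ (v ⊠ v′)) τ * t₀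
        ≈⟨ +-cong (≋-trans (eval-⊞ (u ⊠ u′) _ τ) (+-cong (eval-⊠ u u′ τ) (≋-trans (eval-⊠ B (v ⊠ v′) τ) (*-congˡ (eval-⊠ v v′ τ)))))
            (*-congʳ (≋-trans (eval-⊞ (u ⊠ v′ ⊞ v ⊠ u′) _ τ) (+-cong (≋-trans (eval-⊞ (u ⊠ v′) _ τ) (+-cong (eval-⊠ u v′ τ) (eval-⊠ v u′ τ))) (≋-trans (eval-⊠ A (v ⊠ v′) τ) (*-congˡ (eval-⊠ v v′ τ)))))) ⟩
      _ ≈⟨ solve 7 (λ u v u′ v′ A B t → u :* u′ :+ B :* (v :* v′) :+ (u :* v′ :+ v :* u′ :+ A :* (v :* v′)) :* t
             := u :* u′ :+ (u :* v′ :+ v :* u′) :* t :+ (v :* v′) :* (A :* t :+ B)) ≋-refl (eval u τ) (eval v τ) (eval u′ τ) (eval v′ τ) (eval A τ) (eval B τ) t₀ ⟩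
      eval u τ * eval u′ τ + (eval u τ * eval v′ τ + eval v τ * eval u′ τ) * t₀ + eval v τ * eval v′ τ * (eval A τ * t₀ + eval B τ) ≈⟨ +-congˡ (*-congˡ t₀²) ⟨
      eval u τ * eval u′ τ + (eval u τ * eval v′ τ + eval v τ * eval u′ τ) * t₀ + eval v τ * eval v′ τ * (t₀ * t₀)
        ≈⟨ solve 5 (λ u v u′ v′ t → u :* u′ :+ (u :* v′ :+ v :* u′) :* t :+ v :* v′ :* (t :* t) := (u :+ v :* t) :* (u′ :+ v′ :* t)) ≋-refl (eval u τ) (eval v τ) (eval u′ τ) (eval v′ τ) t₀ ⟩
      value (u , v) * value (u′ , v′) ∎

    value-normal : ∀ P → ⟦ P ⟧ σ₂ ≋ value (normal P)
    value-normal (op [+] x y) = ≋-trans (+-cong (value-normal x) (value-normal y)) (≋-sym (≋-trans (+-cong (eval-⊞ (proj₁ (normal x)) _ τ) (*-congʳ (eval-⊞ (proj₂ (normal x)) _ τ)))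
      (solve 5 (λ a b c d t → a :+ b :+ (c :+ d) :* t := (a :+ c :* t) :+ (b :+ d :* t)) ≋-refl _ _ _ _ t₀)))
    value-normal (op [*] x y) = ≋-trans (*-cong (value-normal x) (value-normal y)) (≋-sym (value-mul (normal x) (normal y)))
    value-normal (con c) = solve 3 (λ c x t → c := c :+ x :* con (+ 0) :+ con (+ 0) :* t) ≋-refl (const c) τ t₀
    value-normal (var zero) = solve 2 (λ x t → x := con (+ 0) :+ x :* (con (+ 1) :+ x :* con (+ 0)) :+ con (+ 0) :* t) ≋-refl τ t₀
    value-normal (var (suc zero)) = solve 2 (λ x t → t := con (+ 0) :+ (con (+ 1) :+ x :* con (+ 0)) :* t) ≋-refl τ t₀
    value-normal (x :^ k) = go k
      where
      go : ∀ k → ⟦ x ⟧ σ₂ ^ k ≋ value (powᵉ (normal x) k)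
      go zero = solve 2 (λ x t → con (+ 1) := con (+ 1) :+ x :* con (+ 0) :+ con (+ 0) :* t) ≋-refl τ t₀
      go (suc k) = ≋-trans (*-cong (value-normal x) (go k)) (≋-sym (value-mul (normal x) (powᵉ (normal x) k)))
    value-normal (:- x) = ≋-trans (-‿cong (value-normal x)) (≋-sym (≋-trans (+-cong (eval-· -[1+ 0 ] (proj₁ (normal x)) τ) (*-congʳ (eval-· -[1+ 0 ] (proj₂ (normal x)) τ)))
      (solve 3 (λ a b t → con -[1+ 0 ] :* a :+ (con -[1+ 0 ] :* b) :* t := :- (a :+ b :* t)) ≋-refl _ _ t₀)))

    zero? : (x : Elt) → Dec (All (_≡ + 0) (proj₁ x) × All (_≡ + 0) (proj₂ x))
    zero? (u , v) = All.all? (ℤ._≟ + 0) u ×-dec All.all? (ℤ._≟ + 0) v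

    -- Equality modulo the quadratic equation is decided by evaluating the normal form of P - Q on
    -- lists of integers.
    by-computation : ∀ P Q → {True (zero? (normal (P :- Q)))} → ⟦ P ⟧ σ₂ ≋ ⟦ Q ⟧ σ₂
    by-computation P Q {h} = begin
      ⟦ P ⟧ σ₂ ≈⟨ solve 2 (λ x y → x := x :- y :+ y) ≋-refl (⟦ P ⟧ σ₂) (⟦ Q ⟧ σ₂) ⟩
      ⟦ P ⟧ σ₂ - ⟦ Q ⟧ σ₂ + ⟦ Q ⟧ σ₂ ≈⟨ +-congʳ (≋-trans (value-normal (P :- Q)) (≋-trans (+-cong (eval-0 τ (proj₁ z)) (*-congʳ (eval-0 τ (proj₂ z)))) (≋-trans (+-identityˡ _) (zeroˡ t₀)))) ⟩
      0# + ⟦ Q ⟧ σ₂ ≈⟨ +-identityˡ _ ⟩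
      ⟦ Q ⟧ σ₂ ∎
      where
      z = toWitness {a? = zero? (normal (P :- Q))} h

  open QuadraticExtension using (by-computation)

  -- `:s` and `:ψ` are the derivative by t₀ and minus the derivative by τ of t₀² - A t₀ - B. `:u` is
  -- fixed by `identity₀` and makes u / ψ the ratio of 𝓔(q^7) to 𝓔. `:t₀²Q₁` and `:t₀²r₁` are t₀²
  -- Q(t₁) and t₀² r(t₁), freed of t₁ by t₀ t₁ = τ⁴.
  :s :ψ :u :Q :t₀²Q₁ :r :t₀²r₁ : Polynomial 2
  :s = con (+ 2) :* x₁ :- :A x₀
  :ψ = (con (+ 7) :+ con (+ 70) :* x₀ :+ con (+ 147) :* x₀ :^ 2) :* x₁
    :+ (con (+ 1) :+ con (+ 14) :* x₀ :+ con (+ 63) :* x₀ :^ 2 :+ con (+ 196) :* x₀ :^ 3 :+ con (+ 735) :* x₀ :^ 4 :+ con (+ 2058) :* x₀ :^ 5 :+ con (+ 2401) :* x₀ :^ 6)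
  :u = con (+ 1) :+ con (+ 6) :* x₀ :+ con (+ 15) :* x₀ :^ 2 :+ con (+ 28) :* x₀ :^ 3 :+ con (+ 63) :* x₀ :^ 4 :+ con (+ 98) :* x₀ :^ 5 :+ con (+ 49) :* x₀ :^ 6
    :+ (con (+ 3) :+ con (+ 10) :* x₀ :+ con (+ 7) :* x₀ :^ 2) :* x₁
  :Q = con (+ 1) :+ con (+ 13) :* x₁ :+ con (+ 49) :* x₁ :^ 2
  :r = con (+ 1) :+ con (+ 245) :* x₁ :+ con (+ 2401) :* x₁ :^ 2
  :t₀²Q₁ = x₁ :^ 2 :+ con (+ 13) :* (x₁ :* x₀ :^ 4) :+ con (+ 49) :* x₀ :^ 8
  :t₀²r₁ = x₁ :^ 2 :+ con (+ 245) :* (x₁ :* x₀ :^ 4) :+ con (+ 2401) :* x₀ :^ 8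

  s ψ u Q r : Series
  s = ⟦ :s ⟧ σ₂
  ψ = ⟦ :ψ ⟧ σ₂
  u = ⟦ :u ⟧ σ₂
  Q = ⟦ :Q ⟧ σ₂
  r = ⟦ :r ⟧ σ₂

  identity₀ : const (+ 4) * (s * t₀) - ψ * τ ≋ const (+ 7) * τ * u
  identity₀ = by-computation (con (+ 4) :* (:s :* x₁) :- :ψ :* x₀) (con (+ 7) :* x₀ :* :u)

  -- Compatibility of 𝓔³ = Z Q² with q ↦ q^7, where Z is η(z)^14 / η(7 z)^2 and q ↦ q^7 multiplies Z
  -- by t₀⁴ / τ².
  identity₁ : ψ ^ 3 * ⟦ :t₀²Q₁ ⟧ σ₂ ^ 2 ≋ τ ^ 2 * (u ^ 3 * Q ^ 2)
  identity₁ = by-computation (:ψ :^ 3 :* :t₀²Q₁ :^ 2) (x₀ :^ 2 :* (:u :^ 3 :* :Q :^ 2))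

  -- Compatibility of the expressions 𝓔² r / Q for E₄ and 𝓔² (1 + 5 t + t²) / Q for E₄(q^7).
  identity₂ : ψ ^ 2 * (⟦ :t₀²Q₁ ⟧ σ₂ * (1# + const (+ 5) * t₀ + t₀ ^ 2)) ≋ u ^ 2 * (Q * ⟦ :t₀²r₁ ⟧ σ₂)
  identity₂ = by-computation (:ψ :^ 2 :* (:t₀²Q₁ :* (con (+ 1) :+ con (+ 5) :* x₁ :+ x₁ :^ 2))) (:u :^ 2 :* (:Q :* :t₀²r₁))

-- Equations between a series and its image under q ↦ q^7; the cube of 𝓔

module TwistedEquations where
  open SeriesRing
  open SeriesOperators
  open EulerProduct
  open EisensteinSeries
  open LinearEquations
  open ModularEquation
  open NormDerivative
  open NormEvaluation
  open PowersOfTau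
  open AlgebraicIdentities
  open import Data.Fin using (zero; suc)
  open import Data.Vec using (Vec; []; _∷_; lookup; _++_; map)

  open Solver using (solve; prove; Polynomial; op; [+]; [*]; _:+_; _:*_; _:-_; :-_; _:^_; con; var; _:=_; ⟦_⟧)
  open ≋-Reasoning

  -- If X is divisible by q^n, then φ 7 X is divisible by q^(7 n).
  φ-rigid : ∀ {V U X} .{{_ : ℤ.NonZero (V 0)}} → V * X ≋ φ 7 X * U → X 0 ≡ + 0 → X ≋ 0#
  φ-rigid {V} {U} {X} h base = ≋-by-mod (≡.trans base (≡.sym (const-zero (+ 0)))) next
    where
    next : ∀ n → X ≋ 0# mod (suc n) → X (suc n) ≡ 0# (suc n)
    next n below = ≡.trans (ℤP.*-cancelˡ-≡ (V 0) (X (suc n)) (+ 0) (≡.trans (≡.sym lhs) (≡.trans (at h (suc n)) (≡.trans rhs (≡.sym (ℤP.*-zeroʳ (V 0)))))))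
      (≡.sym (const-suc (+ 0) n))
      where
      lhs : (V * X) (suc n) ≡ V 0 ℤ.* X (suc n)
      lhs = ≡.trans (*-at-suc V X n) (≡.trans (≡.cong (λ z → V 0 ℤ.* X (suc n) ℤ.+ z) (≡.trans (0*-mod (tail V) below n ℕP.≤-refl) (const-0-at n))) (ℤP.+-identityʳ _))
      φX : φ 7 X ≋ 0# mod (suc (suc n))
      φX = mod-trans (mod-≤ (s≤s (s≤s (ℕP.≤-trans (ℕP.m≤m*n n 7) (ℕP.m≤n+m (n ℕ.* 7) 5)))) (φ-mod 7 below)) (≋⇒mod (φ-const 7 (+ 0)))
      rhs : (φ 7 X * U) (suc n) ≡ + 0
      rhs = ≡.trans (mod-* φX (mod-refl {U}) (suc n) ℕP.≤-refl) (≡.trans (at (zeroˡ U) (suc n)) (const-0-at (suc n)))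

  -- 𝓔 = (7 E₂(7 z) - E₂(z)) / 6.
  𝓔 𝓔₁ M₇ : Series
  𝓔 = 1# + const (+ 28) * L₇ - const (+ 4) * L
  𝓔₁ = φ 7 𝓔
  M₇ = φ 7 (D L)

  Dt₀ : D t₀ ≋ 𝓔 * t₀
  Dt₀ = ≋-trans (D-* _ _) (≋-trans (+-cong (*-congʳ (≋-trans (D-* q _) (+-cong (*-congʳ D-q) (*-congˡ (D-^suc E₇ _ 4 DE₇))))) (*-congˡ (D-^suc p (- L) 4 (≋-trans Dp (solve 2 (λ l p → :- (l :* p) := :- l :* p) ≋-refl L p)))))
    (solve 5 (λ q e p l₇ l → (q :* e :+ q :* (con (+ 4) :* (con (+ 7) :* l₇) :* e)) :* p :+ q :* e :* (con (+ 4) :* :- l :* p) := (con (+ 1) :+ con (+ 28) :* l₇ :- con (+ 4) :* l) :* (q :* e :* p)) ≋-refl q (E₇ ^ 4) (p ^ 4) L₇ L))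

  Dm : D m ≋ (const (+ 2) + const (+ 49) * L₄₉) * m
  Dm = ≋-trans (D-* _ _) (≋-trans (+-cong (*-congʳ (≋-trans (D-^2 q) (*-congˡ D-q))) (*-congˡ DE₄₉))
    (solve 3 (λ q l e → con (+ 2) :* q :* q :* e :+ q :^ 2 :* (con (+ 49) :* l :* e) := (con (+ 2) :+ con (+ 49) :* l) :* (q :^ 2 :* e)) ≋-refl q L₄₉ E₄₉))

  Dτ : const (+ 4) * D τ ≋ (𝓔 + const (+ 7) * 𝓔₁) * τ
  Dτ = ≋-trans (*-congˡ (≋-trans (D-* m p) (+-cong (*-congʳ Dm) (*-congˡ Dp)))) (≋-trans
    (solve 5 (λ m p l l₇ l₄₉ → con (+ 4) :* ((con (+ 2) :+ con (+ 49) :* l₄₉) :* m :* p :+ m :* :- (l :* p))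
      := (con (+ 1) :+ con (+ 28) :* l₇ :- con (+ 4) :* l :+ con (+ 7) :* (con (+ 1) :+ con (+ 28) :* l₄₉ :- con (+ 4) :* l₇)) :* (m :* p)) ≋-refl m p L L₇ L₄₉)
    (*-congʳ (+-congˡ (*-congˡ (≋-sym 𝓔₁≋)))))
    where
    𝓔₁≋ : 𝓔₁ ≋ 1# + const (+ 28) * L₄₉ - const (+ 4) * L₇
    𝓔₁≋ = ≋-trans (φ-+ 7 _ _) (+-cong (≋-trans (φ-+ 7 _ _) (+-cong (φ-const 7 (+ 1)) (φ-scale 7 (+ 28) L₇))) (≋-trans (φ-neg 7 _) (-‿cong (φ-scale 7 (+ 4) L))))

  s*Dt₀ : s * D t₀ ≋ ψ * D τ
  s*Dt₀ = begin
    s * D t₀ ≈⟨ prove σ (:s′ :* y₁) (y₁ :* z₁ :+ z₁ :* y₁ :- :A z₀ :* y₁) ≋-refl ⟩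
    D t₀ * t₀ + t₀ * D t₀ - ⟦ :A z₀ ⟧ σ * D t₀ ≈⟨ +-congʳ (≋-trans (≋-sym (D-* t₀ t₀)) (≋-trans (D-cong t₀-quadratic) (D-⟦⟧ σ₂ (:A x₀ :* x₁ :+ :B x₀)))) ⟩
    ⟦ der (:A x₀ :* x₁ :+ :B x₀) ⟧ σ - ⟦ :A z₀ ⟧ σ * D t₀ ≈⟨ prove σ (der (:A x₀ :* x₁ :+ :B x₀) :- :A z₀ :* y₁) (:ψ′ :* y₀) ≋-refl ⟩
    ψ * D τ ∎
    where
    σ : Vec Series 4
    σ = σ₂ ++ map D σ₂
    z₀ z₁ y₀ y₁ :s′ :ψ′ : Polynomial 4
    z₀ = v₀
    z₁ = v₁
    y₀ = v₂
    y₁ = v₃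
    :s′ = weaken :s
    :ψ′ = weaken :ψ

  constantTerm : ∀ {n} → Polynomial n → ℤ
  constantTerm (op [+] x y) = constantTerm x ℤ.+ constantTerm y
  constantTerm (op [*] x y) = constantTerm x ℤ.* constantTerm y
  constantTerm (con c) = c
  constantTerm (var i) = + 0
  constantTerm (x :^ k) = constantTerm x ℤ.^ k
  constantTerm (:- x) = ℤ.- constantTerm x

  ⟦⟧-at-0 : ∀ {n} (σ : Vec Series n) → (∀ i → lookup σ i 0 ≡ + 0) → ∀ P → ⟦ P ⟧ σ 0 ≡ constantTerm P
  ⟦⟧-at-0 σ h (op [+] x y) = ≡.trans (+-at _ _ 0) (≡.cong₂ ℤ._+_ (⟦⟧-at-0 σ h x) (⟦⟧-at-0 σ h y))
  ⟦⟧-at-0 σ h (op [*] x y) = ≡.trans (*-at-0 _ _) (≡.cong₂ ℤ._*_ (⟦⟧-at-0 σ h x) (⟦⟧-at-0 σ h y))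
  ⟦⟧-at-0 σ h (con c) = const-zero c
  ⟦⟧-at-0 σ h (var i) = h i
  ⟦⟧-at-0 σ h (x :^ zero) = const-zero (+ 1)
  ⟦⟧-at-0 σ h (x :^ suc k) = ≡.trans (*-at-0 _ _) (≡.cong₂ ℤ._*_ (⟦⟧-at-0 σ h x) (⟦⟧-at-0 σ h (x :^ k)))
  ⟦⟧-at-0 σ h (:- x) = ≡.trans (neg-at _ 0) (≡.cong ℤ.-_ (⟦⟧-at-0 σ h x))

  τ-at-0 : τ 0 ≡ + 0
  τ-at-0 = ≡.trans (*-at-0 m p) (≡.cong (ℤ._* p 0) (≡.trans (at (*-assoc q _ E₄₉) 0) (q*-zero _)))

  t₀-at-0 : t₀ 0 ≡ + 0
  t₀-at-0 = ≡.trans (at (*-assoc q (E₇ ^ 4) (p ^ 4)) 0) (q*-zero _)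

  σ₂-at-0 : ∀ P → ⟦ P ⟧ σ₂ 0 ≡ constantTerm P
  σ₂-at-0 = ⟦⟧-at-0 σ₂ λ { zero → τ-at-0 ; (suc zero) → t₀-at-0 }

  unit-cancel : ∀ P → constantTerm P ≡ + 1 → ∀ k {x y} → ⟦ P ⟧ σ₂ ^ k * x ≋ ⟦ P ⟧ σ₂ ^ k * y → x ≋ y
  unit-cancel P e k = *-cancelˡ-≋ (⟦ P ⟧ σ₂ ^ k) {{≡.subst ℤ.NonZero (≡.sym (≡.trans (σ₂-at-0 (P :^ k)) (≡.trans (≡.cong (ℤ._^ k) e) (ℤP.^-zeroˡ k)))) _}}

  t₀-cancel : ∀ {x y} → t₀ * x ≋ t₀ * y → x ≋ y
  t₀-cancel {x} {y} h = q^-*-cancel 1 (≋-trans (unit x) (≋-trans (*-congˡ h) (≋-sym (unit y))))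
    where
    unit : ∀ x → q ^ 1 * x ≋ E ^ 4 * p₇ ^ 4 * (t₀ * x)
    unit x = ≋-sym (≋-trans (solve 6 (λ q e e₇ p p₇ x → e :^ 4 :* p₇ :^ 4 :* (q :* e₇ :^ 4 :* p :^ 4 :* x) := q :^ 1 :* x :* ((e :* p) :^ 4 :* (e₇ :* p₇) :^ 4)) ≋-refl q E E₇ p p₇ x)
      (*-1# _ (≋-trans (*-cong (^-1# 4 E*partition) (^-1# 4 E₇*p₇)) (*-identityˡ 1#))))

  t₀^-cancel : ∀ k {x y} → t₀ ^ k * x ≋ t₀ ^ k * y → x ≋ y
  t₀^-cancel zero {x} {y} h = ≋-trans (≋-sym (*-identityˡ x)) (≋-trans h (*-identityˡ y))
  t₀^-cancel (suc k) {x} {y} h = t₀^-cancel k (t₀-cancel (≋-trans (≋-sym (*-assoc t₀ (t₀ ^ k) x)) (≋-trans h (*-assoc t₀ (t₀ ^ k) y))))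

  -- Since τ⁴ = t₀ t₁, the logarithmic derivative of τ is (𝓔 + 7 𝓔₁) / 4. Inserted into the
  -- differentiated modular equation s D t₀ = ψ D τ, it leaves a linear relation between 𝓔 and 𝓔₁.
  𝓔-ratio : u * 𝓔 ≋ ψ * 𝓔₁
  𝓔-ratio = τ-cancel (const-*-cancel (+ 7) (begin
    const (+ 7) * (τ * (u * 𝓔)) ≈⟨ solve 4 (λ c t u e → c :* (t :* (u :* e)) := c :* t :* u :* e) ≋-refl (const (+ 7)) τ u 𝓔 ⟩
    const (+ 7) * τ * u * 𝓔 ≈⟨ *-congʳ identity₀ ⟨
    (const (+ 4) * (s * t₀) - ψ * τ) * 𝓔 ≈⟨ solve 5 (λ s t x τ e → (con (+ 4) :* (s :* t) :- x :* τ) :* e := con (+ 4) :* (s :* (e :* t)) :- x :* τ :* e) ≋-refl s t₀ ψ τ 𝓔 ⟩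
    const (+ 4) * (s * (𝓔 * t₀)) - ψ * τ * 𝓔 ≈⟨ +-congʳ (*-congˡ (≋-trans (*-congˡ (≋-sym Dt₀)) s*Dt₀)) ⟩
    const (+ 4) * (ψ * D τ) - ψ * τ * 𝓔 ≈⟨ +-congʳ (≋-trans (solve 2 (λ x d → con (+ 4) :* (x :* d) := x :* (con (+ 4) :* d)) ≋-refl ψ (D τ)) (*-congˡ Dτ)) ⟩
    ψ * ((𝓔 + const (+ 7) * 𝓔₁) * τ) - ψ * τ * 𝓔 ≈⟨ solve 4 (λ x e e₁ τ → x :* ((e :+ con (+ 7) :* e₁) :* τ) :- x :* τ :* e := con (+ 7) :* (τ :* (x :* e₁))) ≋-refl ψ 𝓔 𝓔₁ τ ⟩
    const (+ 7) * (τ * (ψ * 𝓔₁)) ∎))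

  Z Q₁ r₁ Z₁ : Series
  Z = E ^ 14 * p₇ ^ 2
  Z₁ = φ 7 Z
  Q₁ = φ 7 Q
  r₁ = φ 7 r

  Z₁≋ : Z₁ ≋ E₇ ^ 14 * p₄₉ ^ 2
  Z₁≋ = ≋-trans (φ-* 7 _ _) (*-cong (φ-^ 7 E 14) (φ-^ 7 p₇ 2))

  private
    φ-quadratic : ∀ α β → φ 7 (1# + const α * t₀ + const β * t₀ ^ 2) ≋ 1# + const α * t₁ + const β * t₁ ^ 2
    φ-quadratic α β = ≋-trans (φ-+ 7 _ _) (+-cong (≋-trans (φ-+ 7 _ _) (+-cong (φ-const 7 (+ 1)) (φ-scale 7 α t₀))) (≋-trans (φ-scale 7 β _) (*-congˡ (φ-^ 7 t₀ 2))))

  t₀²Q₁ : t₀ ^ 2 * Q₁ ≋ ⟦ :t₀²Q₁ ⟧ σ₂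
  t₀²Q₁ = ≋-trans (*-congˡ (φ-quadratic (+ 13) (+ 49))) (≋-trans (solve 2 (λ t w → t :^ 2 :* (con (+ 1) :+ con (+ 13) :* w :+ con (+ 49) :* w :^ 2) := t :^ 2 :+ con (+ 13) :* (t :* (t :* w)) :+ con (+ 49) :* (t :* w) :^ 2) ≋-refl t₀ t₁)
    (≋-trans (+-cong (+-congˡ (*-congˡ (*-congˡ t₀*t₁))) (*-congˡ (^-congˡ 2 t₀*t₁))) (solve 2 (λ t x → t :^ 2 :+ con (+ 13) :* (t :* x :^ 4) :+ con (+ 49) :* (x :^ 4) :^ 2 := t :^ 2 :+ con (+ 13) :* (t :* x :^ 4) :+ con (+ 49) :* x :^ 8) ≋-refl t₀ τ)))

  t₀²r₁ : t₀ ^ 2 * r₁ ≋ ⟦ :t₀²r₁ ⟧ σ₂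
  t₀²r₁ = ≋-trans (*-congˡ (φ-quadratic (+ 245) (+ 2401))) (≋-trans (solve 2 (λ t w → t :^ 2 :* (con (+ 1) :+ con (+ 245) :* w :+ con (+ 2401) :* w :^ 2) := t :^ 2 :+ con (+ 245) :* (t :* (t :* w)) :+ con (+ 2401) :* (t :* w) :^ 2) ≋-refl t₀ t₁)
    (≋-trans (+-cong (+-congˡ (*-congˡ (*-congˡ t₀*t₁))) (*-congˡ (^-congˡ 2 t₀*t₁))) (solve 2 (λ t x → t :^ 2 :+ con (+ 245) :* (t :* x :^ 4) :+ con (+ 2401) :* (x :^ 4) :^ 2 := t :^ 2 :+ con (+ 245) :* (t :* x :^ 4) :+ con (+ 2401) :* x :^ 8) ≋-refl t₀ τ)))

  τ²Z₁ : τ ^ 2 * Z₁ ≋ t₀ ^ 4 * Z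
  τ²Z₁ = ≋-trans (*-congˡ Z₁≋) (≋-trans (≋-sym (*-1# _ (≋-trans (*-cong (^-1# 14 E*partition) (^-1# 2 E₇*p₇)) (*-identityˡ 1#))))
    (≋-trans (solve 6 (λ q x p e₇ p₄₉ w → (q :^ 2 :* x :* p) :^ 2 :* (e₇ :^ 14 :* p₄₉ :^ 2) :* w := q :^ 4 :* p :^ 2 :* e₇ :^ 14 :* w :* (x :* p₄₉) :^ 2) ≋-refl q E₄₉ p E₇ p₄₉ ((E * p) ^ 14 * (E₇ * p₇) ^ 2))
    (≋-trans (*-1# _ (^-1# 2 E₄₉*p₄₉)) (solve 5 (λ q p e₇ e p₇ → q :^ 4 :* p :^ 2 :* e₇ :^ 14 :* ((e :* p) :^ 14 :* (e₇ :* p₇) :^ 2) := (q :* e₇ :^ 4 :* p :^ 4) :^ 4 :* (e :^ 14 :* p₇ :^ 2)) ≋-refl q p E₇ E p₇))))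

  Z-at-0 : Z 0 ≡ + 1
  Z-at-0 = ≡.trans (mod-* (mod-^ 14 E-1) (mod-^ 2 p₇-1) 0 (s≤s z≤n)) (≡.trans (at (solve 0 (con (+ 1) :^ 14 :* con (+ 1) :^ 2 := con (+ 1)) ≋-refl) 0) (const-zero (+ 1)))
    where
    E-1 : E ≋ 1# mod 1
    E-1 zero _ = ≡.sym (const-zero (+ 1))
    E-1 (suc _) (s≤s ())
    p₇-1 : p₇ ≋ 1# mod 1
    p₇-1 zero _ = ≡.trans (φ-at-0 7 p) (≡.sym (const-zero (+ 1)))
    p₇-1 (suc _) (s≤s ())

  𝓔-at-0 : 𝓔 0 ≡ + 1
  𝓔-at-0 = ≡.trans (⟦⟧-at-0 (L ∷ L₇ ∷ []) (λ { zero → L-at-0 ; (suc zero) → ≡.trans (φ-at-0 7 L) L-at-0 })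
    (con (+ 1) :+ con (+ 28) :* var (suc zero) :- con (+ 4) :* var zero)) ≡.refl

  module CubicIdentity where
    Y Y₁ Ω Ω₁ : Series
    Y = 𝓔 ^ 3
    Y₁ = 𝓔₁ ^ 3
    Ω = Z * Q ^ 2
    Ω₁ = Z₁ * Q₁ ^ 2

    twisted : Y * Ω₁ ≋ Y₁ * Ω
    twisted = t₀^-cancel 4 (unit-cancel :u ≡.refl 3 (begin
      u ^ 3 * (t₀ ^ 4 * (Y * Ω₁)) ≈⟨ solve 5 (λ u t e z w → u :^ 3 :* (t :^ 4 :* (e :^ 3 :* (z :* w :^ 2))) := (u :* e) :^ 3 :* z :* (t :^ 2 :* w) :^ 2) ≋-refl u t₀ 𝓔 Z₁ Q₁ ⟩
      (u * 𝓔) ^ 3 * Z₁ * (t₀ ^ 2 * Q₁) ^ 2 ≈⟨ *-cong (*-congʳ (^-congˡ 3 𝓔-ratio)) (^-congˡ 2 t₀²Q₁) ⟩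
      (ψ * 𝓔₁) ^ 3 * Z₁ * ⟦ :t₀²Q₁ ⟧ σ₂ ^ 2 ≈⟨ solve 4 (λ x e z w → (x :* e) :^ 3 :* z :* w :^ 2 := e :^ 3 :* z :* (x :^ 3 :* w :^ 2)) ≋-refl ψ 𝓔₁ Z₁ (⟦ :t₀²Q₁ ⟧ σ₂) ⟩
      Y₁ * Z₁ * (ψ ^ 3 * ⟦ :t₀²Q₁ ⟧ σ₂ ^ 2) ≈⟨ *-congˡ identity₁ ⟩
      Y₁ * Z₁ * (τ ^ 2 * (u ^ 3 * Q ^ 2)) ≈⟨ solve 5 (λ y z t u w → y :* z :* (t :^ 2 :* (u :^ 3 :* w :^ 2)) := u :^ 3 :* (y :* ((t :^ 2 :* z) :* w :^ 2))) ≋-refl Y₁ Z₁ τ u Q ⟩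
      u ^ 3 * (Y₁ * ((τ ^ 2 * Z₁) * Q ^ 2)) ≈⟨ *-congˡ (*-congˡ (*-congʳ τ²Z₁)) ⟩
      u ^ 3 * (Y₁ * ((t₀ ^ 4 * Z) * Q ^ 2)) ≈⟨ solve 5 (λ y z t u w → u :^ 3 :* (y :* ((t :^ 4 :* z) :* w :^ 2)) := u :^ 3 :* (t :^ 4 :* (y :* (z :* w :^ 2)))) ≋-refl Y₁ Z t₀ u Q ⟩
      u ^ 3 * (t₀ ^ 4 * (Y₁ * Ω)) ∎))

    Ω-at-0 : Ω 0 ≡ + 1
    Ω-at-0 = ≡.trans (*-at-0 Z (Q ^ 2)) (≡.cong₂ ℤ._*_ Z-at-0 (σ₂-at-0 (:Q :^ 2)))

    Ω₁≋ : φ 7 Ω ≋ Ω₁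
    Ω₁≋ = ≋-trans (φ-* 7 _ _) (*-congˡ (φ-^ 7 Q 2))

    -- `twisted` only says that Y / Ω is unchanged by q ↦ q^7. Rewritten for Y - Ω, it meets
    -- `φ-rigid`, because both constant terms are 1.
    difference : Y - Ω ≋ 0#
    difference = φ-rigid {Ω₁} {Ω} {Y - Ω} {{≡.subst ℤ.NonZero (≡.sym (≡.trans (≡.sym (at Ω₁≋ 0)) (≡.trans (φ-at-0 7 Ω) Ω-at-0))) _}} (begin
      Ω₁ * (Y - Ω) ≈⟨ solve 3 (λ w y o → w :* (y :- o) := y :* w :- w :* o) ≋-refl Ω₁ Y Ω ⟩
      Y * Ω₁ - Ω₁ * Ω ≈⟨ +-congʳ twisted ⟩
      Y₁ * Ω - Ω₁ * Ω ≈⟨ solve 3 (λ y w o → y :* o :- w :* o := (y :- w) :* o) ≋-refl Y₁ Ω₁ Ω ⟩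
      (Y₁ - Ω₁) * Ω ≈⟨ *-congʳ (≋-trans (φ-+ 7 _ _) (+-cong (φ-^ 7 𝓔 3) (≋-trans (φ-neg 7 _) (-‿cong Ω₁≋)))) ⟨
      φ 7 (Y - Ω) * Ω ∎) base
      where
      base : (Y - Ω) 0 ≡ + 0
      base = ≡.trans (+-at _ _ 0) (≡.cong₂ ℤ._+_ Y-at-0 (≡.trans (neg-at Ω 0) (≡.cong ℤ.-_ Ω-at-0)))
        where
        Y-at-0 : Y 0 ≡ + 1
        Y-at-0 = ≡.trans (*-at-0 𝓔 _) (≡.cong₂ ℤ._*_ 𝓔-at-0 (≡.trans (*-at-0 𝓔 _) (≡.cong₂ ℤ._*_ 𝓔-at-0 (≡.trans (*-at-0 𝓔 _) (≡.cong₂ ℤ._*_ 𝓔-at-0 (const-zero (+ 1)))))))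

    𝓔³ : 𝓔 ^ 3 ≋ Z * Q ^ 2
    𝓔³ = ≋-trans (solve 2 (λ y w → y := (y :- w) :+ w) ≋-refl Y Ω) (≋-trans (+-congʳ difference) (+-identityˡ Ω))

-- E₄ and E₆ in terms of 𝓔, Z and t

module EisensteinSix where
  open SeriesRing
  open SeriesOperators
  open EulerProduct
  open EisensteinSeries
  open DivisorSums
  open LinearEquations
  open NormEvaluation
  open PowersOfTau
  open AlgebraicIdentities
  open TwistedEquations
  open import Data.Fin using (zero; suc)
  open import Data.Vec using ([]; _∷_)
  open import Data.List using ([]; _∷_)

  open Solver using (solve; prove; Polynomial; _:+_; _:*_; _:-_; :-_; _:^_; con; var; _:=_; ⟦_⟧)
  open ≋-Reasoning
  open Eisenstein using (D-scale; E₆′)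

  𝓔-cancel : ∀ k {x y} → 𝓔 ^ k * x ≋ 𝓔 ^ k * y → x ≋ y
  𝓔-cancel k = *-cancelˡ-≋ (𝓔 ^ k) {{≡.subst ℤ.NonZero (≡.sym (power k)) _}}
    where
    power : ∀ k → (𝓔 ^ k) 0 ≡ + 1
    power zero = const-zero (+ 1)
    power (suc k) = ≡.trans (*-at-0 𝓔 _) (≡.cong₂ ℤ._*_ 𝓔-at-0 (power k))

  -- t₀ dQ/dt₀ and t₀ dr/dt₀
  tQ′ tr′ : Series
  tQ′ = const (+ 13) * t₀ + const (+ 98) * t₀ ^ 2
  tr′ = const (+ 245) * t₀ + const (+ 4802) * t₀ ^ 2

  private
    D-quadratic : ∀ α β γ → γ ≡ + 2 ℤ.* β → D (1# + const α * t₀ + const β * t₀ ^ 2) ≋ (const α * t₀ + const γ * t₀ ^ 2) * 𝓔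
    D-quadratic α β γ ≡.refl = ≋-trans (D-+ _ _) (≋-trans (+-cong (≋-trans (D-+ _ _) (+-cong (D-const (+ 1)) (≋-trans (D-scale α t₀) (*-congˡ Dt₀)))) (≋-trans (D-scale β _) (*-congˡ (≋-trans (D-^2 t₀) (*-congˡ Dt₀)))))
      (≋-trans (solve 4 (λ α β t e → con (+ 0) :+ α :* (e :* t) :+ β :* (con (+ 2) :* t :* (e :* t)) := (α :* t :+ (con (+ 2) :* β) :* t :^ 2) :* e) ≋-refl (const α) (const β) t₀ 𝓔)
        (*-congʳ (+-congˡ (*-congʳ (≋-sym (const-* (+ 2) β)))))))

  DQ : D Q ≋ tQ′ * 𝓔
  DQ = D-quadratic (+ 13) (+ 49) (+ 98) ≡.refl

  Dr : D r ≋ tr′ * 𝓔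
  Dr = D-quadratic (+ 245) (+ 2401) (+ 4802) ≡.refl

  DL₇ : D L₇ ≋ const (+ 7) * M₇
  DL₇ = D-φ 7 L

  D𝓔 : D 𝓔 ≋ const (+ 196) * M₇ - const (+ 4) * D L
  D𝓔 = ≋-trans (D-+ _ _) (≋-trans (+-cong (≋-trans (D-+ _ _) (+-cong (D-const (+ 1)) (≋-trans (D-scale (+ 28) L₇) (*-congˡ DL₇)))) (≋-trans (D-neg _) (-‿cong (D-scale (+ 4) L))))
    (solve 2 (λ m d → con (+ 0) :+ con (+ 28) :* (con (+ 7) :* m) :- con (+ 4) :* d := con (+ 196) :* m :- con (+ 4) :* d) ≋-refl M₇ (D L)))

  DZ : D Z ≋ const (+ 14) * (L - L₇) * Z
  DZ = ≋-trans (D-* _ _) (≋-trans (+-cong (*-congʳ (D-^suc E L 14 (≋-trans DE≋E*L (*-comm E L)))) (*-congˡ (D-^suc p₇ (- (const (+ 7) * L₇)) 2 Dp₇)))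
    (solve 4 (λ e p l l₇ → con (+ 14) :* l :* e :* p :+ e :* (con (+ 2) :* :- (con (+ 7) :* l₇) :* p) := con (+ 14) :* (l :- l₇) :* (e :* p)) ≋-refl (E ^ 14) (p₇ ^ 2) L L₇))
    where
    Dp₇ : D p₇ ≋ - (const (+ 7) * L₇) * p₇
    Dp₇ = ≋-trans (D-φ 7 p) (≋-trans (*-congˡ (≋-trans (φ-cong 7 Dp) (≋-trans (φ-neg 7 _) (-‿cong (φ-* 7 L p))))) (solve 2 (λ l p → con (+ 7) :* :- (l :* p) := :- (con (+ 7) :* l) :* p) ≋-refl L₇ p₇))

  -- The logarithmic derivative of 𝓔³ = Z Q².
  3QD𝓔 : const (+ 3) * (Q * D 𝓔) ≋ 𝓔 * (const (+ 14) * (L - L₇) * Q + const (+ 2) * (tQ′ * 𝓔))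
  3QD𝓔 = 𝓔-cancel 2 (begin
    𝓔 ^ 2 * (const (+ 3) * (Q * D 𝓔)) ≈⟨ solve 3 (λ e w d → e :^ 2 :* (con (+ 3) :* (w :* d)) := w :* (con (+ 3) :* e :^ 2 :* d)) ≋-refl 𝓔 Q (D 𝓔) ⟩
    Q * (const (+ 3) * 𝓔 ^ 2 * D 𝓔) ≈⟨ *-congˡ (≋-trans (≋-sym (D-^3 𝓔)) (≋-trans (D-cong CubicIdentity.𝓔³) (≋-trans (D-* Z (Q ^ 2)) (+-cong (*-congʳ DZ) (*-congˡ (≋-trans (D-^2 Q) (*-congˡ DQ))))))) ⟩
    Q * (const (+ 14) * (L - L₇) * Z * Q ^ 2 + Z * (const (+ 2) * Q * (tQ′ * 𝓔)))
      ≈⟨ solve 6 (λ w l l₇ z t e → w :* (con (+ 14) :* (l :- l₇) :* z :* w :^ 2 :+ z :* (con (+ 2) :* w :* (t :* e))) := (z :* w :^ 2) :* (con (+ 14) :* (l :- l₇) :* w :+ con (+ 2) :* (t :* e))) ≋-refl Q L L₇ Z tQ′ 𝓔 ⟩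
    Z * Q ^ 2 * (const (+ 14) * (L - L₇) * Q + const (+ 2) * (tQ′ * 𝓔)) ≈⟨ *-congʳ CubicIdentity.𝓔³ ⟨
    𝓔 ^ 3 * (const (+ 14) * (L - L₇) * Q + const (+ 2) * (tQ′ * 𝓔)) ≈⟨ solve 2 (λ e x → e :^ 3 :* x := e :^ 2 :* (e :* x)) ≋-refl 𝓔 _ ⟩
    𝓔 ^ 2 * (𝓔 * (const (+ 14) * (L - L₇) * Q + const (+ 2) * (tQ′ * 𝓔))) ∎)

  -- Ramanujan's formula P² - 12 D P, where P = 1 + 24 L is the Eisenstein series of weight 2.
  E₄ : Series
  E₄ = (1# + const (+ 24) * L) ^ 2 - const (+ 288) * D L

  φE₄ : φ 7 E₄ ≋ (1# + const (+ 24) * L₇) ^ 2 - const (+ 288) * M₇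
  φE₄ = ≋-trans (φ-+ 7 _ _) (+-cong (≋-trans (φ-^ 7 _ 2) (^-congˡ 2 (≋-trans (φ-+ 7 _ _) (+-cong (φ-const 7 (+ 1)) (φ-scale 7 (+ 24) L))))) (≋-trans (φ-neg 7 _) (-‿cong (φ-scale 7 (+ 288) (D L)))))

  -- The derivatives of L in E₄ - 49 E₄(q^7) combine to 72 D 𝓔, which `3QD𝓔` expresses without
  -- derivatives; the remaining L and L₇ then combine to 𝓔².
  E₄-step : Q * (E₄ - const (+ 49) * φ 7 E₄) ≋ const (+ 48) * 𝓔 ^ 2 * (const (+ 49) * t₀ ^ 2 - 1#)
  E₄-step = begin
    Q * (E₄ - const (+ 49) * φ 7 E₄) ≈⟨ *-congˡ (+-congˡ (-‿cong (*-congˡ φE₄))) ⟩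
    Q * (E₄ - const (+ 49) * ((1# + const (+ 24) * L₇) ^ 2 - const (+ 288) * M₇))
      ≈⟨ solve 5 (λ w l l₇ d m → w :* ((con (+ 1) :+ con (+ 24) :* l) :^ 2 :- con (+ 288) :* d :- con (+ 49) :* ((con (+ 1) :+ con (+ 24) :* l₇) :^ 2 :- con (+ 288) :* m))
           := w :* ((con (+ 1) :+ con (+ 24) :* l) :^ 2 :- con (+ 49) :* (con (+ 1) :+ con (+ 24) :* l₇) :^ 2) :+ con (+ 72) :* (w :* (con (+ 196) :* m :- con (+ 4) :* d))) ≋-refl Q L L₇ (D L) M₇ ⟩
    Q * ((1# + const (+ 24) * L) ^ 2 - const (+ 49) * (1# + const (+ 24) * L₇) ^ 2) + const (+ 72) * (Q * (const (+ 196) * M₇ - const (+ 4) * D L))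
      ≈⟨ +-congˡ (≋-trans (*-congˡ (*-congˡ (≋-sym D𝓔))) (≋-trans (solve 1 (λ x → con (+ 72) :* x := con (+ 24) :* (con (+ 3) :* x)) ≋-refl (Q * D 𝓔)) (*-congˡ 3QD𝓔))) ⟩
    Q * ((1# + const (+ 24) * L) ^ 2 - const (+ 49) * (1# + const (+ 24) * L₇) ^ 2) + const (+ 24) * (𝓔 * (const (+ 14) * (L - L₇) * Q + const (+ 2) * (tQ′ * 𝓔)))
      ≈⟨ prove (L ∷ L₇ ∷ t₀ ∷ []) (:q :* ((con (+ 1) :+ con (+ 24) :* l) :^ 2 :- con (+ 49) :* (con (+ 1) :+ con (+ 24) :* l₇) :^ 2)
             :+ con (+ 24) :* (:e :* (con (+ 14) :* (l :- l₇) :* :q :+ con (+ 2) :* ((con (+ 13) :* t :+ con (+ 98) :* t :^ 2) :* :e))))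
           (con (+ 48) :* :e :^ 2 :* (con (+ 49) :* t :^ 2 :- con (+ 1))) ≋-refl ⟩
    const (+ 48) * 𝓔 ^ 2 * (const (+ 49) * t₀ ^ 2 - 1#) ∎
    where
    l l₇ t :q :e : Polynomial 3
    l = var zero
    l₇ = var (suc zero)
    t = var (suc (suc zero))
    :q = con (+ 1) :+ con (+ 13) :* t :+ con (+ 49) :* t :^ 2
    :e = con (+ 1) :+ con (+ 28) :* l₇ :- con (+ 4) :* l

  -- The counterpart of r for E₄(q^7): t² r(1 / (49 t)), the image of r under the Fricke involution.
  five : Series
  five = 1# + const (+ 5) * t₀ + t₀ ^ 2

  five-step : Q₁ * 𝓔 ^ 2 * five ≋ Q * 𝓔₁ ^ 2 * r₁
  five-step = t₀^-cancel 2 (unit-cancel :u ≡.refl 2 (begin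
    u ^ 2 * (t₀ ^ 2 * (Q₁ * 𝓔 ^ 2 * five)) ≈⟨ solve 5 (λ u t w e f → u :^ 2 :* (t :^ 2 :* (w :* e :^ 2 :* f)) := (u :* e) :^ 2 :* ((t :^ 2 :* w) :* f)) ≋-refl u t₀ Q₁ 𝓔 five ⟩
    (u * 𝓔) ^ 2 * ((t₀ ^ 2 * Q₁) * five) ≈⟨ *-cong (^-congˡ 2 𝓔-ratio) (*-congʳ t₀²Q₁) ⟩
    (ψ * 𝓔₁) ^ 2 * (⟦ :t₀²Q₁ ⟧ σ₂ * five) ≈⟨ solve 3 (λ x e w → (x :* e) :^ 2 :* w := e :^ 2 :* (x :^ 2 :* w)) ≋-refl ψ 𝓔₁ (⟦ :t₀²Q₁ ⟧ σ₂ * five) ⟩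
    𝓔₁ ^ 2 * (ψ ^ 2 * (⟦ :t₀²Q₁ ⟧ σ₂ * five)) ≈⟨ *-congˡ identity₂ ⟩
    𝓔₁ ^ 2 * (u ^ 2 * (Q * ⟦ :t₀²r₁ ⟧ σ₂)) ≈⟨ *-congˡ (*-congˡ (*-congˡ t₀²r₁)) ⟨
    𝓔₁ ^ 2 * (u ^ 2 * (Q * (t₀ ^ 2 * r₁))) ≈⟨ solve 5 (λ e u w t r → e :^ 2 :* (u :^ 2 :* (w :* (t :^ 2 :* r))) := u :^ 2 :* (t :^ 2 :* (w :* e :^ 2 :* r))) ≋-refl 𝓔₁ u Q t₀ r₁ ⟩
    u ^ 2 * (t₀ ^ 2 * (Q * 𝓔₁ ^ 2 * r₁)) ∎))

  -- By `E₄-step`, the defect Δ equals 49 times Q E₄(q^7) - 𝓔² five. Multiplied by Q₁ and rewritten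
  -- with `five-step`, this is 49 Q times Δ(q^7), so `φ-rigid` applies.
  Q*E₄ : Q * E₄ ≋ 𝓔 ^ 2 * r
  Q*E₄ = ≋-trans (solve 2 (λ x y → x := (x :- y) :+ y) ≋-refl (Q * E₄) (𝓔 ^ 2 * r)) (≋-trans (+-congʳ difference) (+-identityˡ _))
    where
    Δ : Series
    Δ = Q * E₄ - 𝓔 ^ 2 * r
    φΔ : φ 7 Δ ≋ Q₁ * φ 7 E₄ - 𝓔₁ ^ 2 * r₁
    φΔ = ≋-trans (φ-+ 7 _ _) (+-cong (φ-* 7 Q E₄) (≋-trans (φ-neg 7 _) (-‿cong (≋-trans (φ-* 7 _ r) (*-congʳ (φ-^ 7 𝓔 2))))))
    r-five : r - const (+ 48) * (const (+ 49) * t₀ ^ 2 - 1#) ≋ const (+ 49) * five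
    r-five = solve 1 (λ t → con (+ 1) :+ con (+ 245) :* t :+ con (+ 2401) :* t :^ 2 :- con (+ 48) :* (con (+ 49) :* t :^ 2 :- con (+ 1)) := con (+ 49) :* (con (+ 1) :+ con (+ 5) :* t :+ t :^ 2)) ≋-refl t₀
    twisted : Q₁ * Δ ≋ φ 7 Δ * (const (+ 49) * Q)
    twisted = begin
      Q₁ * (Q * E₄ - 𝓔 ^ 2 * r) ≈⟨ solve 7 (λ w₁ w f g e r x → w₁ :* (w :* f :- e :^ 2 :* r) := w₁ :* (w :* (f :- con (+ 49) :* g)) :+ con (+ 49) :* (w₁ :* w :* g) :- w₁ :* e :^ 2 :* r) ≋-refl Q₁ Q E₄ (φ 7 E₄) 𝓔 r t₀ ⟩
      Q₁ * (Q * (E₄ - const (+ 49) * φ 7 E₄)) + const (+ 49) * (Q₁ * Q * φ 7 E₄) - Q₁ * 𝓔 ^ 2 * r ≈⟨ +-congʳ (+-congʳ (*-congˡ E₄-step)) ⟩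
      Q₁ * (const (+ 48) * 𝓔 ^ 2 * (const (+ 49) * t₀ ^ 2 - 1#)) + const (+ 49) * (Q₁ * Q * φ 7 E₄) - Q₁ * 𝓔 ^ 2 * r
        ≈⟨ solve 6 (λ w₁ e x g r w → w₁ :* (con (+ 48) :* e :^ 2 :* x) :+ con (+ 49) :* (w₁ :* w :* g) :- w₁ :* e :^ 2 :* r := con (+ 49) :* (w₁ :* w :* g) :- w₁ :* e :^ 2 :* (r :- con (+ 48) :* x)) ≋-refl Q₁ 𝓔 (const (+ 49) * t₀ ^ 2 - 1#) (φ 7 E₄) r Q ⟩
      const (+ 49) * (Q₁ * Q * φ 7 E₄) - Q₁ * 𝓔 ^ 2 * (r - const (+ 48) * (const (+ 49) * t₀ ^ 2 - 1#)) ≈⟨ +-congˡ (-‿cong (*-congˡ r-five)) ⟩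
      const (+ 49) * (Q₁ * Q * φ 7 E₄) - Q₁ * 𝓔 ^ 2 * (const (+ 49) * five) ≈⟨ solve 5 (λ w₁ w g e f → con (+ 49) :* (w₁ :* w :* g) :- w₁ :* e :^ 2 :* (con (+ 49) :* f) := con (+ 49) :* (w₁ :* w :* g) :- con (+ 49) :* (w₁ :* e :^ 2 :* f)) ≋-refl Q₁ Q (φ 7 E₄) 𝓔 five ⟩
      const (+ 49) * (Q₁ * Q * φ 7 E₄) - const (+ 49) * (Q₁ * 𝓔 ^ 2 * five) ≈⟨ +-congˡ (-‿cong (*-congˡ five-step)) ⟩
      const (+ 49) * (Q₁ * Q * φ 7 E₄) - const (+ 49) * (Q * 𝓔₁ ^ 2 * r₁) ≈⟨ solve 5 (λ w₁ w g e r → con (+ 49) :* (w₁ :* w :* g) :- con (+ 49) :* (w :* e :^ 2 :* r) := (w₁ :* g :- e :^ 2 :* r) :* (con (+ 49) :* w)) ≋-refl Q₁ Q (φ 7 E₄) 𝓔₁ r₁ ⟩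
      (Q₁ * φ 7 E₄ - 𝓔₁ ^ 2 * r₁) * (const (+ 49) * Q) ≈⟨ *-congʳ φΔ ⟨
      φ 7 Δ * (const (+ 49) * Q) ∎
    E₄-at-0 : E₄ 0 ≡ + 1
    E₄-at-0 = ⟦⟧-at-0 (L ∷ D L ∷ []) (λ { zero → L-at-0 ; (suc zero) → D-at L 0 }) ((con (+ 1) :+ con (+ 24) :* var zero) :^ 2 :- con (+ 288) :* var (suc zero))
    difference : Δ ≋ 0#
    difference = φ-rigid {Q₁} {const (+ 49) * Q} {Δ} {{≡.subst ℤ.NonZero (≡.sym (≡.trans (φ-at-0 7 Q) (σ₂-at-0 :Q))) _}} twisted
      (≡.trans (+-at _ _ 0) (≡.cong₂ ℤ._+_ (≡.trans (*-at-0 Q E₄) (≡.cong₂ ℤ._*_ (σ₂-at-0 :Q) E₄-at-0))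
        (≡.trans (neg-at _ 0) (≡.cong ℤ.-_ (≡.trans (*-at-0 _ r) (≡.cong₂ ℤ._*_ (≡.trans (*-at-0 𝓔 _) (≡.cong₂ ℤ._*_ 𝓔-at-0 (≡.trans (*-at-0 𝓔 _) (≡.cong₂ ℤ._*_ 𝓔-at-0 (const-zero (+ 1)))))) (σ₂-at-0 :r)))))))

  -- Apart from signs the coefficients are 1, 10 * 7², 9 * 7⁴, 2 * 7⁶ and 7⁷.
  R-poly : Poly
  R-poly = + 1 ∷ -[1+ 489 ] ∷ -[1+ 21608 ] ∷ -[1+ 235297 ] ∷ -[1+ 823542 ] ∷ []

  -- E₆ = P E₄ - 3 D E₄ with P = 1 + 24 L, and D E₄ is found by differentiating `Q*E₄`.
  -- Multiplication by Q² clears the denominators.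
  E6≋Z*R : E6coeff ≋ Z * eval R-poly t₀
  E6≋Z*R = ≋-trans E6≋E₆′ (unit-cancel :Q ≡.refl 2 (begin
    Q ^ 2 * E₆′ ≈⟨ solve 4 (λ w l d d₂ → w :^ 2 :* ((con (+ 1) :+ con (+ 24) :* l) :^ 3 :- con (+ 432) :* ((con (+ 1) :+ con (+ 24) :* l) :* d) :+ con (+ 864) :* d₂)
        := w :* (con (+ 1) :+ con (+ 24) :* l) :* (w :* ((con (+ 1) :+ con (+ 24) :* l) :^ 2 :- con (+ 288) :* d)) :- con (+ 3) :* w :* (w :* (con (+ 48) :* (con (+ 1) :+ con (+ 24) :* l) :* d :- con (+ 288) :* d₂))) ≋-refl Q L (D L) (D (D L)) ⟩
    Q * P * (Q * E₄) - const (+ 3) * Q * (Q * DE₄) ≈⟨ +-cong (*-congˡ Q*E₄) (-‿cong (*-congˡ QDE₄)) ⟩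
    Q * P * (𝓔 ^ 2 * r) - const (+ 3) * Q * (const (+ 2) * 𝓔 * D 𝓔 * r + 𝓔 ^ 2 * (tr′ * 𝓔) - tQ′ * 𝓔 * E₄)
      ≈⟨ solve 8 (λ w p e r d b a f → w :* p :* (e :^ 2 :* r) :- con (+ 3) :* w :* (con (+ 2) :* e :* d :* r :+ e :^ 2 :* (b :* e) :- a :* e :* f)
           := w :* p :* (e :^ 2 :* r) :- con (+ 2) :* e :* r :* (con (+ 3) :* (w :* d)) :- con (+ 3) :* w :* b :* e :^ 3 :+ con (+ 3) :* a :* e :* (w :* f)) ≋-refl Q P 𝓔 r (D 𝓔) tr′ tQ′ E₄ ⟩
    Q * P * (𝓔 ^ 2 * r) - const (+ 2) * 𝓔 * r * (const (+ 3) * (Q * D 𝓔)) - const (+ 3) * Q * tr′ * 𝓔 ^ 3 + const (+ 3) * tQ′ * 𝓔 * (Q * E₄)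
      ≈⟨ +-cong (+-congʳ (+-congˡ (-‿cong (*-congˡ 3QD𝓔)))) (*-congˡ Q*E₄) ⟩
    Q * P * (𝓔 ^ 2 * r) - const (+ 2) * 𝓔 * r * (𝓔 * (const (+ 14) * (L - L₇) * Q + const (+ 2) * (tQ′ * 𝓔))) - const (+ 3) * Q * tr′ * 𝓔 ^ 3 + const (+ 3) * tQ′ * 𝓔 * (𝓔 ^ 2 * r)
      ≈⟨ prove (L ∷ L₇ ∷ t₀ ∷ []) (:q :* :p :* (:e :^ 2 :* :ρ) :- con (+ 2) :* :e :* :ρ :* (:e :* (con (+ 14) :* (l :- l₇) :* :q :+ con (+ 2) :* (:a :* :e))) :- con (+ 3) :* :q :* :b :* :e :^ 3 :+ con (+ 3) :* :a :* :e :* (:e :^ 2 :* :ρ))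
           (:e :^ 3 :* :eval R-poly t) ≋-refl ⟩
    𝓔 ^ 3 * eval R-poly t₀ ≈⟨ *-congʳ CubicIdentity.𝓔³ ⟩
    Z * Q ^ 2 * eval R-poly t₀ ≈⟨ solve 3 (λ z w r → z :* w :* r := w :* (z :* r)) ≋-refl Z (Q ^ 2) (eval R-poly t₀) ⟩
    Q ^ 2 * (Z * eval R-poly t₀) ∎))
    where
    P DE₄ : Series
    P = 1# + const (+ 24) * L
    DE₄ = const (+ 48) * P * D L - const (+ 288) * D (D L)
    DE₄≋ : D E₄ ≋ DE₄
    DE₄≋ = ≋-trans (D-+ _ _) (≋-trans (+-cong (≋-trans (D-^2 P) (*-congˡ (≋-trans (D-+ _ _) (+-cong (D-const (+ 1)) (D-scale (+ 24) L))))) (≋-trans (D-neg _) (-‿cong (D-scale (+ 288) (D L)))))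
      (solve 3 (λ p d d₂ → con (+ 2) :* p :* (con (+ 0) :+ con (+ 24) :* d) :- con (+ 288) :* d₂ := con (+ 48) :* p :* d :- con (+ 288) :* d₂) ≋-refl P (D L) (D (D L))))
    QDE₄ : Q * DE₄ ≋ const (+ 2) * 𝓔 * D 𝓔 * r + 𝓔 ^ 2 * (tr′ * 𝓔) - tQ′ * 𝓔 * E₄
    QDE₄ = begin
      Q * DE₄ ≈⟨ solve 3 (λ w d x → w :* d := (x :+ w :* d) :- x) ≋-refl Q DE₄ (tQ′ * 𝓔 * E₄) ⟩
      (tQ′ * 𝓔 * E₄ + Q * DE₄) - tQ′ * 𝓔 * E₄ ≈⟨ +-congʳ (≋-trans (+-cong (*-congʳ (≋-sym DQ)) (*-congˡ (≋-sym DE₄≋))) (≋-sym (D-* Q E₄))) ⟩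
      D (Q * E₄) - tQ′ * 𝓔 * E₄ ≈⟨ +-congʳ (≋-trans (D-cong Q*E₄) (≋-trans (D-* _ r) (+-cong (*-congʳ (D-^2 𝓔)) (*-congˡ Dr)))) ⟩
      const (+ 2) * 𝓔 * D 𝓔 * r + 𝓔 ^ 2 * (tr′ * 𝓔) - tQ′ * 𝓔 * E₄ ∎
    l l₇ t :q :e :p :ρ :a :b : Polynomial 3
    l = var zero
    l₇ = var (suc zero)
    t = var (suc (suc zero))
    :q = con (+ 1) :+ con (+ 13) :* t :+ con (+ 49) :* t :^ 2
    :ρ = con (+ 1) :+ con (+ 245) :* t :+ con (+ 2401) :* t :^ 2
    :e = con (+ 1) :+ con (+ 28) :* l₇ :- con (+ 4) :* l
    :p = con (+ 1) :+ con (+ 24) :* l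
    :a = con (+ 13) :* t :+ con (+ 98) :* t :^ 2
    :b = con (+ 245) :* t :+ con (+ 4802) :* t :^ 2

-- Two applications of U as matrices acting on polynomials in t

module IteratedU where
  open SeriesRing
  open SeriesOperators
  open ResidueClasses
  open EulerProduct
  open EisensteinSeries
  open ModularEquation
  open NormEvaluation
  open PowersOfTau
  open EisensteinSix
  open import Data.Nat.Solver using () renaming (module +-*-Solver to ℕSolver)
  open import Data.List using ([]; _∷_; drop)
  open import Data.Integer.Divisibility.Signed using () renaming (_∣_ to _∣ₛ_)
  open import Data.Integer.Solver using (module +-*-Solver)
  open import Algebra.Properties.CommutativeSemiring.Exp (CommutativeRing.commutativeSemiring seriesRing) using (^-distrib-*)

  open Solver using (solve; _:+_; _:*_; _:^_; con; _:=_)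

  coeff : Poly → ℕ → ℤ
  coeff [] _ = + 0
  coeff (x ∷ f) zero = x
  coeff (x ∷ f) (suc j) = coeff f j

  coeff-⊞ : ∀ f g j → coeff (f ⊞ g) j ≡ coeff f j ℤ.+ coeff g j
  coeff-⊞ [] g j = ≡.sym (ℤP.+-identityˡ _)
  coeff-⊞ (x ∷ f) [] j = ≡.sym (ℤP.+-identityʳ _)
  coeff-⊞ (x ∷ f) (y ∷ g) zero = ≡.refl
  coeff-⊞ (x ∷ f) (y ∷ g) (suc j) = coeff-⊞ f g j

  coeff-· : ∀ c f j → coeff (c · f) j ≡ c ℤ.* coeff f j
  coeff-· c [] j = ≡.sym (ℤP.*-zeroʳ c)
  coeff-· c (x ∷ f) zero = ≡.refl
  coeff-· c (x ∷ f) (suc j) = coeff-· c f j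

  coeff-drop : ∀ i f j → coeff (drop i f) j ≡ coeff f (i ℕ.+ j)
  coeff-drop zero f j = ≡.refl
  coeff-drop (suc i) [] j = ≡.refl
  coeff-drop (suc i) (x ∷ f) j = coeff-drop i f j

  record Ord (o : ℕ) (f : Poly) : Set where
    constructor ord
    field below : ∀ j → j ℕ.< o → coeff f j ≡ + 0
  open Ord public

  eval-drop : ∀ i f t → Ord i f → eval f t ≋ t ^ i * eval (drop i f) t
  eval-drop zero f t h = ≋-sym (*-identityˡ _)
  eval-drop (suc i) [] t h = ≋-sym (zeroʳ _)
  eval-drop (suc i) (x ∷ f) t h with below h 0 (s≤s z≤n)
  ... | ≡.refl = ≋-trans (eval-shift f t) (≋-trans (*-congˡ (eval-drop i f t (ord λ j j<i → below h (suc j) (s≤s j<i)))) (≋-sym (*-assoc t (t ^ i) _)))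

  module Step where
    open ≋-Reasoning

    combine : (ℕ → Poly) → ℕ → Poly → Poly
    combine γ i [] = []
    combine γ i (x ∷ f) = x · γ i ⊞ combine γ (suc i) f

    -- The rows of the two matrices. Multiplication by t₁^i turns E^13 t₀^i into X (4 i), and by
    -- t₁^i m³ turns E^10 t₀^i into X (4 i + 3). Afterwards these factors are cancelled; m³ costs
    -- one more power of t₁ because W t₁ = m³ W′.
    γ δ′ : ℕ → Poly
    γ i = drop i (α (4 ℕ.* i))
    δ′ i = drop (suc i) (α (4 ℕ.* i ℕ.+ 3))

    t^-τ : ∀ i → t₁ ^ i * t₀ ^ i ≋ τ ^ (4 ℕ.* i)
    t^-τ i = ≋-trans (≋-trans (*-comm _ _) (≋-sym (^-distrib-* t₀ t₁ i))) (≋-trans (^-congˡ i t₀*t₁) (^-assocʳ τ 4 i))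

    Cls-t₁^ : ∀ i → Cls (i ℕ.* 0) (t₁ ^ i)
    Cls-t₁^ i = Cls-^ i (Cls-φ t₀)

    i*0≡₇ : ∀ i r → i ℕ.* 0 ℕ.+ r ≡₇ r
    i*0≡₇ i r rewrite ℕP.*-zeroʳ i = ≡.refl

    module _ (ord-γ : ∀ i → Ord i (α (4 ℕ.* i))) (ord-δ : ∀ i → Ord (suc i) (α (4 ℕ.* i ℕ.+ 3))) where

      pr-γ : ∀ i → pr 5 (E ^ 13 * t₀ ^ i) ≋ W * eval (γ i) t₁
      pr-γ i = t₁^-cancel i (begin
        t₁ ^ i * pr 5 (E ^ 13 * t₀ ^ i) ≈⟨ pr-*ˡ 5 5 _ (Cls-t₁^ i) (i*0≡₇ i 5) ⟨
        pr 5 (t₁ ^ i * (E ^ 13 * t₀ ^ i)) ≈⟨ pr-cong (≋-trans (solve 3 (λ a b c → a :* (b :* c) := b :* (a :* c)) ≋-refl (t₁ ^ i) (E ^ 13) (t₀ ^ i)) (*-congˡ (t^-τ i))) ⟩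
        pr 5 (X (4 ℕ.* i)) ≈⟨ pr-X (4 ℕ.* i) ⟩
        W * eval (α (4 ℕ.* i)) t₁ ≈⟨ *-congˡ (eval-drop i (α (4 ℕ.* i)) t₁ (ord-γ i)) ⟩
        W * (t₁ ^ i * eval (γ i) t₁) ≈⟨ solve 3 (λ a b c → a :* (b :* c) := b :* (a :* c)) ≋-refl W (t₁ ^ i) (eval (γ i) t₁) ⟩
        t₁ ^ i * (W * eval (γ i) t₁) ∎)

      W′ : Series
      W′ = q ^ 6 * (E₄₉ ^ 2 * E₇ ^ 8)

      W*t₁ : W * t₁ ≋ m ^ 3 * W′
      W*t₁ = ≋-trans (*-congˡ t₁≋) (≋-trans (solve 4 (λ q x e p → q :^ 5 :* (x :* e :^ 12) :* (q :^ 7 :* x :^ 4 :* p :^ 4) := (q :^ 2 :* x) :^ 3 :* (q :^ 6 :* (x :^ 2 :* e :^ 8)) :* (e :* p) :^ 4) ≋-refl q E₄₉ E₇ p₇)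
        (*-1# _ (^-1# 4 E₇*p₇)))

      m³-cancel : ∀ {x y} → m ^ 3 * x ≋ m ^ 3 * y → x ≋ y
      m³-cancel {x} {y} h = τ-cancel (τ-cancel (τ-cancel (begin
        τ * (τ * (τ * x)) ≈⟨ solve 3 (λ m p x → (m :* p) :* ((m :* p) :* ((m :* p) :* x)) := p :^ 3 :* (m :^ 3 :* x)) ≋-refl m p x ⟩
        p ^ 3 * (m ^ 3 * x) ≈⟨ *-congˡ h ⟩
        p ^ 3 * (m ^ 3 * y) ≈⟨ solve 3 (λ m p x → (m :* p) :* ((m :* p) :* ((m :* p) :* x)) := p :^ 3 :* (m :^ 3 :* x)) ≋-refl m p y ⟨
        τ * (τ * (τ * y)) ∎)))

      pr-δ : ∀ i → pr 6 (E ^ 10 * t₀ ^ i) ≋ W′ * eval (δ′ i) t₁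
      pr-δ i = m³-cancel (t₁^-cancel i (begin
        t₁ ^ i * (m ^ 3 * pr 6 (E ^ 10 * t₀ ^ i)) ≈⟨ *-congˡ (pr-*ˡ 6 5 _ (Cls-^ 3 Cls-m) ≡.refl) ⟨
        t₁ ^ i * pr 5 (m ^ 3 * (E ^ 10 * t₀ ^ i)) ≈⟨ pr-*ˡ 5 5 _ (Cls-t₁^ i) (i*0≡₇ i 5) ⟨
        pr 5 (t₁ ^ i * (m ^ 3 * (E ^ 10 * t₀ ^ i))) ≈⟨ pr-cong regroup ⟩
        pr 5 (X (4 ℕ.* i ℕ.+ 3)) ≈⟨ pr-X (4 ℕ.* i ℕ.+ 3) ⟩
        W * eval (α (4 ℕ.* i ℕ.+ 3)) t₁ ≈⟨ *-congˡ (eval-drop (suc i) (α (4 ℕ.* i ℕ.+ 3)) t₁ (ord-δ i)) ⟩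
        W * (t₁ ^ suc i * eval (δ′ i) t₁) ≈⟨ solve 4 (λ w t r e → w :* (t :* r :* e) := r :* ((w :* t) :* e)) ≋-refl W t₁ (t₁ ^ i) (eval (δ′ i) t₁) ⟩
        t₁ ^ i * ((W * t₁) * eval (δ′ i) t₁) ≈⟨ *-congˡ (≋-trans (*-congʳ W*t₁) (*-assoc _ _ _)) ⟩
        t₁ ^ i * (m ^ 3 * (W′ * eval (δ′ i) t₁)) ∎))
        where
        regroup : t₁ ^ i * (m ^ 3 * (E ^ 10 * t₀ ^ i)) ≋ X (4 ℕ.* i ℕ.+ 3)
        regroup = begin
          t₁ ^ i * (m ^ 3 * (E ^ 10 * t₀ ^ i)) ≈⟨ *-1# _ (^-1# 3 E*partition) ⟨
          t₁ ^ i * (m ^ 3 * (E ^ 10 * t₀ ^ i)) * (E * p) ^ 3 ≈⟨ solve 5 (λ a m e b p → a :* (m :^ 3 :* (e :^ 10 :* b)) :* (e :* p) :^ 3 := e :^ 13 :* ((a :* b) :* (m :* p) :^ 3)) ≋-refl (t₁ ^ i) m E (t₀ ^ i) p ⟩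
          E ^ 13 * ((t₁ ^ i * t₀ ^ i) * τ ^ 3) ≈⟨ *-congˡ (≋-trans (*-congʳ (t^-τ i)) (≋-sym (^-homo-* τ (4 ℕ.* i) 3))) ⟩
          X (4 ℕ.* i ℕ.+ 3) ∎

      pr-combine : ∀ r A B (η : ℕ → Poly) → (∀ i → pr r (A * t₀ ^ i) ≋ B * eval (η i) t₁) →
        ∀ f i → pr r (A * (t₀ ^ i * eval f t₀)) ≋ B * eval (combine η i f) t₁
      pr-combine r A B η h [] i = ≋-trans (pr-cong (solve 2 (λ a b → a :* (b :* con (+ 0)) := con (+ 0)) ≋-refl A (t₀ ^ i))) (≋-trans (pr-0 r) (≋-sym (zeroʳ B)))
      pr-combine r A B η h (x ∷ f) i = begin
        pr r (A * (t₀ ^ i * (const x + t₀ * eval f t₀)))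
          ≈⟨ pr-cong (solve 5 (λ a b x t f → a :* (b :* (x :+ t :* f)) := x :* (a :* b) :+ a :* (t :* b :* f)) ≋-refl A (t₀ ^ i) (const x) t₀ (eval f t₀)) ⟩
        pr r (const x * (A * t₀ ^ i) + A * (t₀ ^ suc i * eval f t₀)) ≈⟨ pr-+ r _ _ ⟩
        pr r (const x * (A * t₀ ^ i)) + pr r (A * (t₀ ^ suc i * eval f t₀)) ≈⟨ +-cong (≋-trans (pr-scale r x _) (*-congˡ (h i))) (pr-combine r A B η h f (suc i)) ⟩
        const x * (B * eval (η i) t₁) + B * eval (combine η (suc i) f) t₁
          ≈⟨ solve 4 (λ x b e g → x :* (b :* e) :+ b :* g := b :* (x :* e :+ g)) ≋-refl (const x) B (eval (η i) t₁) (eval (combine η (suc i) f) t₁) ⟩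
        B * (const x * eval (η i) t₁ + eval (combine η (suc i) f) t₁) ≈⟨ *-congˡ (≋-trans (eval-⊞ (x · η i) _ t₁) (+-congʳ (eval-· x (η i) t₁))) ⟨
        B * eval (combine η i (x ∷ f)) t₁ ∎

      -- U maps G f to G₁ of a polynomial, and that to G₂ of a polynomial; by t₀ η(z)^13 / η(7 z)² = η(z)^9 η(7 z)²,
      -- G₂ g is G of t g, up to a shift.
      G G₁ G₂ : Poly → Series
      G f = E ^ 13 * p₇ ^ 2 * eval f t₀
      G₁ f = E ^ 10 * E₇ * eval f t₀
      G₂ f = E ^ 9 * E₇ ^ 2 * eval f t₀

      U-G : ∀ f n → G f (n ℕ.* 7 ℕ.+ 5) ≡ G₁ (combine γ 0 f) n
      U-G f = pr⇒coefficients 5 (begin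
        pr 5 (E ^ 13 * p₇ ^ 2 * eval f t₀) ≈⟨ pr-cong (solve 3 (λ e p f → e :* p :* f := p :* (e :* (con (+ 1) :* f))) ≋-refl (E ^ 13) (p₇ ^ 2) (eval f t₀)) ⟩
        pr 5 (p₇ ^ 2 * (E ^ 13 * (t₀ ^ 0 * eval f t₀))) ≈⟨ pr-*ˡ 5 5 _ (Cls-^ 2 (Cls-φ p)) ≡.refl ⟩
        p₇ ^ 2 * pr 5 (E ^ 13 * (t₀ ^ 0 * eval f t₀)) ≈⟨ *-congˡ (pr-combine 5 (E ^ 13) W γ pr-γ f 0) ⟩
        p₇ ^ 2 * (W * eval g t₁) ≈⟨ solve 5 (λ p q x e f → p :^ 2 :* (q :^ 5 :* (x :* e :^ 12) :* f) := q :^ 5 :* (e :^ 10 :* x :* f) :* (e :* p) :^ 2) ≋-refl p₇ q E₄₉ E₇ (eval g t₁) ⟩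
        q ^ 5 * (E₇ ^ 10 * E₄₉ * eval g t₁) * (E₇ * p₇) ^ 2 ≈⟨ *-1# _ (^-1# 2 E₇*p₇) ⟩
        q ^ 5 * (E₇ ^ 10 * E₄₉ * eval g t₁) ≈⟨ *-congˡ (≋-trans (φ-* 7 _ _) (*-cong (≋-trans (φ-* 7 _ _) (*-congʳ (φ-^ 7 E 10))) (φ-eval 7 g t₀))) ⟨
        q ^ 5 * φ 7 (G₁ g) ∎)
        where
        g = combine γ 0 f

      U-G₁ : ∀ f n → G₁ f (n ℕ.* 7 ℕ.+ 6) ≡ G₂ (combine δ′ 0 f) n
      U-G₁ f = pr⇒coefficients 6 (begin
        pr 6 (E ^ 10 * E₇ * eval f t₀) ≈⟨ pr-cong (solve 3 (λ e p f → e :* p :* f := p :* (e :* (con (+ 1) :* f))) ≋-refl (E ^ 10) E₇ (eval f t₀)) ⟩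
        pr 6 (E₇ * (E ^ 10 * (t₀ ^ 0 * eval f t₀))) ≈⟨ pr-*ˡ 6 6 _ (Cls-φ E) ≡.refl ⟩
        E₇ * pr 6 (E ^ 10 * (t₀ ^ 0 * eval f t₀)) ≈⟨ *-congˡ (pr-combine 6 (E ^ 10) W′ δ′ pr-δ f 0) ⟩
        E₇ * (W′ * eval g t₁) ≈⟨ solve 4 (λ q x e f → e :* (q :^ 6 :* (x :^ 2 :* e :^ 8) :* f) := q :^ 6 :* (e :^ 9 :* x :^ 2 :* f)) ≋-refl q E₄₉ E₇ (eval g t₁) ⟩
        q ^ 6 * (E₇ ^ 9 * E₄₉ ^ 2 * eval g t₁) ≈⟨ *-congˡ (≋-trans (φ-* 7 _ _) (*-cong (≋-trans (φ-* 7 _ _) (*-cong (φ-^ 7 E 9) (φ-^ 7 E₇ 2))) (φ-eval 7 g t₀))) ⟨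
        q ^ 6 * φ 7 (G₂ g) ∎)
        where
        g = combine δ′ 0 f

      G-shift : ∀ f n → G (+ 0 ∷ f) (suc n) ≡ G₂ f n
      G-shift f n = ≡.trans (at eq (suc n)) (q*-suc (G₂ f) n)
        where
        eq : G (+ 0 ∷ f) ≋ q * G₂ f
        eq = begin
          E ^ 13 * p₇ ^ 2 * eval (+ 0 ∷ f) t₀ ≈⟨ *-congˡ (eval-shift f t₀) ⟩
          E ^ 13 * p₇ ^ 2 * (q * E₇ ^ 4 * p ^ 4 * eval f t₀) ≈⟨ solve 6 (λ e p₇ q e₇ p f → e :^ 13 :* p₇ :^ 2 :* (q :* e₇ :^ 4 :* p :^ 4 :* f) := q :* (e :^ 9 :* e₇ :^ 2 :* f) :* ((e :* p) :^ 4 :* (e₇ :* p₇) :^ 2)) ≋-refl E p₇ q E₇ p (eval f t₀) ⟩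
          q * G₂ f * ((E * p) ^ 4 * (E₇ * p₇) ^ 2) ≈⟨ *-1# _ (≋-trans (*-cong (^-1# 4 E*partition) (^-1# 2 E₇*p₇)) (*-identityˡ 1#)) ⟩
          q * G₂ f ∎

      next : Poly → Poly
      next f = + 0 ∷ combine δ′ 0 (combine γ 0 f)

      U²-G : ∀ f n → G f ((n ℕ.* 7 ℕ.+ 6) ℕ.* 7 ℕ.+ 5) ≡ G (next f) (suc n)
      U²-G f n = ≡.trans (U-G f (n ℕ.* 7 ℕ.+ 6)) (≡.trans (U-G₁ (combine γ 0 f) n) (≡.sym (G-shift (combine δ′ 0 (combine γ 0 f)) n)))

      e6-G : ∀ n → e6 n ≡ G R-poly n
      e6-G n = ≡.trans (≡.sym (*-at E6coeff p n)) (at (begin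
        E6coeff * p ≈⟨ *-congʳ E6≋Z*R ⟩
        E ^ 14 * p₇ ^ 2 * eval R-poly t₀ * p ≈⟨ solve 4 (λ e p₇ f p → e :^ 14 :* p₇ :^ 2 :* f :* p := e :^ 13 :* p₇ :^ 2 :* f :* (e :* p)) ≋-refl E p₇ (eval R-poly t₀) p ⟩
        G R-poly * (E * p) ≈⟨ *-1# _ E*partition ⟩
        G R-poly ∎) n)

-- Valuations of the matrices and the final induction

module SevenAdicEstimates where
  open import Data.Bool using (T)
  open SeriesRing
  open EulerProduct
  open NormEvaluation
  open PowersOfTau
  open EisensteinSix
  open IteratedU
  open import Data.Nat.Solver using () renaming (module +-*-Solver to ℕSolver)
  import Data.Nat.Divisibility as ℕD
  open import Data.List using ([]; _∷_; length)
  import Data.Integer.Divisibility as ℤD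
  open import Data.Integer.Divisibility.Signed using (divides; ∣⇒∣ᵤ; _∣?_) renaming (_∣_ to _∣ₛ_)
  open import Data.Integer.Solver using (module +-*-Solver)

  open Solver using (solve; _:+_; _:*_; con; _:=_)
  open Step

  infix 4 7^_∣_
  7^_∣_ : ℕ → ℤ → Set
  7^ e ∣ x = + (7 ℕ.^ e) ∣ₛ x

  7^∣0 : ∀ e → 7^ e ∣ + 0
  7^∣0 e = divides (+ 0) ≡.refl

  7^∣-≤ : ∀ {e e′ x} → e ℕ.≤ e′ → 7^ e′ ∣ x → 7^ e ∣ x
  7^∣-≤ {e} {e′} {x} e≤e′ (divides k eq) with ℕP.m≤n⇒∃[o]m+o≡n e≤e′
  ... | d , ≡.refl = divides (k ℤ.* + (7 ℕ.^ d)) (≡.trans eq (≡.trans (≡.cong (k ℤ.*_) (≡.trans (≡.cong +_ (≡.trans (ℕP.^-distribˡ-+-* 7 e d) (ℕP.*-comm (7 ℕ.^ e) (7 ℕ.^ d)))) (ℤP.pos-* (7 ℕ.^ d) (7 ℕ.^ e))))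
    (≡.sym (ℤP.*-assoc k _ _))))

  7^∣-+ : ∀ {e x y} → 7^ e ∣ x → 7^ e ∣ y → 7^ e ∣ x ℤ.+ y
  7^∣-+ (divides k eq) (divides l eq′) = divides (k ℤ.+ l) (≡.trans (≡.cong₂ ℤ._+_ eq eq′) (≡.sym (ℤP.*-distribʳ-+ _ k l)))

  7^∣-* : ∀ {a b x y} → 7^ a ∣ x → 7^ b ∣ y → 7^ (a ℕ.+ b) ∣ x ℤ.* y
  7^∣-* {a} {b} (divides k eq) (divides l eq′) = divides (k ℤ.* l) (≡.trans (≡.cong₂ ℤ._*_ eq eq′)
    (≡.trans (+-*-Solver.solve 4 (λ k l a b → k :*ℤ a :*ℤ (l :*ℤ b) :=ℤ k :*ℤ l :*ℤ (a :*ℤ b)) ≡.refl k l (+ (7 ℕ.^ a)) (+ (7 ℕ.^ b)))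
      (≡.cong (k ℤ.* l ℤ.*_) (≡.trans (≡.sym (ℤP.pos-* (7 ℕ.^ a) (7 ℕ.^ b))) (≡.cong +_ (≡.sym (ℕP.^-distribˡ-+-* 7 a b)))))))
    where open +-*-Solver using () renaming (_:*_ to _:*ℤ_; _:=_ to _:=ℤ_)

  -- v is the number of factors 7 by which the coefficient of t^j may fall short of 7^j.
  -- Multiplication by t raises it by one and a factor 7 lowers it by one.
  record Val (v : ℕ) (f : Poly) : Set where
    constructor val
    field divisible : ∀ j → 7^ (j ℕ.∸ v) ∣ coeff f j
  open Val

  Val-≤ : ∀ {v v′ f} → v ℕ.≤ v′ → Val v f → Val v′ f
  Val-≤ {v} {v′} v≤v′ h = val λ j → 7^∣-≤ (ℕP.∸-monoʳ-≤ j v≤v′) (divisible h j)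

  Val-⊞ : ∀ {v f g} → Val v f → Val v g → Val v (f ⊞ g)
  Val-⊞ {v} {f} {g} h k = val λ j → ≡.subst (7^ (j ℕ.∸ v) ∣_) (≡.sym (coeff-⊞ f g j)) (7^∣-+ {j ℕ.∸ v} (divisible h j) (divisible k j))

  Val-· : ∀ e {c v f} → 7^ e ∣ c → Val (e ℕ.+ v) f → Val v (c · f)
  Val-· e {c} {v} {f} d h = val λ j → ≡.subst (7^ (j ℕ.∸ v) ∣_) (≡.sym (coeff-· c f j)) (7^∣-≤ (bound j) (7^∣-* {e} d (divisible h j)))
    where
    bound : ∀ j → j ℕ.∸ v ℕ.≤ e ℕ.+ (j ℕ.∸ (e ℕ.+ v))
    bound j = ℕP.≤-trans (ℕP.m≤n+m∸n (j ℕ.∸ v) e) (ℕP.≤-reflexive (≡.cong (e ℕ.+_) (≡.trans (ℕP.∸-+-assoc j v e) (≡.cong (j ℕ.∸_) (ℕP.+-comm v e)))))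

  Val-shift : ∀ {v f} → Val v f → Val (suc v) (+ 0 ∷ f)
  Val-shift h = val λ { zero → 7^∣0 0 ; (suc j) → divisible h j }

  Ord-≤ : ∀ {o o′ f} → o ℕ.≤ o′ → Ord o′ f → Ord o f
  Ord-≤ o≤o′ h = ord λ j j<o → below h j (ℕP.≤-trans j<o o≤o′)

  Ord-⊞ : ∀ {o f g} → Ord o f → Ord o g → Ord o (f ⊞ g)
  Ord-⊞ {o} {f} {g} h k = ord λ j j<o → ≡.trans (coeff-⊞ f g j) (≡.cong₂ ℤ._+_ (below h j j<o) (below k j j<o))

  Ord-· : ∀ {o f} c → Ord o f → Ord o (c · f)
  Ord-· {o} {f} c h = ord λ j j<o → ≡.trans (coeff-· c f j) (≡.trans (≡.cong (c ℤ.*_) (below h j j<o)) (ℤP.*-zeroʳ c))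

  Ord-shift : ∀ {o f} → Ord o f → Ord (suc o) (+ 0 ∷ f)
  Ord-shift h = ord λ { zero _ → ≡.refl ; (suc j) (s≤s j<o) → below h j j<o }

  ⌊_/4⌋ : ℕ → ℕ
  ⌊ n /4⌋ = ⌊ ⌊ n /2⌋ /2⌋

  /4-mono : ∀ {m n} → m ℕ.≤ n → ⌊ m /4⌋ ℕ.≤ ⌊ n /4⌋
  /4-mono m≤n = ℕP.⌊n/2⌋-mono (ℕP.⌊n/2⌋-mono m≤n)

  -- The recursion forms index i + 7 from t times the indices i + 4, i + 5, i + 6 and t² times all
  -- seven; either way the order reaches ⌊ i /4⌋ + 2.
  α-Ord-window : ∀ i k → k ℕ.< 7 → Ord ⌊ suc (k ℕ.+ i) /4⌋ (α (k ℕ.+ i))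
  α-Ord-window zero 0 _ = ord λ _ ()
  α-Ord-window zero 1 _ = ord λ _ ()
  α-Ord-window zero 2 _ = ord λ _ ()
  α-Ord-window zero 3 _ = ord λ { zero _ → ≡.refl ; (suc j) (s≤s ()) }
  α-Ord-window zero 4 _ = ord λ { zero _ → ≡.refl ; (suc j) (s≤s ()) }
  α-Ord-window zero 5 _ = ord λ { zero _ → ≡.refl ; (suc j) (s≤s ()) }
  α-Ord-window zero 6 _ = ord λ { zero _ → ≡.refl ; (suc j) (s≤s ()) }
  α-Ord-window zero (suc (suc (suc (suc (suc (suc (suc _))))))) (s≤s (s≤s (s≤s (s≤s (s≤s (s≤s (s≤s ())))))))
  α-Ord-window (suc i) k k<7 with k ℕ.≟ 6
  ... | no k≢6 = ≡.subst (λ n → Ord ⌊ suc n /4⌋ (α n)) (≡.sym (ℕP.+-suc k i)) (α-Ord-window i (suc k) (s≤s (ℕP.≤∧≢⇒< (ℕP.≤-pred k<7) k≢6)))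
  ... | yes ≡.refl = Ord-⊞ (Ord-shift (Ord-⊞ (Ord-⊞ (c₁ 7 4 _) (c₁ 35 5 _)) (c₁ 49 6 _)))
    (Ord-shift (Ord-shift (Ord-⊞ (Ord-⊞ (Ord-⊞ (Ord-⊞ (Ord-⊞ (Ord-⊞ (w 0 (s≤s z≤n)) (c₂ 7 1 _)) (c₂ 21 2 _)) (c₂ 49 3 _)) (c₂ 147 4 _)) (c₂ 343 5 _)) (c₂ 343 6 _))))
    where
    w : ∀ k → k ℕ.< 7 → Ord ⌊ i /4⌋ (α (k ℕ.+ i))
    w k k<7 = Ord-≤ (/4-mono (ℕP.m≤n+m i (suc k))) (α-Ord-window i k k<7)
    c₂ : ∀ c k → T (k ℕ.<ᵇ 7) → Ord ⌊ i /4⌋ (+ c · α (k ℕ.+ i))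
    c₂ c k lt = Ord-· (+ c) (w k (ℕP.<ᵇ⇒< k 7 lt))
    c₁ : ∀ c k → T (k ℕ.<ᵇ 7) → {T (3 ℕ.≤ᵇ k)} → Ord (suc ⌊ i /4⌋) (+ c · α (k ℕ.+ i))
    c₁ c k lt {3≤k} = Ord-· (+ c) (Ord-≤ (/4-mono (ℕP.+-monoˡ-≤ i (s≤s (ℕP.≤ᵇ⇒≤ 3 k 3≤k)))) (α-Ord-window i k (ℕP.<ᵇ⇒< k 7 lt)))

  α-Ord : ∀ i → Ord ⌊ suc i /4⌋ (α i)
  α-Ord i = α-Ord-window i 0 (s≤s z≤n)

  /4-4* : ∀ i → ⌊ 4 ℕ.* i /4⌋ ≡ i
  /4-4* zero = ≡.refl
  /4-4* (suc i) = ≡.trans (≡.cong ⌊_/4⌋ (ℕP.*-suc 4 i)) (≡.cong suc (/4-4* i))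

  ord-γ : ∀ i → Ord i (α (4 ℕ.* i))
  ord-γ i = Ord-≤ (ℕP.≤-trans (ℕP.≤-reflexive (≡.sym (/4-4* i))) (/4-mono (ℕP.n≤1+n (4 ℕ.* i)))) (α-Ord (4 ℕ.* i))

  ord-δ : ∀ i → Ord (suc i) (α (4 ℕ.* i ℕ.+ 3))
  ord-δ i = Ord-≤ (ℕP.≤-reflexive (≡.sym (≡.trans (≡.cong (λ n → ⌊ suc n /4⌋) (ℕP.+-comm (4 ℕ.* i) 3)) (≡.cong suc (/4-4* i))))) (α-Ord (4 ℕ.* i ℕ.+ 3))

  private
    7∣7 : 7^ 1 ∣ + 7
    7∣7 = divides (+ 1) ≡.refl
    7∣35 : 7^ 1 ∣ + 35
    7∣35 = divides (+ 5) ≡.refl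
    7∣21 : 7^ 1 ∣ + 21
    7∣21 = divides (+ 3) ≡.refl
    49∣49 : 7^ 2 ∣ + 49
    49∣49 = divides (+ 1) ≡.refl
    49∣147 : 7^ 2 ∣ + 147
    49∣147 = divides (+ 3) ≡.refl
    343∣343 : 7^ 3 ∣ + 343
    343∣343 = divides (+ 1) ≡.refl

  check : ∀ (e : ℕ → ℕ) f → {True (ℕP.allUpTo? (λ j → + (7 ℕ.^ e j) ∣? coeff f j) (length f))} → ∀ j → 7^ e j ∣ coeff f j
  check e f {h} j with j ℕ.<? length f
  ... | yes j<l = toWitness {a? = ℕP.allUpTo? (λ j → + (7 ℕ.^ e j) ∣? coeff f j) (length f)} h j<l
  ... | no j≮l = ≡.subst (7^ e j ∣_) (≡.sym (beyond f j (ℕP.≮⇒≥ j≮l))) (7^∣0 (e j))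
    where
    beyond : ∀ f j → length f ℕ.≤ j → coeff f j ≡ + 0
    beyond [] j _ = ≡.refl
    beyond (x ∷ f) (suc j) (s≤s l≤j) = beyond f j l≤j

  /2-+ : ∀ m n → ⌊ m ℕ.+ n /2⌋ ℕ.≤ ⌊ suc m /2⌋ ℕ.+ ⌊ n /2⌋
  /2-+ zero n = ℕP.≤-refl
  /2-+ (suc zero) n = go n
    where
    go : ∀ n → ⌊ suc n /2⌋ ℕ.≤ suc ⌊ n /2⌋
    go zero = z≤n
    go (suc zero) = s≤s z≤n
    go (suc (suc n)) = s≤s (go n)
  /2-+ (suc (suc m)) n = s≤s (/2-+ m n)

  -- The estimate starts at index 7; the smaller indices 0, 3 and 4 that occur in the matrices are
  -- checked directly in `γ-val` and `δ-val`.
  α-Val-window : ∀ i k → k ℕ.< 7 → Val (suc ⌊ suc (k ℕ.+ i) /2⌋) (α (7 ℕ.+ (k ℕ.+ i)))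
  α-Val-window zero 0 _ = val (check (ℕ._∸ 1) (α 7))
  α-Val-window zero 1 _ = val (check (ℕ._∸ 2) (α 8))
  α-Val-window zero 2 _ = val (check (ℕ._∸ 2) (α 9))
  α-Val-window zero 3 _ = val (check (ℕ._∸ 3) (α 10))
  α-Val-window zero 4 _ = val (check (ℕ._∸ 3) (α 11))
  α-Val-window zero 5 _ = val (check (ℕ._∸ 4) (α 12))
  α-Val-window zero 6 _ = val (check (ℕ._∸ 4) (α 13))
  α-Val-window zero (suc (suc (suc (suc (suc (suc (suc _))))))) (s≤s (s≤s (s≤s (s≤s (s≤s (s≤s (s≤s ())))))))
  α-Val-window (suc i) k k<7 with k ℕ.≟ 6
  ... | no k≢6 = ≡.subst (λ n → Val (suc ⌊ suc n /2⌋) (α (7 ℕ.+ n))) (≡.sym (ℕP.+-suc k i)) (α-Val-window i (suc k) (s≤s (ℕP.≤∧≢⇒< (ℕP.≤-pred k<7) k≢6)))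
  -- With h = ⌊ i /2⌋ the new entry may have shortfall 5 + h. The factors t and t² leave 4 + h and 3
  -- + h, and each factor 7 of a coefficient gives one back.
  ... | yes ≡.refl = Val-⊞ (Val-shift (Val-⊞ (Val-⊞ (Val-· 1 7∣7 (term 4 (5 ℕ.+ h) 4≤5)) (Val-· 1 7∣35 (term 5 (5 ℕ.+ h) 4≤5))) (Val-· 2 49∣49 (term 6 (6 ℕ.+ h) 5≤6))))
    (Val-shift (Val-shift (Val-⊞ (Val-⊞ (Val-⊞ (Val-⊞ (Val-⊞ (Val-⊞ (term 0 (3 ℕ.+ h) 2≤3) (Val-· 1 7∣7 (term 1 (4 ℕ.+ h) 2≤4))) (Val-· 1 7∣21 (term 2 (4 ℕ.+ h) 3≤4)))
      (Val-· 2 49∣49 (term 3 (5 ℕ.+ h) 3≤5))) (Val-· 2 49∣147 (term 4 (5 ℕ.+ h) 4≤5))) (Val-· 3 343∣343 (term 5 (6 ℕ.+ h) 4≤6))) (Val-· 3 343∣343 (term 6 (6 ℕ.+ h) 5≤6)))))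
    where
    h = ⌊ i /2⌋
    slack : ∀ m d → m ℕ.+ h ℕ.≤ d ℕ.+ m ℕ.+ h
    slack m d = ℕP.+-monoˡ-≤ h (ℕP.m≤n+m m d)
    2≤3 = slack 2 1
    2≤4 = slack 2 2
    3≤4 = slack 3 1
    3≤5 = slack 3 2
    4≤5 = slack 4 1
    4≤6 = slack 4 2
    5≤6 = slack 5 1
    term : ∀ k v → {T (k ℕ.<ᵇ 7)} → suc (suc ⌊ k /2⌋) ℕ.+ h ℕ.≤ v → Val v (α (7 ℕ.+ (k ℕ.+ i)))
    term k v {lt} b≤v = Val-≤ (ℕP.≤-trans (s≤s (/2-+ (suc k) i)) b≤v) (α-Val-window i k (ℕP.<ᵇ⇒< k 7 lt))

  α-Val : ∀ i → Val (suc ⌊ suc i /2⌋) (α (7 ℕ.+ i))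
  α-Val i = α-Val-window i 0 (s≤s z≤n)

  /2-4* : ∀ i → ⌊ 4 ℕ.* i /2⌋ ≡ i ℕ.+ i
  /2-4* zero = ≡.refl
  /2-4* (suc i) = ≡.trans (≡.cong ⌊_/2⌋ (ℕP.*-suc 4 i)) (≡.trans (≡.cong (2 ℕ.+_) (/2-4* i)) (≡.cong suc (≡.sym (ℕP.+-suc i i))))

  /2-1+4* : ∀ i → ⌊ suc (4 ℕ.* i) /2⌋ ≡ i ℕ.+ i
  /2-1+4* zero = ≡.refl
  /2-1+4* (suc i) = ≡.trans (≡.cong (λ n → ⌊ suc n /2⌋) (ℕP.*-suc 4 i)) (≡.trans (≡.cong (2 ℕ.+_) (/2-1+4* i)) (≡.cong suc (≡.sym (ℕP.+-suc i i))))

  γ-val : ∀ i j → 7^ suc j ℕ.∸ i ∣ coeff (γ i) j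
  γ-val 0 j = check suc (γ 0) j
  γ-val 1 j = check (λ j → j) (γ 1) j
  γ-val (suc (suc i)) j = ≡.subst (7^ suc j ℕ.∸ suc (suc i) ∣_) (≡.sym (coeff-drop (2 ℕ.+ i) (α (4 ℕ.* (2 ℕ.+ i))) j))
    (7^∣-≤ bound (≡.subst (λ n → 7^ (2 ℕ.+ i ℕ.+ j) ℕ.∸ suc ⌊ 2 ℕ.+ 4 ℕ.* i /2⌋ ∣ coeff (α n) (2 ℕ.+ i ℕ.+ j)) index (divisible (α-Val (suc (4 ℕ.* i))) (2 ℕ.+ i ℕ.+ j))))
    where
    index : 7 ℕ.+ suc (4 ℕ.* i) ≡ 4 ℕ.* (2 ℕ.+ i)
    index = ≡.sym (ℕP.*-distribˡ-+ 4 2 i)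
    bound : suc j ℕ.∸ suc (suc i) ℕ.≤ (2 ℕ.+ i ℕ.+ j) ℕ.∸ suc ⌊ 2 ℕ.+ 4 ℕ.* i /2⌋
    bound rewrite /2-4* i | ℕP.[m+n]∸[m+o]≡n∸o i j i = ℕP.∸-monoʳ-≤ j (ℕP.n≤1+n i)

  δ-val : ∀ i j → 7^ suc (suc j) ℕ.∸ i ∣ coeff (δ′ i) j
  δ-val zero j = check (λ j → suc (suc j)) (δ′ 0) j
  δ-val (suc i) j = ≡.subst (7^ suc j ℕ.∸ i ∣_) (≡.sym (coeff-drop (2 ℕ.+ i) (α (4 ℕ.* suc i ℕ.+ 3)) j))
    (7^∣-≤ bound (≡.subst (λ n → 7^ (2 ℕ.+ i ℕ.+ j) ℕ.∸ suc ⌊ suc (4 ℕ.* i) /2⌋ ∣ coeff (α n) (2 ℕ.+ i ℕ.+ j)) index (divisible (α-Val (4 ℕ.* i)) (2 ℕ.+ i ℕ.+ j))))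
    where
    index : 7 ℕ.+ 4 ℕ.* i ≡ 4 ℕ.* suc i ℕ.+ 3
    index = ≡.trans (≡.cong (3 ℕ.+_) (≡.sym (ℕP.*-suc 4 i))) (ℕP.+-comm 3 (4 ℕ.* suc i))
    bound : suc j ℕ.∸ i ℕ.≤ (2 ℕ.+ i ℕ.+ j) ℕ.∸ suc ⌊ suc (4 ℕ.* i) /2⌋
    bound rewrite /2-1+4* i | ≡.sym (ℕP.+-suc i j) | ℕP.[m+n]∸[m+o]≡n∸o i (suc j) i = ℕP.≤-refl

  -- Valuations of a vector times a matrix: w bounds the vector, ν the matrix and w′ the result.
  combine-val : ∀ (w w′ : ℕ → ℕ) (ν : ℕ → ℕ → ℕ) η → (∀ i j → 7^ ν i j ∣ coeff (η i) j) → (∀ i j → w′ j ℕ.≤ w i ℕ.+ ν i j) →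
    ∀ f i → (∀ k → 7^ w (i ℕ.+ k) ∣ coeff f k) → ∀ j → 7^ w′ j ∣ coeff (combine η i f) j
  combine-val w w′ ν η h b [] i hf j = 7^∣0 (w′ j)
  combine-val w w′ ν η h b (x ∷ f) i hf j = ≡.subst (7^ w′ j ∣_) (≡.sym (coeff-⊞ (x · η i) _ j))
    (7^∣-+ {w′ j} (≡.subst (7^ w′ j ∣_) (≡.sym (coeff-· x (η i) j)) (7^∣-≤ (b i j) (7^∣-* {w i} (≡.subst (λ n → 7^ w n ∣ x) (ℕP.+-identityʳ i) (hf 0)) (h i j))))
      (combine-val w w′ ν η h b f (suc i) (λ k → ≡.subst (λ n → 7^ w n ∣ coeff f k) (ℕP.+-suc i k) (hf (suc k))) j))

  -- The generating function of e6, after 2 k applications of U, is G (F k).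
  F : ℕ → Poly
  F zero = R-poly
  F (suc k) = next ord-γ ord-δ (F k)

  -- The first matrix turns the exponent 2 k + i - 1 into 2 k + j, the second one adds 2, and the
  -- leading zero of `next` moves j to j + 1, which restores the form for k + 1.
  F-val : ∀ k i → 7^ 2 ℕ.* k ℕ.+ ℕ.pred i ∣ coeff (F k) i
  F-val zero i = check ℕ.pred R-poly i
  F-val (suc k) zero = 7^∣0 (2 ℕ.* suc k ℕ.+ 0)
  F-val (suc k) (suc j) = ≡.subst (λ n → 7^ n ∣ coeff (F (suc k)) (suc j)) (≡.cong (ℕ._+ j) (≡.sym (ℕP.*-suc 2 k)))
    (combine-val (2 ℕ.* k ℕ.+_) (λ j → 2 ℕ.+ 2 ℕ.* k ℕ.+ j) (λ n j → suc (suc j) ℕ.∸ n) δ′ δ-val outer (combine γ 0 (F k)) 0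
      (combine-val (λ i → 2 ℕ.* k ℕ.+ ℕ.pred i) (2 ℕ.* k ℕ.+_) (λ i j → suc j ℕ.∸ i) γ γ-val inner (F k) 0 (F-val k)) j)
    where
    inner : ∀ i j → 2 ℕ.* k ℕ.+ j ℕ.≤ 2 ℕ.* k ℕ.+ ℕ.pred i ℕ.+ (suc j ℕ.∸ i)
    inner i j = ℕP.≤-trans (ℕP.+-monoʳ-≤ (2 ℕ.* k) (go i)) (ℕP.≤-reflexive (≡.sym (ℕP.+-assoc (2 ℕ.* k) _ _)))
      where
      go : ∀ i → j ℕ.≤ ℕ.pred i ℕ.+ (suc j ℕ.∸ i)
      go zero = ℕP.n≤1+n j
      go (suc i) = ℕP.m≤n+m∸n j i
    outer : ∀ n j → 2 ℕ.+ 2 ℕ.* k ℕ.+ j ℕ.≤ 2 ℕ.* k ℕ.+ n ℕ.+ (suc (suc j) ℕ.∸ n)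
    outer n j = ℕP.≤-trans (ℕP.≤-reflexive (ℕSolver.solve 2 (λ k j → con₁ 2 :+₁ k :+₁ j :=₁ k :+₁ (con₁ 2 :+₁ j)) ≡.refl (2 ℕ.* k) j))
      (ℕP.≤-trans (ℕP.+-monoʳ-≤ (2 ℕ.* k) (ℕP.m≤n+m∸n (2 ℕ.+ j) n)) (ℕP.≤-reflexive (≡.sym (ℕP.+-assoc (2 ℕ.* k) _ _))))
      where open ℕSolver using () renaming (con to con₁; _:+_ to _:+₁_; _:=_ to _:=₁_)

  factor-out : ∀ c f t → (∀ i → c ∣ₛ coeff f i) → ∃ λ g → eval f t ≋ const c * g
  factor-out c [] t h = 0# , ≋-sym (zeroʳ _)
  factor-out c (x ∷ f) t h with h 0 | factor-out c f t (h ∘ suc)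
  ... | divides k ≡.refl | g , eq = const k + t * g , ≋-trans (+-cong (const-* k c) (*-congˡ eq))
    (solve 4 (λ k c t g → k :* c :+ t :* (c :* g) := c :* (k :+ t :* g)) ≋-refl (const k) (const c) t g)

  G-divisible : ∀ c f → (∀ i → c ∣ₛ coeff f i) → ∀ n → c ∣ₛ G ord-γ ord-δ f n
  G-divisible c f h n with factor-out c f t₀ h
  ... | g , eq = divides ((E ^ 13 * p₇ ^ 2 * g) n) (≡.trans (at (≋-trans (*-congˡ eq)
    (solve 3 (λ a c g → a :* (c :* g) := c :* (a :* g)) ≋-refl (E ^ 13 * p₇ ^ 2) (const c) g)) n) (≡.trans (const-*-at c _ n) (ℤP.*-comm c _)))

  -- The residue (23 * 49^k + 1) / 24, by a recursion that makes the progressions nest: 49^k (49 n +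
  -- 46) + d k.
  d : ℕ → ℕ
  d zero = 1
  d (suc k) = 46 ℕ.* 49 ℕ.^ k ℕ.+ d k

  24*d : ∀ k → 24 ℕ.* d k ≡ 23 ℕ.* 49 ℕ.^ k ℕ.+ 1
  24*d zero = ≡.refl
  24*d (suc k) = ≡.trans (ℕP.*-distribˡ-+ 24 (46 ℕ.* 49 ℕ.^ k) (d k)) (≡.trans (≡.cong (24 ℕ.* (46 ℕ.* 49 ℕ.^ k) ℕ.+_) (24*d k))
    (ℕSolver.solve 1 (λ x → con₁ 24 :*₁ (con₁ 46 :*₁ x) :+₁ (con₁ 23 :*₁ x :+₁ con₁ 1) :=₁ con₁ 23 :*₁ (con₁ 49 :*₁ x) :+₁ con₁ 1) ≡.refl (49 ℕ.^ k)))
    where open ℕSolver using () renaming (con to con₁; _:+_ to _:+₁_; _:*_ to _:*₁_; _:=_ to _:=₁_)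

  -- The index n + 1 accounts for d 0 = 1 and afterwards for the factor t introduced by `next`; two
  -- applications of U fit because 49 n + 47 = 7 (7 n + 6) + 5.
  e6-F : ∀ k n → e6 (49 ℕ.^ k ℕ.* n ℕ.+ d k) ≡ G ord-γ ord-δ (F k) (suc n)
  e6-F zero n = ≡.trans (≡.cong e6 (≡.trans (≡.cong (ℕ._+ 1) (ℕP.*-identityˡ n)) (ℕP.+-comm n 1))) (e6-G ord-γ ord-δ (suc n))
  e6-F (suc k) n = ≡.trans (≡.cong e6 index) (≡.trans (e6-F k (n ℕ.* 49 ℕ.+ 46)) (≡.trans (≡.cong (G ord-γ ord-δ (F k)) index′) (U²-G ord-γ ord-δ (F k) n)))
    where
    open ℕSolver using () renaming (con to con₁; _:+_ to _:+₁_; _:*_ to _:*₁_; _:=_ to _:=₁_)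
    index : 49 ℕ.^ suc k ℕ.* n ℕ.+ d (suc k) ≡ 49 ℕ.^ k ℕ.* (n ℕ.* 49 ℕ.+ 46) ℕ.+ d k
    index = ℕSolver.solve 3 (λ x n d → (con₁ 49 :*₁ x) :*₁ n :+₁ (con₁ 46 :*₁ x :+₁ d) :=₁ x :*₁ (n :*₁ con₁ 49 :+₁ con₁ 46) :+₁ d) ≡.refl (49 ℕ.^ k) n (d k)
    index′ : suc (n ℕ.* 49 ℕ.+ 46) ≡ (n ℕ.* 7 ℕ.+ 6) ℕ.* 7 ℕ.+ 5
    index′ = ℕSolver.solve 1 (λ n → con₁ 1 :+₁ (n :*₁ con₁ 49 :+₁ con₁ 46) :=₁ (n :*₁ con₁ 7 :+₁ con₁ 6) :*₁ con₁ 7 :+₁ con₁ 5) ≡.refl n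

  -- Write 24 δ = c 49^k + 1. The bound on δ gives c < 24, and 49^k ≡ 1 modulo 24 gives 24 ∣ c + 1;
  -- hence c = 23.
  d-unique : ∀ k δ → 0 ℕ.< δ → δ ℕ.< 49 ℕ.^ k → 49 ℕ.^ k ℕD.∣ 24 ℕ.* δ ℕ.∸ 1 → δ ≡ d k
  d-unique k δ@(suc δ⁻) _ δ<M (ℕD.divides c eq) = ℕP.*-cancelˡ-≡ δ (d k) 24 (≡.trans 24δ (≡.trans (≡.cong (λ c → c ℕ.* M ℕ.+ 1) c≡23) (≡.sym (24*d k))))
    where
    M = 49 ℕ.^ k
    24δ : 24 ℕ.* δ ≡ c ℕ.* M ℕ.+ 1
    24δ = ≡.trans (≡.sym (ℕP.m∸n+n≡m {24 ℕ.* δ} {1} (ℕP.≤-trans (s≤s z≤n) (ℕP.m≤n*m δ 24)))) (≡.cong (ℕ._+ 1) eq)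
    c<24 : c ℕ.< 24
    c<24 = ℕP.*-cancelʳ-< M c 24 (ℕP.≤-trans (ℕP.≤-reflexive (≡.trans (ℕP.+-comm 1 (c ℕ.* M)) (≡.sym 24δ))) (ℕP.*-monoʳ-≤ 24 (ℕP.<⇒≤ δ<M)))
    M≡1 : ∀ k → ∃ λ x → 49 ℕ.^ k ≡ 24 ℕ.* x ℕ.+ 1
    M≡1 zero = 0 , ≡.refl
    M≡1 (suc k) with M≡1 k
    ... | x , e = 49 ℕ.* x ℕ.+ 2 , ≡.trans (≡.cong (49 ℕ.*_) e) (ℕSolver.solve 1 (λ x → con₁ 49 :*₁ (con₁ 24 :*₁ x :+₁ con₁ 1) :=₁ con₁ 24 :*₁ (con₁ 49 :*₁ x :+₁ con₁ 2) :+₁ con₁ 1) ≡.refl x)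
      where open ℕSolver using () renaming (con to con₁; _:+_ to _:+₁_; _:*_ to _:*₁_; _:=_ to _:=₁_)
    24∣c+1 : 24 ℕD.∣ c ℕ.+ 1
    24∣c+1 with M≡1 k
    ... | x , e = ℕD.∣m+n∣m⇒∣n {24} {24 ℕ.* (c ℕ.* x)} (ℕD.divides δ (≡.trans split (≡.trans (≡.sym 24δ) (ℕP.*-comm 24 δ)))) (ℕD.m∣m*n (c ℕ.* x))
      where
      split : 24 ℕ.* (c ℕ.* x) ℕ.+ (c ℕ.+ 1) ≡ c ℕ.* M ℕ.+ 1
      split = ≡.trans (ℕSolver.solve 2 (λ c x → con₁ 24 :*₁ (c :*₁ x) :+₁ (c :+₁ con₁ 1) :=₁ c :*₁ (con₁ 24 :*₁ x :+₁ con₁ 1) :+₁ con₁ 1) ≡.refl c x) (≡.cong (λ M → c ℕ.* M ℕ.+ 1) (≡.sym e))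
        where open ℕSolver using () renaming (con to con₁; _:+_ to _:+₁_; _:*_ to _:*₁_; _:=_ to _:=₁_)
    c≡23 : c ≡ 23
    c≡23 = ℕP.≤-antisym (ℕP.≤-pred c<24) (ℕP.≤-pred (ℕP.≤-trans (ℕD.∣⇒≤ {{ℕ.>-nonZero (ℕP.≤-trans (s≤s z≤n) (ℕP.m≤n+m 1 c))}} 24∣c+1) (ℕP.≤-reflexive (ℕP.+-comm c 1))))

  e6-congruence : ∀ k n δ → 0 ℕ.< δ → δ ℕ.< 7 ℕ.^ (2 ℕ.* k) → + (7 ℕ.^ (2 ℕ.* k)) ℤD.∣ + (24 ℕ.* δ) ℤ.- + 1 →
    + (7 ℕ.^ (2 ℕ.* k)) ℤD.∣ e6 (7 ℕ.^ (2 ℕ.* k) ℕ.* n ℕ.+ δ)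
  e6-congruence k n δ@(suc _) 0<δ δ<M h = ≡.subst₂ (λ M δ → (+ (7 ℕ.^ (2 ℕ.* k))) ℤD.∣ e6 (M ℕ.* n ℕ.+ δ)) (≡.sym 7^2k) (≡.sym δ≡)
    (≡.subst ((+ (7 ℕ.^ (2 ℕ.* k))) ℤD.∣_) (≡.sym (e6-F k n)) (∣⇒∣ᵤ (G-divisible (+ (7 ℕ.^ (2 ℕ.* k))) (F k) (λ i → 7^∣-≤ (ℕP.m≤m+n (2 ℕ.* k) (ℕ.pred i)) (F-val k i)) (suc n))))
    where
    7^2k : 7 ℕ.^ (2 ℕ.* k) ≡ 49 ℕ.^ k
    7^2k = ≡.sym (ℕP.^-*-assoc 7 2 k)
    δ≡ : δ ≡ d k
    -- Because δ is matched as a successor, the absolute value of 24 δ - 1 computes to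
    -- `24 ℕ.* δ ℕ.∸ 1`, and h is already a divisibility in ℕ.
    δ≡ = d-unique k δ 0<δ (≡.subst (δ ℕ.<_) 7^2k δ<M) (≡.subst (ℕD._∣ 24 ℕ.* δ ℕ.∸ 1) 7^2k h)

open import Data.Nat using (ℕ; _+_; _*_; _^_; _<_; _≥_)
open import Data.Integer using (+_) renaming (_-_ to _-ℤ_)
open import Data.Integer.Divisibility using (_∣_)
open import Data.Product using (_×_)

theorem5p11 : ∀ (k n δ : ℕ) → k ≥ 1 →
  0 < δ → δ < 7 ^ (2 * k) → (+ (7 ^ (2 * k))) ∣ (+ (24 * δ) -ℤ + 1) →
  (+ (7 ^ (2 * k))) ∣ e6 (7 ^ (2 * k) * n + δ)
theorem5p11 k n δ _ = SevenAdicEstimates.e6-congruence k n δ
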